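{- Let $(\mathbf{P},m,\Delta)$ be a twisted bialgebra with a compatible contraction-extraction coproduct (in the sense of the context). Then $\mathcal{F}_\bullet[\mathbf{P}]$ is a functor from the category of commutative, not necessarily unitary, bialgebras to the category of double bialgebras: it sends $(V,\cdot,\delta_V)$ to the double bialgebra $(\mathcal{F}_V[\mathbf{P}],m,\Delta,\delta)$, and a bialgebra morphism $f:V\to W$ to the map $\overline{v_1\ldots v_n\otimes p}\mapsto\overline{f(v_1)\ldots f(v_n)\otimes p}$.
   Context: $\mathbb{K}$ is a field. A species $\mathbf{P}$ is a functor from the category of finite sets with bijections to $\mathbb{K}$-vector spaces, written $X\mapsto\mathbf{P}[X]$, $\sigma\mapsto\mathbf{P}[\sigma]$; $[n]=\{1,\ldots,n\}$ and $\mathbf{P}[n]=\mathbf{P}[\{1,\ldots,n\}]$. $\sqcup$ is disjoint union, $c$ is the flip, $m_{1,3,24}(a\otimes b\otimes a'\otimes b')=a\otimes a'\otimes m(b\otimes b')$. A not necessarily unitary bialgebra $(V,\cdot,\delta_V)$ is an associative algebra (possibly without unit) with a coassociative coproduct $\delta_V$ with counit $\epsilon_V$, both $\delta_V$ and $\epsilon_V$ being multiplicative; morphisms are linear maps compatible with products, coproducts and counits. Twisted algebra $(\mathbf{P},m)$: linear maps $m_{X,Y}:\mathbf{P}[X]\otimes\mathbf{P}[Y]\to\mathbf{P}[X\sqcup Y]$, natural in bijections, associative, with unit $1_{\mathbf{P}}\in\mathbf{P}[\emptyset]$. Twisted coalgebra $(\mathbf{P},\Delta)$: linear maps $\Delta_{X,Y}:\mathbf{P}[X\sqcup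 Y]\to\mathbf{P}[X]\otimes\mathbf{P}[Y]$, natural in bijections, with $(\Delta_{X,Y}\otimes\mathrm{Id})\circ\Delta_{X\sqcup Y,Z}=(\mathrm{Id}\otimes\Delta_{Y,Z})\circ\Delta_{X,Y\sqcup Z}$ and a counit $\varepsilon_\Delta:\mathbf{P}[\emptyset]\to\mathbb{K}$. Twisted bialgebra: both, such that whenever $I\sqcup J=I'\sqcup J'$, $\Delta_{I,J}\circ m_{I',J'}=(m_{I'\cap I,J'\cap I}\otimes m_{I'\cap J,J'\cap J})\circ(\mathrm{Id}\otimes c\otimes\mathrm{Id})\circ(\Delta_{I'\cap I,I'\cap J}\otimes\Delta_{J'\cap I,J'\cap J})$, $\Delta_{\emptyset,\emptyset}(1_{\mathbf{P}})=1_{\mathbf{P}}\otimes1_{\mathbf{P}}$, and $\varepsilon_\Delta$ is multiplicative and unital on $\mathbf{P}[\emptyset]$. Equivalences. $\mathcal{E}[X]$ is the set of equivalence relations on $X$, ordered by: $\sim\leq\sim'$ iff ($x\sim'y\Rightarrow x\sim y$). One identifies $\mathcal{E}[X/\sim']$ with $\{\sim\in\mathcal{E}[X]:\sim\leq\sim'\}$ and $(X/\sim')/\sim$ with $X/\sim$. For a bijection $\sigma:X\to Y$, $\sim_\sigma$ is the transported equivalence and $\sigma/\sim:X/\sim\to Y/\sim_\sigma$ the induced bijection. $\sim_X\sqcup\sim_Y$ is the equivalence on $X\sqcup Y$ whose classes are those of $\sim_X$ and those of $\sim_Y$. Contraction-extraction coproduct $\delta$ on $\mathbf{P}$: linear maps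 $\delta_\sim:\mathbf{P}[X]\to\mathbf{P}[X/\sim]\otimes\mathbf{P}[X]$ for every finite $X$ and $\sim\in\mathcal{E}[X]$, with: (i) $\delta_{\sim_\sigma}\circ\mathbf{P}[\sigma]=(\mathbf{P}[\sigma/\sim]\otimes\mathbf{P}[\sigma])\circ\delta_\sim$ for bijections $\sigma:X\to Y$; (ii) if $\sim\leq\sim'$, $(\delta_\sim\otimes\mathrm{Id})\circ\delta_{\sim'}=(\mathrm{Id}\otimes\delta_{\sim'})\circ\delta_\sim$ (on the left $\delta_\sim$ is applied to $\mathbf{P}[X/\sim']$), and if $\sim\leq\sim'$ fails, $(\mathrm{Id}\otimes\delta_{\sim'})\circ\delta_\sim=0$; (iii) there are linear maps $\epsilon_\delta[X]:\mathbf{P}[X]\to\mathbb{K}$, invariant under bijections, such that $(\mathrm{Id}\otimes\epsilon_\delta[X])\circ\delta_\sim$ is $\mathrm{Id}$ if $\sim$ is the equality and $0$ otherwise, and $\sum_{\sim\in\mathcal{E}[X]}(\epsilon_\delta[X/\sim]\otimes\mathrm{Id})\circ\delta_\sim=\mathrm{Id}_{\mathbf{P}[X]}$. It is compatible with $(m,\Delta)$ if for all finite $X,Y$ and $\sim\in\mathcal{E}[X\sqcup Y]$, with $\sim_X=\sim\cap X^2$, $\sim_Y=\sim\cap Y^2$: $\delta_\sim\circ m_{X,Y}$ equals $(m_{X/\sim_X,Y/\sim_Y}\otimes m_{X,Y})\circ(\mathrm{Id}\otimes c\otimes\mathrm{Id})\circ(\delta_{\sim_X}\otimes\delta_{\sim_Y})$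 if $\sim=\sim_X\sqcup\sim_Y$ and $0$ otherwise; $(\Delta_{X/\sim_X,Y/\sim_Y}\otimes\mathrm{Id})\circ\delta_\sim=m_{1,3,24}\circ(\delta_{\sim_X}\otimes\delta_{\sim_Y})\circ\Delta_{X,Y}$ if $\sim=\sim_X\sqcup\sim_Y$; and, $\sim_\emptyset$ being the equivalence on $\emptyset$, $\delta_{\sim_\emptyset}(1_{\mathbf{P}})=1_{\mathbf{P}}\otimes1_{\mathbf{P}}$ and $(\varepsilon_\Delta\otimes\mathrm{Id})\circ\delta_{\sim_\emptyset}(x)=\varepsilon_\Delta(x)1_{\mathbf{P}}$ for $x\in\mathbf{P}[\emptyset]$. The structure on $\mathcal{F}_V[\mathbf{P}]$: $\mathcal{F}_V[\mathbf{P}]=\bigoplus_{n\geq0}V^{\otimes n}\otimes_{\mathfrak{S}_n}\mathbf{P}[n]$, the quotient of $\bigoplus_nV^{\otimes n}\otimes\mathbf{P}[n]$ by the relations $v_1\ldots v_n\otimes\mathbf{P}[\sigma](p)=v_{\sigma(1)}\ldots v_{\sigma(n)}\otimes p$, $\sigma\in\mathfrak{S}_n$; classes are denoted by a bar and $v_1\ldots v_n$ means $v_1\otimes\cdots\otimes v_n$. Product: $\overline{v_1\ldots v_k\otimes p}\cdot\overline{v_{k+1}\ldots v_{k+l}\otimes q}=\overline{v_1\ldots v_{k+l}\otimes\mathbf{P}[\sigma_{k,l}]\circ m_{[k],[l]}(p\otimes q)}$, where $\sigma_{k,l}:[k]\sqcup[l]\to[k+l]$ is $i\in[k]\mapsto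 i$, $j\in[l]\mapsto k+j$. First coproduct: $\Delta(\overline{v_1\ldots v_n\otimes p})=\sum_{A\sqcup B=[n]}\overline{v_A\otimes\mathbf{P}[\sigma_A](p^{(1)})}\otimes\overline{v_B\otimes\mathbf{P}[\sigma_B](p^{(2)})}$, where $\Delta_{A,B}(p)=p^{(1)}\otimes p^{(2)}$, $\sigma_A:A\to[|A|]$ is the increasing bijection and $v_A$ is the tensor of the $v_i$, $i\in A$, in increasing order. Second coproduct: writing $\delta_\sim(p)=p^{(1)_\sim}\otimes p^{(2)_\sim}$, $\delta_V(v)=v'\otimes v''$, and choosing for each $\sim\in\mathcal{E}[[n]]$ a bijection $\sigma_\sim:[n]/\sim\to[k_\sim]$, $\delta(\overline{v_1\ldots v_n\otimes p})=\sum_{\sim\in\mathcal{E}[[n]]}\overline{w_1^\sim\ldots w_{k_\sim}^\sim\otimes\mathbf{P}[\sigma_\sim](p^{(1)_\sim})}\otimes\overline{v''_1\ldots v''_n\otimes p^{(2)_\sim}}$, with $w_j^\sim=\prod_{i\in\sigma_\sim^{ -1}(j)}v'_i$ (product in $V$). Double bialgebra $(A,m,\Delta,\delta)$: $(A,m,\Delta)$ is a bialgebra with unit $1$ and counit $\varepsilon_\Delta$, $\delta:A\to A\otimes A$ is coassociative with a counit $\epsilon_\delta$, $\delta$ is a unital algebra morphism, and $(\Delta\otimes\mathrm{Id})\circ\delta=m_{1,3,24}\circ(\delta\otimes\delta)\circ\Delta$, $(\varepsilon_\Delta\otimes\mathrm{Id})\circ\delta(x)=\varepsilon_\Delta(x)1$.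 Morphisms of double bialgebras are linear maps compatible with products, units, both coproducts and both counits. -}

module Defs where

open import Level using (Level; 0ℓ; _⊔_) renaming (suc to lsuc)
open import Algebra.Apartness.Bundles using (HeytingField; HeytingCommutativeRing)
open import Algebra.Bundles using (CommutativeMonoid; CommutativeRing)
import Algebra.Properties.CommutativeSemigroup as CommutativeSemigroupProperties
open import Algebra.Module.Bundles using (Module)
open import Algebra.Module.Structures using (IsModule)
open import Algebra.Module.Structures.Biased using (IsModuleFromLeft)
open import Algebra.Module.Morphism.Structures using (module ModuleMorphisms)
import Algebra.Module.Construct.TensorUnit as TensorUnit
open import Data.Bool.Base using (Bool; true; false; T)
open import Data.Bool.Properties using (T?)
open import Data.Empty using (⊥-elim)
open import Data.Fin.Base using (Fin; zero; suc; join; splitAt)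
open import Data.Fin.Properties using (_≟_; any?; all?; +↔⊎; join-splitAt; splitAt-join)
open import Data.Fin.Subset using (Subset; inside; outside; _∈_; ∁; ∣_∣)
open import Data.Fin.Subset.Properties using (_∈?_; x∉p⇒x∈∁p; x∈∁p⇒x∉p)
open import Data.List.Base using (List; []; _∷_; foldr; filter; mapMaybe; concatMap)
  renaming (map to mapᴸ; allFin to allFinᴸ)
open import Data.Maybe.Base using () renaming (map to mapᴹ)
open import Data.Nat.Base using (ℕ; zero; suc; _+_)
open import Data.Product.Base using (Σ; Σ-syntax; _×_; _,_; proj₁; proj₂)
open import Data.Sum.Base using (inj₁; inj₂)
open import Data.Sum.Function.Setoid using (_⊎-inverse_)
open import Data.Sum.Relation.Binary.Pointwise
  using (Pointwise; inj₁; inj₂; ⊎-setoid; ⊎-isEquivalence; ⊎-decidable)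
open import Data.Vec.Base using (Vec; []; _∷_; lookup; here; there)
import Data.Vec.Functional as VF
open import Function.Base using (_∘_; id; flip)
open import Function.Bundles using (Inverse)
import Function.Construct.Composition as Comp
import Function.Construct.Identity as Ident
import Function.Construct.Symmetry as Symm
open import Relation.Binary.Bundles using (Setoid)
open import Relation.Binary.Core using (Rel)
open import Relation.Binary.Definitions using (Decidable)
open import Relation.Binary.Structures using (IsEquivalence)
import Relation.Binary.Construct.On as On
open import Relation.Binary.PropositionalEquality as ≡ using (_≡_; refl)
open import Relation.Nullary using (¬_; Dec; yes; no; ¬?)
open import Relation.Nullary.Decidable using (map′; _×-dec_; _→-dec_)
open import Relation.Nullary.Decidable.Core using (dec⇒maybe)

private
  variable
    ℓ : Level

strictInverse : ∀ {S T : Setoid 0ℓ 0ℓ} →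
  let module S = Setoid S
      module T = Setoid T
  in
  (to : S.Carrier → T.Carrier) (from : T.Carrier → S.Carrier) →
  (∀ {x y} → x S.≈ y → to x T.≈ to y) →
  (∀ {x y} → x T.≈ y → from x S.≈ from y) →
  (∀ y → to (from y) T.≈ y) → (∀ x → from (to x) S.≈ x) →
  Inverse S T
strictInverse {S} {T} to from to-cong from-cong to∘from from∘to = record
  { to        = to
  ; from      = from
  ; to-cong   = to-cong
  ; from-cong = from-cong
  ; inverse   = (λ {y} p → Setoid.trans T (to-cong p) (to∘from y))
              , (λ {x} p → Setoid.trans S (from-cong p) (from∘to x))
  }

-- Finite sets are setoids, so that X/∼ has the same carrier as X and ∼ as
-- its equality.  In particular (X/∼′)/∼ and X/∼ have equal carriers and
-- equal equalities, and the two differ by an identity relabelling.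

record FinSet : Set₁ where
  field
    setoid : Setoid 0ℓ 0ℓ
    size   : ℕ
    enum   : Inverse setoid (≡.setoid (Fin size))

  open Setoid setoid public
    renaming (refl to ≈-refl; sym to ≈-sym; trans to ≈-trans)

infix 3 _≃_

record _≃_ (X Y : FinSet) : Set where
  constructor bijection
  field
    underlying : Inverse (FinSet.setoid X) (FinSet.setoid Y)

  open Inverse underlying public

strict≃ : ∀ {X Y} →
  let module X = FinSet X
      module Y = FinSet Y
  in
  (to : X.Carrier → Y.Carrier) (from : Y.Carrier → X.Carrier) →
  (∀ {x y} → x X.≈ y → to x Y.≈ to y) →
  (∀ {x y} → x Y.≈ y → from x X.≈ from y) →
  (∀ y → to (from y) Y.≈ y) → (∀ x → from (to x) X.≈ x) →
  X ≃ Y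
strict≃ {X} {Y} to from to-cong from-cong to∘from from∘to = bijection
  (strictInverse {S = FinSet.setoid X} {T = FinSet.setoid Y} to from to-cong from-cong to∘from from∘to)

id≃ : ∀ {X} → X ≃ X
id≃ {X} = bijection (Ident.inverse (FinSet.setoid X))

infixr 9 _∘≃_

_∘≃_ : ∀ {X Y Z} → Y ≃ Z → X ≃ Y → X ≃ Z
bijection g ∘≃ bijection f = bijection (Comp.inverse f g)

_⁻¹≃ : ∀ {X Y} → X ≃ Y → Y ≃ X
bijection f ⁻¹≃ = bijection (Symm.inverse f)

infix 4 _≗≃_

_≗≃_ : ∀ {X Y} → X ≃ Y → X ≃ Y → Set
_≗≃_ {X} {Y} f g = ∀ x → FinSet._≈_ Y (_≃_.to f x) (_≃_.to g x)

[_] : ℕ → FinSet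
[ n ] = record
  { setoid = ≡.setoid (Fin n)
  ; size   = n
  ; enum   = Ident.inverse (≡.setoid (Fin n))
  }

∅ : FinSet
∅ = [ 0 ]

join≃ : ∀ m n → Inverse (⊎-setoid (≡.setoid (Fin m)) (≡.setoid (Fin n))) (≡.setoid (Fin (m + n)))
join≃ m n = strictInverse {S = ⊎-setoid (≡.setoid (Fin m)) (≡.setoid (Fin n))} {T = ≡.setoid (Fin (m + n))}
  (join m n) (splitAt m)
  (λ { (inj₁ refl) → refl ; (inj₂ refl) → refl })
  (λ { {x} refl → Setoid.refl S′ {splitAt m x} })
  (join-splitAt m n)
  (λ x → Setoid.reflexive S′ (splitAt-join m n x))
  where S′ = ⊎-setoid (≡.setoid (Fin m)) (≡.setoid (Fin n))

infixr 6 _⊔ˢ_ _⊔≃_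

_⊔ˢ_ : FinSet → FinSet → FinSet
X ⊔ˢ Y = record
  { setoid = ⊎-setoid X.setoid Y.setoid
  ; size   = X.size + Y.size
  ; enum   = Comp.inverse (X.enum ⊎-inverse Y.enum) (join≃ X.size Y.size)
  }
  where
  module X = FinSet X
  module Y = FinSet Y

_⊔≃_ : ∀ {X Y X′ Y′} → X ≃ X′ → Y ≃ Y′ → (X ⊔ˢ Y) ≃ (X′ ⊔ˢ Y′)
bijection f ⊔≃ bijection g = bijection (f ⊎-inverse g)

-- σ_{k,l}: i ∈ [k] goes to i, and j ∈ [l] to k + j.

shift : ∀ k l → ([ k ] ⊔ˢ [ l ]) ≃ [ k + l ]
shift k l = bijection (join≃ k l)

⊔-assoc : ∀ X Y Z → ((X ⊔ˢ Y) ⊔ˢ Z) ≃ (X ⊔ˢ (Y ⊔ˢ Z))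
⊔-assoc X Y Z = strict≃
  (λ { (inj₁ (inj₁ x)) → inj₁ x ; (inj₁ (inj₂ y)) → inj₂ (inj₁ y) ; (inj₂ z) → inj₂ (inj₂ z) })
  (λ { (inj₁ x) → inj₁ (inj₁ x) ; (inj₂ (inj₁ y)) → inj₁ (inj₂ y) ; (inj₂ (inj₂ z)) → inj₂ z })
  (λ { (inj₁ (inj₁ p)) → inj₁ p ; (inj₁ (inj₂ p)) → inj₂ (inj₁ p) ; (inj₂ p) → inj₂ (inj₂ p) })
  (λ { (inj₁ p) → inj₁ (inj₁ p) ; (inj₂ (inj₁ p)) → inj₁ (inj₂ p) ; (inj₂ (inj₂ p)) → inj₂ p })
  (λ { (inj₁ x) → inj₁ (FinSet.≈-refl X) ; (inj₂ (inj₁ y)) → inj₂ (inj₁ (FinSet.≈-refl Y))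
     ; (inj₂ (inj₂ z)) → inj₂ (inj₂ (FinSet.≈-refl Z)) })
  (λ { (inj₁ (inj₁ x)) → inj₁ (inj₁ (FinSet.≈-refl X)) ; (inj₁ (inj₂ y)) → inj₁ (inj₂ (FinSet.≈-refl Y))
     ; (inj₂ z) → inj₂ (FinSet.≈-refl Z) })

∅⊔≃ : ∀ X → (∅ ⊔ˢ X) ≃ X
∅⊔≃ X = strict≃
  (λ { (inj₂ x) → x }) inj₂
  (λ { (inj₂ p) → p }) inj₂
  (λ _ → FinSet.≈-refl X) (λ { (inj₂ x) → inj₂ (FinSet.≈-refl X) })

⊔∅≃ : ∀ X → (X ⊔ˢ ∅) ≃ X
⊔∅≃ X = strict≃
  (λ { (inj₁ x) → x }) inj₁
  (λ { (inj₁ p) → p }) inj₁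
  (λ _ → FinSet.≈-refl X) (λ { (inj₁ x) → inj₁ (FinSet.≈-refl X) })

middle-swap : ∀ A B C D → ((A ⊔ˢ B) ⊔ˢ (C ⊔ˢ D)) ≃ ((A ⊔ˢ C) ⊔ˢ (B ⊔ˢ D))
middle-swap A B C D = strict≃
  (λ { (inj₁ (inj₁ x)) → inj₁ (inj₁ x) ; (inj₁ (inj₂ x)) → inj₂ (inj₁ x)
     ; (inj₂ (inj₁ x)) → inj₁ (inj₂ x) ; (inj₂ (inj₂ x)) → inj₂ (inj₂ x) })
  (λ { (inj₁ (inj₁ x)) → inj₁ (inj₁ x) ; (inj₁ (inj₂ x)) → inj₂ (inj₁ x)
     ; (inj₂ (inj₁ x)) → inj₁ (inj₂ x) ; (inj₂ (inj₂ x)) → inj₂ (inj₂ x) })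
  (λ { (inj₁ (inj₁ x)) → inj₁ (inj₁ x) ; (inj₁ (inj₂ x)) → inj₂ (inj₁ x)
     ; (inj₂ (inj₁ x)) → inj₁ (inj₂ x) ; (inj₂ (inj₂ x)) → inj₂ (inj₂ x) })
  (λ { (inj₁ (inj₁ x)) → inj₁ (inj₁ x) ; (inj₁ (inj₂ x)) → inj₂ (inj₁ x)
     ; (inj₂ (inj₁ x)) → inj₁ (inj₂ x) ; (inj₂ (inj₂ x)) → inj₂ (inj₂ x) })
  (λ { (inj₁ (inj₁ x)) → inj₁ (inj₁ (FinSet.≈-refl A)) ; (inj₁ (inj₂ x)) → inj₁ (inj₂ (FinSet.≈-refl C))
     ; (inj₂ (inj₁ x)) → inj₂ (inj₁ (FinSet.≈-refl B)) ; (inj₂ (inj₂ x)) → inj₂ (inj₂ (FinSet.≈-refl D)) })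
  (λ { (inj₁ (inj₁ x)) → inj₁ (inj₁ (FinSet.≈-refl A)) ; (inj₁ (inj₂ x)) → inj₁ (inj₂ (FinSet.≈-refl B))
     ; (inj₂ (inj₁ x)) → inj₂ (inj₁ (FinSet.≈-refl C)) ; (inj₂ (inj₂ x)) → inj₂ (inj₂ (FinSet.≈-refl D)) })

vectors : ∀ {A : Set} → List A → ∀ n → List (Vec A n)
vectors as zero    = [] ∷ []
vectors as (suc n) = concatMap (λ a → mapᴸ (a ∷_) (vectors as n)) as

subsets : ∀ n → List (Subset n)
subsets = vectors (inside ∷ outside ∷ [])

rank : ∀ {n} (A : Subset n) {i} → i ∈ A → Fin ∣ A ∣
rank (inside  ∷ A) here      = zero
rank (inside  ∷ A) (there p) = suc (rank A p)
rank (outside ∷ A) (there p) = rank A p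

unrank : ∀ {n} (A : Subset n) → Fin ∣ A ∣ → Σ[ i ∈ Fin n ] i ∈ A
unrank (inside  ∷ A) zero    = zero , here
unrank (inside  ∷ A) (suc j) = let (i , p) = unrank A j in suc i , there p
unrank (outside ∷ A) j       = let (i , p) = unrank A j in suc i , there p

rank-cong : ∀ {n} (A : Subset n) {i j} (p : i ∈ A) (q : j ∈ A) → i ≡ j → rank A p ≡ rank A q
rank-cong (inside  ∷ A) here      here      _    = refl
rank-cong (inside  ∷ A) (there p) (there q) refl = ≡.cong suc (rank-cong A p q refl)
rank-cong (outside ∷ A) (there p) (there q) refl = rank-cong A p q refl

rank-unrank : ∀ {n} (A : Subset n) j → rank A (proj₂ (unrank A j)) ≡ j
rank-unrank (inside  ∷ A) zero    = refl
rank-unrank (inside  ∷ A) (suc j) = ≡.cong suc (rank-unrank A j)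
rank-unrank (outside ∷ A) j       = rank-unrank A j

unrank-rank : ∀ {n} (A : Subset n) {i} (p : i ∈ A) → proj₁ (unrank A (rank A p)) ≡ i
unrank-rank (inside  ∷ A) here      = refl
unrank-rank (inside  ∷ A) (there p) = ≡.cong suc (unrank-rank A p)
unrank-rank (outside ∷ A) (there p) = ≡.cong suc (unrank-rank A p)

-- A as a finite set, enumerated by the increasing bijection A → [ ∣ A ∣ ].

⟪_⟫ : ∀ {n} → Subset n → FinSet
⟪_⟫ {n} A = record { setoid = S ; size = ∣ A ∣ ; enum = e }
  where
  S : Setoid 0ℓ 0ℓ
  S = On.setoid {B = Σ[ i ∈ Fin n ] i ∈ A} (≡.setoid (Fin n)) proj₁

  e : Inverse S (≡.setoid (Fin ∣ A ∣))
  e = strictInverse {S = S} {T = ≡.setoid (Fin ∣ A ∣)}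
    (λ x → rank A (proj₂ x)) (unrank A)
    (λ {x} {y} → rank-cong A (proj₂ x) (proj₂ y)) (λ { refl → refl })
    (rank-unrank A) (λ x → unrank-rank A (proj₂ x))

σ⟪_⟫ : ∀ {n} (A : Subset n) → ⟪ A ⟫ ≃ [ ∣ A ∣ ]
σ⟪ A ⟫ = bijection (FinSet.enum ⟪ A ⟫)

partition≃ : ∀ {n} (A : Subset n) → (⟪ A ⟫ ⊔ˢ ⟪ ∁ A ⟫) ≃ [ n ]
partition≃ {n} A = strict≃ to from
  (λ { (inj₁ p) → p ; (inj₂ p) → p })
  (λ { {x} refl → Setoid.refl S {from x} })
  to∘from from∘to
  where
  S = FinSet.setoid (⟪ A ⟫ ⊔ˢ ⟪ ∁ A ⟫)

  to : Setoid.Carrier S → Fin n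
  to (inj₁ x) = proj₁ x
  to (inj₂ x) = proj₁ x

  from : Fin n → Setoid.Carrier S
  from i with i ∈? A
  ... | yes p = inj₁ (i , p)
  ... | no ¬p = inj₂ (i , x∉p⇒x∈∁p ¬p)

  to∘from : ∀ i → to (from i) ≡ i
  to∘from i with i ∈? A
  ... | yes p = refl
  ... | no ¬p = refl

  from∘to : ∀ x → Setoid._≈_ S (from (to x)) x
  from∘to (inj₁ (i , p)) with i ∈? A
  ... | yes _ = inj₁ refl
  ... | no ¬p = ⊥-elim (¬p p)
  from∘to (inj₂ (i , q)) with i ∈? A
  ... | yes p = ⊥-elim (x∈∁p⇒x∉p q p)
  ... | no _  = inj₂ refl

record 𝓔 (X : FinSet) : Set₁ where
  open FinSet X using (Carrier; _≈_)
  infix 4 _∼_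
  field
    _∼_           : Rel Carrier 0ℓ
    isEquivalence : IsEquivalence _∼_
    reflexive     : ∀ {x y} → x ≈ y → x ∼ y
    _∼?_          : Decidable _∼_

  open IsEquivalence isEquivalence public
    using () renaming (refl to ∼-refl; sym to ∼-sym; trans to ∼-trans)

-- E ≤ᴱ E′ says that E is the coarser one.  Equivalences are equal when they
-- relate the same elements, which is _≐_.

infix 4 _≤ᴱ_ _≐_

_≤ᴱ_ : ∀ {X} → 𝓔 X → 𝓔 X → Set
E ≤ᴱ E′ = ∀ {x y} → 𝓔._∼_ E′ x y → 𝓔._∼_ E x y

_≐_ : ∀ {X} → 𝓔 X → 𝓔 X → Set
E ≐ E′ = (E ≤ᴱ E′) × (E′ ≤ᴱ E)

IsEquality : ∀ {X} → 𝓔 X → Set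
IsEquality {X} E = ∀ {x y} → 𝓔._∼_ E x y → FinSet._≈_ X x y

-- The opaque blocks hold proofs, and an enumeration of the classes whose
-- choice is immaterial; they keep normal forms small.

opaque
  quotientFin : ∀ n (_∼_ : Rel (Fin n) 0ℓ) (eq : IsEquivalence _∼_) → Decidable _∼_ →
    Σ[ k ∈ ℕ ] Inverse (record { Carrier = Fin n ; _≈_ = _∼_ ; isEquivalence = eq }) (≡.setoid (Fin k))
  quotientFin zero _∼_ eq _∼?_ = 0 , strictInverse
    {S = record { isEquivalence = eq }} {T = ≡.setoid (Fin 0)}
    (λ ()) (λ ()) (λ { {()} }) (λ { {()} }) (λ ()) (λ ())
  quotientFin (suc n) _∼_ eq _∼?_
    with quotientFin n (λ i j → suc i ∼ suc j)
           (record { refl = IsEquivalence.refl eq ; sym = IsEquivalence.sym eq ; trans = IsEquivalence.trans eq })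
           (λ i j → suc i ∼? suc j)
       | any? (λ i → zero ∼? suc i)
  ... | k , φ | yes (i₀ , r) = k , strictInverse {S = record { isEquivalence = eq }} {T = ≡.setoid (Fin k)}
          to (λ c → suc (φ.from c)) (λ {x} {y} → to-cong {x} {y}) (λ { refl → E.refl }) φ.strictlyInverseˡ from∘to
    where
    module φ = Inverse φ
    module E = IsEquivalence eq

    to : Fin (suc n) → Fin k
    to zero    = φ.to i₀
    to (suc i) = φ.to i

    to-cong : ∀ {x y} → x ∼ y → to x ≡ to y
    to-cong {zero}  {zero}  p = refl
    to-cong {zero}  {suc y} p = φ.to-cong (E.trans (E.sym r) p)
    to-cong {suc x} {zero}  p = φ.to-cong (E.trans p r)
    to-cong {suc x} {suc y} p = φ.to-cong p

    from∘to : ∀ x → suc (φ.from (to x)) ∼ x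
    from∘to zero    = E.trans (φ.strictlyInverseʳ i₀) (E.sym r)
    from∘to (suc x) = φ.strictlyInverseʳ x
  ... | k , φ | no ¬r = suc k , strictInverse {S = record { isEquivalence = eq }} {T = ≡.setoid (Fin (suc k))}
          to from (λ {x} {y} → to-cong {x} {y}) (λ { refl → E.refl })
          (λ { zero → refl ; (suc c) → ≡.cong suc (φ.strictlyInverseˡ c) })
          (λ { zero → E.refl ; (suc x) → φ.strictlyInverseʳ x })
    where
    module φ = Inverse φ
    module E = IsEquivalence eq

    to : Fin (suc n) → Fin (suc k)
    to zero    = zero
    to (suc i) = suc (φ.to i)

    from : Fin (suc k) → Fin (suc n)
    from zero    = zero
    from (suc c) = suc (φ.from c)

    to-cong : ∀ {x y} → x ∼ y → to x ≡ to y
    to-cong {zero}  {zero}  p = refl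
    to-cong {zero}  {suc y} p = ⊥-elim (¬r (y , p))
    to-cong {suc x} {zero}  p = ⊥-elim (¬r (x , E.sym p))
    to-cong {suc x} {suc y} p = ≡.cong suc (φ.to-cong p)

infixl 7 _/_

_/_ : (X : FinSet) → 𝓔 X → FinSet
X / E = record
  { setoid = S
  ; size   = proj₁ q
  ; enum   = Comp.inverse e (proj₂ q)
  }
  where
  module X = FinSet X
  module e = Inverse X.enum
  open 𝓔 E

  S : Setoid 0ℓ 0ℓ
  S = record { isEquivalence = isEquivalence }

  _∼ᶠ_ : Rel (Fin X.size) 0ℓ
  i ∼ᶠ j = e.from i ∼ e.from j

  eqᶠ : IsEquivalence _∼ᶠ_
  eqᶠ = On.isEquivalence e.from isEquivalence

  Sᶠ : Setoid 0ℓ 0ℓ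
  Sᶠ = record { isEquivalence = eqᶠ }

  q = quotientFin X.size _∼ᶠ_ eqᶠ (λ i j → e.from i ∼? e.from j)

  unit : ∀ x → e.from (e.to x) ∼ x
  unit x = reflexive (e.strictlyInverseʳ x)

  e : Inverse S Sᶠ
  e = strictInverse {S = S} {T = Sᶠ} e.to e.from
    (λ {x} {y} p → ∼-trans (unit x) (∼-trans p (∼-sym (unit y))))
    id
    (λ i → unit (e.from i))
    unit

-- The transport ∼_σ along σ : X ≃ Y, and the induced bijection
-- σ/∼ : X/∼ ≃ Y/∼_σ.

transport : ∀ {X Y} → X ≃ Y → 𝓔 X → 𝓔 Y
transport σ E = record
  { _∼_           = λ x y → from x ∼ from y
  ; isEquivalence = On.isEquivalence from isEquivalence
  ; reflexive     = λ p → reflexive (from-cong p)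
  ; _∼?_          = λ x y → from x ∼? from y
  }
  where
  open _≃_ σ
  open 𝓔 E

quotient≃ : ∀ {X Y} (σ : X ≃ Y) (E : 𝓔 X) (E′ : 𝓔 Y) → E′ ≐ transport σ E → (X / E) ≃ (Y / E′)
quotient≃ {X} {Y} σ E E′ (⊒ , ⊑) = strict≃
  to from
  (λ {x} {y} p → ⊒ (E.∼-trans (unit x) (E.∼-trans p (E.∼-sym (unit y)))))
  ⊑
  (λ y → E′.reflexive (strictlyInverseˡ y))
  unit
  where
  open _≃_ σ
  module E = 𝓔 E
  module E′ = 𝓔 E′

  unit : ∀ x → from (to x) E.∼ x
  unit x = E.reflexive (strictlyInverseʳ x)

-- The equivalence on X/∼′ given by an equivalence ∼ ≤ ∼′ on X.

descend : ∀ {X} (E E′ : 𝓔 X) → E ≤ᴱ E′ → 𝓔 (X / E′)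
descend E E′ le = record
  { _∼_           = _∼_
  ; isEquivalence = isEquivalence
  ; reflexive     = le
  ; _∼?_          = _∼?_
  }
  where open 𝓔 E

third-iso : ∀ {X} (E E′ : 𝓔 X) (le : E ≤ᴱ E′) → ((X / E′) / descend E E′ le) ≃ (X / E)
third-iso {X} E E′ le = bijection (Ident.inverse (FinSet.setoid (X / E)))

equality≃ : ∀ {X} (E : 𝓔 X) → IsEquality E → (X / E) ≃ X
equality≃ {X} E le = strict≃
  id id le (𝓔.reflexive E) (λ _ → FinSet.≈-refl X) (λ _ → 𝓔.∼-refl E)

∅/≃ : (E : 𝓔 ∅) → (∅ / E) ≃ ∅
∅/≃ E = equality≃ E λ { {()} }

restrictˡ : ∀ {X Y} → 𝓔 (X ⊔ˢ Y) → 𝓔 X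
restrictˡ E = record
  { _∼_           = λ x y → inj₁ x ∼ inj₁ y
  ; isEquivalence = On.isEquivalence inj₁ isEquivalence
  ; reflexive     = λ p → reflexive (inj₁ p)
  ; _∼?_          = λ x y → inj₁ x ∼? inj₁ y
  }
  where open 𝓔 E

restrictʳ : ∀ {X Y} → 𝓔 (X ⊔ˢ Y) → 𝓔 Y
restrictʳ E = record
  { _∼_           = λ x y → inj₂ x ∼ inj₂ y
  ; isEquivalence = On.isEquivalence inj₂ isEquivalence
  ; reflexive     = λ p → reflexive (inj₂ p)
  ; _∼?_          = λ x y → inj₂ x ∼? inj₂ y
  }
  where open 𝓔 E

_⊔ᴱ_ : ∀ {X Y} → 𝓔 X → 𝓔 Y → 𝓔 (X ⊔ˢ Y)
E ⊔ᴱ F = record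
  { _∼_           = Pointwise E._∼_ F._∼_
  ; isEquivalence = ⊎-isEquivalence E.isEquivalence F.isEquivalence
  ; reflexive     = λ { (inj₁ p) → inj₁ (E.reflexive p) ; (inj₂ p) → inj₂ (F.reflexive p) }
  ; _∼?_          = ⊎-decidable E._∼?_ F._∼?_
  }
  where
  module E = 𝓔 E
  module F = 𝓔 F

Splits : ∀ {X Y} → 𝓔 (X ⊔ˢ Y) → Set
Splits E = E ≐ (restrictˡ E ⊔ᴱ restrictʳ E)

split-quotient≃ : ∀ {X Y} (E : 𝓔 (X ⊔ˢ Y)) → Splits E →
  ((X / restrictˡ E) ⊔ˢ (Y / restrictʳ E)) ≃ ((X ⊔ˢ Y) / E)
split-quotient≃ {X} {Y} E (⊒ , ⊑) = strict≃
  id id ⊒ ⊑ (λ _ → 𝓔.∼-refl E) (λ x → Setoid.refl (FinSet.setoid ((X / restrictˡ E) ⊔ˢ (Y / restrictʳ E))) {x})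

-- The finite list of all equivalences on X, each occurring once up to ≐:
-- those Boolean matrices indexed by the elements of X, in the order given by
-- the enumeration of X, that are equivalence relations.

BoolMatrix : ℕ → Set
BoolMatrix n = Vec (Vec Bool n) n

matrixRel : ∀ {n} → BoolMatrix n → Rel (Fin n) 0ℓ
matrixRel M i j = T (lookup (lookup M i) j)

matrixRel? : ∀ {n} (M : BoolMatrix n) → Decidable (matrixRel M)
matrixRel? M i j = T? (lookup (lookup M i) j)

isEquivalence? : ∀ {n} (M : BoolMatrix n) → Dec (IsEquivalence (matrixRel M))
isEquivalence? M = map′
  (λ { (r , s , t) → record { refl  = λ {i} → r i
                            ; sym   = λ {i} {j} → s i j
                            ; trans = λ {i} {j} {k} → t i j k } })
  (λ e → (λ i → IsEquivalence.refl e {i})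
       , (λ i j → IsEquivalence.sym e {i} {j})
       , (λ i j k → IsEquivalence.trans e {i} {j} {k}))
  (all? (λ i → R? i i)
   ×-dec all? (λ i → all? (λ j → R? i j →-dec R? j i))
   ×-dec all? (λ i → all? (λ j → all? (λ k → R? i j →-dec (R? j k →-dec R? i k)))))
  where R? = matrixRel? M

matrix⇒𝓔 : ∀ X (M : BoolMatrix (FinSet.size X)) → IsEquivalence (matrixRel M) → 𝓔 X
matrix⇒𝓔 X M eq = record
  { _∼_           = λ x y → matrixRel M (to x) (to y)
  ; isEquivalence = On.isEquivalence to eq
  ; reflexive     = λ {x} p → ≡.subst (matrixRel M (to x)) (to-cong p) (IsEquivalence.refl eq)
  ; _∼?_          = λ x y → matrixRel? M (to x) (to y)
  }
  where open Inverse (FinSet.enum X)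

equivalences : ∀ X → List (𝓔 X)
equivalences X = mapMaybe
  (λ M → mapᴹ (matrix⇒𝓔 X M) (dec⇒maybe (isEquivalence? M)))
  (vectors (vectors (true ∷ false ∷ []) n) n)
  where n = FinSet.size X

record Category (o h e : Level) : Set (lsuc (o ⊔ h ⊔ e)) where
  infix  4 _≈_
  infixr 9 _∘ᶜ_
  field
    Obj       : Set o
    Hom       : Obj → Obj → Set h
    _≈_       : ∀ {A B} → Rel (Hom A B) e
    idᶜ       : ∀ {A} → Hom A A
    _∘ᶜ_      : ∀ {A B C} → Hom B C → Hom A B → Hom A C
    equiv     : ∀ {A B} → IsEquivalence (_≈_ {A} {B})
    assoc     : ∀ {A B C D} (h : Hom C D) (g : Hom B C) (f : Hom A B) →
                (h ∘ᶜ g) ∘ᶜ f ≈ h ∘ᶜ (g ∘ᶜ f)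
    identityˡ : ∀ {A B} (f : Hom A B) → idᶜ ∘ᶜ f ≈ f
    identityʳ : ∀ {A B} (f : Hom A B) → f ∘ᶜ idᶜ ≈ f
    ∘-resp-≈  : ∀ {A B C} {g g′ : Hom B C} {f f′ : Hom A B} →
                g ≈ g′ → f ≈ f′ → g ∘ᶜ f ≈ g′ ∘ᶜ f′

record FunctorOn {o h e o′ h′ e′} (C : Category o h e) (D : Category o′ h′ e′)
                 (F₀ : Category.Obj C → Category.Obj D) : Set (o ⊔ h ⊔ e ⊔ h′ ⊔ e′) where
  private
    module C = Category C
    module D = Category D
  field
    F₁       : ∀ {A B} → C.Hom A B → D.Hom (F₀ A) (F₀ B)
    F-resp-≈ : ∀ {A B} {f g : C.Hom A B} → f C.≈ g → F₁ f D.≈ F₁ g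
    F-id     : ∀ {A} → F₁ (C.idᶜ {A}) D.≈ D.idᶜ
    F-∘      : ∀ {A B C} (g : C.Hom B C) (f : C.Hom A B) → F₁ (g C.∘ᶜ f) D.≈ (F₁ g D.∘ᶜ F₁ f)

module Over (K : HeytingField ℓ ℓ ℓ) where

  commRing : CommutativeRing ℓ ℓ
  commRing = HeytingCommutativeRing.commutativeRing (HeytingField.heytingCommutativeRing K)

  open CommutativeRing commRing public
    using (_*_; 0#; 1#; -_)
    renaming (Carrier to 𝕜; _≈_ to _≈ᵏ_; _+_ to _+ᵏ_)
  private module 𝕜 = CommutativeRing commRing

  Vect : Set (lsuc ℓ)
  Vect = Module commRing ℓ ℓ

  ⌊_⌋ : Vect → Set ℓ
  ⌊ M ⌋ = Module.Carrierᴹ M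

  infix 4 _⊢_≈_

  _⊢_≈_ : (M : Vect) → Rel ⌊ M ⌋ ℓ
  M ⊢ x ≈ y = Module._≈ᴹ_ M x y

  infix 3 _⊸_

  record _⊸_ (M N : Vect) : Set ℓ where
    infixr 5 _⟨$⟩_
    field
      _⟨$⟩_                : ⌊ M ⌋ → ⌊ N ⌋
      isModuleHomomorphism :
        ModuleMorphisms.IsModuleHomomorphism (Module.rawModule M) (Module.rawModule N) _⟨$⟩_

    open ModuleMorphisms.IsModuleHomomorphism isModuleHomomorphism public
      using (⟦⟧-cong; +ᴹ-homo; 0ᴹ-homo; -ᴹ-homo; *ₗ-homo; *ᵣ-homo)

  open _⊸_ public using (_⟨$⟩_)

  infix 3 _≗ᴸ_

  _≗ᴸ_ : ∀ {M N} → M ⊸ N → M ⊸ N → Set ℓ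
  _≗ᴸ_ {M} {N} f g = ∀ x → N ⊢ f ⟨$⟩ x ≈ g ⟨$⟩ x

  opaque
    linear-isHom : ∀ {M N} →
      let module M = Module M
          module N = Module N
      in
      (f : ⌊ M ⌋ → ⌊ N ⌋) →
      (∀ {x y} → x M.≈ᴹ y → f x N.≈ᴹ f y) →
      (∀ x y → f (x M.+ᴹ y) N.≈ᴹ f x N.+ᴹ f y) →
      (∀ k x → f (k M.*ₗ x) N.≈ᴹ k N.*ₗ f x) →
      ModuleMorphisms.IsModuleHomomorphism M.rawModule N.rawModule f
    linear-isHom {M} {N} f cong hom-+ hom-* = record
      { isBimoduleHomomorphism = record
        { +ᴹ-isGroupHomomorphism = record
          { isMonoidHomomorphism = record
            { isMagmaHomomorphism = record
              { isRelHomomorphism = record { cong = cong }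
              ; homo = hom-+
              }
            ; ε-homo = 0-homo
            }
          ; ⁻¹-homo = λ x → N.uniqueˡ‿-ᴹ (f (M.-ᴹ x)) (f x)
              (N.≈ᴹ-trans (N.≈ᴹ-sym (hom-+ (M.-ᴹ x) x)) (N.≈ᴹ-trans (cong (M.-ᴹ‿inverseˡ x)) 0-homo))
          }
        ; *ₗ-homo = hom-*
        ; *ᵣ-homo = λ k x → N.≈ᴹ-trans (cong (M.≈ᴹ-sym (M.*ₗ-*ᵣ-coincident k x)))
            (N.≈ᴹ-trans (hom-* k x) (N.*ₗ-*ᵣ-coincident k (f x)))
        }
      }
      where
      module M = Module M
      module N = Module N

      0-homo : f M.0ᴹ N.≈ᴹ N.0ᴹ
      0-homo = N.≈ᴹ-trans (cong (M.≈ᴹ-sym (M.*ₗ-zeroˡ M.0ᴹ)))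
                 (N.≈ᴹ-trans (hom-* 0# M.0ᴹ) (N.*ₗ-zeroˡ (f M.0ᴹ)))

  linear : ∀ {M N} →
    let module M = Module M
        module N = Module N
    in
    (f : ⌊ M ⌋ → ⌊ N ⌋) →
    (∀ {x y} → x M.≈ᴹ y → f x N.≈ᴹ f y) →
    (∀ x y → f (x M.+ᴹ y) N.≈ᴹ f x N.+ᴹ f y) →
    (∀ k x → f (k M.*ₗ x) N.≈ᴹ k N.*ₗ f x) →
    M ⊸ N
  linear {M} {N} f cong hom-+ hom-* = record
    { _⟨$⟩_ = f ; isModuleHomomorphism = linear-isHom {M} {N} f cong hom-+ hom-* }

  idᴸ : ∀ {M} → M ⊸ M
  idᴸ {M} = linear id id (λ _ _ → Module.≈ᴹ-refl M) (λ _ _ → Module.≈ᴹ-refl M)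

  0ᴸ : ∀ {M N} → M ⊸ N
  0ᴸ {M} {N} = linear (λ _ → N.0ᴹ) (λ _ → N.≈ᴹ-refl)
    (λ _ _ → N.≈ᴹ-sym (N.+ᴹ-identityˡ N.0ᴹ)) (λ k _ → N.≈ᴹ-sym (N.*ₗ-zeroʳ k))
    where module N = Module N

  infixr 9 _∘ᴸ_

  _∘ᴸ_ : ∀ {M N P} → N ⊸ P → M ⊸ N → M ⊸ P
  _∘ᴸ_ {P = P} g f = linear (λ x → g ⟨$⟩ (f ⟨$⟩ x))
    (λ p → g.⟦⟧-cong (f.⟦⟧-cong p))
    (λ x y → Module.≈ᴹ-trans P (g.⟦⟧-cong (f.+ᴹ-homo x y)) (g.+ᴹ-homo _ _))
    (λ k x → Module.≈ᴹ-trans P (g.⟦⟧-cong (f.*ₗ-homo k x)) (g.*ₗ-homo k _))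
    where
    module f = _⊸_ f
    module g = _⊸_ g

  infixl 6 _+ᴸ_
  infixr 7 _*ᴸ_

  _+ᴸ_ : ∀ {M N} → M ⊸ N → M ⊸ N → M ⊸ N
  _+ᴸ_ {M} {N} f g = linear (λ x → (f ⟨$⟩ x) N.+ᴹ (g ⟨$⟩ x))
    (λ p → N.+ᴹ-cong (f.⟦⟧-cong p) (g.⟦⟧-cong p))
    (λ x y → N.≈ᴹ-trans (N.+ᴹ-cong (f.+ᴹ-homo x y) (g.+ᴹ-homo x y)) (interchange _ _ _ _))
    (λ k x → N.≈ᴹ-trans (N.+ᴹ-cong (f.*ₗ-homo k x) (g.*ₗ-homo k x)) (N.≈ᴹ-sym (N.*ₗ-distribˡ k _ _)))
    where
    module f = _⊸_ f
    module g = _⊸_ g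
    module N = Module N
    open CommutativeSemigroupProperties
      (CommutativeMonoid.commutativeSemigroup N.+ᴹ-commutativeMonoid) using (interchange)

  _*ᴸ_ : ∀ {M N} → 𝕜 → M ⊸ N → M ⊸ N
  _*ᴸ_ {M} {N} k f = linear (λ x → k N.*ₗ (f ⟨$⟩ x))
    (λ p → N.*ₗ-cong 𝕜.refl (f.⟦⟧-cong p))
    (λ x y → N.≈ᴹ-trans (N.*ₗ-cong 𝕜.refl (f.+ᴹ-homo x y)) (N.*ₗ-distribˡ k _ _))
    (λ l x → N.≈ᴹ-trans (N.*ₗ-cong 𝕜.refl (f.*ₗ-homo l x))
      (N.≈ᴹ-trans (N.≈ᴹ-sym (N.*ₗ-assoc k l _))
        (N.≈ᴹ-trans (N.*ₗ-cong (𝕜.*-comm k l) N.≈ᴹ-refl) (N.*ₗ-assoc l k _))))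
    where
    module f = _⊸_ f
    module N = Module N

  𝕂 : Vect
  𝕂 = TensorUnit.⟨module⟩

  ∑ : ∀ {a} {A : Set a} (M : Vect) → List A → (A → ⌊ M ⌋) → ⌊ M ⌋
  ∑ M as f = foldr (λ a x → Module._+ᴹ_ M (f a) x) (Module.0ᴹ M) as

  data Term (G : Set ℓ) : Set ℓ where
    gen : G → Term G
    𝟎   : Term G
    _⊕_ : Term G → Term G → Term G
    _·_ : 𝕜 → Term G → Term G

  infixl 6 _⊕_
  infixr 7 _·_

  eval : ∀ {G} (M : Vect) → (G → ⌊ M ⌋) → Term G → ⌊ M ⌋
  eval M f (gen g) = f g
  eval M f 𝟎       = Module.0ᴹ M
  eval M f (s ⊕ t) = Module._+ᴹ_ M (eval M f s) (eval M f t)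
  eval M f (k · t) = Module._*ₗ_ M k (eval M f t)

  module _ {G : Set ℓ} (R : Rel (Term G) ℓ) where

    infix 4 _≈ᵗ_

    data _≈ᵗ_ : Rel (Term G) ℓ where
      rel         : ∀ {s t} → R s t → s ≈ᵗ t
      ≈-refl      : ∀ {s} → s ≈ᵗ s
      ≈-sym       : ∀ {s t} → s ≈ᵗ t → t ≈ᵗ s
      ≈-trans     : ∀ {s t u} → s ≈ᵗ t → t ≈ᵗ u → s ≈ᵗ u
      ⊕-cong      : ∀ {s s′ t t′} → s ≈ᵗ s′ → t ≈ᵗ t′ → s ⊕ t ≈ᵗ s′ ⊕ t′
      ·-cong      : ∀ {k k′ t t′} → k ≈ᵏ k′ → t ≈ᵗ t′ → k · t ≈ᵗ k′ · t′
      ⊕-assoc     : ∀ s t u → (s ⊕ t) ⊕ u ≈ᵗ s ⊕ (t ⊕ u)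
      ⊕-comm      : ∀ s t → s ⊕ t ≈ᵗ t ⊕ s
      ⊕-identityˡ : ∀ t → 𝟎 ⊕ t ≈ᵗ t
      ·-distribʳ  : ∀ t k l → (k +ᵏ l) · t ≈ᵗ k · t ⊕ l · t
      ·-distribˡ  : ∀ k s t → k · (s ⊕ t) ≈ᵗ k · s ⊕ k · t
      ·-assoc     : ∀ k l t → (k * l) · t ≈ᵗ k · (l · t)
      ·-identity  : ∀ t → 1# · t ≈ᵗ t
      ·-zeroˡ     : ∀ t → 0# · t ≈ᵗ 𝟎

    opaque
      presented-isModule : IsModule commRing _≈ᵗ_ _⊕_ 𝟎 ((- 1#) ·_) _·_ (flip _·_)
      presented-isModule = IsModuleFromLeft.isModule isModuleFromLeft
        where
        isEq : IsEquivalence _≈ᵗ_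
        isEq = record { refl = ≈-refl ; sym = ≈-sym ; trans = ≈-trans }

        negˡ : ∀ t → (- 1#) · t ⊕ t ≈ᵗ 𝟎
        negˡ t = ≈-trans (⊕-cong ≈-refl (≈-sym (·-identity t)))
                   (≈-trans (≈-sym (·-distribʳ t (- 1#) 1#))
                     (≈-trans (·-cong (𝕜.-‿inverseˡ 1#) ≈-refl) (·-zeroˡ t)))

        isModuleFromLeft : IsModuleFromLeft commRing _≈ᵗ_ _⊕_ 𝟎 ((- 1#) ·_) _·_
        isModuleFromLeft = record { isLeftModule = record
          { isLeftSemimodule = record
            { +ᴹ-isCommutativeMonoid = record
              { isMonoid = record
                { isSemigroup = record
                  { isMagma = record { isEquivalence = isEq ; ∙-cong = ⊕-cong }
                  ; assoc = ⊕-assoc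
                  }
                ; identity = ⊕-identityˡ , λ t → ≈-trans (⊕-comm t 𝟎) (⊕-identityˡ t)
                }
              ; comm = ⊕-comm
              }
            ; isPreleftSemimodule = record
              { *ₗ-cong      = ·-cong
              ; *ₗ-zeroˡ     = ·-zeroˡ
              ; *ₗ-distribʳ  = ·-distribʳ
              ; *ₗ-identityˡ = ·-identity
              ; *ₗ-assoc     = ·-assoc
              ; *ₗ-zeroʳ     = λ k → ≈-trans (·-cong 𝕜.refl (≈-sym (·-zeroˡ 𝟎)))
                  (≈-trans (≈-sym (·-assoc k 0# 𝟎)) (≈-trans (·-cong (𝕜.zeroʳ k) ≈-refl) (·-zeroˡ 𝟎)))
              ; *ₗ-distribˡ  = ·-distribˡ
              }
            }
          ; -ᴹ‿cong    = ·-cong 𝕜.refl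
          ; -ᴹ‿inverse = negˡ , λ t → ≈-trans (⊕-comm t ((- 1#) · t)) (negˡ t)
          } }

    Presented : Vect
    Presented = record { isModule = presented-isModule }

    opaque
      eval-cong : (M : Vect) (f : G → ⌊ M ⌋) →
                  (∀ {s t} → R s t → M ⊢ eval M f s ≈ eval M f t) →
                  ∀ {s t} → s ≈ᵗ t → M ⊢ eval M f s ≈ eval M f t
      eval-cong M f resp = cong
        where
        module M = Module M

        cong : ∀ {s t} → s ≈ᵗ t → M ⊢ eval M f s ≈ eval M f t
        cong (rel r)            = resp r
        cong ≈-refl             = M.≈ᴹ-refl
        cong (≈-sym p)          = M.≈ᴹ-sym (cong p)
        cong (≈-trans p q)      = M.≈ᴹ-trans (cong p) (cong q)
        cong (⊕-cong p q)       = M.+ᴹ-cong (cong p) (cong q)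
        cong (·-cong k p)       = M.*ₗ-cong k (cong p)
        cong (⊕-assoc s t u)    = M.+ᴹ-assoc _ _ _
        cong (⊕-comm s t)       = M.+ᴹ-comm _ _
        cong (⊕-identityˡ t)    = M.+ᴹ-identityˡ _
        cong (·-distribʳ t k l) = M.*ₗ-distribʳ _ k l
        cong (·-distribˡ k s t) = M.*ₗ-distribˡ k _ _
        cong (·-assoc k l t)    = M.*ₗ-assoc k l _
        cong (·-identity t)     = M.*ₗ-identityˡ _
        cong (·-zeroˡ t)        = M.*ₗ-zeroˡ _

    lift : (M : Vect) (f : G → ⌊ M ⌋) →
           (∀ {s t} → R s t → M ⊢ eval M f s ≈ eval M f t) → Presented ⊸ M
    lift M f resp = linear (eval M f) (eval-cong M f resp)
      (λ _ _ → Module.≈ᴹ-refl M) (λ _ _ → Module.≈ᴹ-refl M)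

    ext : ∀ {M} (f g : Presented ⊸ M) →
          (∀ x → M ⊢ f ⟨$⟩ gen x ≈ g ⟨$⟩ gen x) → f ≗ᴸ g
    ext {M} f g p = go
      where
      module M = Module M
      module f = _⊸_ f
      module g = _⊸_ g

      go : f ≗ᴸ g
      go (gen x) = p x
      go 𝟎       = M.≈ᴹ-trans f.0ᴹ-homo (M.≈ᴹ-sym g.0ᴹ-homo)
      go (s ⊕ t) = M.≈ᴹ-trans (f.+ᴹ-homo s t)
                     (M.≈ᴹ-trans (M.+ᴹ-cong (go s) (go t)) (M.≈ᴹ-sym (g.+ᴹ-homo s t)))
      go (k · t) = M.≈ᴹ-trans (f.*ₗ-homo k t)
                     (M.≈ᴹ-trans (M.*ₗ-cong 𝕜.refl (go t)) (M.≈ᴹ-sym (g.*ₗ-homo k t)))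

  module _ (M N : Vect) where
    private
      module M = Module M
      module N = Module N

    data Bilin : Rel (Term (⌊ M ⌋ × ⌊ N ⌋)) ℓ where
      ⊗-cong : ∀ {x x′ y y′} → x M.≈ᴹ x′ → y N.≈ᴹ y′ → Bilin (gen (x , y)) (gen (x′ , y′))
      ⊗-+ˡ   : ∀ x x′ y → Bilin (gen (x M.+ᴹ x′ , y)) (gen (x , y) ⊕ gen (x′ , y))
      ⊗-+ʳ   : ∀ x y y′ → Bilin (gen (x , y N.+ᴹ y′)) (gen (x , y) ⊕ gen (x , y′))
      ⊗-*ˡ   : ∀ k x y → Bilin (gen (k M.*ₗ x , y)) (k · gen (x , y))
      ⊗-*ʳ   : ∀ k x y → Bilin (gen (x , k N.*ₗ y)) (k · gen (x , y))

  infixr 6 _⊗_ _⊗ₜ_ _⊗₁_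

  _⊗_ : Vect → Vect → Vect
  M ⊗ N = Presented (Bilin M N)

  _⊗ₜ_ : ∀ {X Y : Set ℓ} → X → Y → Term (X × Y)
  x ⊗ₜ y = gen (x , y)

  record Bilinear (M N Q : Vect) : Set ℓ where
    private
      module M = Module M
      module N = Module N
      module Q = Module Q
    field
      fun  : ⌊ M ⌋ → ⌊ N ⌋ → ⌊ Q ⌋
      cong : ∀ {x x′ y y′} → x M.≈ᴹ x′ → y N.≈ᴹ y′ → fun x y Q.≈ᴹ fun x′ y′
      +ˡ   : ∀ x x′ y → fun (x M.+ᴹ x′) y Q.≈ᴹ fun x y Q.+ᴹ fun x′ y
      +ʳ   : ∀ x y y′ → fun x (y N.+ᴹ y′) Q.≈ᴹ fun x y Q.+ᴹ fun x y′
      *ˡ   : ∀ k x y → fun (k M.*ₗ x) y Q.≈ᴹ k Q.*ₗ fun x y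
      *ʳ   : ∀ k x y → fun x (k N.*ₗ y) Q.≈ᴹ k Q.*ₗ fun x y

  ⊗-lift : ∀ {M N Q} → Bilinear M N Q → M ⊗ N ⊸ Q
  ⊗-lift {M} {N} {Q} b = lift (Bilin M N) Q (λ xy → fun (proj₁ xy) (proj₂ xy)) λ
    { (⊗-cong p q)   → cong p q
    ; (⊗-+ˡ x x′ y)  → +ˡ x x′ y
    ; (⊗-+ʳ x y y′)  → +ʳ x y y′
    ; (⊗-*ˡ k x y)   → *ˡ k x y
    ; (⊗-*ʳ k x y)   → *ʳ k x y
    }
    where open Bilinear b

  _⊗₁_ : ∀ {M N M′ N′} → M ⊸ M′ → N ⊸ N′ → M ⊗ N ⊸ M′ ⊗ N′
  _⊗₁_ {M} {N} {M′} {N′} f g = ⊗-lift {M} {N} {M′ ⊗ N′} record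
    { fun  = λ x y → (f ⟨$⟩ x) ⊗ₜ (g ⟨$⟩ y)
    ; cong = λ p q → rel (⊗-cong (f.⟦⟧-cong p) (g.⟦⟧-cong q))
    ; +ˡ   = λ x x′ y → ≈-trans (rel (⊗-cong (f.+ᴹ-homo x x′) N′.≈ᴹ-refl)) (rel (⊗-+ˡ _ _ _))
    ; +ʳ   = λ x y y′ → ≈-trans (rel (⊗-cong M′.≈ᴹ-refl (g.+ᴹ-homo y y′))) (rel (⊗-+ʳ _ _ _))
    ; *ˡ   = λ k x y → ≈-trans (rel (⊗-cong (f.*ₗ-homo k x) N′.≈ᴹ-refl)) (rel (⊗-*ˡ k _ _))
    ; *ʳ   = λ k x y → ≈-trans (rel (⊗-cong M′.≈ᴹ-refl (g.*ₗ-homo k y))) (rel (⊗-*ʳ k _ _))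
    }
    where
    module f = _⊸_ f
    module g = _⊸_ g
    module M′ = Module M′
    module N′ = Module N′

  ⊗-flip : ∀ M N → M ⊗ N ⊸ N ⊗ M
  ⊗-flip M N = ⊗-lift {M} {N} {N ⊗ M} record
    { fun  = λ x y → y ⊗ₜ x
    ; cong = λ p q → rel (⊗-cong q p)
    ; +ˡ   = λ x x′ y → rel (⊗-+ʳ y x x′)
    ; +ʳ   = λ x y y′ → rel (⊗-+ˡ y y′ x)
    ; *ˡ   = λ k x y → rel (⊗-*ʳ k y x)
    ; *ʳ   = λ k x y → rel (⊗-*ˡ k y x)
    }

  -- Maps out of (M ⊗ N) ⊗ Q from maps L z : M ⊗ N → R which, on pure tensors,
  -- depend linearly on z.

  ⊗-lift-family : ∀ {M N Q R} → let module Q = Module Q in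
    (L : ⌊ Q ⌋ → M ⊗ N ⊸ R) →
    (∀ {z z′} → z Q.≈ᴹ z′ → ∀ xy → R ⊢ L z ⟨$⟩ gen xy ≈ L z′ ⟨$⟩ gen xy) →
    (∀ z z′ xy → R ⊢ L (z Q.+ᴹ z′) ⟨$⟩ gen xy ≈ (L z +ᴸ L z′) ⟨$⟩ gen xy) →
    (∀ k z xy → R ⊢ L (k Q.*ₗ z) ⟨$⟩ gen xy ≈ (k *ᴸ L z) ⟨$⟩ gen xy) →
    (M ⊗ N) ⊗ Q ⊸ R
  ⊗-lift-family {M} {N} {Q} {R} L L-cong L-+ L-* = ⊗-lift {M ⊗ N} {Q} {R} record
    { fun  = λ t z → L z ⟨$⟩ t
    ; cong = λ {t} {t′} {z} {z′} p q → Module.≈ᴹ-trans R (_⊸_.⟦⟧-cong (L z) p)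
               (ext (Bilin M N) (L z) (L z′) (L-cong q) t′)
    ; +ˡ   = λ t t′ z → _⊸_.+ᴹ-homo (L z) t t′
    ; +ʳ   = λ t z z′ → ext (Bilin M N) (L (Module._+ᴹ_ Q z z′)) (L z +ᴸ L z′) (L-+ z z′) t
    ; *ˡ   = λ k t z → _⊸_.*ₗ-homo (L z) k t
    ; *ʳ   = λ k t z → ext (Bilin M N) (L (Module._*ₗ_ Q k z)) (k *ᴸ L z) (L-* k z) t
    }

  ⊗-assoc : ∀ M N Q → (M ⊗ N) ⊗ Q ⊸ M ⊗ (N ⊗ Q)
  ⊗-assoc M N Q = ⊗-lift-family {M} {N} {Q} {M ⊗ (N ⊗ Q)}
    (λ z → ⊗-lift {M} {N} {M ⊗ (N ⊗ Q)} record
      { fun  = λ x y → x ⊗ₜ (y ⊗ₜ z)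
      ; cong = λ p q → rel (⊗-cong p (rel (⊗-cong q Q.≈ᴹ-refl)))
      ; +ˡ   = λ x x′ y → rel (⊗-+ˡ x x′ _)
      ; +ʳ   = λ x y y′ → ≈-trans (rel (⊗-cong M.≈ᴹ-refl (rel (⊗-+ˡ y y′ z)))) (rel (⊗-+ʳ x _ _))
      ; *ˡ   = λ k x y → rel (⊗-*ˡ k x _)
      ; *ʳ   = λ k x y → ≈-trans (rel (⊗-cong M.≈ᴹ-refl (rel (⊗-*ˡ k y z)))) (rel (⊗-*ʳ k x _))
      })
    (λ p xy → rel (⊗-cong M.≈ᴹ-refl (rel (⊗-cong N.≈ᴹ-refl p))))
    (λ z z′ xy → ≈-trans (rel (⊗-cong M.≈ᴹ-refl (rel (⊗-+ʳ _ z z′)))) (rel (⊗-+ʳ _ _ _)))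
    (λ k z xy → ≈-trans (rel (⊗-cong M.≈ᴹ-refl (rel (⊗-*ʳ k _ z)))) (rel (⊗-*ʳ k _ _)))
    where
    module M = Module M
    module N = Module N
    module Q = Module Q

  -- (Id ⊗ c ⊗ Id) : a ⊗ b ⊗ a′ ⊗ b′ ↦ a ⊗ a′ ⊗ b ⊗ b′.

  Id⊗c⊗Id : ∀ M N M′ N′ → (M ⊗ N) ⊗ (M′ ⊗ N′) ⊸ (M ⊗ M′) ⊗ (N ⊗ N′)
  Id⊗c⊗Id M N M′ N′ = ⊗-lift-family {M} {N} {M′ ⊗ N′} {R}
    (λ t → ⊗-lift {M} {N} {R} record
      { fun  = λ x y → S x y ⟨$⟩ t
      ; cong = λ p q → ext B′ (S _ _) (S _ _)
                 (λ _ → rel (⊗-cong (rel (⊗-cong p M′.≈ᴹ-refl)) (rel (⊗-cong q N′.≈ᴹ-refl)))) t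
      ; +ˡ   = λ x x′ y → ext B′ (S _ _) (S _ _ +ᴸ S _ _)
                 (λ _ → ≈-trans (rel (⊗-cong (rel (⊗-+ˡ x x′ _)) ≈-refl)) (rel (⊗-+ˡ _ _ _))) t
      ; +ʳ   = λ x y y′ → ext B′ (S _ _) (S _ _ +ᴸ S _ _)
                 (λ _ → ≈-trans (rel (⊗-cong ≈-refl (rel (⊗-+ˡ y y′ _)))) (rel (⊗-+ʳ _ _ _))) t
      ; *ˡ   = λ k x y → ext B′ (S _ _) (k *ᴸ S _ _)
                 (λ _ → ≈-trans (rel (⊗-cong (rel (⊗-*ˡ k x _)) ≈-refl)) (rel (⊗-*ˡ k _ _))) t
      ; *ʳ   = λ k x y → ext B′ (S _ _) (k *ᴸ S _ _)
                 (λ _ → ≈-trans (rel (⊗-cong ≈-refl (rel (⊗-*ˡ k y _)))) (rel (⊗-*ʳ k _ _))) t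
      })
    (λ p xy → _⊸_.⟦⟧-cong (S _ _) p)
    (λ t t′ xy → ≈-refl)
    (λ k t xy → ≈-refl)
    where
    module M′ = Module M′
    module N′ = Module N′

    R : Vect
    R = (M ⊗ M′) ⊗ (N ⊗ N′)

    B′ = Bilin M′ N′

    S : ⌊ M ⌋ → ⌊ N ⌋ → M′ ⊗ N′ ⊸ R
    S x y = ⊗-lift {M′} {N′} {R} record
      { fun  = λ x′ y′ → (x ⊗ₜ x′) ⊗ₜ (y ⊗ₜ y′)
      ; cong = λ p q → rel (⊗-cong (rel (⊗-cong (Module.≈ᴹ-refl M) p)) (rel (⊗-cong (Module.≈ᴹ-refl N) q)))
      ; +ˡ   = λ a b y′ → ≈-trans (rel (⊗-cong (rel (⊗-+ʳ x a b)) ≈-refl)) (rel (⊗-+ˡ _ _ _))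
      ; +ʳ   = λ x′ a b → ≈-trans (rel (⊗-cong ≈-refl (rel (⊗-+ʳ y a b)))) (rel (⊗-+ʳ _ _ _))
      ; *ˡ   = λ k x′ y′ → ≈-trans (rel (⊗-cong (rel (⊗-*ʳ k x x′)) ≈-refl)) (rel (⊗-*ˡ k _ _))
      ; *ʳ   = λ k x′ y′ → ≈-trans (rel (⊗-cong ≈-refl (rel (⊗-*ʳ k y y′)))) (rel (⊗-*ʳ k _ _))
      }

  -- m_{1,3,24} : a ⊗ b ⊗ a′ ⊗ b′ ↦ a ⊗ a′ ⊗ m(b ⊗ b′).

  m₁,₃,₂₄ : ∀ M N M′ N′ {Q} → N ⊗ N′ ⊸ Q → (M ⊗ N) ⊗ (M′ ⊗ N′) ⊸ (M ⊗ M′) ⊗ Q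
  m₁,₃,₂₄ M N M′ N′ m = (idᴸ ⊗₁ m) ∘ᴸ Id⊗c⊗Id M N M′ N′

  unitˡ : ∀ M → 𝕂 ⊗ M ⊸ M
  unitˡ M = ⊗-lift {𝕂} {M} {M} record
    { fun  = M._*ₗ_
    ; cong = M.*ₗ-cong
    ; +ˡ   = λ k l x → M.*ₗ-distribʳ x k l
    ; +ʳ   = M.*ₗ-distribˡ
    ; *ˡ   = M.*ₗ-assoc
    ; *ʳ   = λ k l x → M.≈ᴹ-trans (M.≈ᴹ-sym (M.*ₗ-assoc l k x))
               (M.≈ᴹ-trans (M.*ₗ-cong (𝕜.*-comm l k) M.≈ᴹ-refl) (M.*ₗ-assoc k l x))
    }
    where module M = Module M

  unitʳ : ∀ M → M ⊗ 𝕂 ⊸ M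
  unitʳ M = unitˡ M ∘ᴸ ⊗-flip M 𝕂

  -- Sweedler notation: for t = t′ ⊗ t″ in M ⊗ N, and for t i = tᵢ′ ⊗ tᵢ″ with
  -- i ranging over Fin n, an expression in the components stands for the
  -- corresponding (multi)linear extension.

  sweedler : ∀ {X Y : Set ℓ} (Q : Vect) → Term (X × Y) → (X → Y → ⌊ Q ⌋) → ⌊ Q ⌋
  sweedler Q t f = eval Q (λ xy → f (proj₁ xy) (proj₂ xy)) t

  sweedlers : ∀ {X Y : Set ℓ} (Q : Vect) {n} → (Fin n → Term (X × Y)) →
              ((Fin n → X) → (Fin n → Y) → ⌊ Q ⌋) → ⌊ Q ⌋
  sweedlers Q {zero}  t f = f (λ ()) (λ ())
  sweedlers Q {suc n} t f = sweedler Q (t zero) λ x y →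
    sweedlers Q (λ i → t (suc i)) λ xs ys → f (x VF.∷ xs) (y VF.∷ ys)

  record Species : Set (lsuc 0ℓ ⊔ lsuc ℓ) where
    field
      P₀     : FinSet → Vect
      P₁     : ∀ {X Y} → X ≃ Y → P₀ X ⊸ P₀ Y
      P-resp : ∀ {X Y} {σ τ : X ≃ Y} → σ ≗≃ τ → P₁ σ ≗ᴸ P₁ τ
      P-id   : ∀ {X} → P₁ (id≃ {X}) ≗ᴸ idᴸ
      P-∘    : ∀ {X Y Z} (τ : Y ≃ Z) (σ : X ≃ Y) → P₁ (τ ∘≃ σ) ≗ᴸ P₁ τ ∘ᴸ P₁ σ

  record TwistedAlgebra (P : Species) : Set (lsuc 0ℓ ⊔ ℓ) where
    open Species P
    field
      m         : ∀ X Y → P₀ X ⊗ P₀ Y ⊸ P₀ (X ⊔ˢ Y)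
      1ₚ        : ⌊ P₀ ∅ ⌋
      m-natural : ∀ {X Y X′ Y′} (σ : X ≃ X′) (τ : Y ≃ Y′) →
                  m X′ Y′ ∘ᴸ (P₁ σ ⊗₁ P₁ τ) ≗ᴸ P₁ (σ ⊔≃ τ) ∘ᴸ m X Y
      m-assoc   : ∀ X Y Z →
                  P₁ (⊔-assoc X Y Z) ∘ᴸ m (X ⊔ˢ Y) Z ∘ᴸ (m X Y ⊗₁ idᴸ)
                  ≗ᴸ m X (Y ⊔ˢ Z) ∘ᴸ (idᴸ ⊗₁ m Y Z) ∘ᴸ ⊗-assoc (P₀ X) (P₀ Y) (P₀ Z)
      m-unitˡ   : ∀ X x → P₀ X ⊢ P₁ (∅⊔≃ X) ⟨$⟩ m ∅ X ⟨$⟩ 1ₚ ⊗ₜ x ≈ x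
      m-unitʳ   : ∀ X x → P₀ X ⊢ P₁ (⊔∅≃ X) ⟨$⟩ m X ∅ ⟨$⟩ x ⊗ₜ 1ₚ ≈ x

  record TwistedCoalgebra (P : Species) : Set (lsuc 0ℓ ⊔ ℓ) where
    open Species P
    field
      Δ         : ∀ X Y → P₀ (X ⊔ˢ Y) ⊸ P₀ X ⊗ P₀ Y
      ε         : P₀ ∅ ⊸ 𝕂
      Δ-natural : ∀ {X Y X′ Y′} (σ : X ≃ X′) (τ : Y ≃ Y′) →
                  Δ X′ Y′ ∘ᴸ P₁ (σ ⊔≃ τ) ≗ᴸ (P₁ σ ⊗₁ P₁ τ) ∘ᴸ Δ X Y
      Δ-coassoc : ∀ X Y Z →
                  ⊗-assoc (P₀ X) (P₀ Y) (P₀ Z) ∘ᴸ (Δ X Y ⊗₁ idᴸ) ∘ᴸ Δ (X ⊔ˢ Y) Z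
                  ≗ᴸ (idᴸ ⊗₁ Δ Y Z) ∘ᴸ Δ X (Y ⊔ˢ Z) ∘ᴸ P₁ (⊔-assoc X Y Z)
      Δ-counitˡ : ∀ X → unitˡ (P₀ X) ∘ᴸ (ε ⊗₁ idᴸ) ∘ᴸ Δ ∅ X ≗ᴸ P₁ (∅⊔≃ X)
      Δ-counitʳ : ∀ X → unitʳ (P₀ X) ∘ᴸ (idᴸ ⊗₁ ε) ∘ᴸ Δ X ∅ ≗ᴸ P₁ (⊔∅≃ X)

  record TwistedBialgebra (P : Species) : Set (lsuc 0ℓ ⊔ ℓ) where
    open Species P
    field
      algebra   : TwistedAlgebra P
      coalgebra : TwistedCoalgebra P

    open TwistedAlgebra algebra public
    open TwistedCoalgebra coalgebra public

    field
      -- θ is the identification I′ ⊔ J′ = I ⊔ J; the bijections i′, j′, i, j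
      -- express that A, B, C, D are the intersections
      -- I′ ∩ I, I′ ∩ J, J′ ∩ I, J′ ∩ J.
      Δ-m : ∀ {I J I′ J′ A B C D} (θ : (I′ ⊔ˢ J′) ≃ (I ⊔ˢ J))
            (i′ : (A ⊔ˢ B) ≃ I′) (j′ : (C ⊔ˢ D) ≃ J′)
            (i : (A ⊔ˢ C) ≃ I) (j : (B ⊔ˢ D) ≃ J) →
            θ ∘≃ (i′ ⊔≃ j′) ≗≃ (i ⊔≃ j) ∘≃ middle-swap A B C D →
            Δ I J ∘ᴸ P₁ θ ∘ᴸ m I′ J′
            ≗ᴸ ((P₁ i ∘ᴸ m A C) ⊗₁ (P₁ j ∘ᴸ m B D))
               ∘ᴸ Id⊗c⊗Id (P₀ A) (P₀ B) (P₀ C) (P₀ D)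
               ∘ᴸ ((Δ A B ∘ᴸ P₁ (i′ ⁻¹≃)) ⊗₁ (Δ C D ∘ᴸ P₁ (j′ ⁻¹≃)))
      Δ-1 : P₀ ∅ ⊗ P₀ ∅ ⊢ Δ ∅ ∅ ⟨$⟩ P₁ (∅⊔≃ ∅ ⁻¹≃) ⟨$⟩ 1ₚ ≈ 1ₚ ⊗ₜ 1ₚ
      ε-m : ε ∘ᴸ P₁ (∅⊔≃ ∅) ∘ᴸ m ∅ ∅ ≗ᴸ unitˡ 𝕂 ∘ᴸ (ε ⊗₁ ε)
      ε-1 : ε ⟨$⟩ 1ₚ ≈ᵏ 1#

  record ContractionExtraction (P : Species) : Set (lsuc 0ℓ ⊔ ℓ) where
    open Species P
    field
      δ          : ∀ {X} (E : 𝓔 X) → P₀ X ⊸ P₀ (X / E) ⊗ P₀ X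
      -- With σ the identity this also says that δ E depends on E only up to ≐.
      δ-natural  : ∀ {X Y} (σ : X ≃ Y) (E : 𝓔 X) (E′ : 𝓔 Y) (t : E′ ≐ transport σ E) →
                   δ E′ ∘ᴸ P₁ σ ≗ᴸ (P₁ (quotient≃ σ E E′ t) ⊗₁ P₁ σ) ∘ᴸ δ E
      δ-coassoc  : ∀ {X} (E E′ : 𝓔 X) (le : E ≤ᴱ E′) →
                   ⊗-assoc (P₀ (X / E)) (P₀ (X / E′)) (P₀ X)
                     ∘ᴸ (((P₁ (third-iso E E′ le) ⊗₁ idᴸ) ∘ᴸ δ (descend E E′ le)) ⊗₁ idᴸ)
                     ∘ᴸ δ E′
                   ≗ᴸ (idᴸ ⊗₁ δ E′) ∘ᴸ δ E
      δ-vanish   : ∀ {X} (E E′ : 𝓔 X) → ¬ (E ≤ᴱ E′) → (idᴸ ⊗₁ δ E′) ∘ᴸ δ E ≗ᴸ 0ᴸ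
      ϵ          : ∀ X → P₀ X ⊸ 𝕂
      ϵ-natural  : ∀ {X Y} (σ : X ≃ Y) → ϵ Y ∘ᴸ P₁ σ ≗ᴸ ϵ X
      δ-counitʳ  : ∀ {X} (E : 𝓔 X) (eq : IsEquality E) →
                   P₁ (equality≃ E eq) ∘ᴸ unitʳ (P₀ (X / E)) ∘ᴸ (idᴸ ⊗₁ ϵ X) ∘ᴸ δ E ≗ᴸ idᴸ
      δ-counitʳ₀ : ∀ {X} (E : 𝓔 X) → ¬ IsEquality E →
                   unitʳ (P₀ (X / E)) ∘ᴸ (idᴸ ⊗₁ ϵ X) ∘ᴸ δ E ≗ᴸ 0ᴸ
      δ-counitˡ  : ∀ X p →
                   P₀ X ⊢ ∑ (P₀ X) (equivalences X)
                            (λ E → (unitˡ (P₀ X) ∘ᴸ (ϵ (X / E) ⊗₁ idᴸ) ∘ᴸ δ E) ⟨$⟩ p)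
                        ≈ p

  record Compatible {P : Species} (B : TwistedBialgebra P) (C : ContractionExtraction P)
                    : Set (lsuc 0ℓ ⊔ ℓ) where
    open Species P
    open TwistedBialgebra B
    open ContractionExtraction C
    field
      δ-m  : ∀ X Y (E : 𝓔 (X ⊔ˢ Y)) (s : Splits E) →
             δ E ∘ᴸ m X Y
             ≗ᴸ ((P₁ (split-quotient≃ E s) ∘ᴸ m (X / restrictˡ E) (Y / restrictʳ E)) ⊗₁ m X Y)
                ∘ᴸ Id⊗c⊗Id (P₀ (X / restrictˡ E)) (P₀ X) (P₀ (Y / restrictʳ E)) (P₀ Y)
                ∘ᴸ (δ (restrictˡ E) ⊗₁ δ (restrictʳ E))
      δ-m₀ : ∀ X Y (E : 𝓔 (X ⊔ˢ Y)) → ¬ Splits E → δ E ∘ᴸ m X Y ≗ᴸ 0ᴸ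
      Δ-δ  : ∀ X Y (E : 𝓔 (X ⊔ˢ Y)) (s : Splits E) →
             ((Δ (X / restrictˡ E) (Y / restrictʳ E) ∘ᴸ P₁ (split-quotient≃ E s ⁻¹≃)) ⊗₁ idᴸ) ∘ᴸ δ E
             ≗ᴸ m₁,₃,₂₄ (P₀ (X / restrictˡ E)) (P₀ X) (P₀ (Y / restrictʳ E)) (P₀ Y) (m X Y)
                ∘ᴸ (δ (restrictˡ E) ⊗₁ δ (restrictʳ E))
                ∘ᴸ Δ X Y
      δ-1  : ∀ (E : 𝓔 ∅) →
             P₀ ∅ ⊗ P₀ ∅ ⊢ (P₁ (∅/≃ E) ⊗₁ idᴸ {P₀ ∅}) ⟨$⟩ δ E ⟨$⟩ 1ₚ ≈ 1ₚ ⊗ₜ 1ₚ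
      ε-δ  : ∀ (E : 𝓔 ∅) x →
             P₀ ∅ ⊢ (unitˡ (P₀ ∅) ∘ᴸ ((ε ∘ᴸ P₁ (∅/≃ E)) ⊗₁ idᴸ) ∘ᴸ δ E) ⟨$⟩ x
                  ≈ Module._*ₗ_ (P₀ ∅) (ε ⟨$⟩ x) 1ₚ

  record CommBialgebra : Set (lsuc ℓ) where
    field
      space : Vect
      mul   : space ⊗ space ⊸ space
      δ     : space ⊸ space ⊗ space
      ε     : space ⊸ 𝕂

      mul-assoc : mul ∘ᴸ (mul ⊗₁ idᴸ) ≗ᴸ mul ∘ᴸ (idᴸ ⊗₁ mul) ∘ᴸ ⊗-assoc space space space
      mul-comm  : mul ∘ᴸ ⊗-flip space space ≗ᴸ mul
      δ-coassoc : ⊗-assoc space space space ∘ᴸ (δ ⊗₁ idᴸ) ∘ᴸ δ ≗ᴸ (idᴸ ⊗₁ δ) ∘ᴸ δ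
      δ-counitˡ : unitˡ space ∘ᴸ (ε ⊗₁ idᴸ) ∘ᴸ δ ≗ᴸ idᴸ
      δ-counitʳ : unitʳ space ∘ᴸ (idᴸ ⊗₁ ε) ∘ᴸ δ ≗ᴸ idᴸ
      δ-mul     : δ ∘ᴸ mul ≗ᴸ (mul ⊗₁ mul) ∘ᴸ Id⊗c⊗Id space space space space ∘ᴸ (δ ⊗₁ δ)
      ε-mul     : ε ∘ᴸ mul ≗ᴸ unitˡ 𝕂 ∘ᴸ (ε ⊗₁ ε)

  record BialgebraHom (V W : CommBialgebra) : Set ℓ where
    private
      module V = CommBialgebra V
      module W = CommBialgebra W
    field
      map     : V.space ⊸ W.space
      map-mul : map ∘ᴸ V.mul ≗ᴸ W.mul ∘ᴸ (map ⊗₁ map)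
      map-δ   : W.δ ∘ᴸ map ≗ᴸ (map ⊗₁ map) ∘ᴸ V.δ
      map-ε   : W.ε ∘ᴸ map ≗ᴸ V.ε

  ⊗₁-id : ∀ {M N} → idᴸ {M} ⊗₁ idᴸ {N} ≗ᴸ idᴸ
  ⊗₁-id {M} {N} = ext (Bilin M N) (idᴸ ⊗₁ idᴸ) idᴸ (λ _ → ≈-refl)

  ⊗₁-∘ : ∀ {M M′ M″ N N′ N″} (f′ : M′ ⊸ M″) (f : M ⊸ M′) (g′ : N′ ⊸ N″) (g : N ⊸ N′) →
         (f′ ∘ᴸ f) ⊗₁ (g′ ∘ᴸ g) ≗ᴸ (f′ ⊗₁ g′) ∘ᴸ (f ⊗₁ g)
  ⊗₁-∘ {M} {N = N} f′ f g′ g =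
    ext (Bilin M N) ((f′ ∘ᴸ f) ⊗₁ (g′ ∘ᴸ g)) ((f′ ⊗₁ g′) ∘ᴸ (f ⊗₁ g)) (λ _ → ≈-refl)

  mul-id : ∀ {A} (μ : A ⊗ A ⊸ A) → idᴸ ∘ᴸ μ ≗ᴸ μ ∘ᴸ (idᴸ ⊗₁ idᴸ)
  mul-id {A} μ x = Module.≈ᴹ-sym A (_⊸_.⟦⟧-cong μ (⊗₁-id {A} {A} x))

  comul-id : ∀ {A} (δ : A ⊸ A ⊗ A) → δ ∘ᴸ idᴸ ≗ᴸ (idᴸ ⊗₁ idᴸ) ∘ᴸ δ
  comul-id {A} δ x = ≈-sym (⊗₁-id {A} {A} (δ ⟨$⟩ x))

  mul-∘ : ∀ {A B C} (μ : A ⊗ A ⊸ A) (ν : B ⊗ B ⊸ B) (ξ : C ⊗ C ⊸ C) (g : B ⊸ C) (f : A ⊸ B) →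
          g ∘ᴸ ν ≗ᴸ ξ ∘ᴸ (g ⊗₁ g) → f ∘ᴸ μ ≗ᴸ ν ∘ᴸ (f ⊗₁ f) →
          (g ∘ᴸ f) ∘ᴸ μ ≗ᴸ ξ ∘ᴸ ((g ∘ᴸ f) ⊗₁ (g ∘ᴸ f))
  mul-∘ {C = C} μ ν ξ g f p q x = C.≈ᴹ-trans (_⊸_.⟦⟧-cong g (q x))
    (C.≈ᴹ-trans (p ((f ⊗₁ f) ⟨$⟩ x)) (C.≈ᴹ-sym (_⊸_.⟦⟧-cong ξ (⊗₁-∘ g f g f x))))
    where module C = Module C

  comul-∘ : ∀ {A B C} (μ : A ⊸ A ⊗ A) (ν : B ⊸ B ⊗ B) (ξ : C ⊸ C ⊗ C) (g : B ⊸ C) (f : A ⊸ B) →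
            ξ ∘ᴸ g ≗ᴸ (g ⊗₁ g) ∘ᴸ ν → ν ∘ᴸ f ≗ᴸ (f ⊗₁ f) ∘ᴸ μ →
            ξ ∘ᴸ (g ∘ᴸ f) ≗ᴸ ((g ∘ᴸ f) ⊗₁ (g ∘ᴸ f)) ∘ᴸ μ
  comul-∘ μ ν ξ g f p q x = ≈-trans (p (f ⟨$⟩ x))
    (≈-trans (_⊸_.⟦⟧-cong (g ⊗₁ g) (q x)) (≈-sym (⊗₁-∘ g f g f (μ ⟨$⟩ x))))

  ≗ᴸ-isEquivalence : ∀ {M N} → IsEquivalence (_≗ᴸ_ {M} {N})
  ≗ᴸ-isEquivalence {N = N} = record
    { refl  = λ _ → N.≈ᴹ-refl
    ; sym   = λ p x → N.≈ᴹ-sym (p x)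
    ; trans = λ p q x → N.≈ᴹ-trans (p x) (q x)
    }
    where module N = Module N

  BialgebraHom-id : ∀ {V} → BialgebraHom V V
  BialgebraHom-id {V} = record
    { map     = idᴸ
    ; map-mul = mul-id mul
    ; map-δ   = comul-id δ
    ; map-ε   = λ _ → 𝕜.refl
    }
    where open CommBialgebra V

  BialgebraHom-∘ : ∀ {U V W} → BialgebraHom V W → BialgebraHom U V → BialgebraHom U W
  BialgebraHom-∘ {U} {V} {W} g f = record
    { map     = g.map ∘ᴸ f.map
    ; map-mul = mul-∘ U.mul V.mul W.mul g.map f.map g.map-mul f.map-mul
    ; map-δ   = comul-∘ U.δ V.δ W.δ g.map f.map g.map-δ f.map-δ
    ; map-ε   = λ x → 𝕜.trans (g.map-ε (f.map ⟨$⟩ x)) (f.map-ε x)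
    }
    where
    module U = CommBialgebra U
    module V = CommBialgebra V
    module W = CommBialgebra W
    module g = BialgebraHom g
    module f = BialgebraHom f

  CommBialgebras : Category (lsuc ℓ) ℓ ℓ
  CommBialgebras = record
    { Obj       = CommBialgebra
    ; Hom       = BialgebraHom
    ; _≈_       = λ f g → map f ≗ᴸ map g
    ; idᶜ       = BialgebraHom-id
    ; _∘ᶜ_      = BialgebraHom-∘
    ; equiv     = On.isEquivalence map ≗ᴸ-isEquivalence
    ; assoc     = λ {D = D} _ _ _ _ → Module.≈ᴹ-refl (CommBialgebra.space D)
    ; identityˡ = λ {B = B} _ _ → Module.≈ᴹ-refl (CommBialgebra.space B)
    ; identityʳ = λ {B = B} _ _ → Module.≈ᴹ-refl (CommBialgebra.space B)
    ; ∘-resp-≈  = λ {C = C} {g′ = g′} {f = f} p q x →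
        Module.≈ᴹ-trans (CommBialgebra.space C) (p (map f ⟨$⟩ x)) (_⊸_.⟦⟧-cong (map g′) (q x))
    }
    where open BialgebraHom using (map)

  -- ϵδ is only a counit: it is not required to be multiplicative.

  record DoubleBialgebraStructure (A : Vect) : Set ℓ where
    field
      mul : A ⊗ A ⊸ A
      one : ⌊ A ⌋
      Δ   : A ⊸ A ⊗ A
      εΔ  : A ⊸ 𝕂
      δ   : A ⊸ A ⊗ A
      ϵδ  : A ⊸ 𝕂

      mul-assoc : mul ∘ᴸ (mul ⊗₁ idᴸ) ≗ᴸ mul ∘ᴸ (idᴸ ⊗₁ mul) ∘ᴸ ⊗-assoc A A A
      mul-unitˡ : ∀ x → A ⊢ mul ⟨$⟩ one ⊗ₜ x ≈ x
      mul-unitʳ : ∀ x → A ⊢ mul ⟨$⟩ x ⊗ₜ one ≈ x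

      Δ-coassoc : ⊗-assoc A A A ∘ᴸ (Δ ⊗₁ idᴸ) ∘ᴸ Δ ≗ᴸ (idᴸ ⊗₁ Δ) ∘ᴸ Δ
      Δ-counitˡ : unitˡ A ∘ᴸ (εΔ ⊗₁ idᴸ) ∘ᴸ Δ ≗ᴸ idᴸ
      Δ-counitʳ : unitʳ A ∘ᴸ (idᴸ ⊗₁ εΔ) ∘ᴸ Δ ≗ᴸ idᴸ
      Δ-mul     : Δ ∘ᴸ mul ≗ᴸ (mul ⊗₁ mul) ∘ᴸ Id⊗c⊗Id A A A A ∘ᴸ (Δ ⊗₁ Δ)
      Δ-one     : A ⊗ A ⊢ Δ ⟨$⟩ one ≈ one ⊗ₜ one
      εΔ-mul    : εΔ ∘ᴸ mul ≗ᴸ unitˡ 𝕂 ∘ᴸ (εΔ ⊗₁ εΔ)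
      εΔ-one    : εΔ ⟨$⟩ one ≈ᵏ 1#

      δ-coassoc : ⊗-assoc A A A ∘ᴸ (δ ⊗₁ idᴸ) ∘ᴸ δ ≗ᴸ (idᴸ ⊗₁ δ) ∘ᴸ δ
      δ-counitˡ : unitˡ A ∘ᴸ (ϵδ ⊗₁ idᴸ) ∘ᴸ δ ≗ᴸ idᴸ
      δ-counitʳ : unitʳ A ∘ᴸ (idᴸ ⊗₁ ϵδ) ∘ᴸ δ ≗ᴸ idᴸ
      δ-mul     : δ ∘ᴸ mul ≗ᴸ (mul ⊗₁ mul) ∘ᴸ Id⊗c⊗Id A A A A ∘ᴸ (δ ⊗₁ δ)
      δ-one     : A ⊗ A ⊢ δ ⟨$⟩ one ≈ one ⊗ₜ one

      Δ-δ       : (Δ ⊗₁ idᴸ) ∘ᴸ δ ≗ᴸ m₁,₃,₂₄ A A A A mul ∘ᴸ (δ ⊗₁ δ) ∘ᴸ Δ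
      εΔ-δ      : ∀ x → A ⊢ (unitˡ A ∘ᴸ (εΔ ⊗₁ idᴸ) ∘ᴸ δ) ⟨$⟩ x ≈ Module._*ₗ_ A (εΔ ⟨$⟩ x) one

  record DoubleBialgebra : Set (lsuc ℓ) where
    constructor doubleBialgebra
    field
      space     : Vect
      structure : DoubleBialgebraStructure space

    open DoubleBialgebraStructure structure public

  record DoubleBialgebraHom (A B : DoubleBialgebra) : Set ℓ where
    private
      module A = DoubleBialgebra A
      module B = DoubleBialgebra B
    field
      map     : A.space ⊸ B.space
      map-mul : map ∘ᴸ A.mul ≗ᴸ B.mul ∘ᴸ (map ⊗₁ map)
      map-one : B.space ⊢ map ⟨$⟩ A.one ≈ B.one
      map-Δ   : B.Δ ∘ᴸ map ≗ᴸ (map ⊗₁ map) ∘ᴸ A.Δ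
      map-εΔ  : B.εΔ ∘ᴸ map ≗ᴸ A.εΔ
      map-δ   : B.δ ∘ᴸ map ≗ᴸ (map ⊗₁ map) ∘ᴸ A.δ
      map-ϵδ  : B.ϵδ ∘ᴸ map ≗ᴸ A.ϵδ

  DoubleBialgebraHom-id : ∀ {A} → DoubleBialgebraHom A A
  DoubleBialgebraHom-id {A} = record
    { map     = idᴸ
    ; map-mul = mul-id mul
    ; map-one = Module.≈ᴹ-refl space
    ; map-Δ   = comul-id Δ
    ; map-εΔ  = λ _ → 𝕜.refl
    ; map-δ   = comul-id δ
    ; map-ϵδ  = λ _ → 𝕜.refl
    }
    where open DoubleBialgebra A

  DoubleBialgebraHom-∘ : ∀ {A B C} → DoubleBialgebraHom B C → DoubleBialgebraHom A B → DoubleBialgebraHom A C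
  DoubleBialgebraHom-∘ {A} {B} {C} g f = record
    { map     = g.map ∘ᴸ f.map
    ; map-mul = mul-∘ A.mul B.mul C.mul g.map f.map g.map-mul f.map-mul
    ; map-one = Module.≈ᴹ-trans C.space (_⊸_.⟦⟧-cong g.map f.map-one) g.map-one
    ; map-Δ   = comul-∘ A.Δ B.Δ C.Δ g.map f.map g.map-Δ f.map-Δ
    ; map-εΔ  = λ x → 𝕜.trans (g.map-εΔ (f.map ⟨$⟩ x)) (f.map-εΔ x)
    ; map-δ   = comul-∘ A.δ B.δ C.δ g.map f.map g.map-δ f.map-δ
    ; map-ϵδ  = λ x → 𝕜.trans (g.map-ϵδ (f.map ⟨$⟩ x)) (f.map-ϵδ x)
    }
    where
    module A = DoubleBialgebra A
    module B = DoubleBialgebra B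
    module C = DoubleBialgebra C
    module g = DoubleBialgebraHom g
    module f = DoubleBialgebraHom f

  DoubleBialgebras : Category (lsuc ℓ) ℓ ℓ
  DoubleBialgebras = record
    { Obj       = DoubleBialgebra
    ; Hom       = DoubleBialgebraHom
    ; _≈_       = λ f g → map f ≗ᴸ map g
    ; idᶜ       = DoubleBialgebraHom-id
    ; _∘ᶜ_      = DoubleBialgebraHom-∘
    ; equiv     = On.isEquivalence map ≗ᴸ-isEquivalence
    ; assoc     = λ {D = D} _ _ _ _ → Module.≈ᴹ-refl (DoubleBialgebra.space D)
    ; identityˡ = λ {B = B} _ _ → Module.≈ᴹ-refl (DoubleBialgebra.space B)
    ; identityʳ = λ {B = B} _ _ → Module.≈ᴹ-refl (DoubleBialgebra.space B)
    ; ∘-resp-≈  = λ {C = C} {g′ = g′} {f = f} p q x →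
        Module.≈ᴹ-trans (DoubleBialgebra.space C) (p (map f ⟨$⟩ x)) (_⊸_.⟦⟧-cong (map g′) (q x))
    }
    where open DoubleBialgebraHom using (map)

  -- 𝓕_V[P] = ⊕ₙ V^{⊗n} ⊗_{𝔖ₙ} P[n] is generated by the v₁…vₙ ⊗ p, subject to
  -- multilinearity (the relations of V^{⊗n} ⊗ P[n]) and to
  -- v₁…vₙ ⊗ P[σ](p) = v_{σ(1)}…v_{σ(n)} ⊗ p.

  module _ (P : Species) (V : Vect) where
    open Species P
    private module V = Module V

    FockGen : Set ℓ
    FockGen = Σ[ n ∈ ℕ ] ((Fin n → ⌊ V ⌋) × ⌊ P₀ [ n ] ⌋)

    data FockRel : Rel (Term FockGen) ℓ where
      f-cong : ∀ {n v v′ p p′} → (∀ i → v i V.≈ᴹ v′ i) → P₀ [ n ] ⊢ p ≈ p′ →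
               FockRel (gen (n , v , p)) (gen (n , v′ , p′))
      f-+ᵥ   : ∀ {n} v i a b p →
               FockRel (gen (n , VF.updateAt v i (λ _ → a V.+ᴹ b) , p))
                       (gen (n , VF.updateAt v i (λ _ → a) , p) ⊕ gen (n , VF.updateAt v i (λ _ → b) , p))
      f-*ᵥ   : ∀ {n} v i k a p →
               FockRel (gen (n , VF.updateAt v i (λ _ → k V.*ₗ a) , p))
                       (k · gen (n , VF.updateAt v i (λ _ → a) , p))
      f-+ₚ   : ∀ {n} v p q →
               FockRel (gen (n , v , Module._+ᴹ_ (P₀ [ n ]) p q)) (gen (n , v , p) ⊕ gen (n , v , q))
      f-*ₚ   : ∀ {n} v k p →
               FockRel (gen (n , v , Module._*ₗ_ (P₀ [ n ]) k p)) (k · gen (n , v , p))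
      f-𝔖    : ∀ {n} v (σ : [ n ] ≃ [ n ]) p →
               FockRel (gen (n , v , P₁ σ ⟨$⟩ p)) (gen (n , (λ i → v (_≃_.to σ i)) , p))

    𝓕 : Vect
    𝓕 = Presented FockRel

    -- The class of v₁…vₙ ⊗ p.

    cl : ∀ n → (Fin n → ⌊ V ⌋) → ⌊ P₀ [ n ] ⌋ → ⌊ 𝓕 ⌋
    cl n v p = gen (n , v , p)

  -- The product in V of the v i over the block σ⁻¹(j) of E; the block is
  -- non-empty, so that no unit is needed, and the product starts from one of
  -- its elements.

  blockProduct : (V : CommBialgebra) → let open CommBialgebra V in
    ∀ {n k} (E : 𝓔 [ n ]) → ([ n ] / E) ≃ [ k ] → (Fin n → ⌊ space ⌋) → Fin k → ⌊ space ⌋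
  blockProduct V {n} E σ v j =
    foldr (λ i x → mul ⟨$⟩ v i ⊗ₜ x) (v i₀)
          (filter (λ i → (σ.to i ≟ j) ×-dec ¬? (i ≟ i₀)) (allFinᴸ n))
    where
    open CommBialgebra V
    module σ = _≃_ σ

    i₀ : Fin n
    i₀ = σ.from j

  record FockFormulas {P : Species} (B : TwistedBialgebra P) (C : ContractionExtraction P)
                      (V : CommBialgebra)
                      (S : DoubleBialgebraStructure (𝓕 P (CommBialgebra.space V)))
                      : Set (lsuc 0ℓ ⊔ ℓ) where
    open Species P
    private
      module P = TwistedBialgebra B
      module C = ContractionExtraction C
      module V = CommBialgebra V
      module S = DoubleBialgebraStructure S
      𝓕V       = 𝓕 P V.space

      ⟦_∣_⟧ : ∀ {n} → (Fin n → ⌊ V.space ⌋) → ⌊ P₀ [ n ] ⌋ → ⌊ 𝓕V ⌋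
      ⟦ v ∣ p ⟧ = cl P V.space _ v p
    field
      mul-formula : ∀ {k l} v w p q →
        𝓕V ⊢ S.mul ⟨$⟩ ⟦_∣_⟧ {k} v p ⊗ₜ ⟦_∣_⟧ {l} w q
           ≈ ⟦ v VF.++ w ∣ P₁ (shift k l) ⟨$⟩ P.m [ k ] [ l ] ⟨$⟩ p ⊗ₜ q ⟧

      Δ-formula : ∀ {n} v p →
        𝓕V ⊗ 𝓕V ⊢ S.Δ ⟨$⟩ ⟦_∣_⟧ {n} v p
                ≈ ∑ (𝓕V ⊗ 𝓕V) (subsets n) λ A →
                    sweedler (𝓕V ⊗ 𝓕V) (P.Δ ⟪ A ⟫ ⟪ ∁ A ⟫ ⟨$⟩ P₁ (partition≃ A ⁻¹≃) ⟨$⟩ p) λ p₁ p₂ →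
                      ⟦ (λ j → v (proj₁ (unrank A j)))     ∣ P₁ σ⟪ A ⟫ ⟨$⟩ p₁ ⟧
                      ⊗ₜ ⟦ (λ j → v (proj₁ (unrank (∁ A) j))) ∣ P₁ σ⟪ ∁ A ⟫ ⟨$⟩ p₂ ⟧

      -- k_∼ is the number of classes; σ is any choice of the bijections σ_∼.
      δ-formula : ∀ {n} (σ : ∀ (E : 𝓔 [ n ]) → ([ n ] / E) ≃ [ FinSet.size ([ n ] / E) ]) v p →
        𝓕V ⊗ 𝓕V ⊢ S.δ ⟨$⟩ ⟦_∣_⟧ {n} v p
                ≈ ∑ (𝓕V ⊗ 𝓕V) (equivalences [ n ]) λ E →
                    sweedlers (𝓕V ⊗ 𝓕V) (λ i → V.δ ⟨$⟩ v i) λ v′ v″ →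
                      sweedler (𝓕V ⊗ 𝓕V) (C.δ E ⟨$⟩ p) λ p₁ p₂ →
                        ⟦ blockProduct V E (σ E) v′ ∣ P₁ (σ E) ⟨$⟩ p₁ ⟧ ⊗ₜ ⟦ v″ ∣ p₂ ⟧

{-# OPTIONS --safe #-}

-- The spaces H[X] = V^{⊗X} ⊗ P[X] form a species which inherits the structure of
-- P: products and coproducts of P are carried along with the concatenation and
-- restriction of decorations X → V, while δ_∼ contracts the decorations v′ over
-- the classes of ∼ and keeps the v″.  So H is again a twisted bialgebra with a
-- compatible contraction-extraction coproduct; coassociativity and compatibility
-- use that V is commutative and that δ_V and ε_V are multiplicative.
--
-- 𝓕_V[P] is the universal recipient of maps H[n] → M which are invariant under
-- 𝔖ₙ.  For any species H with such a structure, its universal recipient is a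
-- double bialgebra: the axioms hold on generators because both sides are sums
-- over the same configurations (decompositions and equivalences of a finite
-- set), each listed exactly once.  Everything is natural in H, hence in V.

module Submission where

open import Defs
open import Level using (Level; 0ℓ; _⊔_) renaming (suc to lsuc)
open import Algebra.Apartness.Bundles using (HeytingField)
open import Algebra.Bundles using (CommutativeMonoid; CommutativeRing)
import Algebra.Construct.Add.Identity as AddIdentity
open import Algebra.Module.Bundles using (Module)
open import Algebra.Module.Structures.Biased using (IsModuleFromLeft)
import Algebra.Properties.CommutativeSemigroup as CommutativeSemigroupProperties
open import Data.Bool.Base using (Bool; true; false; T)
import Data.Bool.Properties as Bool
open import Data.Empty using (⊥-elim)
open import Data.Fin.Base using (Fin; zero; suc; splitAt)
open import Data.Fin.Permutation using (↔⇒≡)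
open import Data.Fin.Properties as Fin using (all?)
open import Data.Fin.Subset using (Subset; ∁)
open import Data.Fin.Subset.Properties using (_∈?_)
open import Data.List.Base using (List; []; _∷_; _++_; foldr; mapMaybe; concatMap; filter)
  renaming (map to mapᴸ; allFin to allFinᴸ; tabulate to tabulateᴸ)
open import Data.List.Relation.Unary.All as All using (All; []; _∷_)
import Data.List.Relation.Unary.All.Properties as All
open import Data.Maybe.Base using (Maybe; just; nothing; is-nothing) renaming (map to mapᴹ)
import Data.Maybe.Properties as Maybe
open import Data.Nat.Base using (zero; suc)
open import Data.Product.Base using (Σ; Σ-syntax; ∃-syntax; _×_; _,_; proj₁; proj₂)
open import Data.Sum.Base using (_⊎_; inj₁; inj₂)
open import Data.Sum.Relation.Binary.Pointwise using (Pointwise; inj₁; inj₂; drop-inj₁; drop-inj₂)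
open import Data.Unit.Base using (⊤; tt)
open import Data.Vec.Base using ([]; _∷_; lookup; here; there)
import Data.Vec.Functional as VF
open import Data.Vec.Functional.Properties using (updateAt-updates; updateAt-minimal)
import Data.Vec.Properties as Vec
open import Function.Base using (_∘_; id)
open import Relation.Binary.Bundles using (Setoid)
open import Relation.Binary.Construct.Add.Point.Equality using (∙≈∙) renaming ([_] to just≈)
open import Relation.Binary.Core using (Rel)
open import Relation.Binary.PropositionalEquality as ≡ using (_≡_; refl)
open import Relation.Nullary using (¬_; Dec; yes; no; ¬?)
open import Relation.Nullary.Decidable using (map′; _×-dec_; _→-dec_; does)
open import Relation.Nullary.Decidable.Core using (dec⇒maybe)
open import Relation.Unary using (Pred; Decidable)

-- The index sets are the obstacle. Equivalences are compared only up to `≐`, and decompositions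
-- only up to relabelling of their parts, so the two sides of an axiom are sums over lists with no
-- honest bijection between them. Each list is shown instead to contain exactly one entry with a
-- prescribed property (`ExactlyOne`, which also stores the refutations for all other entries), and
-- two sums are compared along a relation that is a matching in this sense. On either side an entry
-- may stay unmatched if its term vanishes; this is where the vanishing axioms for δ enter. The
-- second obstacle is that V need not have a unit and X carries no order. Block products are
-- therefore computed after adjoining a unit, and multilinearity is stated for families over an
-- unordered set, slot by slot. A multilinear map on families of tensors is known from its values on
-- families of pure tensors, so most identities on the decorated species reduce to elements a ⊗ b in
-- each slot, and the axioms of P apply to the rest unchanged.

private
  variable
    a b p q : Level
    A : Set a
    B : Set b

-- Lists containing exactly one entry with a given property.

data ExactlyOne {A : Set a} (Q : Pred A p) : List A → Set (a ⊔ p) where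
  here  : ∀ {x xs} → Q x → All (¬_ ∘ Q) xs → ExactlyOne Q (x ∷ xs)
  there : ∀ {x xs} → ¬ Q x → ExactlyOne Q xs → ExactlyOne Q (x ∷ xs)

one-resp : ∀ {P : Pred A p} {Q : Pred A q} → (∀ x → P x → Q x) → (∀ x → Q x → P x) →
           ∀ {xs} → ExactlyOne P xs → ExactlyOne Q xs
one-resp f g (here p ps)  = here (f _ p) (All.map (λ np q → np (g _ q)) ps)
one-resp f g (there np e) = there (λ q → np (g _ q)) (one-resp f g e)

one-++ˡ : ∀ {P : Pred A p} {xs ys} → ExactlyOne P xs → All (¬_ ∘ P) ys → ExactlyOne P (xs ++ ys)
one-++ˡ (here p ps)  ns = here p (All.++⁺ ps ns)
one-++ˡ (there np e) ns = there np (one-++ˡ e ns)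

one-++ʳ : ∀ {P : Pred A p} {xs ys} → All (¬_ ∘ P) xs → ExactlyOne P ys → ExactlyOne P (xs ++ ys)
one-++ʳ []       e = e
one-++ʳ (n ∷ ns) e = there n (one-++ʳ ns e)

one-map : ∀ {P : Pred B p} (f : A → B) {xs} → ExactlyOne (P ∘ f) xs → ExactlyOne P (mapᴸ f xs)
one-map f (here p ps)  = here p (All.map⁺ ps)
one-map f (there np e) = there np (one-map f e)

none-concatMap : ∀ {P : Pred B p} (f : A → List B) {xs} →
                 All (λ x → All (¬_ ∘ P) (f x)) xs → All (¬_ ∘ P) (concatMap f xs)
none-concatMap f []       = []
none-concatMap f (n ∷ ns) = All.++⁺ n (none-concatMap f ns)

one-concatMap : ∀ {P : Pred A p} {Q : Pred B q} (f : A → List B) {xs} →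
                (∀ x → P x → ExactlyOne Q (f x)) → (∀ x → ¬ P x → All (¬_ ∘ Q) (f x)) →
                ExactlyOne P xs → ExactlyOne Q (concatMap f xs)
one-concatMap f y n (here p ps)  = one-++ˡ (y _ p) (none-concatMap f (All.map (λ {x} → n x) ps))
one-concatMap f y n (there np e) = one-++ʳ (n _ np) (one-concatMap f y n e)

dpairs : ∀ {B : A → Set b} → List A → (∀ x → List (B x)) → List (Σ A B)
dpairs xs f = concatMap (λ x → mapᴸ (x ,_) (f x)) xs

-- Two choices in turn: `P` selects the first component, and no pair over another first component
-- can satisfy `Q`. Iterated coproducts are indexed by such pairs, the inner list depending on the
-- outer choice.
one-dpairs : ∀ {B : A → Set b} {P : Pred A p} {Q : Pred (Σ A B) q} {xs} {f : ∀ x → List (B x)} →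
             (∀ x → P x → ExactlyOne (λ y → Q (x , y)) (f x)) → (∀ x y → Q (x , y) → P x) →
             ExactlyOne P xs → ExactlyOne Q (dpairs xs f)
one-dpairs {f = f} y n = one-concatMap _ (λ x p → one-map (x ,_) (y x p))
  (λ x np → All.map⁺ (All.universal (λ z q → np (n x z q)) (f x)))

none-mapMaybe : ∀ {P : Pred A p} {Q : Pred B q} (f : A → Maybe B) →
                (∀ x y → f x ≡ just y → Q y → P x) →
                ∀ {xs} → All (¬_ ∘ P) xs → All (¬_ ∘ Q) (mapMaybe f xs)
none-mapMaybe f h [] = []
none-mapMaybe f h {x ∷ xs} (n ∷ ns) with f x in eq
... | just y  = (λ q → n (h x y eq q)) ∷ none-mapMaybe f h ns
... | nothing = none-mapMaybe f h ns

-- The first hypothesis makes the distinguished entry survive the filtering, the second keeps every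
-- other survivor from satisfying `Q`. It is meant for Boolean matrices filtered by the test for
-- being an equivalence.
one-mapMaybe : ∀ {P : Pred A p} {Q : Pred B q} (f : A → Maybe B) →
               (∀ x → P x → ∃[ y ] f x ≡ just y × Q y) → (∀ x y → f x ≡ just y → Q y → P x) →
               ∀ {xs} → ExactlyOne P xs → ExactlyOne Q (mapMaybe f xs)
one-mapMaybe f g h {x ∷ xs} (here p ps) with f x | g x p
... | .(just y) | y , refl , q = here q (none-mapMaybe f h ps)
one-mapMaybe f g h {x ∷ xs} (there np e) with f x in eq
... | just y  = there (λ q → np (h x y eq q)) (one-mapMaybe f g h e)
... | nothing = one-mapMaybe f g h e

-- A condition on each coordinate separately fixes the head, and hence the only block of the
-- concatenation that can contain a solution; the tail is found by induction.
one-vectors : ∀ {A : Set} {as : List A} n (Q : Fin n → Pred A p) →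
              (∀ i → ExactlyOne (Q i) as) → ExactlyOne (λ v → ∀ i → Q i (lookup v i)) (vectors as n)
one-vectors zero    Q e = here (λ ()) []
one-vectors {as = as} (suc n) Q e = one-concatMap (λ a → mapᴸ (a ∷_) (vectors as n))
  (λ a q → one-map (a ∷_) (one-resp (λ v r → λ { zero → q ; (suc i) → r i }) (λ v r i → r (suc i))
             (one-vectors n (Q ∘ suc) (e ∘ suc))))
  (λ a nq → All.map⁺ (All.universal (λ v r → nq (r zero)) _))
  (e zero)

one-tabulate : ∀ {P : Pred A p} n (f : Fin n → A) i₀ → P (f i₀) → (∀ i → P (f i) → i ≡ i₀) →
               ExactlyOne P (tabulateᴸ f)
one-tabulate {P = P} (suc n) f zero q u =
  here q (All.tabulate⁺ (λ i r → case-0 (u (suc i) r)))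
  where
  case-0 : ∀ {i : Fin n} → ¬ (Fin.suc i ≡ zero)
  case-0 ()
one-tabulate (suc n) f (suc i₀) q u =
  there (λ r → case-s (u zero r)) (one-tabulate n (f ∘ suc) i₀ q (λ i r → suc-inj (u (suc i) r)))
  where
  case-s : ∀ {i : Fin n} → ¬ (zero ≡ Fin.suc i)
  case-s ()
  suc-inj : ∀ {i j : Fin n} → Fin.suc i ≡ suc j → i ≡ j
  suc-inj refl = refl

-- Finite sums in a commutative monoid and their reindexing along a relation.

module Sums {c ℓ} (M : CommutativeMonoid c ℓ) where
  open CommutativeMonoid M
    renaming (Carrier to C; _∙_ to _+_; ε to 0#; ∙-cong to +-cong; identityˡ to +-identityˡ;
              identityʳ to +-identityʳ; assoc to +-assoc; refl to ≈-refl; sym to ≈-sym; trans to ≈-trans)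
  open CommutativeSemigroupProperties commutativeSemigroup using (interchange)

  ⨁ : List A → (A → C) → C
  ⨁ as f = foldr (λ x y → f x + y) 0# as

  -- A sum over a decidable part of a list is written as a sum over the whole list with zeros, so
  -- that two summations can be interchanged even if the inner range depends on the outer index.
  when : ∀ {P : Set p} → Dec P → C → C
  when (yes _) x = x
  when (no _)  x = 0#

  when-yes : ∀ {P : Set p} (d : Dec P) x → P → when d x ≈ x
  when-yes (yes _) x _ = ≈-refl
  when-yes (no n)  x q = ⊥-elim (n q)

  when-no : ∀ {P : Set p} (d : Dec P) x → ¬ P → when d x ≈ 0#
  when-no (yes q) x n = ⊥-elim (n q)
  when-no (no _)  x _ = ≈-refl

  when-cong : ∀ {P : Set p} {Q : Set q} (d : Dec P) (d′ : Dec Q) {x y} →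
              (P → Q) → (Q → P) → (P → x ≈ y) → when d x ≈ when d′ y
  when-cong (yes p) d′ f g h = ≈-trans (h p) (≈-sym (when-yes d′ _ (f p)))
  when-cong (no n)  d′ f g h = ≈-sym (when-no d′ _ (λ q → n (g q)))

  ⨁-cong : ∀ (as : List A) {f g : A → C} → (∀ x → f x ≈ g x) → ⨁ as f ≈ ⨁ as g
  ⨁-cong []       h = ≈-refl
  ⨁-cong (x ∷ as) h = +-cong (h x) (⨁-cong as h)

  ⨁-none : ∀ {as : List A} {P : Pred A p} {f : A → C} → (∀ x → P x → f x ≈ 0#) → All P as → ⨁ as f ≈ 0#
  ⨁-none h []       = ≈-refl
  ⨁-none h (q ∷ qs) = ≈-trans (+-cong (h _ q) (⨁-none h qs)) (+-identityˡ 0#)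

  ⨁-0 : ∀ (as : List A) → ⨁ as (λ _ → 0#) ≈ 0#
  ⨁-0 as = ⨁-none (λ _ _ → ≈-refl) (All.universal (λ _ → refl {x = 0#}) as)

  ⨁-+ : ∀ (as : List A) (f g : A → C) → ⨁ as (λ x → f x + g x) ≈ ⨁ as f + ⨁ as g
  ⨁-+ []       f g = ≈-sym (+-identityˡ 0#)
  ⨁-+ (x ∷ as) f g = ≈-trans (+-cong ≈-refl (⨁-+ as f g)) (interchange _ _ _ _)

  ⨁-swap : ∀ (as : List A) (bs : List B) (f : A → B → C) →
           ⨁ as (λ x → ⨁ bs (f x)) ≈ ⨁ bs (λ y → ⨁ as (λ x → f x y))
  ⨁-swap []       bs f = ≈-sym (⨁-0 bs)
  ⨁-swap (x ∷ as) bs f = ≈-trans (+-cong ≈-refl (⨁-swap as bs f)) (≈-sym (⨁-+ bs _ _))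

  ⨁-++ : ∀ (as bs : List A) (f : A → C) → ⨁ (as ++ bs) f ≈ ⨁ as f + ⨁ bs f
  ⨁-++ []       bs f = ≈-sym (+-identityˡ _)
  ⨁-++ (x ∷ as) bs f = ≈-trans (+-cong ≈-refl (⨁-++ as bs f)) (≈-sym (+-assoc _ _ _))

  ⨁-map : ∀ (g : A → B) as (f : B → C) → ⨁ (mapᴸ g as) f ≡ ⨁ as (f ∘ g)
  ⨁-map g []       f = refl
  ⨁-map g (x ∷ as) f = ≡.cong (f (g x) +_) (⨁-map g as f)

  ⨁-dpairs : ∀ {B : A → Set b} (as : List A) (bs : ∀ x → List (B x)) (f : Σ A B → C) →
             ⨁ (dpairs as bs) f ≈ ⨁ as (λ x → ⨁ (bs x) (λ y → f (x , y)))
  ⨁-dpairs []       bs f = ≈-refl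
  ⨁-dpairs (x ∷ as) bs f = ≈-trans (⨁-++ (mapᴸ (x ,_) (bs x)) _ f)
    (+-cong (reflexive (⨁-map (x ,_) (bs x) f)) (⨁-dpairs as bs f))

  ⨁-single : ∀ {as : List A} {P : Pred A p} {f : A → C} {y} → ExactlyOne P as →
             (∀ x → P x → f x ≈ y) → (∀ x → ¬ P x → f x ≈ 0#) → ⨁ as f ≈ y
  ⨁-single (here q ns)  h k = ≈-trans (+-cong (h _ q) (⨁-none k ns)) (+-identityʳ _)
  ⨁-single (there n e)  h k = ≈-trans (+-cong (k _ n) (⨁-single e h k)) (+-identityˡ _)

  ⨁-when : ∀ {as : List A} {P : Pred A p} (P? : Decidable P) {f : A → C} {y} → ExactlyOne P as →
           (∀ x → P x → f x ≈ y) → ⨁ as (λ x → when (P? x) (f x)) ≈ y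
  ⨁-when P? {f} e h = ⨁-single e (λ x q → ≈-trans (when-yes (P? x) _ q) (h x q)) (λ x → when-no (P? x) _)

  -- Both sums equal the double sum over the pairs related by R.

  ⨁-reindex : ∀ {as : List A} {bs : List B} (R : A → B → Set p) (R? : ∀ x y → Dec (R x y))
              {f : A → C} {g : B → C} →
              (∀ x → ExactlyOne (R x) bs ⊎ (f x ≈ 0# × (∀ y → ¬ R x y))) →
              (∀ y → ExactlyOne (λ x → R x y) as ⊎ (g y ≈ 0# × (∀ x → ¬ R x y))) →
              (∀ x y → R x y → f x ≈ g y) → ⨁ as f ≈ ⨁ bs g
  ⨁-reindex {as = as} {bs} R R? {f} {g} l r h =
    ≈-trans (⨁-cong as row) (≈-trans (⨁-swap as bs _) (⨁-cong bs col))
    where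
    row : ∀ x → f x ≈ ⨁ bs (λ y → when (R? x y) (f x))
    row x with l x
    ... | inj₁ e       = ≈-sym (⨁-when (R? x) e (λ _ _ → ≈-refl))
    ... | inj₂ (z , n) = ≈-trans z (≈-sym (⨁-none (λ y → when-no (R? x y) _) (All.universal n bs)))

    col : ∀ y → ⨁ as (λ x → when (R? x y) (f x)) ≈ g y
    col y with r y
    ... | inj₁ e       = ⨁-when (λ x → R? x y) e (λ x → h x y)
    ... | inj₂ (z , n) = ≈-trans (⨁-none (λ x → when-no (R? x y) _) (All.universal n as)) (≈-sym z)

-- Enumerations and decidability on finite sets.

open FinSet using (Carrier; size)

enum≃ : ∀ X → X ≃ [ size X ]
enum≃ X = bijection (FinSet.enum X)

size-≡ : ∀ {m n} → [ m ] ≃ [ n ] → m ≡ n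
size-≡ (bijection f) = ↔⇒≡ f

-- Finite quantification is decided on the enumeration; `resp` carries the property from the
-- enumerated representative back to the given element.
dec-∀ : ∀ X {Q : Carrier X → Set p} → (∀ {x y} → FinSet._≈_ X x y → Q x → Q y) →
        (∀ x → Dec (Q x)) → Dec (∀ x → Q x)
dec-∀ X resp Q? = map′ (λ h x → resp (_≃_.strictlyInverseʳ (enum≃ X) x) (h (_≃_.to (enum≃ X) x)))
  (λ h i → h (_≃_.from (enum≃ X) i)) (all? (λ i → Q? (_≃_.from (enum≃ X) i)))

≈-dec : ∀ X (x y : Carrier X) → Dec (FinSet._≈_ X x y)
≈-dec X x y = map′
  (λ e → X.≈-trans (X.≈-sym (_≃_.strictlyInverseʳ (enum≃ X) x))
           (X.≈-trans (_≃_.from-cong (enum≃ X) e) (_≃_.strictlyInverseʳ (enum≃ X) y)))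
  (_≃_.to-cong (enum≃ X)) (_ Fin.≟ _)
  where
  module X = FinSet X

-- Decompositions into two parts.

left? : A ⊎ B → Bool
left? (inj₁ _) = true
left? (inj₂ _) = false

left?-resp : ∀ {R : Rel A p} {S : Rel B p} {z w} → Pointwise R S z w → left? z ≡ left? w
left?-resp (inj₁ _) = refl
left?-resp (inj₂ _) = refl

-- This two-colouring of X determines a decomposition up to bijections of its two parts, so equality
-- of colourings serves as the equality of decompositions throughout.
side : ∀ {X A B} → (A ⊔ˢ B) ≃ X → Carrier X → Bool
side θ x = left? (_≃_.from θ x)

side-cong : ∀ {X A B} (θ : (A ⊔ˢ B) ≃ X) {x y} → FinSet._≈_ X x y → side θ x ≡ side θ y
side-cong θ r = left?-resp (_≃_.from-cong θ r)

side-to : ∀ {X A B} (θ : (A ⊔ˢ B) ≃ X) z → side θ (_≃_.to θ z) ≡ left? z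
side-to θ z = left?-resp (_≃_.strictlyInverseʳ θ z)

record Decomp (X : FinSet) : Set₁ where
  constructor decomp
  field
    {L R} : FinSet
    iso   : (L ⊔ˢ R) ≃ X

open Decomp public

subsetDecomp : ∀ X → Subset (size X) → Decomp X
subsetDecomp X A = decomp (enum≃ X ⁻¹≃ ∘≃ partition≃ A)

-- Listing the subsets of the enumeration, in the order of `subsets`, makes the coproduct sum
-- literally the sum over A in the formula for Δ.
decompositions : ∀ X → List (Decomp X)
decompositions X = mapᴸ (subsetDecomp X) (subsets (size X))

side-partition : ∀ {n} (A : Subset n) i → side (partition≃ A) i ≡ lookup A i
side-partition A i with i ∈? A
... | yes p = ≡.sym (Vec.[]=⇒lookup p)
... | no ¬p with lookup A i in eq
...   | true  = ⊥-elim (¬p (Vec.lookup⇒[]= i A eq))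
...   | false = refl

one-Bool : ∀ b → ExactlyOne (_≡ b) (true ∷ false ∷ [])
one-Bool true  = here refl ((λ ()) ∷ [])
one-Bool false = there (λ ()) (here refl [])

-- In the enumeration of X the colouring `c` is a Boolean vector, and a subset is such a vector;
-- respect for the equality of X transfers the comparison between points and their indices.
one-decomposition : ∀ X (c : Carrier X → Bool) → (∀ {x y} → FinSet._≈_ X x y → c x ≡ c y) →
                    ExactlyOne (λ d → ∀ x → side (iso d) x ≡ c x) (decompositions X)
one-decomposition X c c-cong = one-map (subsetDecomp X) (one-resp
  (λ A h x → ≡.trans (side-partition A (e.to x)) (≡.trans (h (e.to x)) (c-cong (e.strictlyInverseʳ x))))
  (λ A h i → ≡.trans (≡.sym (side-partition A i))
    (≡.trans (≡.cong (side (partition≃ A)) (≡.sym (e.strictlyInverseˡ i))) (h (e.from i))))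
  (one-vectors (size X) (λ i b → b ≡ c (e.from i)) (λ i → one-Bool _)))
  where module e = _≃_ (enum≃ X)

side-dec : ∀ {X} (c c′ : Carrier X → Bool) → (∀ {x y} → FinSet._≈_ X x y → c x ≡ c y) →
           (∀ {x y} → FinSet._≈_ X x y → c′ x ≡ c′ y) → Dec (∀ x → c x ≡ c′ x)
side-dec {X} c c′ r r′ = dec-∀ X (λ e h → ≡.trans (≡.sym (r e)) (≡.trans h (r′ e))) (λ x → c x Bool.≟ c′ x)

module _ {A B A′ B′ : FinSet} (φ : (A ⊔ˢ B) ≃ (A′ ⊔ˢ B′)) where
  private
    module φ = _≃_ φ
    module S = FinSet (A ⊔ˢ B)
    module S′ = FinSet (A′ ⊔ˢ B′)

    getˡ : ∀ {A B : Set} (z : A ⊎ B) → left? z ≡ true → A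
    getˡ (inj₁ a) _ = a

    getʳ : ∀ {A B : Set} (z : A ⊎ B) → left? z ≡ false → B
    getʳ (inj₂ b) _ = b

    inj-getˡ : ∀ {A B : Set} (z : A ⊎ B) e → inj₁ (getˡ z e) ≡ z
    inj-getˡ (inj₁ a) _ = refl

    inj-getʳ : ∀ {A B : Set} (z : A ⊎ B) e → inj₂ (getʳ z e) ≡ z
    inj-getʳ (inj₂ b) _ = refl

  -- Preserving sides means that each image can be read off in the matching summand, and the inverse
  -- preserves sides as well. This turns an equality of colourings into a pair of relabellings, to
  -- which the naturality of the structure maps applies.
  split-bijection : (∀ z → left? (φ.to z) ≡ left? z) →
                    Σ[ α ∈ A ≃ A′ ] Σ[ β ∈ B ≃ B′ ] φ ≗≃ α ⊔≃ β
  split-bijection h = α , β , λ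
    { (inj₁ a) → S′.reflexive (≡.sym (inj-getˡ (φ.to (inj₁ a)) (h (inj₁ a))))
    ; (inj₂ b) → S′.reflexive (≡.sym (inj-getʳ (φ.to (inj₂ b)) (h (inj₂ b)))) }
    where
    h′ : ∀ w → left? (φ.from w) ≡ left? w
    h′ w = ≡.trans (≡.sym (h (φ.from w))) (left?-resp (φ.strictlyInverseˡ w))

    toˡ : Carrier A → Carrier A′
    toˡ a = getˡ (φ.to (inj₁ a)) (h (inj₁ a))
    fromˡ : Carrier A′ → Carrier A
    fromˡ a = getˡ (φ.from (inj₁ a)) (h′ (inj₁ a))
    toʳ : Carrier B → Carrier B′
    toʳ b = getʳ (φ.to (inj₂ b)) (h (inj₂ b))
    fromʳ : Carrier B′ → Carrier B
    fromʳ b = getʳ (φ.from (inj₂ b)) (h′ (inj₂ b))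

    eˡ : ∀ a → φ.to (inj₁ a) S′.≈ inj₁ (toˡ a)
    eˡ a = S′.reflexive (≡.sym (inj-getˡ (φ.to (inj₁ a)) (h (inj₁ a))))
    eˡ′ : ∀ a → φ.from (inj₁ a) S.≈ inj₁ (fromˡ a)
    eˡ′ a = S.reflexive (≡.sym (inj-getˡ (φ.from (inj₁ a)) (h′ (inj₁ a))))
    eʳ : ∀ b → φ.to (inj₂ b) S′.≈ inj₂ (toʳ b)
    eʳ b = S′.reflexive (≡.sym (inj-getʳ (φ.to (inj₂ b)) (h (inj₂ b))))
    eʳ′ : ∀ b → φ.from (inj₂ b) S.≈ inj₂ (fromʳ b)
    eʳ′ b = S.reflexive (≡.sym (inj-getʳ (φ.from (inj₂ b)) (h′ (inj₂ b))))

    α : A ≃ A′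
    α = strict≃ toˡ fromˡ
      (λ {x} {y} p → drop-inj₁ (S′.≈-trans (S′.≈-sym (eˡ x)) (S′.≈-trans (φ.to-cong (inj₁ p)) (eˡ y))))
      (λ {x} {y} p → drop-inj₁ (S.≈-trans (S.≈-sym (eˡ′ x)) (S.≈-trans (φ.from-cong (inj₁ p)) (eˡ′ y))))
      (λ y → drop-inj₁ (S′.≈-trans (S′.≈-sym (eˡ (fromˡ y)))
        (S′.≈-trans (φ.to-cong (S.≈-sym (eˡ′ y))) (φ.strictlyInverseˡ (inj₁ y)))))
      (λ x → drop-inj₁ (S.≈-trans (S.≈-sym (eˡ′ (toˡ x)))
        (S.≈-trans (φ.from-cong (S′.≈-sym (eˡ x))) (φ.strictlyInverseʳ (inj₁ x)))))

    β : B ≃ B′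
    β = strict≃ toʳ fromʳ
      (λ {x} {y} p → drop-inj₂ (S′.≈-trans (S′.≈-sym (eʳ x)) (S′.≈-trans (φ.to-cong (inj₂ p)) (eʳ y))))
      (λ {x} {y} p → drop-inj₂ (S.≈-trans (S.≈-sym (eʳ′ x)) (S.≈-trans (φ.from-cong (inj₂ p)) (eʳ′ y))))
      (λ y → drop-inj₂ (S′.≈-trans (S′.≈-sym (eʳ (fromʳ y)))
        (S′.≈-trans (φ.to-cong (S.≈-sym (eʳ′ y))) (φ.strictlyInverseˡ (inj₂ y)))))
      (λ x → drop-inj₂ (S.≈-trans (S.≈-sym (eʳ′ (toʳ x)))
        (S.≈-trans (φ.from-cong (S′.≈-sym (eʳ x))) (φ.strictlyInverseʳ (inj₂ x)))))

same-side : ∀ {X A B A′ B′} (θ : (A ⊔ˢ B) ≃ X) (θ′ : (A′ ⊔ˢ B′) ≃ X) →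
            (∀ x → side θ x ≡ side θ′ x) →
            Σ[ α ∈ A ≃ A′ ] Σ[ β ∈ B ≃ B′ ] θ′ ⁻¹≃ ∘≃ θ ≗≃ α ⊔≃ β
same-side θ θ′ h = split-bijection (θ′ ⁻¹≃ ∘≃ θ)
  (λ z → ≡.trans (≡.sym (h (_≃_.to θ z))) (side-to θ z))

-- Decompositions into three parts.

-- Three colours: `nothing` for the first part, `just true` and `just false` for the second and the
-- third. Grouping two adjacent parts is then `is-nothing` or `notLast`.
colour₃ : ∀ {A B C : Set} → A ⊎ (B ⊎ C) → Maybe Bool
colour₃ (inj₁ _) = nothing
colour₃ (inj₂ z) = just (left? z)

colour₃-resp : ∀ {A B C : Set} {Q : Rel A 0ℓ} {R : Rel B 0ℓ} {S : Rel C 0ℓ} {z w} →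
               Pointwise Q (Pointwise R S) z w → colour₃ z ≡ colour₃ w
colour₃-resp (inj₁ _) = refl
colour₃-resp (inj₂ e) = ≡.cong just (left?-resp e)

side₃ : ∀ {X A B C} → (A ⊔ˢ (B ⊔ˢ C)) ≃ X → Carrier X → Maybe Bool
side₃ ψ x = colour₃ (_≃_.from ψ x)

side₃-cong : ∀ {X A B C} (ψ : (A ⊔ˢ (B ⊔ˢ C)) ≃ X) {x y} → FinSet._≈_ X x y → side₃ ψ x ≡ side₃ ψ y
side₃-cong ψ r = colour₃-resp (_≃_.from-cong ψ r)

-- Two applications of the two-part case: the first part is separated from the union of the others,
-- and the bijection obtained on that union again preserves sides.
same-side₃ : ∀ {X A B C A′ B′ C′} (ψ : (A ⊔ˢ (B ⊔ˢ C)) ≃ X) (ψ′ : (A′ ⊔ˢ (B′ ⊔ˢ C′)) ≃ X) →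
             (∀ x → side₃ ψ x ≡ side₃ ψ′ x) →
             Σ[ α ∈ A ≃ A′ ] Σ[ β ∈ B ≃ B′ ] Σ[ γ ∈ C ≃ C′ ] ψ′ ⁻¹≃ ∘≃ ψ ≗≃ α ⊔≃ (β ⊔≃ γ)
same-side₃ {A′ = A′} {B′} {C′} ψ ψ′ h =
  let (α , βγ , e) = same-side ψ ψ′ (λ x → nothing-left (_≃_.from ψ x) (_≃_.from ψ′ x) (h x))
      (β , γ , e′) = split-bijection βγ (λ z → just-inj (≡.trans (≡.sym (colour₃-resp (e (inj₂ z))))
        (≡.trans (≡.sym (h (_≃_.to ψ (inj₂ z)))) (colour₃-resp (_≃_.strictlyInverseʳ ψ (inj₂ z))))))
  in α , β , γ , λ
  { (inj₁ a) → e (inj₁ a)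
  ; (inj₂ z) → FinSet.≈-trans (A′ ⊔ˢ (B′ ⊔ˢ C′)) (e (inj₂ z)) (inj₂ (e′ z)) }
  where
  nothing-left : ∀ {A B C A′ B′ C′ : Set} (z : A ⊎ (B ⊎ C)) (w : A′ ⊎ (B′ ⊎ C′)) →
                 colour₃ z ≡ colour₃ w → left? z ≡ left? w
  nothing-left (inj₁ _) (inj₁ _) _ = refl
  nothing-left (inj₂ _) (inj₂ _) _ = refl

  just-inj : ∀ {a b : Bool} → just a ≡ just b → a ≡ b
  just-inj refl = refl

-- Both iterated decompositions are bracketed to the right, so that they can be compared by one
-- three-colouring.
refineˡ : ∀ {X} (d : Decomp X) (d′ : Decomp (L d)) → (L d′ ⊔ˢ (R d′ ⊔ˢ R d)) ≃ X
refineˡ d d′ = iso d ∘≃ (iso d′ ⊔≃ id≃) ∘≃ ⊔-assoc _ _ _ ⁻¹≃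

refineʳ : ∀ {X} (d : Decomp X) (d′ : Decomp (R d)) → (L d ⊔ˢ (L d′ ⊔ˢ R d′)) ≃ X
refineʳ d d′ = iso d ∘≃ (id≃ ⊔≃ iso d′)

module _ (X : FinSet) (c : Carrier X → Maybe Bool) (c-cong : ∀ {x y} → FinSet._≈_ X x y → c x ≡ c y) where
  private
    notLast : Maybe Bool → Bool
    notLast (just false) = false
    notLast _            = true

  -- Given the three-colouring, the outer decomposition must cut off the third colour and the inner
  -- one must separate the first from the second; each is a two-colouring, hence listed exactly
  -- once.
  one-refineˡ : ExactlyOne (λ s → ∀ x → side₃ (refineˡ (proj₁ s) (proj₂ s)) x ≡ c x)
                           (dpairs (decompositions X) (λ d → decompositions (L d)))
  one-refineˡ = one-dpairs
    (λ d h → one-resp (fwd d h) (bwd d)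
      (one-decomposition (L d) (λ z → is-nothing (c (_≃_.to (iso d) (inj₁ z))))
        (λ r → ≡.cong is-nothing (c-cong (_≃_.to-cong (iso d) (inj₁ r))))))
    (λ d d′ h x → outer d d′ x (h x))
    (one-decomposition X (notLast ∘ c) (λ r → ≡.cong notLast (c-cong r)))
    where
    outer : ∀ (d : Decomp X) (d′ : Decomp (L d)) x → side₃ (refineˡ d d′) x ≡ c x → side (iso d) x ≡ notLast (c x)
    outer d d′ x h with _≃_.from (iso d) x
    ... | inj₂ r = ≡.cong notLast h
    ... | inj₁ z with _≃_.from (iso d′) z
    ...   | inj₁ _ = ≡.cong notLast h
    ...   | inj₂ _ = ≡.cong notLast h

    fwd : ∀ (d : Decomp X) → (∀ x → side (iso d) x ≡ notLast (c x)) → (d′ : Decomp (L d)) →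
          (∀ z → side (iso d′) z ≡ is-nothing (c (_≃_.to (iso d) (inj₁ z)))) →
          ∀ x → side₃ (refineˡ d d′) x ≡ c x
    fwd d h d′ k x with _≃_.from (iso d) x | _≃_.strictlyInverseˡ (iso d) x | h x
    ... | inj₂ r | _ | hx with c x
    ...   | just false = refl
    -- The outer side `hx` and the inner side, moved back to `x` along `e`, leave a single colour in
    -- each case.
    fwd d h d′ k x | inj₁ z | e | hx
      with _≃_.from (iso d′) z | c x | hx | ≡.trans (k z) (≡.cong is-nothing (c-cong e))
    ...   | inj₁ _ | nothing   | _ | _ = refl
    ...   | inj₂ _ | just true | _ | _ = refl

    bwd : ∀ (d : Decomp X) (d′ : Decomp (L d)) → (∀ x → side₃ (refineˡ d d′) x ≡ c x) →
          ∀ z → side (iso d′) z ≡ is-nothing (c (_≃_.to (iso d) (inj₁ z)))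
    bwd d d′ h z = ≡.trans (go (_≃_.from (iso d′) z))
      (≡.cong is-nothing (≡.trans (≡.sym (colour₃-resp
          (_≃_.strictlyInverseʳ (refineˡ d d′) (_≃_.to (⊔-assoc (L d′) (R d′) (R d)) (inj₁ (_≃_.from (iso d′) z))))))
        (≡.trans (h _) (c-cong (_≃_.to-cong (iso d)
          (FinSet.≈-trans (L d ⊔ˢ R d) (inj-lemma (_≃_.from (iso d′) z)) (inj₁ (_≃_.strictlyInverseˡ (iso d′) z))))))))
      where
      go : ∀ w → left? w ≡ is-nothing (colour₃ (_≃_.to (⊔-assoc (L d′) (R d′) (R d)) (inj₁ w)))
      go (inj₁ _) = refl
      go (inj₂ _) = refl

      inj-lemma : ∀ w → FinSet._≈_ (L d ⊔ˢ R d)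
        (_≃_.to (iso d′ ⊔≃ id≃ {R d}) (_≃_.from (⊔-assoc (L d′) (R d′) (R d)) (_≃_.to (⊔-assoc (L d′) (R d′) (R d)) (inj₁ w))))
        (inj₁ (_≃_.to (iso d′) w))
      inj-lemma (inj₁ a) = FinSet.≈-refl (L d ⊔ˢ R d) {inj₁ _}
      inj-lemma (inj₂ b) = FinSet.≈-refl (L d ⊔ˢ R d) {inj₁ _}

  one-refineʳ : ExactlyOne (λ s → ∀ x → side₃ (refineʳ (proj₁ s) (proj₂ s)) x ≡ c x)
                           (dpairs (decompositions X) (λ d → decompositions (R d)))
  one-refineʳ = one-dpairs
    (λ d h → one-resp (fwd d h) (bwd d)
      (one-decomposition (R d) (λ z → notLast (c (_≃_.to (iso d) (inj₂ z))))
        (λ r → ≡.cong notLast (c-cong (_≃_.to-cong (iso d) (inj₂ r))))))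
    (λ d d′ h x → outer d d′ x (h x))
    (one-decomposition X (is-nothing ∘ c) (λ r → ≡.cong is-nothing (c-cong r)))
    where
    outer : ∀ (d : Decomp X) (d′ : Decomp (R d)) x → side₃ (refineʳ d d′) x ≡ c x → side (iso d) x ≡ is-nothing (c x)
    outer d d′ x h with _≃_.from (iso d) x
    ... | inj₁ r = ≡.cong is-nothing h
    ... | inj₂ z = ≡.cong is-nothing h

    fwd : ∀ (d : Decomp X) → (∀ x → side (iso d) x ≡ is-nothing (c x)) → (d′ : Decomp (R d)) →
          (∀ z → side (iso d′) z ≡ notLast (c (_≃_.to (iso d) (inj₂ z)))) →
          ∀ x → side₃ (refineʳ d d′) x ≡ c x
    fwd d h d′ k x with _≃_.from (iso d) x | _≃_.strictlyInverseˡ (iso d) x | h x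
    ... | inj₁ r | _ | hx with c x
    ...   | nothing = refl
    fwd d h d′ k x | inj₂ z | e | hx
      with _≃_.from (iso d′) z | c x | hx | ≡.trans (k z) (≡.cong notLast (c-cong e))
    ...   | inj₁ _ | just true  | _ | _ = refl
    ...   | inj₂ _ | just false | _ | _ = refl

    bwd : ∀ (d : Decomp X) (d′ : Decomp (R d)) → (∀ x → side₃ (refineʳ d d′) x ≡ c x) →
          ∀ z → side (iso d′) z ≡ notLast (c (_≃_.to (iso d) (inj₂ z)))
    bwd d d′ h z = ≡.trans (go (_≃_.from (iso d′) z))
      (≡.cong notLast (≡.trans (≡.sym (colour₃-resp
          (_≃_.strictlyInverseʳ (refineʳ d d′) (inj₂ (_≃_.from (iso d′) z)))))
        (≡.trans (h _) (c-cong (_≃_.to-cong (iso d) (inj₂ (_≃_.strictlyInverseˡ (iso d′) z)))))))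
      where
      go : ∀ (w : Carrier (L d′) ⊎ Carrier (R d′)) → left? w ≡ notLast (just (left? w))
      go (inj₁ _) = refl
      go (inj₂ _) = refl

_⊔ᴰ_ : ∀ {X Y} → Decomp X → Decomp Y → Decomp (X ⊔ˢ Y)
d ⊔ᴰ e = decomp ((iso d ⊔≃ iso e) ∘≃ middle-swap (L d) (L e) (R d) (R e))

module _ (X Y : FinSet) (c : Carrier (X ⊔ˢ Y) → Bool)
         (c-cong : ∀ {x y} → FinSet._≈_ (X ⊔ˢ Y) x y → c x ≡ c y) where

  -- A colouring of a disjoint union is a pair of independent colourings; the middle swap in `⊔ᴰ`
  -- leaves the side of every element unchanged.
  one-⊔ᴰ : ExactlyOne (λ s → ∀ x → side (iso (proj₁ s ⊔ᴰ proj₂ s)) x ≡ c x)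
                      (dpairs (decompositions X) (λ _ → decompositions Y))
  one-⊔ᴰ = one-dpairs
    (λ d h → one-resp (λ e k → λ { (inj₁ x) → ≡.trans (sˡ d e x) (h x) ; (inj₂ y) → ≡.trans (sʳ d e y) (k y) })
                      (λ e k y → ≡.trans (≡.sym (sʳ d e y)) (k (inj₂ y)))
               (one-decomposition Y (c ∘ inj₂) (c-cong ∘ inj₂)))
    (λ d e h x → ≡.trans (≡.sym (sˡ d e x)) (h (inj₁ x)))
    (one-decomposition X (c ∘ inj₁) (c-cong ∘ inj₁))
    where
    sˡ : ∀ (d : Decomp X) (e : Decomp Y) x → side (iso (d ⊔ᴰ e)) (inj₁ x) ≡ side (iso d) x
    sˡ d e x with _≃_.from (iso d) x
    ... | inj₁ _ = refl
    ... | inj₂ _ = refl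

    sʳ : ∀ (d : Decomp X) (e : Decomp Y) y → side (iso (d ⊔ᴰ e)) (inj₂ y) ≡ side (iso e) y
    sʳ d e y with _≃_.from (iso e) y
    ... | inj₁ _ = refl
    ... | inj₂ _ = refl

-- Equivalence relations.

≤ᴱ? : ∀ {X} (E E′ : 𝓔 X) → Dec (E ≤ᴱ E′)
≤ᴱ? {X} E E′ = map′ (λ h {x} {y} → h x y) (λ h x y → h)
  (dec-∀ X (λ r h y q → E.∼-trans (E.∼-sym (E.reflexive r)) (h y (E′.∼-trans (E′.reflexive r) q)))
    (λ x → dec-∀ X (λ r h q → E.∼-trans (h (E′.∼-trans q (E′.∼-sym (E′.reflexive r)))) (E.reflexive r))
      (λ y → (x E′.∼? y) →-dec (x E.∼? y))))
  where
  module E = 𝓔 E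
  module E′ = 𝓔 E′

_≐?_ : ∀ {X} (E E′ : 𝓔 X) → Dec (E ≐ E′)
E ≐? E′ = ≤ᴱ? E E′ ×-dec ≤ᴱ? E′ E

≐-sym : ∀ {X} {E E′ : 𝓔 X} → E ≐ E′ → E′ ≐ E
≐-sym (f , g) = g , f

≐-trans : ∀ {X} {E E′ E″ : 𝓔 X} → E ≐ E′ → E′ ≐ E″ → E ≐ E″
≐-trans (f , g) (f′ , g′) = (λ e → f (f′ e)) , (λ e → g′ (g e))

equality : ∀ X → 𝓔 X
equality X = record
  { _∼_ = X._≈_
  ; isEquivalence = Setoid.isEquivalence X.setoid
  ; reflexive = id
  ; _∼?_ = ≈-dec X
  }
  where module X = FinSet X

private
  T-ext : ∀ {a b} → (T a → T b) → (T b → T a) → a ≡ b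
  T-ext {false} {false} f g = refl
  T-ext {false} {true}  f g = ⊥-elim (g tt)
  T-ext {true}  {false} f g = ⊥-elim (f tt)
  T-ext {true}  {true}  f g = refl

  T-does : ∀ {P : Set} (d : Dec P) → T (does d) → P
  T-does (yes q) _ = q

  does-T : ∀ {P : Set} (d : Dec P) → P → T (does d)
  does-T (yes _) _ = tt
  does-T (no n)  q = n q

-- The matrix of truth values of `E` in the enumeration passes the test and gives back `E` up to
-- `≐`. Conversely, a matrix whose relation is `E` has these truth values entry by entry, since a
-- Boolean is determined by whether it holds.
one-equivalence : ∀ X (E : 𝓔 X) → ExactlyOne (_≐ E) (equivalences X)
one-equivalence X E = one-mapMaybe _ found only
  (one-vectors n (λ i r → ∀ j → lookup r j ≡ related i j)
    (λ i → one-vectors n (λ j c → c ≡ related i j) (λ j → one-Bool _)))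
  where
  n = size X
  module e = _≃_ (enum≃ X)
  module E = 𝓔 E

  related : Fin n → Fin n → Bool
  related i j = does (e.from i E.∼? e.from j)

  unit : ∀ x → e.from (e.to x) E.∼ x
  unit x = E.reflexive (e.strictlyInverseʳ x)

  Coded : BoolMatrix n → Set
  Coded M = ∀ i j → lookup (lookup M i) j ≡ related i j

  to∼ : ∀ {M} → Coded M → ∀ {i j} → matrixRel M i j → e.from i E.∼ e.from j
  to∼ h {i} {j} r = T-does (e.from i E.∼? e.from j) (≡.subst T (h i j) r)

  from∼ : ∀ {M} → Coded M → ∀ {i j} → e.from i E.∼ e.from j → matrixRel M i j
  from∼ h {i} {j} r = ≡.subst T (≡.sym (h i j)) (does-T (e.from i E.∼? e.from j) r)

  found : ∀ M → Coded M →
          ∃[ F ] mapᴹ (matrix⇒𝓔 X M) (dec⇒maybe (isEquivalence? M)) ≡ just F × F ≐ E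
  found M h with isEquivalence? M
  ... | yes eq = matrix⇒𝓔 X M eq , refl
      , (λ {x} {y} r → from∼ {M} h (E.∼-trans (unit x) (E.∼-trans r (E.∼-sym (unit y)))))
      , (λ {x} {y} r → E.∼-trans (E.∼-sym (unit x)) (E.∼-trans (to∼ {M} h r) (unit y)))
  ... | no n = ⊥-elim (n (record
      { refl  = from∼ {M} h E.∼-refl
      ; sym   = λ r → from∼ {M} h (E.∼-sym (to∼ {M} h r))
      ; trans = λ r s → from∼ {M} h (E.∼-trans (to∼ {M} h r) (to∼ {M} h s)) }))

  only : ∀ M F → mapᴹ (matrix⇒𝓔 X M) (dec⇒maybe (isEquivalence? M)) ≡ just F → F ≐ E → Coded M
  only M F eq (f , g) i j with isEquivalence? M
  only M .(matrix⇒𝓔 X M eq) refl (f , g) i j | yes eq = T-ext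
    (λ r → does-T (e.from i E.∼? e.from j)
       (g {e.from i} {e.from j}
         (≡.subst₂ (matrixRel M) (≡.sym (e.strictlyInverseˡ i)) (≡.sym (e.strictlyInverseˡ j)) r)))
    (λ r → ≡.subst₂ (matrixRel M) (e.strictlyInverseˡ i) (e.strictlyInverseˡ j)
       (f (T-does (e.from i E.∼? e.from j) r)))

-- Linear algebra: sums of maps, internal Hom, extensionality on tensor products.

module Linear {ℓ} (K : HeytingField ℓ ℓ ℓ) where
  open Over K
  private module 𝕜 = CommutativeRing commRing

  private
    variable
      M N Q M′ N′ Q′ M″ N″ : Vect

  module Chain (M : Vect) where
    infixr 4 _⟫_

    _⟫_ : ∀ {x y z} → M ⊢ x ≈ y → M ⊢ y ≈ z → M ⊢ x ≈ z
    _⟫_ = Module.≈ᴹ-trans M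

    ↺ : ∀ {x y} → M ⊢ x ≈ y → M ⊢ y ≈ x
    ↺ = Module.≈ᴹ-sym M

    ∎ : ∀ {x} → M ⊢ x ≈ x
    ∎ = Module.≈ᴹ-refl M

  infixr 5 _▹_

  _▹_ : (f : M ⊸ N) → ∀ {x y} → M ⊢ x ≈ y → N ⊢ f ⟨$⟩ x ≈ f ⟨$⟩ y
  f ▹ p = _⊸_.⟦⟧-cong f p

  infixr 6 _⊠_

  _⊠_ : ∀ {x x′ y y′} → M ⊢ x ≈ x′ → N ⊢ y ≈ y′ → M ⊗ N ⊢ x ⊗ₜ y ≈ x′ ⊗ₜ y′
  p ⊠ q = rel (⊗-cong p q)

  module ∑ (M : Vect) = Sums (Module.+ᴹ-commutativeMonoid M)

  ∑-cong : ∀ (M : Vect) (as : List A) {f g : A → ⌊ M ⌋} → (∀ x → M ⊢ f x ≈ g x) → M ⊢ ∑ M as f ≈ ∑ M as g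
  ∑-cong M as h = Sums.⨁-cong (Module.+ᴹ-commutativeMonoid M) as h

  map-∑ : ∀ (f : M ⊸ N) (as : List A) (g : A → ⌊ M ⌋) →
          N ⊢ f ⟨$⟩ ∑ M as g ≈ ∑ N as (λ x → f ⟨$⟩ g x)
  map-∑         f []       g = _⊸_.0ᴹ-homo f
  map-∑ {N = N} f (x ∷ as) g = _⊸_.+ᴹ-homo f _ _ ⟫ Module.+ᴹ-cong N ∎ (map-∑ f as g)
    where open Chain N

  opaque
    0-vec : ∀ (M : Vect) k → M ⊢ Module._*ₗ_ M k (Module.0ᴹ M) ≈ Module.0ᴹ M
    0-vec M k = Module.*ₗ-zeroʳ M k

  ∑-*ₗ : ∀ (M : Vect) k (as : List A) (g : A → ⌊ M ⌋) →
         M ⊢ ∑ M as (λ x → Module._*ₗ_ M k (g x)) ≈ Module._*ₗ_ M k (∑ M as g)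
  ∑-*ₗ M k []       g = Module.≈ᴹ-sym M (0-vec M k)
  ∑-*ₗ M k (x ∷ as) g = Module.+ᴹ-cong M ∎ (∑-*ₗ M k as g) ⟫ ↺ (Module.*ₗ-distribˡ M k _ _)
    where open Chain M

  ∑ᴸ : List A → (A → M ⊸ N) → M ⊸ N
  ∑ᴸ {M = M} {N = N} as f = linear (λ x → ∑ N as (λ i → f i ⟨$⟩ x))
    (λ p → ∑-cong N as (λ i → f i ▹ p))
    (λ x y → ∑-cong N as (λ i → _⊸_.+ᴹ-homo (f i) x y) ⟫ ∑.⨁-+ N as _ _)
    (λ k x → ∑-cong N as (λ i → _⊸_.*ₗ-homo (f i) k x) ⟫ ∑-*ₗ N k as _)
    where open Chain N

  opaque
    Hom-isModule : ∀ M N → IsModuleFromLeft commRing (_≗ᴸ_ {M} {N}) _+ᴸ_ 0ᴸ ((- 1#) *ᴸ_) _*ᴸ_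
    Hom-isModule M N = record { isLeftModule = record
      { isLeftSemimodule = record
        { +ᴹ-isCommutativeMonoid = record
          { isMonoid = record
            { isSemigroup = record
              { isMagma = record
                { isEquivalence = ≗ᴸ-isEquivalence {M} {N}
                ; ∙-cong = λ p q x → N.+ᴹ-cong (p x) (q x) }
              ; assoc = λ f g h x → N.+ᴹ-assoc _ _ _
              }
            ; identity = (λ f x → N.+ᴹ-identityˡ _) , (λ f x → N.+ᴹ-identityʳ _)
            }
          ; comm = λ f g x → N.+ᴹ-comm _ _
          }
        ; isPreleftSemimodule = record
          { *ₗ-cong      = λ p q x → N.*ₗ-cong p (q x)
          ; *ₗ-zeroˡ     = λ f x → N.*ₗ-zeroˡ _
          ; *ₗ-distribʳ  = λ f k l x → N.*ₗ-distribʳ _ k l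
          ; *ₗ-identityˡ = λ f x → N.*ₗ-identityˡ _
          ; *ₗ-assoc     = λ k l f x → N.*ₗ-assoc k l _
          ; *ₗ-zeroʳ     = λ k x → N.*ₗ-zeroʳ k
          ; *ₗ-distribˡ  = λ k f g x → N.*ₗ-distribˡ k _ _
          }
        }
      ; -ᴹ‿cong = λ p x → N.*ₗ-cong 𝕜.refl (p x)
      ; -ᴹ‿inverse = (λ f x → negˡ (f ⟨$⟩ x)) , (λ f x → N.+ᴹ-comm _ _ ⟫ negˡ (f ⟨$⟩ x))
      } }
      where
      module N = Module N
      open Chain N
      negˡ : ∀ x → N ⊢ (- 1#) N.*ₗ x N.+ᴹ x ≈ N.0ᴹ
      negˡ x = N.+ᴹ-cong ∎ (↺ (N.*ₗ-identityˡ x)) ⟫ ↺ (N.*ₗ-distribʳ x (- 1#) 1#)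
               ⟫ N.*ₗ-cong (𝕜.-‿inverseˡ 1#) ∎ ⟫ N.*ₗ-zeroˡ x

  -- The internal Hom reduces universal properties in two variables to one variable: a map out of a
  -- tensor product is a map into `Hom`, and invariance is checked one variable at a time.
  Hom : Vect → Vect → Vect
  Hom M N = record { isModule = IsModuleFromLeft.isModule (Hom-isModule M N) }

  inˡ : ∀ {M N} → ⌊ N ⌋ → M ⊸ M ⊗ N
  inˡ {M} {N} y = linear (_⊗ₜ y) (λ p → p ⊠ Module.≈ᴹ-refl N)
    (λ x x′ → rel (⊗-+ˡ x x′ y)) (λ k x → rel (⊗-*ˡ k x y))

  inʳ : ∀ {M N} → ⌊ M ⌋ → N ⊸ M ⊗ N
  inʳ {M} {N} x = linear (x ⊗ₜ_) (λ p → Module.≈ᴹ-refl M ⊠ p)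
    (λ y y′ → rel (⊗-+ʳ x y y′)) (λ k y → rel (⊗-*ʳ k x y))

  uncurry : ∀ {M N Q} → M ⊸ Hom N Q → M ⊗ N ⊸ Q
  uncurry {M} {N} {Q} f = ⊗-lift {M} {N} {Q} record
    { fun  = λ x y → (f ⟨$⟩ x) ⟨$⟩ y
    ; cong = λ {x} {x′} {y} {y′} p q → ((f ⟨$⟩ x) ▹ q) ⟫ (f ▹ p) y′
    ; +ˡ   = λ x x′ y → _⊸_.+ᴹ-homo f x x′ y
    ; +ʳ   = λ x y y′ → _⊸_.+ᴹ-homo (f ⟨$⟩ x) y y′
    ; *ˡ   = λ k x y → _⊸_.*ₗ-homo f k x y
    ; *ʳ   = λ k x y → _⊸_.*ₗ-homo (f ⟨$⟩ x) k y
    }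
    where open Chain Q

  ⊗-ext : ∀ {M N Q} (f g : M ⊗ N ⊸ Q) →
          (∀ x y → Q ⊢ f ⟨$⟩ x ⊗ₜ y ≈ g ⟨$⟩ x ⊗ₜ y) → f ≗ᴸ g
  ⊗-ext {M} {N} f g h = ext (Bilin M N) f g (λ xy → h (proj₁ xy) (proj₂ xy))

  ⊗-ext₃ : ∀ {M N Q R} (f g : (M ⊗ N) ⊗ Q ⊸ R) →
           (∀ x y z → R ⊢ f ⟨$⟩ (x ⊗ₜ y) ⊗ₜ z ≈ g ⟨$⟩ (x ⊗ₜ y) ⊗ₜ z) → f ≗ᴸ g
  ⊗-ext₃ {M} {N} {Q} f g h = ⊗-ext {M ⊗ N} {Q} f g (λ t z →
    ⊗-ext {M} {N} (f ∘ᴸ inˡ z) (g ∘ᴸ inˡ z) (λ x y → h x y z) t)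

  ⊗-ext₄ : ∀ {M N M′ N′ R} (f g : (M ⊗ N) ⊗ (M′ ⊗ N′) ⊸ R) →
           (∀ x y x′ y′ → R ⊢ f ⟨$⟩ (x ⊗ₜ y) ⊗ₜ (x′ ⊗ₜ y′) ≈ g ⟨$⟩ (x ⊗ₜ y) ⊗ₜ (x′ ⊗ₜ y′)) → f ≗ᴸ g
  ⊗-ext₄ {M} {N} {M′} {N′} f g h = ⊗-ext₃ {M} {N} {M′ ⊗ N′} f g (λ x y t →
    ⊗-ext {M′} {N′} (f ∘ᴸ inʳ (x ⊗ₜ y)) (g ∘ᴸ inʳ (x ⊗ₜ y)) (λ x′ y′ → h x y x′ y′) t)

  ⊗₁-cong : ∀ {M N M′ N′} {f f′ : M ⊸ M′} {g g′ : N ⊸ N′} → f ≗ᴸ f′ → g ≗ᴸ g′ → f ⊗₁ g ≗ᴸ f′ ⊗₁ g′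
  ⊗₁-cong {f = f} {f′} {g} {g′} p q = ⊗-ext (f ⊗₁ g) (f′ ⊗₁ g′) (λ x y → p x ⊠ q y)

  assoc-natural : ∀ {M N Q M′ N′ Q′} (f : M ⊸ M′) (g : N ⊸ N′) (h : Q ⊸ Q′) →
                  ⊗-assoc M′ N′ Q′ ∘ᴸ ((f ⊗₁ g) ⊗₁ h) ≗ᴸ (f ⊗₁ (g ⊗₁ h)) ∘ᴸ ⊗-assoc M N Q
  assoc-natural {M} {N} {Q} {M′} {N′} {Q′} f g h =
    ⊗-ext₃ (⊗-assoc M′ N′ Q′ ∘ᴸ ((f ⊗₁ g) ⊗₁ h)) ((f ⊗₁ (g ⊗₁ h)) ∘ᴸ ⊗-assoc M N Q)
      (λ _ _ _ → ≈-refl)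

  -- Coinvariants of the sum of all H[n], characterised by existence (`desc`) and uniqueness
  -- (`ι-ext`) of factorisations. The double bialgebra axioms are derived from this interface alone;
  -- the presentation of `𝓕` by generators enters later, with the instance and the explicit
  -- formulas.
  record FockSpace (H : Species) : Set (lsuc 0ℓ ⊔ lsuc ℓ) where
    open Species H
    field
      space  : Vect
      ι      : ∀ n → P₀ [ n ] ⊸ space
      ι-𝔖    : ∀ {n} (σ : [ n ] ≃ [ n ]) x → space ⊢ ι n ⟨$⟩ P₁ σ ⟨$⟩ x ≈ ι n ⟨$⟩ x
      desc   : ∀ {M} (f : ∀ n → P₀ [ n ] ⊸ M) →
               (∀ {n} (σ : [ n ] ≃ [ n ]) x → M ⊢ f n ⟨$⟩ P₁ σ ⟨$⟩ x ≈ f n ⟨$⟩ x) → space ⊸ M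
      desc-ι : ∀ {M} (f : ∀ n → P₀ [ n ] ⊸ M)
               (inv : ∀ {n} (σ : [ n ] ≃ [ n ]) x → M ⊢ f n ⟨$⟩ P₁ σ ⟨$⟩ x ≈ f n ⟨$⟩ x) n x →
               M ⊢ desc {M} f (λ {n} → inv {n}) ⟨$⟩ ι n ⟨$⟩ x ≈ f n ⟨$⟩ x
      ι-ext  : ∀ {M} (f g : space ⊸ M) →
               (∀ n x → M ⊢ f ⟨$⟩ ι n ⟨$⟩ x ≈ g ⟨$⟩ ι n ⟨$⟩ x) → f ≗ᴸ g

-- Product and coassociative first coproduct on the coinvariants.

module FockAlgebra {ℓ} (K : HeytingField ℓ ℓ ℓ)
                   (H : Over.Species K) (F : Linear.FockSpace K H) where
  open Over K
  open Linear K
  open Species H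
  open FockSpace F

  private
    S : Vect
    S = space

  P-merge : ∀ {X Y Z} (τ : Y ≃ Z) (σ : X ≃ Y) (υ : X ≃ Z) → τ ∘≃ σ ≗≃ υ → ∀ x →
            P₀ Z ⊢ P₁ τ ⟨$⟩ P₁ σ ⟨$⟩ x ≈ P₁ υ ⟨$⟩ x
  P-merge {Z = Z} τ σ υ e x = ↺ (P-∘ τ σ x) ⟫ P-resp {σ = τ ∘≃ σ} {τ = υ} e x
    where open Chain (P₀ Z)

  P-square : ∀ {X Y Y′ Z} (τ : Y ≃ Z) (σ : X ≃ Y) (τ′ : Y′ ≃ Z) (σ′ : X ≃ Y′) →
             τ ∘≃ σ ≗≃ τ′ ∘≃ σ′ → ∀ x →
             P₀ Z ⊢ P₁ τ ⟨$⟩ P₁ σ ⟨$⟩ x ≈ P₁ τ′ ⟨$⟩ P₁ σ′ ⟨$⟩ x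
  P-square {Z = Z} τ σ τ′ σ′ e x = P-merge τ σ (τ′ ∘≃ σ′) e x ⟫ P-∘ τ′ σ′ x
    where open Chain (P₀ Z)

  -- A bijection between standard finite sets forces their sizes to agree, after which it is a
  -- permutation and invariance applies.
  ι-≃ : ∀ {m n} (ρ : [ m ] ≃ [ n ]) x → S ⊢ ι n ⟨$⟩ P₁ ρ ⟨$⟩ x ≈ ι m ⟨$⟩ x
  ι-≃ {m} {n} ρ x with size-≡ ρ
  ... | refl = ι-𝔖 ρ x

  -- Extends `ι` from [n] to every finite set through its enumeration. By naturality along
  -- bijections the enumeration leaves no trace, so the axioms of H can be used on X ⊔ Y and X/E
  -- themselves, without renumbering.
  ι̂ : ∀ X → P₀ X ⊸ S
  ι̂ X = ι (size X) ∘ᴸ P₁ (enum≃ X)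

  ι̂-[] : ∀ n x → S ⊢ ι̂ [ n ] ⟨$⟩ x ≈ ι n ⟨$⟩ x
  ι̂-[] n x = ι n ▹ P-id x

  ι̂-natural : ∀ {X Y} (σ : X ≃ Y) x → S ⊢ ι̂ Y ⟨$⟩ P₁ σ ⟨$⟩ x ≈ ι̂ X ⟨$⟩ x
  ι̂-natural {X} {Y} σ x =
    (ι (size Y) ▹ P-square (enum≃ Y) σ (enum≃ Y ∘≃ σ ∘≃ enum≃ X ⁻¹≃) (enum≃ X)
      (λ x → _≃_.to-cong (enum≃ Y) (_≃_.to-cong σ (FinSet.≈-sym X (_≃_.strictlyInverseʳ (enum≃ X) x)))) x)
    ⟫ ι-≃ (enum≃ Y ∘≃ σ ∘≃ enum≃ X ⁻¹≃) _
    where open Chain S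

  ι̂⊗-natural : ∀ {X Y X′ Y′} (σ : X ≃ X′) (τ : Y ≃ Y′) →
               (ι̂ X′ ⊗₁ ι̂ Y′) ∘ᴸ (P₁ σ ⊗₁ P₁ τ) ≗ᴸ ι̂ X ⊗₁ ι̂ Y
  ι̂⊗-natural {X} {Y} {X′} {Y′} σ τ = ⊗-ext ((ι̂ X′ ⊗₁ ι̂ Y′) ∘ᴸ (P₁ σ ⊗₁ P₁ τ)) (ι̂ X ⊗₁ ι̂ Y)
    (λ x y → ι̂-natural σ x ⊠ ι̂-natural τ y)

  ι-ext₂ : ∀ {M} (f g : S ⊗ S ⊸ M) →
           (∀ k l x y → M ⊢ f ⟨$⟩ (ι k ⟨$⟩ x) ⊗ₜ (ι l ⟨$⟩ y) ≈ g ⟨$⟩ (ι k ⟨$⟩ x) ⊗ₜ (ι l ⟨$⟩ y)) → f ≗ᴸ g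
  ι-ext₂ f g h = ⊗-ext f g (λ s t →
    ι-ext (f ∘ᴸ inˡ t) (g ∘ᴸ inˡ t) (λ k x →
      ι-ext (f ∘ᴸ inʳ (ι k ⟨$⟩ x)) (g ∘ᴸ inʳ (ι k ⟨$⟩ x)) (λ l y → h k l x y) t) s)

  ι-ext₃ : ∀ {M} (f g : (S ⊗ S) ⊗ S ⊸ M) →
           (∀ k l m x y z → M ⊢ f ⟨$⟩ ((ι k ⟨$⟩ x) ⊗ₜ (ι l ⟨$⟩ y)) ⊗ₜ (ι m ⟨$⟩ z)
                              ≈ g ⟨$⟩ ((ι k ⟨$⟩ x) ⊗ₜ (ι l ⟨$⟩ y)) ⊗ₜ (ι m ⟨$⟩ z)) → f ≗ᴸ g
  ι-ext₃ f g h = ⊗-ext {S ⊗ S} {S} f g (λ s t →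
    ι-ext₂ (f ∘ᴸ inˡ t) (g ∘ᴸ inˡ t) (λ k l x y →
      ι-ext (f ∘ᴸ inʳ _) (g ∘ᴸ inʳ _) (λ m z → h k l m x y z) t) s)

  -- Universal property in two variables. Invariance in one variable is the given invariance with
  -- the identity permutation in the other. For fixed `x` the second variable descends; the
  -- resulting maps form a linear family in `x`, which is itself invariant and descends in turn.
  module _ {M : Vect} (f : ∀ k l → P₀ [ k ] ⊗ P₀ [ l ] ⊸ M)
           (inv : ∀ {k l} (σ : [ k ] ≃ [ k ]) (τ : [ l ] ≃ [ l ]) x y →
                  M ⊢ f k l ⟨$⟩ (P₁ σ ⟨$⟩ x) ⊗ₜ (P₁ τ ⟨$⟩ y) ≈ f k l ⟨$⟩ x ⊗ₜ y) where
    private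
      inv₁ : ∀ {k l} (σ : [ k ] ≃ [ k ]) x y → M ⊢ f k l ⟨$⟩ (P₁ σ ⟨$⟩ x) ⊗ₜ y ≈ f k l ⟨$⟩ x ⊗ₜ y
      inv₁ {k} {l} σ x y = (f k l ▹ Module.≈ᴹ-refl (P₀ [ k ]) ⊠ Module.≈ᴹ-sym (P₀ [ l ]) (P-id y)) ⟫ inv σ id≃ x y
        where open Chain M

      inv₂ : ∀ {k} x {l} (τ : [ l ] ≃ [ l ]) y → M ⊢ f k l ⟨$⟩ x ⊗ₜ (P₁ τ ⟨$⟩ y) ≈ f k l ⟨$⟩ x ⊗ₜ y
      inv₂ {k} x {l} τ y = (f k l ▹ Module.≈ᴹ-sym (P₀ [ k ]) (P-id x) ⊠ Module.≈ᴹ-refl (P₀ [ l ])) ⟫ inv id≃ τ x y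
        where open Chain M

      row : ∀ {k} → ⌊ P₀ [ k ] ⌋ → S ⊸ M
      row {k} x = desc {M} (λ l → f k l ∘ᴸ inʳ x) (inv₂ x)

      row-ι : ∀ {k} x l y → M ⊢ row {k} x ⟨$⟩ ι l ⟨$⟩ y ≈ f k l ⟨$⟩ x ⊗ₜ y
      row-ι {k} x = desc-ι {M} (λ l → f k l ∘ᴸ inʳ x) (inv₂ x)

      rows : ∀ k → P₀ [ k ] ⊸ Hom S M
      rows k = linear {P₀ [ k ]} {Hom S M} row
        (λ {x} {x′} p → ι-ext (row x) (row x′) (λ l y →
          row-ι x l y ⟫ (f k l ▹ p ⊠ Module.≈ᴹ-refl (P₀ [ l ])) ⟫ ↺ (row-ι x′ l y)))
        (λ x x′ → ι-ext (row (Module._+ᴹ_ (P₀ [ k ]) x x′)) (row x +ᴸ row x′) (λ l y →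
          row-ι _ l y ⟫ _⊸_.+ᴹ-homo (f k l ∘ᴸ inˡ y) x x′
          ⟫ Module.+ᴹ-cong M (↺ (row-ι x l y)) (↺ (row-ι x′ l y))))
        (λ c x → ι-ext (row (Module._*ₗ_ (P₀ [ k ]) c x)) (c *ᴸ row x) (λ l y →
          row-ι _ l y ⟫ _⊸_.*ₗ-homo (f k l ∘ᴸ inˡ y) c x
          ⟫ Module.*ₗ-cong M (CommutativeRing.refl commRing) (↺ (row-ι x l y))))
        where open Chain M

      rows-inv : ∀ {k} (σ : [ k ] ≃ [ k ]) x → Hom S M ⊢ rows k ⟨$⟩ P₁ σ ⟨$⟩ x ≈ rows k ⟨$⟩ x
      rows-inv {k} σ x = ι-ext (row (P₁ σ ⟨$⟩ x)) (row x) (λ l y →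
        row-ι _ l y ⟫ inv₁ σ x y ⟫ ↺ (row-ι x l y))
        where open Chain M

    opaque
      table : S ⊸ Hom S M
      table = desc {Hom S M} rows rows-inv

      table-ι : ∀ k x → (table ⟨$⟩ ι k ⟨$⟩ x) ≗ᴸ row x
      table-ι = desc-ι {Hom S M} rows rows-inv

    desc₂ : S ⊗ S ⊸ M
    desc₂ = uncurry {S} {S} {M} table

    desc₂-ι : ∀ k l x y → M ⊢ desc₂ ⟨$⟩ (ι k ⟨$⟩ x) ⊗ₜ (ι l ⟨$⟩ y) ≈ f k l ⟨$⟩ x ⊗ₜ y
    desc₂-ι k l x y = Module.≈ᴹ-trans M (table-ι k x (ι l ⟨$⟩ y)) (row-ι x l y)

  module Product (A : TwistedAlgebra H) where
    open TwistedAlgebra A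

    private
      f : ∀ k l → P₀ [ k ] ⊗ P₀ [ l ] ⊸ S
      f k l = ι̂ ([ k ] ⊔ˢ [ l ]) ∘ᴸ m [ k ] [ l ]

      f-inv : ∀ {k l} (σ : [ k ] ≃ [ k ]) (τ : [ l ] ≃ [ l ]) x y →
              S ⊢ f k l ⟨$⟩ (P₁ σ ⟨$⟩ x) ⊗ₜ (P₁ τ ⟨$⟩ y) ≈ f k l ⟨$⟩ x ⊗ₜ y
      f-inv {k} {l} σ τ x y = (ι̂ ([ k ] ⊔ˢ [ l ]) ▹ m-natural σ τ (x ⊗ₜ y)) ⟫ ι̂-natural (σ ⊔≃ τ) _
        where open Chain S

    opaque
      mul : S ⊗ S ⊸ S
      mul = desc₂ f f-inv

      mul-ι : ∀ k l x y → S ⊢ mul ⟨$⟩ (ι k ⟨$⟩ x) ⊗ₜ (ι l ⟨$⟩ y)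
                            ≈ ι̂ ([ k ] ⊔ˢ [ l ]) ⟨$⟩ m [ k ] [ l ] ⟨$⟩ x ⊗ₜ y
      mul-ι = desc₂-ι f f-inv

    -- By naturality of `m` the enumerations of X and Y can be removed, so that products of products
    -- are computed on (X ⊔ Y) ⊔ Z, where associativity of the twisted algebra is stated.
    mul-ι̂ : ∀ X Y x y → S ⊢ mul ⟨$⟩ (ι̂ X ⟨$⟩ x) ⊗ₜ (ι̂ Y ⟨$⟩ y) ≈ ι̂ (X ⊔ˢ Y) ⟨$⟩ m X Y ⟨$⟩ x ⊗ₜ y
    mul-ι̂ X Y x y = mul-ι _ _ _ _
      ⟫ (ι̂ ([ size X ] ⊔ˢ [ size Y ]) ▹ m-natural (enum≃ X) (enum≃ Y) (x ⊗ₜ y))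
      ⟫ ι̂-natural (enum≃ X ⊔≃ enum≃ Y) _
      where open Chain S

    one : ⌊ S ⌋
    one = ι 0 ⟨$⟩ 1ₚ

    ι̂-1 : S ⊢ ι̂ ∅ ⟨$⟩ 1ₚ ≈ one
    ι̂-1 = ι̂-[] 0 1ₚ

    mul-assoc : mul ∘ᴸ (mul ⊗₁ idᴸ) ≗ᴸ mul ∘ᴸ (idᴸ ⊗₁ mul) ∘ᴸ ⊗-assoc S S S
    mul-assoc = ι-ext₃ (mul ∘ᴸ (mul ⊗₁ idᴸ)) (mul ∘ᴸ (idᴸ ⊗₁ mul) ∘ᴸ ⊗-assoc S S S) (λ k l n x y z →
      (mul ▹ mul-ι k l x y ⊠ ↺ (ι̂-[] n z))
      ⟫ mul-ι̂ ([ k ] ⊔ˢ [ l ]) [ n ] _ z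
      ⟫ ↺ (ι̂-natural (⊔-assoc [ k ] [ l ] [ n ]) _)
      ⟫ (ι̂ ([ k ] ⊔ˢ ([ l ] ⊔ˢ [ n ])) ▹ m-assoc [ k ] [ l ] [ n ] ((x ⊗ₜ y) ⊗ₜ z))
      ⟫ ↺ (mul-ι̂ [ k ] ([ l ] ⊔ˢ [ n ]) x _)
      ⟫ (mul ▹ ι̂-[] k x ⊠ ↺ (mul-ι l n y z)))
      where open Chain S

    mul-unitˡ : ∀ x → S ⊢ mul ⟨$⟩ one ⊗ₜ x ≈ x
    mul-unitˡ = ι-ext (mul ∘ᴸ inʳ one) idᴸ (λ n x →
      (mul ▹ ↺ ι̂-1 ⊠ ↺ (ι̂-[] n x)) ⟫ mul-ι̂ ∅ [ n ] 1ₚ x ⟫ ↺ (ι̂-natural (∅⊔≃ [ n ]) _)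
      ⟫ (ι̂ [ n ] ▹ m-unitˡ [ n ] x) ⟫ ι̂-[] n x)
      where open Chain S

    mul-unitʳ : ∀ x → S ⊢ mul ⟨$⟩ x ⊗ₜ one ≈ x
    mul-unitʳ = ι-ext (mul ∘ᴸ inˡ one) idᴸ (λ n x →
      (mul ▹ ↺ (ι̂-[] n x) ⊠ ↺ ι̂-1) ⟫ mul-ι̂ [ n ] ∅ x 1ₚ ⟫ ↺ (ι̂-natural (⊔∅≃ [ n ]) _)
      ⟫ (ι̂ [ n ] ▹ m-unitʳ [ n ] x) ⟫ ι̂-[] n x)
      where open Chain S

  module Coproduct (C : TwistedCoalgebra H) where
    open TwistedCoalgebra C

    opaque
      D : ∀ {X} → Decomp X → P₀ X ⊸ S ⊗ S
      D d = (ι̂ (L d) ⊗₁ ι̂ (R d)) ∘ᴸ Δ (L d) (R d) ∘ᴸ P₁ (iso d ⁻¹≃)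

      D-def : ∀ {X} (d : Decomp X) x →
              S ⊗ S ⊢ D d ⟨$⟩ x ≈ (ι̂ (L d) ⊗₁ ι̂ (R d)) ⟨$⟩ Δ (L d) (R d) ⟨$⟩ P₁ (iso d ⁻¹≃) ⟨$⟩ x
      D-def d x = ≈-refl

      -- Decompositions matched by `σ` differ by a bijection that preserves sides. It splits into
      -- bijections of the two parts; naturality of `Δ` moves them past the coproduct and `ι̂`
      -- absorbs them.
      D-natural : ∀ {X Y} (d : Decomp X) (e : Decomp Y) (σ : X ≃ Y) →
                  (∀ x → side (iso d) x ≡ side (iso e) (_≃_.to σ x)) → ∀ x →
                  S ⊗ S ⊢ D e ⟨$⟩ P₁ σ ⟨$⟩ x ≈ D d ⟨$⟩ x
      D-natural {X} {Y} d e σ h x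
        with α , β , eq ← split-bijection (iso e ⁻¹≃ ∘≃ σ ∘≃ iso d)
               (λ z → ≡.trans (≡.sym (h _)) (side-to (iso d) z)) =
        (((ι̂ (L e) ⊗₁ ι̂ (R e)) ∘ᴸ Δ (L e) (R e)) ▹
          P-square (iso e ⁻¹≃) σ (α ⊔≃ β) (iso d ⁻¹≃) (λ x →
            FinSet.≈-trans (L e ⊔ˢ R e)
              (_≃_.to-cong (iso e ⁻¹≃) (_≃_.to-cong σ (FinSet.≈-sym X (_≃_.strictlyInverseˡ (iso d) x))))
              (eq (_≃_.from (iso d) x))) x)
        ⟫ ((ι̂ (L e) ⊗₁ ι̂ (R e)) ▹ Δ-natural α β (P₁ (iso d ⁻¹≃) ⟨$⟩ x))
        ⟫ ι̂⊗-natural α β (Δ (L d) (R d) ⟨$⟩ P₁ (iso d ⁻¹≃) ⟨$⟩ x)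
        where open Chain (S ⊗ S)

    -- A bijection matches the colourings of its source with those of its target, and matched terms
    -- agree. For permutations of [n] this is the invariance which lets the sum descend; for the
    -- enumeration of X it gives the coproduct on arbitrary finite sets.
    ∑D-natural : ∀ {X Y} (σ : X ≃ Y) x →
                 S ⊗ S ⊢ ∑ (S ⊗ S) (decompositions Y) (λ e → D e ⟨$⟩ P₁ σ ⟨$⟩ x)
                       ≈ ∑ (S ⊗ S) (decompositions X) (λ d → D d ⟨$⟩ x)
    ∑D-natural {X} {Y} σ x = ∑.⨁-reindex (S ⊗ S)
      (λ e d → ∀ x → side (iso d) x ≡ side (iso e) (_≃_.to σ x))
      (λ e d → side-dec {X} _ _ (side-cong (iso d)) (λ r → side-cong (iso e) (_≃_.to-cong σ r)))
      (λ e → inj₁ (one-decomposition X _ (λ r → side-cong (iso e) (_≃_.to-cong σ r))))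
      (λ d → inj₁ (one-resp
        (λ e h x → ≡.trans (side-cong (iso d) (FinSet.≈-sym X (_≃_.strictlyInverseʳ σ x))) (≡.sym (h (_≃_.to σ x))))
        (λ e h y → ≡.trans (side-cong (iso e) (FinSet.≈-sym Y (_≃_.strictlyInverseˡ σ y))) (≡.sym (h (_≃_.from σ y))))
        (one-decomposition Y (λ y → side (iso d) (_≃_.from σ y)) (λ r → side-cong (iso d) (_≃_.from-cong σ r)))))
      (λ e d h → D-natural d e σ h x)

    private
      sumD : ∀ X → P₀ X ⊸ S ⊗ S
      sumD X = ∑ᴸ (decompositions X) D

    opaque
      Δᶠ : S ⊸ S ⊗ S
      Δᶠ = desc {S ⊗ S} (λ n → sumD [ n ]) ∑D-natural

      Δ-ι : ∀ n x → S ⊗ S ⊢ Δᶠ ⟨$⟩ ι n ⟨$⟩ x ≈ ∑ (S ⊗ S) (decompositions [ n ]) (λ d → D d ⟨$⟩ x)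
      Δ-ι = desc-ι {S ⊗ S} (λ n → sumD [ n ]) ∑D-natural

    Δ-ι̂ : ∀ X x → S ⊗ S ⊢ Δᶠ ⟨$⟩ ι̂ X ⟨$⟩ x ≈ ∑ (S ⊗ S) (decompositions X) (λ d → D d ⟨$⟩ x)
    Δ-ι̂ X x = Δ-ι _ _ ⟫ ∑D-natural (enum≃ X) x
      where open Chain (S ⊗ S)

    private
      S₃ = S ⊗ (S ⊗ S)

      ι₃ : ∀ A B C → P₀ A ⊗ (P₀ B ⊗ P₀ C) ⊸ S₃
      ι₃ A B C = ι̂ A ⊗₁ (ι̂ B ⊗₁ ι̂ C)

    opaque
      unfolding D

      -- Common form of the terms of both iterated coproducts: a decomposition into three parts,
      -- with the right-hand bracketing of Δ.
      D₃ : ∀ {X A B C} → (A ⊔ˢ (B ⊔ˢ C)) ≃ X → P₀ X ⊸ S₃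
      D₃ {X} {A} {B} {C} ψ = ι₃ A B C ∘ᴸ (idᴸ {P₀ A} ⊗₁ Δ B C) ∘ᴸ Δ A (B ⊔ˢ C) ∘ᴸ P₁ (ψ ⁻¹≃)

      D₃-cong : ∀ {X A B C A′ B′ C′} (ψ : (A ⊔ˢ (B ⊔ˢ C)) ≃ X) (ψ′ : (A′ ⊔ˢ (B′ ⊔ˢ C′)) ≃ X) →
                (∀ x → side₃ ψ x ≡ side₃ ψ′ x) → ∀ x → S₃ ⊢ D₃ ψ ⟨$⟩ x ≈ D₃ ψ′ ⟨$⟩ x
      D₃-cong {X} {A} {B} {C} {A′} {B′} {C′} ψ ψ′ h x =
        let (α , β , γ , eq) = same-side₃ ψ ψ′ h in go α β γ eq
        where
        open Chain S₃
        nat : ∀ {A B C A′ B′ C′} (α : A ≃ A′) (β : B ≃ B′) (γ : C ≃ C′) t →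
              S₃ ⊢ ι₃ A′ B′ C′ ⟨$⟩ (idᴸ {P₀ A′} ⊗₁ Δ B′ C′) ⟨$⟩ (P₁ α ⊗₁ P₁ (β ⊔≃ γ)) ⟨$⟩ t
                 ≈ ι₃ A B C ⟨$⟩ (idᴸ {P₀ A} ⊗₁ Δ B C) ⟨$⟩ t
        nat {A} {B} {C} {A′} {B′} {C′} α β γ =
          ⊗-ext (ι₃ A′ B′ C′ ∘ᴸ (idᴸ {P₀ A′} ⊗₁ Δ B′ C′) ∘ᴸ (P₁ α ⊗₁ P₁ (β ⊔≃ γ)))
                (ι₃ A B C ∘ᴸ (idᴸ {P₀ A} ⊗₁ Δ B C))
                (λ a t → ι̂-natural α a ⊠
                  Module.≈ᴹ-trans (S ⊗ S) ((ι̂ B′ ⊗₁ ι̂ C′) ▹ Δ-natural β γ t) (ι̂⊗-natural β γ (Δ B C ⟨$⟩ t)))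

        go : ∀ (α : A ≃ A′) (β : B ≃ B′) (γ : C ≃ C′) → ψ′ ⁻¹≃ ∘≃ ψ ≗≃ α ⊔≃ (β ⊔≃ γ) →
             S₃ ⊢ D₃ ψ ⟨$⟩ x ≈ D₃ ψ′ ⟨$⟩ x
        go α β γ eq = ↺
          (((ι₃ A′ B′ C′ ∘ᴸ (idᴸ {P₀ A′} ⊗₁ Δ B′ C′) ∘ᴸ Δ A′ (B′ ⊔ˢ C′)) ▹
             Module.≈ᴹ-sym (P₀ (A′ ⊔ˢ (B′ ⊔ˢ C′))) (P-merge (α ⊔≃ (β ⊔≃ γ)) (ψ ⁻¹≃) (ψ′ ⁻¹≃)
               (λ x → FinSet.≈-trans (A′ ⊔ˢ (B′ ⊔ˢ C′)) (FinSet.≈-sym (A′ ⊔ˢ (B′ ⊔ˢ C′)) (eq (_≃_.from ψ x)))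
                        (_≃_.to-cong (ψ′ ⁻¹≃) (_≃_.strictlyInverseˡ ψ x))) x))
          ⟫ ((ι₃ A′ B′ C′ ∘ᴸ (idᴸ {P₀ A′} ⊗₁ Δ B′ C′)) ▹ Δ-natural α (β ⊔≃ γ) (P₁ (ψ ⁻¹≃) ⟨$⟩ x))
          ⟫ nat α β γ (Δ A (B ⊔ˢ C) ⟨$⟩ P₁ (ψ ⁻¹≃) ⟨$⟩ x))

      -- Coassociativity of the twisted coalgebra is used here, term by term, to pass from the
      -- left-hand bracketing to the one of `D₃`. Naturality along the inner bijection brings Δ into
      -- the form that the axiom requires.
      D-refineˡ : ∀ {X} (d : Decomp X) x →
                  S₃ ⊢ ⊗-assoc S S S ⟨$⟩ (Δᶠ ⊗₁ idᴸ {S}) ⟨$⟩ D d ⟨$⟩ x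
                     ≈ ∑ S₃ (decompositions (L d)) (λ d′ → D₃ (refineˡ d d′) ⟨$⟩ x)
      D-refineˡ {X} d x = step₁ (Δ (L d) (R d) ⟨$⟩ y) ⟫ ∑-cong S₃ (decompositions (L d)) step₂
        where
        open Chain S₃
        y : ⌊ P₀ (L d ⊔ˢ R d) ⌋
        y = P₁ (iso d ⁻¹≃) ⟨$⟩ x

        term : ∀ (d′ : Decomp (L d)) → P₀ (L d) ⊗ P₀ (R d) ⊸ S₃
        term d′ = ι₃ (L d′) (R d′) (R d) ∘ᴸ ⊗-assoc (P₀ (L d′)) (P₀ (R d′)) (P₀ (R d))
                  ∘ᴸ ((Δ (L d′) (R d′) ∘ᴸ P₁ (iso d′ ⁻¹≃)) ⊗₁ idᴸ {P₀ (R d)})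

        step₁ : ∀ t → S₃ ⊢ ⊗-assoc S S S ⟨$⟩ (Δᶠ ⊗₁ idᴸ {S}) ⟨$⟩ (ι̂ (L d) ⊗₁ ι̂ (R d)) ⟨$⟩ t
                         ≈ ∑ S₃ (decompositions (L d)) (λ d′ → term d′ ⟨$⟩ t)
        step₁ = ⊗-ext (⊗-assoc S S S ∘ᴸ (Δᶠ ⊗₁ idᴸ {S}) ∘ᴸ (ι̂ (L d) ⊗₁ ι̂ (R d)))
                      (∑ᴸ (decompositions (L d)) term)
          (λ a b → ((⊗-assoc S S S ∘ᴸ inˡ (ι̂ (R d) ⟨$⟩ b)) ▹ Δ-ι̂ (L d) a)
            ⟫ map-∑ (⊗-assoc S S S ∘ᴸ inˡ (ι̂ (R d) ⟨$⟩ b)) (decompositions (L d)) (λ d′ → D d′ ⟨$⟩ a)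
            ⟫ ∑-cong S₃ (decompositions (L d)) (λ d′ →
                assoc-natural (ι̂ (L d′)) (ι̂ (R d′)) (ι̂ (R d)) ((Δ (L d′) (R d′) ⟨$⟩ P₁ (iso d′ ⁻¹≃) ⟨$⟩ a) ⊗ₜ b)))

        step₂ : ∀ d′ → S₃ ⊢ term d′ ⟨$⟩ Δ (L d) (R d) ⟨$⟩ P₁ (iso d ⁻¹≃) ⟨$⟩ x ≈ D₃ (refineˡ d d′) ⟨$⟩ x
        step₂ d′ = (ι₃ (L d′) (R d′) (R d) ▹
            ((⊗-assoc (P₀ (L d′)) (P₀ (R d′)) (P₀ (R d)) ▹ ⊗₁-∘ (Δ (L d′) (R d′)) (P₁ (iso d′ ⁻¹≃)) (idᴸ {P₀ (R d)}) (idᴸ {P₀ (R d)}) (Δ (L d) (R d) ⟨$⟩ y))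
             ⟫′ ((⊗-assoc (P₀ (L d′)) (P₀ (R d′)) (P₀ (R d)) ∘ᴸ (Δ (L d′) (R d′) ⊗₁ idᴸ {P₀ (R d)})) ▹
                  (⊗₁-cong {f = P₁ (iso d′ ⁻¹≃)} {P₁ (iso d′ ⁻¹≃)} {idᴸ} {P₁ id≃} (λ _ → Module.≈ᴹ-refl (P₀ (L d′ ⊔ˢ R d′)))
                            (λ r → Module.≈ᴹ-sym (P₀ (R d)) (P-id r)) (Δ (L d) (R d) ⟨$⟩ y)))
             ⟫′ ((⊗-assoc (P₀ (L d′)) (P₀ (R d′)) (P₀ (R d)) ∘ᴸ (Δ (L d′) (R d′) ⊗₁ idᴸ {P₀ (R d)})) ▹ ≈-sym (Δ-natural (iso d′ ⁻¹≃) id≃ y))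
             ⟫′ Δ-coassoc (L d′) (R d′) (R d) (P₁ (iso d′ ⁻¹≃ ⊔≃ id≃ {R d}) ⟨$⟩ y)))
          ⟫ ((ι₃ (L d′) (R d′) (R d) ∘ᴸ (idᴸ {P₀ (L d′)} ⊗₁ Δ (R d′) (R d)) ∘ᴸ Δ (L d′) (R d′ ⊔ˢ R d)) ▹
              ((P₁ (⊔-assoc (L d′) (R d′) (R d)) ▹ Module.≈ᴹ-sym (P₀ ((L d′ ⊔ˢ R d′) ⊔ˢ R d)) (P-∘ (iso d′ ⁻¹≃ ⊔≃ id≃ {R d}) (iso d ⁻¹≃) x))
               ⟫″ P-merge (⊔-assoc (L d′) (R d′) (R d)) ((iso d′ ⁻¹≃ ⊔≃ id≃ {R d}) ∘≃ iso d ⁻¹≃) (refineˡ d d′ ⁻¹≃)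
                    (λ _ → FinSet.≈-refl (L d′ ⊔ˢ (R d′ ⊔ˢ R d))) x))
          where
          open Chain (P₀ (L d′) ⊗ (P₀ (R d′) ⊗ P₀ (R d))) renaming (_⟫_ to _⟫′_)
          open Chain (P₀ (L d′ ⊔ˢ (R d′ ⊔ˢ R d))) renaming (_⟫_ to _⟫″_)

      D-refineʳ : ∀ {X} (d : Decomp X) x →
                  S₃ ⊢ (idᴸ {S} ⊗₁ Δᶠ) ⟨$⟩ D d ⟨$⟩ x
                     ≈ ∑ S₃ (decompositions (R d)) (λ d′ → D₃ (refineʳ d d′) ⟨$⟩ x)
      D-refineʳ {X} d x = step₁ (Δ (L d) (R d) ⟨$⟩ y) ⟫ ∑-cong S₃ (decompositions (R d)) step₂
        where
        open Chain S₃
        y : ⌊ P₀ (L d ⊔ˢ R d) ⌋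
        y = P₁ (iso d ⁻¹≃) ⟨$⟩ x

        term : ∀ (d′ : Decomp (R d)) → P₀ (L d) ⊗ P₀ (R d) ⊸ S₃
        term d′ = ι₃ (L d) (L d′) (R d′) ∘ᴸ (idᴸ {P₀ (L d)} ⊗₁ (Δ (L d′) (R d′) ∘ᴸ P₁ (iso d′ ⁻¹≃)))

        step₁ : ∀ t → S₃ ⊢ (idᴸ {S} ⊗₁ Δᶠ) ⟨$⟩ (ι̂ (L d) ⊗₁ ι̂ (R d)) ⟨$⟩ t
                         ≈ ∑ S₃ (decompositions (R d)) (λ d′ → term d′ ⟨$⟩ t)
        step₁ = ⊗-ext ((idᴸ {S} ⊗₁ Δᶠ) ∘ᴸ (ι̂ (L d) ⊗₁ ι̂ (R d)))
                      (∑ᴸ (decompositions (R d)) term)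
          (λ a b → (inʳ (ι̂ (L d) ⟨$⟩ a) ▹ Δ-ι̂ (R d) b)
            ⟫ map-∑ (inʳ (ι̂ (L d) ⟨$⟩ a)) (decompositions (R d)) (λ d′ → D d′ ⟨$⟩ b))

        step₂ : ∀ d′ → S₃ ⊢ term d′ ⟨$⟩ Δ (L d) (R d) ⟨$⟩ P₁ (iso d ⁻¹≃) ⟨$⟩ x ≈ D₃ (refineʳ d d′) ⟨$⟩ x
        step₂ d′ = (ι₃ (L d) (L d′) (R d′) ▹
            (⊗₁-∘ (idᴸ {P₀ (L d)}) (idᴸ {P₀ (L d)}) (Δ (L d′) (R d′)) (P₁ (iso d′ ⁻¹≃)) (Δ (L d) (R d) ⟨$⟩ y)
             ⟫′ ((idᴸ {P₀ (L d)} ⊗₁ Δ (L d′) (R d′)) ▹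
                  (⊗₁-cong {f = idᴸ} {P₁ id≃} {P₁ (iso d′ ⁻¹≃)} {P₁ (iso d′ ⁻¹≃)} (λ r → Module.≈ᴹ-sym (P₀ (L d)) (P-id r))
                            (λ _ → Module.≈ᴹ-refl (P₀ (L d′ ⊔ˢ R d′))) (Δ (L d) (R d) ⟨$⟩ y)))
             ⟫′ ((idᴸ {P₀ (L d)} ⊗₁ Δ (L d′) (R d′)) ▹ ≈-sym (Δ-natural (id≃ {L d}) (iso d′ ⁻¹≃) y))))
          ⟫ ((ι₃ (L d) (L d′) (R d′) ∘ᴸ (idᴸ {P₀ (L d)} ⊗₁ Δ (L d′) (R d′)) ∘ᴸ Δ (L d) (L d′ ⊔ˢ R d′)) ▹
               P-merge (id≃ {L d} ⊔≃ (iso d′ ⁻¹≃)) (iso d ⁻¹≃) (refineʳ d d′ ⁻¹≃)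
                    (λ _ → FinSet.≈-refl (L d ⊔ˢ (L d′ ⊔ˢ R d′))) x)
          where
          open Chain (P₀ (L d) ⊗ (P₀ (L d′) ⊗ P₀ (R d′))) renaming (_⟫_ to _⟫′_)

    -- Pairs of nested decompositions, refined on the left or on the right, are matched when they
    -- induce the same three-colouring.
    Δᶠ-coassoc : ⊗-assoc S S S ∘ᴸ (Δᶠ ⊗₁ idᴸ {S}) ∘ᴸ Δᶠ ≗ᴸ (idᴸ {S} ⊗₁ Δᶠ) ∘ᴸ Δᶠ
    Δᶠ-coassoc = ι-ext (⊗-assoc S S S ∘ᴸ (Δᶠ ⊗₁ idᴸ {S}) ∘ᴸ Δᶠ) ((idᴸ {S} ⊗₁ Δᶠ) ∘ᴸ Δᶠ) (λ n x →
      ((⊗-assoc S S S ∘ᴸ (Δᶠ ⊗₁ idᴸ {S})) ▹ Δ-ι n x)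
      ⟫ map-∑ (⊗-assoc S S S ∘ᴸ (Δᶠ ⊗₁ idᴸ {S})) (decompositions [ n ]) (λ d → D d ⟨$⟩ x)
      ⟫ ∑-cong S₃ (decompositions [ n ]) (λ d → D-refineˡ d x)
      ⟫ ↺ (∑.⨁-dpairs S₃ (decompositions [ n ]) (λ d → decompositions (L d)) (λ s → D₃ (refineˡ (proj₁ s) (proj₂ s)) ⟨$⟩ x))
      ⟫ ∑.⨁-reindex S₃
          (λ s t → ∀ x → side₃ (refineˡ (proj₁ s) (proj₂ s)) x ≡ side₃ (refineʳ (proj₁ t) (proj₂ t)) x)
          (λ s t → dec-∀ [ n ] (λ { refl h → h }) (λ x → Maybe.≡-dec Bool._≟_ _ _))
          (λ s → inj₁ (one-resp (λ t h x → ≡.sym (h x)) (λ t h x → ≡.sym (h x))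
                   (one-refineʳ [ n ] _ (side₃-cong (refineˡ (proj₁ s) (proj₂ s))))))
          (λ t → inj₁ (one-refineˡ [ n ] _ (side₃-cong (refineʳ (proj₁ t) (proj₂ t)))))
          (λ s t h → D₃-cong (refineˡ (proj₁ s) (proj₂ s)) (refineʳ (proj₁ t) (proj₂ t)) h x)
      ⟫ ∑.⨁-dpairs S₃ (decompositions [ n ]) (λ d → decompositions (R d)) (λ s → D₃ (refineʳ (proj₁ s) (proj₂ s)) ⟨$⟩ x)
      ⟫ ∑-cong S₃ (decompositions [ n ]) (λ d → ↺ (D-refineʳ d x))
      ⟫ ↺ (map-∑ (idᴸ {S} ⊗₁ Δᶠ) (decompositions [ n ]) (λ d → D d ⟨$⟩ x))
      ⟫ ((idᴸ {S} ⊗₁ Δᶠ) ▹ ↺′ (Δ-ι n x)))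
      where
      open Chain S₃
      open Chain (S ⊗ S) using () renaming (↺ to ↺′)

-- Counit of the first coproduct and compatibility with the product.

empty-or-point : ∀ X → (X ≃ ∅) ⊎ FinSet.Carrier X
empty-or-point X = go _ (enum≃ X)
  where
  go : ∀ n → X ≃ [ n ] → (X ≃ ∅) ⊎ FinSet.Carrier X
  go zero    σ = inj₁ σ
  go (suc n) σ = inj₂ (_≃_.from σ zero)

emptyˡ : ∀ {X A B} (θ : (A ⊔ˢ B) ≃ X) → A ≃ ∅ → ∀ x → side θ x ≡ false
emptyˡ θ τ x with _≃_.from θ x
... | inj₁ a with () ← _≃_.to τ a
... | inj₂ _ = refl

emptyʳ : ∀ {X A B} (θ : (A ⊔ˢ B) ≃ X) → B ≃ ∅ → ∀ x → side θ x ≡ true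
emptyʳ θ τ x with _≃_.from θ x
... | inj₁ _ = refl
... | inj₂ b with () ← _≃_.to τ b

⊔-transport : ∀ {X Y} (σ : X ≃ Y) {E : 𝓔 X} {E′ : 𝓔 Y} → E′ ≐ transport σ E → E ≐ transport (σ ⁻¹≃) E′
⊔-transport σ {E} {E′} (f , g) =
  (λ r → E.∼-trans (E.∼-sym (unit _)) (E.∼-trans (g r) (unit _))) ,
  (λ r → f (E.∼-trans (unit _) (E.∼-trans r (E.∼-sym (unit _)))))
  where
  module E = 𝓔 E
  unit : ∀ x → _≃_.from σ (_≃_.to σ x) E.∼ x
  unit x = E.reflexive (_≃_.strictlyInverseʳ σ x)

module FockCoproduct {ℓ} (K : HeytingField ℓ ℓ ℓ)
                     (H : Over.Species K) (F : Linear.FockSpace K H) (B : Over.TwistedBialgebra K H) where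
  open Over K
  open Linear K
  open Species H
  open FockSpace F
  open TwistedBialgebra B
  open FockAlgebra K H F
  open Product algebra
  open Coproduct coalgebra

  private
    S : Vect
    S = space
    module 𝕜 = CommutativeRing commRing

    ε-n : ∀ n → P₀ [ n ] ⊸ 𝕂
    ε-n zero    = ε
    ε-n (suc n) = 0ᴸ

    ε-n-inv : ∀ {n} (σ : [ n ] ≃ [ n ]) x → 𝕂 ⊢ ε-n n ⟨$⟩ P₁ σ ⟨$⟩ x ≈ ε-n n ⟨$⟩ x
    ε-n-inv {zero}  σ x = ε ▹ (P-resp {σ = σ} {τ = id≃} (λ ()) x ⟫ P-id x)
      where open Chain (P₀ ∅)
    ε-n-inv {suc n} σ x = 𝕜.refl

  map-∑∑ : ∀ {a b} {I : Set a} {J : Set b} {M N Q} (φ : M ⊗ N ⊸ Q) (as : List I) f (bs : List J) g →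
           Q ⊢ φ ⟨$⟩ ∑ M as f ⊗ₜ ∑ N bs g ≈ ∑ Q as (λ i → ∑ Q bs (λ j → φ ⟨$⟩ f i ⊗ₜ g j))
  map-∑∑ {M = M} {N} {Q} φ as f bs g = map-∑ (φ ∘ᴸ inˡ (∑ N bs g)) as f
    ⟫ ∑-cong Q as (λ i → map-∑ (φ ∘ᴸ inʳ (f i)) bs g)
    where open Chain Q

  opaque
    εᶠ : S ⊸ 𝕂
    εᶠ = desc {𝕂} ε-n ε-n-inv

    ε-ι : ∀ n x → 𝕂 ⊢ εᶠ ⟨$⟩ ι n ⟨$⟩ x ≈ ε-n n ⟨$⟩ x
    ε-ι = desc-ι {𝕂} ε-n ε-n-inv

  ε-∅ : ∀ {X} (τ : X ≃ ∅) x → 𝕂 ⊢ εᶠ ⟨$⟩ ι̂ X ⟨$⟩ x ≈ ε ⟨$⟩ P₁ τ ⟨$⟩ x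
  ε-∅ τ x = (εᶠ ▹ (↺ (ι̂-natural τ x) ⟫ ι̂-[] 0 _)) ⟫′ ε-ι 0 _
    where
    open Chain S
    open Chain 𝕂 using () renaming (_⟫_ to _⟫′_)

  ε-point : ∀ {X} → Carrier X → ∀ x → 𝕂 ⊢ εᶠ ⟨$⟩ ι̂ X ⟨$⟩ x ≈ 0#
  ε-point {X} c x = go (size X) (_≃_.to (enum≃ X) c) _
    where
    go : ∀ n → Fin n → ∀ y → 𝕂 ⊢ εᶠ ⟨$⟩ ι n ⟨$⟩ y ≈ 0#
    go (suc n) _ y = ε-ι (suc n) y

  private
    counitˡ₀ : ∀ X x → S ⊢ unitˡ S ⟨$⟩ (εᶠ ⊗₁ idᴸ {S}) ⟨$⟩ D (decomp (∅⊔≃ X)) ⟨$⟩ x ≈ ι̂ X ⟨$⟩ x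
    counitˡ₀ X x = ((unitˡ S ∘ᴸ (εᶠ ⊗₁ idᴸ {S})) ▹ D-def (decomp (∅⊔≃ X)) x) ⟫ pure (Δ ∅ X ⟨$⟩ P₁ (∅⊔≃ X ⁻¹≃) ⟨$⟩ x)
      ⟫ (ι̂ X ▹ Δ-counitˡ X (P₁ (∅⊔≃ X ⁻¹≃) ⟨$⟩ x)) ⟫ ι̂-natural (∅⊔≃ X) (P₁ (∅⊔≃ X ⁻¹≃) ⟨$⟩ x) ⟫ ι̂-natural (∅⊔≃ X ⁻¹≃) x
      where
      open Chain S
      pure : ∀ t → S ⊢ unitˡ S ⟨$⟩ (εᶠ ⊗₁ idᴸ {S}) ⟨$⟩ (ι̂ ∅ ⊗₁ ι̂ X) ⟨$⟩ t
                     ≈ ι̂ X ⟨$⟩ unitˡ (P₀ X) ⟨$⟩ (ε ⊗₁ idᴸ {P₀ X}) ⟨$⟩ t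
      pure = ⊗-ext (unitˡ S ∘ᴸ (εᶠ ⊗₁ idᴸ {S}) ∘ᴸ (ι̂ ∅ ⊗₁ ι̂ X)) (ι̂ X ∘ᴸ unitˡ (P₀ X) ∘ᴸ (ε ⊗₁ idᴸ {P₀ X}))
        (λ a b → Module.*ₗ-cong S (𝕜.trans (ε-∅ id≃ a) (ε ▹ P-id a)) ∎ ⟫ ↺ (_⊸_.*ₗ-homo (ι̂ X) _ b))

    counitʳ₀ : ∀ X x → S ⊢ unitʳ S ⟨$⟩ (idᴸ {S} ⊗₁ εᶠ) ⟨$⟩ D (decomp (⊔∅≃ X)) ⟨$⟩ x ≈ ι̂ X ⟨$⟩ x
    counitʳ₀ X x = ((unitʳ S ∘ᴸ (idᴸ {S} ⊗₁ εᶠ)) ▹ D-def (decomp (⊔∅≃ X)) x) ⟫ pure (Δ X ∅ ⟨$⟩ P₁ (⊔∅≃ X ⁻¹≃) ⟨$⟩ x)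
      ⟫ (ι̂ X ▹ Δ-counitʳ X (P₁ (⊔∅≃ X ⁻¹≃) ⟨$⟩ x)) ⟫ ι̂-natural (⊔∅≃ X) (P₁ (⊔∅≃ X ⁻¹≃) ⟨$⟩ x) ⟫ ι̂-natural (⊔∅≃ X ⁻¹≃) x
      where
      open Chain S
      pure : ∀ t → S ⊢ unitʳ S ⟨$⟩ (idᴸ {S} ⊗₁ εᶠ) ⟨$⟩ (ι̂ X ⊗₁ ι̂ ∅) ⟨$⟩ t
                     ≈ ι̂ X ⟨$⟩ unitʳ (P₀ X) ⟨$⟩ (idᴸ {P₀ X} ⊗₁ ε) ⟨$⟩ t
      pure = ⊗-ext (unitʳ S ∘ᴸ (idᴸ {S} ⊗₁ εᶠ) ∘ᴸ (ι̂ X ⊗₁ ι̂ ∅)) (ι̂ X ∘ᴸ unitʳ (P₀ X) ∘ᴸ (idᴸ {P₀ X} ⊗₁ ε))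
        (λ a b → Module.*ₗ-cong S (𝕜.trans (ε-∅ id≃ b) (ε ▹ P-id b)) ∎ ⟫ ↺ (_⊸_.*ₗ-homo (ι̂ X) _ a))

    vanishˡ : ∀ {X} (d : Decomp X) → Carrier (L d) → ∀ x →
              S ⊢ unitˡ S ⟨$⟩ (εᶠ ⊗₁ idᴸ {S}) ⟨$⟩ D d ⟨$⟩ x ≈ Module.0ᴹ S
    vanishˡ d c x = ((unitˡ S ∘ᴸ (εᶠ ⊗₁ idᴸ {S})) ▹ D-def d x)
      ⟫ ⊗-ext (unitˡ S ∘ᴸ (εᶠ ⊗₁ idᴸ {S}) ∘ᴸ (ι̂ (L d) ⊗₁ ι̂ (R d))) 0ᴸ
          (λ a b → Module.*ₗ-cong S (ε-point c a) ∎ ⟫ Module.*ₗ-zeroˡ S _) (Δ (L d) (R d) ⟨$⟩ P₁ (iso d ⁻¹≃) ⟨$⟩ x)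
      where open Chain S

    vanishʳ : ∀ {X} (d : Decomp X) → Carrier (R d) → ∀ x →
              S ⊢ unitʳ S ⟨$⟩ (idᴸ {S} ⊗₁ εᶠ) ⟨$⟩ D d ⟨$⟩ x ≈ Module.0ᴹ S
    vanishʳ d c x = ((unitʳ S ∘ᴸ (idᴸ {S} ⊗₁ εᶠ)) ▹ D-def d x)
      ⟫ ⊗-ext (unitʳ S ∘ᴸ (idᴸ {S} ⊗₁ εᶠ) ∘ᴸ (ι̂ (L d) ⊗₁ ι̂ (R d))) 0ᴸ
          (λ a b → Module.*ₗ-cong S (ε-point c b) ∎ ⟫ Module.*ₗ-zeroˡ S _) (Δ (L d) (R d) ⟨$⟩ P₁ (iso d ⁻¹≃) ⟨$⟩ x)
      where open Chain S

    D-cong : ∀ {X} (d e : Decomp X) → (∀ x → side (iso d) x ≡ side (iso e) x) → ∀ x →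
             S ⊗ S ⊢ D d ⟨$⟩ x ≈ D e ⟨$⟩ x
    D-cong {X} d e h x = ↺ (D-natural d e id≃ h x) ⟫ (D e ▹ P-id x)
      where open Chain (S ⊗ S)

  -- A term with a point in its left part is killed, since `εᶠ` vanishes in positive degree. The one
  -- remaining term has empty left part, and there the counit law of the twisted coalgebra applies.
  Δᶠ-counitˡ : unitˡ S ∘ᴸ (εᶠ ⊗₁ idᴸ {S}) ∘ᴸ Δᶠ ≗ᴸ idᴸ
  Δᶠ-counitˡ = ι-ext (unitˡ S ∘ᴸ (εᶠ ⊗₁ idᴸ {S}) ∘ᴸ Δᶠ) idᴸ (λ n x →
    ((unitˡ S ∘ᴸ (εᶠ ⊗₁ idᴸ {S})) ▹ Δ-ι n x)
    ⟫ map-∑ (unitˡ S ∘ᴸ (εᶠ ⊗₁ idᴸ {S})) (decompositions [ n ]) (λ d → D d ⟨$⟩ x)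
    ⟫ ∑.⨁-single S (one-decomposition [ n ] (λ _ → false) (λ _ → refl))
        (λ d h → ((unitˡ S ∘ᴸ (εᶠ ⊗₁ idᴸ {S})) ▹ D-cong d (decomp (∅⊔≃ [ n ])) h x) ⟫ counitˡ₀ [ n ] x)
        (λ d h → vanish d (empty-or-point (L d)) h x)
    ⟫ ι̂-[] n x)
    where
    open Chain S
    vanish : ∀ {n} (d : Decomp [ n ]) → (L d ≃ ∅) ⊎ Carrier (L d) → ¬ (∀ x → side (iso d) x ≡ false) → ∀ x →
             S ⊢ unitˡ S ⟨$⟩ (εᶠ ⊗₁ idᴸ {S}) ⟨$⟩ D d ⟨$⟩ x ≈ Module.0ᴹ S
    vanish d (inj₁ τ) h = ⊥-elim (h (emptyˡ (iso d) τ))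
    vanish d (inj₂ c) h = vanishˡ d c

  Δᶠ-counitʳ : unitʳ S ∘ᴸ (idᴸ {S} ⊗₁ εᶠ) ∘ᴸ Δᶠ ≗ᴸ idᴸ
  Δᶠ-counitʳ = ι-ext (unitʳ S ∘ᴸ (idᴸ {S} ⊗₁ εᶠ) ∘ᴸ Δᶠ) idᴸ (λ n x →
    ((unitʳ S ∘ᴸ (idᴸ {S} ⊗₁ εᶠ)) ▹ Δ-ι n x)
    ⟫ map-∑ (unitʳ S ∘ᴸ (idᴸ {S} ⊗₁ εᶠ)) (decompositions [ n ]) (λ d → D d ⟨$⟩ x)
    ⟫ ∑.⨁-single S (one-decomposition [ n ] (λ _ → true) (λ _ → refl))
        (λ d h → ((unitʳ S ∘ᴸ (idᴸ {S} ⊗₁ εᶠ)) ▹ D-cong d (decomp (⊔∅≃ [ n ])) h x) ⟫ counitʳ₀ [ n ] x)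
        (λ d h → vanish d (empty-or-point (R d)) h x)
    ⟫ ι̂-[] n x)
    where
    open Chain S
    vanish : ∀ {n} (d : Decomp [ n ]) → (R d ≃ ∅) ⊎ Carrier (R d) → ¬ (∀ x → side (iso d) x ≡ true) → ∀ x →
             S ⊢ unitʳ S ⟨$⟩ (idᴸ {S} ⊗₁ εᶠ) ⟨$⟩ D d ⟨$⟩ x ≈ Module.0ᴹ S
    vanish d (inj₁ τ) h = ⊥-elim (h (emptyʳ (iso d) τ))
    vanish d (inj₂ c) h = vanishʳ d c

  Δᶠ-one : S ⊗ S ⊢ Δᶠ ⟨$⟩ one ≈ one ⊗ₜ one
  Δᶠ-one = Δ-ι 0 1ₚ ⟫ ∑.⨁-single (S ⊗ S) (one-decomposition ∅ (λ _ → false) (λ _ → refl))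
      (λ d _ → D-cong d (decomp (∅⊔≃ ∅)) (λ ()) 1ₚ ⟫ D-def (decomp (∅⊔≃ ∅)) 1ₚ
        ⟫ ((ι̂ ∅ ⊗₁ ι̂ ∅) ▹ Δ-1) ⟫ (ι̂-1 ⊠ ι̂-1))
      (λ d h → ⊥-elim (h (λ ())))
    where open Chain (S ⊗ S)

  -- The axiom linking Δ and m is applied with I and J taken to be the unions of left and of right
  -- parts themselves: the bijections onto I and J are then identities, and the identification is
  -- the inverse of the combined decomposition.
  D-mul : ∀ {X Y} (d : Decomp X) (e : Decomp Y) x y →
          S ⊗ S ⊢ D (d ⊔ᴰ e) ⟨$⟩ m X Y ⟨$⟩ x ⊗ₜ y
                ≈ (mul ⊗₁ mul) ⟨$⟩ Id⊗c⊗Id S S S S ⟨$⟩ (D d ⟨$⟩ x) ⊗ₜ (D e ⟨$⟩ y)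
  D-mul {X} {Y} d e x y = D-def (d ⊔ᴰ e) (m X Y ⟨$⟩ x ⊗ₜ y)
    ⟫ ((ι̂ (L d ⊔ˢ L e) ⊗₁ ι̂ (R d ⊔ˢ R e)) ▹
        Δ-m (iso (d ⊔ᴰ e) ⁻¹≃) (iso d) (iso e) id≃ id≃ eq (x ⊗ₜ y))
    ⟫ pure (Δ (L d) (R d) ⟨$⟩ P₁ (iso d ⁻¹≃) ⟨$⟩ x) (Δ (L e) (R e) ⟨$⟩ P₁ (iso e ⁻¹≃) ⟨$⟩ y)
    ⟫ (((mul ⊗₁ mul) ∘ᴸ Id⊗c⊗Id S S S S) ▹ (≈-sym (D-def d x) ⊠ ≈-sym (D-def e y)))
    where
    open Chain (S ⊗ S)

    eq : iso (d ⊔ᴰ e) ⁻¹≃ ∘≃ (iso d ⊔≃ iso e) ≗≃ (id≃ ⊔≃ id≃) ∘≃ middle-swap (L d) (R d) (L e) (R e)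
    eq z = FinSet.≈-trans Z (_≃_.to-cong (middle-swap (L d) (L e) (R d) (R e) ⁻¹≃) (inv z)) (aux z)
      where
      Z = (L d ⊔ˢ L e) ⊔ˢ (R d ⊔ˢ R e)
      inv : ∀ z → FinSet._≈_ ((L d ⊔ˢ R d) ⊔ˢ (L e ⊔ˢ R e)) (_≃_.from (iso d ⊔≃ iso e) (_≃_.to (iso d ⊔≃ iso e) z)) z
      inv z = _≃_.strictlyInverseʳ (iso d ⊔≃ iso e) z
      aux : ∀ z → FinSet._≈_ Z (_≃_.from (middle-swap (L d) (L e) (R d) (R e)) z)
                               (_≃_.to ((id≃ {L d ⊔ˢ L e} ⊔≃ id≃ {R d ⊔ˢ R e}) ∘≃ middle-swap (L d) (R d) (L e) (R e)) z)
      aux (inj₁ (inj₁ _)) = FinSet.≈-refl Z {inj₁ (inj₁ _)}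
      aux (inj₁ (inj₂ _)) = FinSet.≈-refl Z {inj₂ (inj₁ _)}
      aux (inj₂ (inj₁ _)) = FinSet.≈-refl Z {inj₁ (inj₂ _)}
      aux (inj₂ (inj₂ _)) = FinSet.≈-refl Z {inj₂ (inj₂ _)}

    part : ∀ A B a b → S ⊢ ι̂ (A ⊔ˢ B) ⟨$⟩ P₁ id≃ ⟨$⟩ m A B ⟨$⟩ a ⊗ₜ b ≈ mul ⟨$⟩ (ι̂ A ⟨$⟩ a) ⊗ₜ (ι̂ B ⟨$⟩ b)
    part A B a b = Module.≈ᴹ-trans S (ι̂-natural id≃ _) (Module.≈ᴹ-sym S (mul-ι̂ A B a b))

    pure : ∀ s t → S ⊗ S ⊢ (ι̂ (L d ⊔ˢ L e) ⊗₁ ι̂ (R d ⊔ˢ R e)) ⟨$⟩ ((P₁ id≃ ∘ᴸ m (L d) (L e)) ⊗₁ (P₁ id≃ ∘ᴸ m (R d) (R e)))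
                     ⟨$⟩ Id⊗c⊗Id (P₀ (L d)) (P₀ (R d)) (P₀ (L e)) (P₀ (R e)) ⟨$⟩ s ⊗ₜ t
                   ≈ (mul ⊗₁ mul) ⟨$⟩ Id⊗c⊗Id S S S S ⟨$⟩ ((ι̂ (L d) ⊗₁ ι̂ (R d)) ⟨$⟩ s) ⊗ₜ ((ι̂ (L e) ⊗₁ ι̂ (R e)) ⟨$⟩ t)
    pure s t = ⊗-ext₄
      ((ι̂ (L d ⊔ˢ L e) ⊗₁ ι̂ (R d ⊔ˢ R e)) ∘ᴸ ((P₁ id≃ ∘ᴸ m (L d) (L e)) ⊗₁ (P₁ id≃ ∘ᴸ m (R d) (R e)))
        ∘ᴸ Id⊗c⊗Id (P₀ (L d)) (P₀ (R d)) (P₀ (L e)) (P₀ (R e)))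
      ((mul ⊗₁ mul) ∘ᴸ Id⊗c⊗Id S S S S ∘ᴸ ((ι̂ (L d) ⊗₁ ι̂ (R d)) ⊗₁ (ι̂ (L e) ⊗₁ ι̂ (R e))))
      (λ a b a′ b′ → part (L d) (L e) a a′ ⊠ part (R d) (R e) b b′) (s ⊗ₜ t)

  Δᶠ-mul : Δᶠ ∘ᴸ mul ≗ᴸ (mul ⊗₁ mul) ∘ᴸ Id⊗c⊗Id S S S S ∘ᴸ (Δᶠ ⊗₁ Δᶠ)
  Δᶠ-mul = ι-ext₂ (Δᶠ ∘ᴸ mul) ((mul ⊗₁ mul) ∘ᴸ Id⊗c⊗Id S S S S ∘ᴸ (Δᶠ ⊗₁ Δᶠ)) (λ k l x y →
    (Δᶠ ▹ mul-ι k l x y)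
    ⟫ Δ-ι̂ ([ k ] ⊔ˢ [ l ]) _
    ⟫ ∑.⨁-reindex (S ⊗ S) {as = decompositions ([ k ] ⊔ˢ [ l ])}
        (λ d s → ∀ x → side (iso d) x ≡ side (iso (proj₁ s ⊔ᴰ proj₂ s)) x)
        (λ d s → side-dec {[ k ] ⊔ˢ [ l ]} _ _ (side-cong (iso d)) (side-cong (iso (proj₁ s ⊔ᴰ proj₂ s))))
        (λ d → inj₁ (one-resp (λ t h x → ≡.sym (h x)) (λ t h x → ≡.sym (h x))
                 (one-⊔ᴰ [ k ] [ l ] _ (side-cong (iso d)))))
        (λ s → inj₁ (one-decomposition ([ k ] ⊔ˢ [ l ]) _ (side-cong (iso (proj₁ s ⊔ᴰ proj₂ s)))))
        (λ d s h → D-cong d (proj₁ s ⊔ᴰ proj₂ s) h _ ⟫ D-mul (proj₁ s) (proj₂ s) x y)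
    ⟫ ∑.⨁-dpairs (S ⊗ S) (decompositions [ k ]) (λ _ → decompositions [ l ])
        (λ s → (mul ⊗₁ mul) ⟨$⟩ Id⊗c⊗Id S S S S ⟨$⟩ (D (proj₁ s) ⟨$⟩ x) ⊗ₜ (D (proj₂ s) ⟨$⟩ y))
    ⟫ ↺ (map-∑∑ ((mul ⊗₁ mul) ∘ᴸ Id⊗c⊗Id S S S S) (decompositions [ k ]) (λ d → D d ⟨$⟩ x)
          (decompositions [ l ]) (λ e → D e ⟨$⟩ y))
    ⟫ (((mul ⊗₁ mul) ∘ᴸ Id⊗c⊗Id S S S S) ▹ (≈-sym (Δ-ι k x) ⊠ ≈-sym (Δ-ι l y))))
    where open Chain (S ⊗ S)

  εᶠ-one : εᶠ ⟨$⟩ one ≈ᵏ 1#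
  εᶠ-one = 𝕜.trans (ε-ι 0 1ₚ) ε-1

  -- Outside degree (0, 0) both sides vanish, because a disjoint union containing a point has
  -- positive size; in degree (0, 0) this is multiplicativity of the counit of H.
  εᶠ-mul : εᶠ ∘ᴸ mul ≗ᴸ unitˡ 𝕂 ∘ᴸ (εᶠ ⊗₁ εᶠ)
  εᶠ-mul = ι-ext₂ (εᶠ ∘ᴸ mul) (unitˡ 𝕂 ∘ᴸ (εᶠ ⊗₁ εᶠ)) (λ k l x y → 𝕜.trans (εᶠ ▹ mul-ι k l x y) (go k l x y))
    where
    go : ∀ k l x y → εᶠ ⟨$⟩ ι̂ ([ k ] ⊔ˢ [ l ]) ⟨$⟩ m [ k ] [ l ] ⟨$⟩ x ⊗ₜ y
                     ≈ᵏ (εᶠ ⟨$⟩ ι k ⟨$⟩ x) * (εᶠ ⟨$⟩ ι l ⟨$⟩ y)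
    go zero zero x y = 𝕜.trans (ε-∅ (∅⊔≃ ∅) _) (𝕜.trans (ε-m (x ⊗ₜ y)) (𝕜.sym (𝕜.*-cong (ε-ι 0 x) (ε-ι 0 y))))
    go zero (suc l) x y = 𝕜.trans (ε-point (inj₂ zero) _)
      (𝕜.sym (𝕜.trans (𝕜.*-cong 𝕜.refl (ε-ι (suc l) y)) (𝕜.zeroʳ _)))
    go (suc k) l x y = 𝕜.trans (ε-point (inj₁ zero) _)
      (𝕜.sym (𝕜.trans (𝕜.*-cong (ε-ι (suc k) x) 𝕜.refl) (𝕜.zeroˡ _)))

-- Second coproduct: nested and split equivalences, and the remaining double bialgebra axioms.

lower : ∀ {X} (E : 𝓔 X) → 𝓔 (X / E) → 𝓔 X
lower E G = record
  { _∼_           = G._∼_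
  ; isEquivalence = G.isEquivalence
  ; reflexive     = λ r → G.reflexive (𝓔.reflexive E r)
  ; _∼?_          = G._∼?_
  }
  where module G = 𝓔 G

restrict-⊔ˡ : ∀ {X Y} (E : 𝓔 X) (G : 𝓔 Y) → restrictˡ (E ⊔ᴱ G) ≐ E
restrict-⊔ˡ E G = inj₁ , λ { (inj₁ r) → r }

restrict-⊔ʳ : ∀ {X Y} (E : 𝓔 X) (G : 𝓔 Y) → restrictʳ (E ⊔ᴱ G) ≐ G
restrict-⊔ʳ E G = inj₂ , λ { (inj₂ r) → r }

⊔ᴱ-cong : ∀ {X Y} {E E′ : 𝓔 X} {G G′ : 𝓔 Y} → E ≐ E′ → G ≐ G′ → (E ⊔ᴱ G) ≐ (E′ ⊔ᴱ G′)
⊔ᴱ-cong (f , g) (f′ , g′) =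
  (λ { (inj₁ r) → inj₁ (f r) ; (inj₂ r) → inj₂ (f′ r) }) ,
  (λ { (inj₁ r) → inj₁ (g r) ; (inj₂ r) → inj₂ (g′ r) })

splits-⊔ : ∀ {X Y} (E : 𝓔 X) (G : 𝓔 Y) → Splits (E ⊔ᴱ G)
splits-⊔ E G = ⊔ᴱ-cong {E = E} {restrictˡ (E ⊔ᴱ G)} {G} {restrictʳ (E ⊔ᴱ G)}
  (≐-sym {E = restrictˡ (E ⊔ᴱ G)} {E} (restrict-⊔ˡ E G)) (≐-sym {E = restrictʳ (E ⊔ᴱ G)} {G} (restrict-⊔ʳ E G))

-- An equivalence that is some disjoint union is the union of its own restrictions, so pairs of
-- equivalences index exactly the split ones.
splits-≐ : ∀ {X Y} {H : 𝓔 (X ⊔ˢ Y)} {E : 𝓔 X} {G : 𝓔 Y} → H ≐ (E ⊔ᴱ G) →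
           Splits H × restrictˡ H ≐ E × restrictʳ H ≐ G
splits-≐ {H = H} {E} {G} e@(f , g) =
  ≐-trans {E = H} {E ⊔ᴱ G} {restrictˡ H ⊔ᴱ restrictʳ H} e (⊔ᴱ-cong {E = E} {restrictˡ H} {G} {restrictʳ H}
    (≐-sym {E = restrictˡ H} {E} l) (≐-sym {E = restrictʳ H} {G} r)) , l , r
  where
  l : restrictˡ H ≐ E
  l = (λ q → f (inj₁ q)) , (λ q → proj₂ (restrict-⊔ˡ E G) (g q))
  r : restrictʳ H ≐ G
  r = (λ q → f (inj₂ q)) , (λ q → proj₂ (restrict-⊔ʳ E G) (g q))

≐-cong-≤ : ∀ {X} {E E′ G G′ : 𝓔 X} → E ≐ E′ → G ≐ G′ → E ≤ᴱ G → E′ ≤ᴱ G′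
≐-cong-≤ e g le r = proj₂ e (le (proj₁ g r))

module FockContraction {ℓ} (K : HeytingField ℓ ℓ ℓ)
                       (H : Over.Species K) (F : Linear.FockSpace K H) (B : Over.TwistedBialgebra K H)
                       (C : Over.ContractionExtraction K H) (compatible : Over.Compatible K B C) where
  open Over K
  open Linear K
  open Species H
  open FockSpace F
  open TwistedBialgebra B
  open ContractionExtraction C renaming (δ-coassoc to δE-coassoc; δ-counitˡ to δE-counitˡ; δ-counitʳ to δE-counitʳ)
  open Compatible compatible
  open FockAlgebra K H F
  open Product algebra
  open Coproduct coalgebra
  open FockCoproduct K H F B

  private
    S : Vect
    S = space
    module 𝕜 = CommutativeRing commRing

  -- Naturality along the identity of X: passing to a `≐`-equal equivalence costs only an identity
  -- relabelling of the quotient.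
  δ-cong : ∀ {X} {E E′ : 𝓔 X} (e : E′ ≐ E) x →
           P₀ (X / E′) ⊗ P₀ X ⊢ δ E′ ⟨$⟩ x ≈ (P₁ (quotient≃ id≃ E E′ e) ⊗₁ idᴸ) ⟨$⟩ δ E ⟨$⟩ x
  δ-cong {X} {E} {E′} e x = (δ E′ ▹ Module.≈ᴹ-sym (P₀ X) (P-id x)) ⟫ δ-natural id≃ E E′ e x
    ⟫ ⊗₁-cong {f = P₁ (quotient≃ id≃ E E′ e)} {P₁ (quotient≃ id≃ E E′ e)} {P₁ id≃} {idᴸ}
        (λ _ → Module.≈ᴹ-refl (P₀ (X / E′))) P-id (δ E ⟨$⟩ x)
    where open Chain (P₀ (X / E′) ⊗ P₀ X)

  opaque
    Λ : ∀ {X} → 𝓔 X → P₀ X ⊸ S ⊗ S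
    Λ {X} E = (ι̂ (X / E) ⊗₁ ι̂ X) ∘ᴸ δ E

    Λ-def : ∀ {X} (E : 𝓔 X) x → S ⊗ S ⊢ Λ E ⟨$⟩ x ≈ (ι̂ (X / E) ⊗₁ ι̂ X) ⟨$⟩ δ E ⟨$⟩ x
    Λ-def E x = ≈-refl

    Λ-natural : ∀ {X Y} (σ : X ≃ Y) (E : 𝓔 X) (E′ : 𝓔 Y) → E′ ≐ transport σ E → ∀ x →
                S ⊗ S ⊢ Λ E′ ⟨$⟩ P₁ σ ⟨$⟩ x ≈ Λ E ⟨$⟩ x
    Λ-natural {X} {Y} σ E E′ t x = ((ι̂ (Y / E′) ⊗₁ ι̂ Y) ▹ δ-natural σ E E′ t x)
      ⟫ ι̂⊗-natural (quotient≃ σ E E′ t) σ (δ E ⟨$⟩ x)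
      where open Chain (S ⊗ S)

  Λ-cong : ∀ {X} (E E′ : 𝓔 X) → E ≐ E′ → ∀ x → S ⊗ S ⊢ Λ E ⟨$⟩ x ≈ Λ E′ ⟨$⟩ x
  Λ-cong {X} E E′ e x = (Λ E ▹ Module.≈ᴹ-sym (P₀ X) (P-id x)) ⟫ Λ-natural id≃ E′ E e x
    where open Chain (S ⊗ S)

  -- Transport along `σ` matches the equivalences on X with those on Y. As for the first coproduct,
  -- this yields both the descent and the formula on arbitrary finite sets.
  ∑Λ-natural : ∀ {X Y} (σ : X ≃ Y) x →
               S ⊗ S ⊢ ∑ (S ⊗ S) (equivalences Y) (λ E′ → Λ E′ ⟨$⟩ P₁ σ ⟨$⟩ x)
                     ≈ ∑ (S ⊗ S) (equivalences X) (λ E → Λ E ⟨$⟩ x)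
  ∑Λ-natural {X} {Y} σ x = ∑.⨁-reindex (S ⊗ S) (λ E′ E → E′ ≐ transport σ E) (λ E′ E → E′ ≐? transport σ E)
    (λ E′ → inj₁ (one-resp (λ E → ⊔-transport (σ ⁻¹≃) {E′} {E}) (λ E → ⊔-transport σ {E} {E′})
              (one-equivalence X (transport (σ ⁻¹≃) E′))))
    (λ E → inj₁ (one-equivalence Y (transport σ E)))
    (λ E′ E t → Λ-natural σ E E′ t x)

  private
    sumΛ : ∀ X → P₀ X ⊸ S ⊗ S
    sumΛ X = ∑ᴸ (equivalences X) Λ

  opaque
    δᶠ : S ⊸ S ⊗ S
    δᶠ = desc {S ⊗ S} (λ n → sumΛ [ n ]) ∑Λ-natural

    δ-ι : ∀ n x → S ⊗ S ⊢ δᶠ ⟨$⟩ ι n ⟨$⟩ x ≈ ∑ (S ⊗ S) (equivalences [ n ]) (λ E → Λ E ⟨$⟩ x)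
    δ-ι = desc-ι {S ⊗ S} (λ n → sumΛ [ n ]) ∑Λ-natural

    ϵᶠ : S ⊸ 𝕂
    ϵᶠ = desc {𝕂} (λ n → ϵ [ n ]) (λ σ → ϵ-natural σ)

    ϵ-ι : ∀ n x → 𝕂 ⊢ ϵᶠ ⟨$⟩ ι n ⟨$⟩ x ≈ ϵ [ n ] ⟨$⟩ x
    ϵ-ι = desc-ι {𝕂} (λ n → ϵ [ n ]) (λ σ → ϵ-natural σ)

  δ-ι̂ : ∀ X x → S ⊗ S ⊢ δᶠ ⟨$⟩ ι̂ X ⟨$⟩ x ≈ ∑ (S ⊗ S) (equivalences X) (λ E → Λ E ⟨$⟩ x)
  δ-ι̂ X x = δ-ι _ _ ⟫ ∑Λ-natural (enum≃ X) x
    where open Chain (S ⊗ S)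

  ϵ-ι̂ : ∀ X x → 𝕂 ⊢ ϵᶠ ⟨$⟩ ι̂ X ⟨$⟩ x ≈ ϵ X ⟨$⟩ x
  ϵ-ι̂ X x = 𝕜.trans (ϵ-ι _ _) (ϵ-natural (enum≃ X) x)

  private
    S₃ : Vect
    S₃ = S ⊗ (S ⊗ S)

    -- Terms of both iterated coproducts are brought to this form, indexed by two equivalences on
    -- the same set X, although on one side the first of them lives on X/E′.
    U : ∀ {X} (E E′ : 𝓔 X) → P₀ X ⊸ S₃
    U {X} E E′ = (ι̂ (X / E) ⊗₁ Λ E′) ∘ᴸ δ E

    opaque
      unfolding Λ

      U-cong : ∀ {X} (E E′ G G′ : 𝓔 X) → E ≐ G → E′ ≐ G′ → ∀ x → S₃ ⊢ U E E′ ⟨$⟩ x ≈ U G G′ ⟨$⟩ x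
      U-cong {X} E E′ G G′ e e′ x = ((ι̂ (X / E) ⊗₁ Λ E′) ▹ δ-cong {X} {G} {E} e x) ⟫ pure (δ G ⟨$⟩ x)
        where
        open Chain S₃
        pure : ∀ t → S₃ ⊢ (ι̂ (X / E) ⊗₁ Λ E′) ⟨$⟩ (P₁ (quotient≃ id≃ G E e) ⊗₁ idᴸ {P₀ X}) ⟨$⟩ t
                        ≈ (ι̂ (X / G) ⊗₁ Λ G′) ⟨$⟩ t
        pure = ⊗-ext ((ι̂ (X / E) ⊗₁ Λ E′) ∘ᴸ (P₁ (quotient≃ id≃ G E e) ⊗₁ idᴸ {P₀ X})) (ι̂ (X / G) ⊗₁ Λ G′)
          (λ a b → ι̂-natural (quotient≃ id≃ G E e) a ⊠ Λ-cong E′ G′ e′ b)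

      U-vanish : ∀ {X} (E E′ : 𝓔 X) → ¬ (E ≤ᴱ E′) → ∀ x → S₃ ⊢ U E E′ ⟨$⟩ x ≈ Module.0ᴹ S₃
      U-vanish {X} E E′ n x = ↺ (pure (δ E ⟨$⟩ x))
        ⟫ ((ι̂ (X / E) ⊗₁ (ι̂ (X / E′) ⊗₁ ι̂ X)) ▹ δ-vanish E E′ n x)
        where
        open Chain S₃
        pure : ∀ t → S₃ ⊢ (ι̂ (X / E) ⊗₁ (ι̂ (X / E′) ⊗₁ ι̂ X)) ⟨$⟩ (idᴸ {P₀ (X / E)} ⊗₁ δ E′) ⟨$⟩ t
                        ≈ (ι̂ (X / E) ⊗₁ Λ E′) ⟨$⟩ t
        pure = ⊗-ext ((ι̂ (X / E) ⊗₁ (ι̂ (X / E′) ⊗₁ ι̂ X)) ∘ᴸ (idᴸ {P₀ (X / E)} ⊗₁ δ E′)) (ι̂ (X / E) ⊗₁ Λ E′)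
          (λ a b → ≈-refl)

      Θ : ∀ {X} (E′ : 𝓔 X) (G : 𝓔 (X / E′)) → P₀ X ⊸ S₃
      Θ {X} E′ G = ⊗-assoc S S S ∘ᴸ (Λ G ⊗₁ ι̂ X) ∘ᴸ δ E′

      Θ-def : ∀ {X} (E′ : 𝓔 X) (G : 𝓔 (X / E′)) x →
              S₃ ⊢ Θ E′ G ⟨$⟩ x ≈ ⊗-assoc S S S ⟨$⟩ (Λ G ⊗₁ ι̂ X) ⟨$⟩ δ E′ ⟨$⟩ x
      Θ-def E′ G x = ≈-refl

      -- An equivalence `G` on X/E′ and its lift to X have the same relation, so `descend` undoes
      -- `lower`. The coassociativity axiom applies to `lower E′ G`, which is coarser than `E′`
      -- because `G` respects the equality of X/E′.
      Θ≈U : ∀ {X} (E′ : 𝓔 X) (G : 𝓔 (X / E′)) x → S₃ ⊢ Θ E′ G ⟨$⟩ x ≈ U (lower E′ G) E′ ⟨$⟩ x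
      Θ≈U {X} E′ G x = pure (δ E′ ⟨$⟩ x)
        ⟫ ((ι̂ (X / E) ⊗₁ (ι̂ (X / E′) ⊗₁ ι̂ X)) ▹ δE-coassoc E E′ le x)
        ⟫ pure′ (δ E ⟨$⟩ x)
        where
        open Chain S₃

        E : 𝓔 X
        E = lower E′ G

        le : E ≤ᴱ E′
        le = 𝓔.reflexive G

        pure : ∀ t → S₃ ⊢ ⊗-assoc S S S ⟨$⟩ (Λ G ⊗₁ ι̂ X) ⟨$⟩ t
          ≈ (ι̂ (X / E) ⊗₁ (ι̂ (X / E′) ⊗₁ ι̂ X)) ⟨$⟩ ⊗-assoc (P₀ (X / E)) (P₀ (X / E′)) (P₀ X)
              ⟨$⟩ (((P₁ (third-iso E E′ le) ⊗₁ idᴸ {P₀ (X / E′)}) ∘ᴸ δ (descend E E′ le)) ⊗₁ idᴸ {P₀ X}) ⟨$⟩ t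
        pure = ⊗-ext (⊗-assoc S S S ∘ᴸ (Λ G ⊗₁ ι̂ X))
          ((ι̂ (X / E) ⊗₁ (ι̂ (X / E′) ⊗₁ ι̂ X)) ∘ᴸ ⊗-assoc (P₀ (X / E)) (P₀ (X / E′)) (P₀ X)
              ∘ᴸ (((P₁ (third-iso E E′ le) ⊗₁ idᴸ {P₀ (X / E′)}) ∘ᴸ δ (descend E E′ le)) ⊗₁ idᴸ {P₀ X}))
          (λ a b → pure″ b (δ G ⟨$⟩ a))
          where
          pure″ : ∀ b t → S₃ ⊢ ⊗-assoc S S S ⟨$⟩ ((ι̂ ((X / E′) / G) ⊗₁ ι̂ (X / E′)) ⟨$⟩ t) ⊗ₜ (ι̂ X ⟨$⟩ b)
            ≈ (ι̂ (X / E) ⊗₁ (ι̂ (X / E′) ⊗₁ ι̂ X)) ⟨$⟩ ⊗-assoc (P₀ (X / E)) (P₀ (X / E′)) (P₀ X)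
              ⟨$⟩ ((P₁ (third-iso E E′ le) ⊗₁ idᴸ {P₀ (X / E′)}) ⟨$⟩ t) ⊗ₜ b
          pure″ b = ⊗-ext (⊗-assoc S S S ∘ᴸ inˡ (ι̂ X ⟨$⟩ b) ∘ᴸ (ι̂ ((X / E′) / G) ⊗₁ ι̂ (X / E′)))
            ((ι̂ (X / E) ⊗₁ (ι̂ (X / E′) ⊗₁ ι̂ X)) ∘ᴸ ⊗-assoc (P₀ (X / E)) (P₀ (X / E′)) (P₀ X)
              ∘ᴸ inˡ b ∘ᴸ (P₁ (third-iso E E′ le) ⊗₁ idᴸ {P₀ (X / E′)}))
            (λ a c → Module.≈ᴹ-sym S (ι̂-natural (third-iso E E′ le) a) ⊠ ≈-refl)

        pure′ : ∀ t → S₃ ⊢ (ι̂ (X / E) ⊗₁ (ι̂ (X / E′) ⊗₁ ι̂ X)) ⟨$⟩ (idᴸ {P₀ (X / E)} ⊗₁ δ E′) ⟨$⟩ t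
                        ≈ (ι̂ (X / E) ⊗₁ Λ E′) ⟨$⟩ t
        pure′ = ⊗-ext ((ι̂ (X / E) ⊗₁ (ι̂ (X / E′) ⊗₁ ι̂ X)) ∘ᴸ (idᴸ {P₀ (X / E)} ⊗₁ δ E′)) (ι̂ (X / E) ⊗₁ Λ E′)
          (λ a b → ≈-refl)

    δΛˡ : ∀ {X} (E′ : 𝓔 X) x → S₃ ⊢ ⊗-assoc S S S ⟨$⟩ (δᶠ ⊗₁ idᴸ {S}) ⟨$⟩ Λ E′ ⟨$⟩ x
                                   ≈ ∑ S₃ (equivalences (X / E′)) (λ G → Θ E′ G ⟨$⟩ x)
    δΛˡ {X} E′ x = ((⊗-assoc S S S ∘ᴸ (δᶠ ⊗₁ idᴸ {S})) ▹ Λ-def E′ x) ⟫ pure (δ E′ ⟨$⟩ x)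
      ⟫ ∑-cong S₃ (equivalences (X / E′)) (λ G → ↺ (Θ-def E′ G x))
      where
      open Chain S₃
      pure : ∀ t → S₃ ⊢ ⊗-assoc S S S ⟨$⟩ (δᶠ ⊗₁ idᴸ {S}) ⟨$⟩ (ι̂ (X / E′) ⊗₁ ι̂ X) ⟨$⟩ t
                      ≈ ∑ S₃ (equivalences (X / E′)) (λ G → ⊗-assoc S S S ⟨$⟩ (Λ G ⊗₁ ι̂ X) ⟨$⟩ t)
      pure = ⊗-ext (⊗-assoc S S S ∘ᴸ (δᶠ ⊗₁ idᴸ {S}) ∘ᴸ (ι̂ (X / E′) ⊗₁ ι̂ X))
        (∑ᴸ (equivalences (X / E′)) (λ G → ⊗-assoc S S S ∘ᴸ (Λ G ⊗₁ ι̂ X)))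
        (λ a b → ((⊗-assoc S S S ∘ᴸ inˡ (ι̂ X ⟨$⟩ b)) ▹ δ-ι̂ (X / E′) a)
          ⟫ map-∑ (⊗-assoc S S S ∘ᴸ inˡ (ι̂ X ⟨$⟩ b)) (equivalences (X / E′)) (λ G → Λ G ⟨$⟩ a))

    δΛʳ : ∀ {X} (E : 𝓔 X) x → S₃ ⊢ (idᴸ {S} ⊗₁ δᶠ) ⟨$⟩ Λ E ⟨$⟩ x
                                  ≈ ∑ S₃ (equivalences X) (λ E′ → U E E′ ⟨$⟩ x)
    δΛʳ {X} E x = ((idᴸ {S} ⊗₁ δᶠ) ▹ Λ-def E x) ⟫ pure (δ E ⟨$⟩ x)
      where
      open Chain S₃
      pure : ∀ t → S₃ ⊢ (idᴸ {S} ⊗₁ δᶠ) ⟨$⟩ (ι̂ (X / E) ⊗₁ ι̂ X) ⟨$⟩ t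
                      ≈ ∑ S₃ (equivalences X) (λ E′ → (ι̂ (X / E) ⊗₁ Λ E′) ⟨$⟩ t)
      pure = ⊗-ext ((idᴸ {S} ⊗₁ δᶠ) ∘ᴸ (ι̂ (X / E) ⊗₁ ι̂ X))
        (∑ᴸ (equivalences X) (λ E′ → ι̂ (X / E) ⊗₁ Λ E′))
        (λ a b → (inʳ (ι̂ (X / E) ⟨$⟩ a) ▹ δ-ι̂ X b)
          ⟫ map-∑ (inʳ (ι̂ (X / E) ⟨$⟩ a)) (equivalences X) (λ E′ → Λ E′ ⟨$⟩ b))

    Nested : ∀ {X} → Σ (𝓔 X) (λ E′ → 𝓔 (X / E′)) → 𝓔 X × 𝓔 X → Set
    Nested (E′ , G) (E , E″) = (E′ ≐ E″) × (lower E′ G ≐ E)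

    one-nestedˡ : ∀ {X} (s : Σ (𝓔 X) (λ E′ → 𝓔 (X / E′))) →
                  ExactlyOne (Nested s) (dpairs (equivalences X) (λ _ → equivalences X))
    one-nestedˡ {X} (E′ , G) = one-dpairs
      (λ E e → one-resp (λ E″ e″ → ≐-sym {E = E″} {E′} e″ , ≐-sym {E = E} {lower E′ G} e)
                        (λ E″ h → ≐-sym {E = E′} {E″} (proj₁ h)) (one-equivalence X E′))
      (λ E E″ h → ≐-sym {E = lower E′ G} {E} (proj₂ h))
      (one-equivalence X (lower E′ G))

    -- The hypothesis lets `E` descend to X/E′ for every listed `E′` that agrees with `E″`; up to
    -- `≐` this descent is the only inner choice.
    one-nestedʳ : ∀ {X} (E E″ : 𝓔 X) → E ≤ᴱ E″ →
                  ExactlyOne (λ s → Nested s (E , E″)) (dpairs (equivalences X) (λ E′ → equivalences (X / E′)))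
    one-nestedʳ {X} E E″ le = one-dpairs
      (λ E′ e → one-resp (λ G g → e , g) (λ G h → proj₂ h)
        (one-equivalence (X / E′) (descend E E′ (λ r → le (proj₂ e r)))))
      (λ E′ G h → proj₁ h)
      (one-equivalence X E″)

  -- One side sums over pairs (E′, G) with G on X/E′, the other over all pairs (E, E″) on X. The
  -- pairs with E ≤ E″ are matched with the former, and the remaining terms vanish by the second
  -- half of the axiom.
  δᶠ-coassoc : ⊗-assoc S S S ∘ᴸ (δᶠ ⊗₁ idᴸ) ∘ᴸ δᶠ ≗ᴸ (idᴸ ⊗₁ δᶠ) ∘ᴸ δᶠ
  δᶠ-coassoc = ι-ext (⊗-assoc S S S ∘ᴸ (δᶠ ⊗₁ idᴸ {S}) ∘ᴸ δᶠ) ((idᴸ {S} ⊗₁ δᶠ) ∘ᴸ δᶠ) (λ n x →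
    ((⊗-assoc S S S ∘ᴸ (δᶠ ⊗₁ idᴸ {S})) ▹ δ-ι n x)
    ⟫ map-∑ (⊗-assoc S S S ∘ᴸ (δᶠ ⊗₁ idᴸ {S})) (equivalences [ n ]) (λ E → Λ E ⟨$⟩ x)
    ⟫ ∑-cong S₃ (equivalences [ n ]) (λ E → δΛˡ E x)
    ⟫ ↺ (∑.⨁-dpairs S₃ (equivalences [ n ]) (λ E → equivalences ([ n ] / E)) (λ s → Θ (proj₁ s) (proj₂ s) ⟨$⟩ x))
    ⟫ ∑.⨁-reindex S₃ Nested
        (λ s t → (proj₁ s ≐? proj₂ t) ×-dec (lower (proj₁ s) (proj₂ s) ≐? proj₁ t))
        (λ s → inj₁ (one-nestedˡ s))
        (λ t → found t (≤ᴱ? (proj₁ t) (proj₂ t)) x)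
        (λ s t h → Θ≈U (proj₁ s) (proj₂ s) x
          ⟫ U-cong (lower (proj₁ s) (proj₂ s)) (proj₁ s) (proj₁ t) (proj₂ t) (proj₂ h) (proj₁ h) x)
    ⟫ ∑.⨁-dpairs S₃ (equivalences [ n ]) (λ _ → equivalences [ n ]) (λ t → U (proj₁ t) (proj₂ t) ⟨$⟩ x)
    ⟫ ∑-cong S₃ (equivalences [ n ]) (λ E → ↺ (δΛʳ E x))
    ⟫ ↺ (map-∑ (idᴸ {S} ⊗₁ δᶠ) (equivalences [ n ]) (λ E → Λ E ⟨$⟩ x))
    ⟫ ((idᴸ {S} ⊗₁ δᶠ) ▹ ≈-sym (δ-ι n x)))
    where
    open Chain S₃
    found : ∀ {n} (t : 𝓔 [ n ] × 𝓔 [ n ]) → Dec (proj₁ t ≤ᴱ proj₂ t) → ∀ x →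
            ExactlyOne (λ s → Nested s t) (dpairs (equivalences [ n ]) (λ E′ → equivalences ([ n ] / E′)))
            ⊎ (S₃ ⊢ U (proj₁ t) (proj₂ t) ⟨$⟩ x ≈ Module.0ᴹ S₃ × (∀ s → ¬ Nested s t))
    found (E , E″) (yes le) x = inj₁ (one-nestedʳ E E″ le)
    found (E , E″) (no ¬le) x = inj₂ (U-vanish E E″ ¬le x , λ { (E′ , G) (e , g) →
      ¬le (≐-cong-≤ {E = lower E′ G} {E} {E′} {E″} g e (𝓔.reflexive G)) })

  private
    Λ-ϵʳ : ∀ {X} (E : 𝓔 X) x → S ⊢ unitʳ S ⟨$⟩ (idᴸ {S} ⊗₁ ϵᶠ) ⟨$⟩ Λ E ⟨$⟩ x
                                   ≈ ι̂ (X / E) ⟨$⟩ unitʳ (P₀ (X / E)) ⟨$⟩ (idᴸ ⊗₁ ϵ X) ⟨$⟩ δ E ⟨$⟩ x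
    Λ-ϵʳ {X} E x = ((unitʳ S ∘ᴸ (idᴸ {S} ⊗₁ ϵᶠ)) ▹ Λ-def E x)
      ⟫ ⊗-ext (unitʳ S ∘ᴸ (idᴸ {S} ⊗₁ ϵᶠ) ∘ᴸ (ι̂ (X / E) ⊗₁ ι̂ X)) (ι̂ (X / E) ∘ᴸ unitʳ (P₀ (X / E)) ∘ᴸ (idᴸ ⊗₁ ϵ X))
          (λ a b → Module.*ₗ-cong S (ϵ-ι̂ X b) ∎ ⟫ ↺ (_⊸_.*ₗ-homo (ι̂ (X / E)) _ a)) (δ E ⟨$⟩ x)
      where open Chain S

    Λ-ϵˡ : ∀ {X} (E : 𝓔 X) x → S ⊢ unitˡ S ⟨$⟩ (ϵᶠ ⊗₁ idᴸ {S}) ⟨$⟩ Λ E ⟨$⟩ x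
                                   ≈ ι̂ X ⟨$⟩ unitˡ (P₀ X) ⟨$⟩ (ϵ (X / E) ⊗₁ idᴸ) ⟨$⟩ δ E ⟨$⟩ x
    Λ-ϵˡ {X} E x = ((unitˡ S ∘ᴸ (ϵᶠ ⊗₁ idᴸ {S})) ▹ Λ-def E x)
      ⟫ ⊗-ext (unitˡ S ∘ᴸ (ϵᶠ ⊗₁ idᴸ {S}) ∘ᴸ (ι̂ (X / E) ⊗₁ ι̂ X)) (ι̂ X ∘ᴸ unitˡ (P₀ X) ∘ᴸ (ϵ (X / E) ⊗₁ idᴸ))
          (λ a b → Module.*ₗ-cong S (ϵ-ι̂ (X / E) a) ∎ ⟫ ↺ (_⊸_.*ₗ-homo (ι̂ X) _ b)) (δ E ⟨$⟩ x)
      where open Chain S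

  -- The list contains exactly one equivalence `≐` to equality; its term is the identity and the
  -- axiom kills the others. In the left counit law no single term is distinguished: there the axiom
  -- is already a sum over all equivalences.
  δᶠ-counitʳ : unitʳ S ∘ᴸ (idᴸ ⊗₁ ϵᶠ) ∘ᴸ δᶠ ≗ᴸ idᴸ
  δᶠ-counitʳ = ι-ext (unitʳ S ∘ᴸ (idᴸ {S} ⊗₁ ϵᶠ) ∘ᴸ δᶠ) idᴸ (λ n x →
    ((unitʳ S ∘ᴸ (idᴸ {S} ⊗₁ ϵᶠ)) ▹ δ-ι n x)
    ⟫ map-∑ (unitʳ S ∘ᴸ (idᴸ {S} ⊗₁ ϵᶠ)) (equivalences [ n ]) (λ E → Λ E ⟨$⟩ x)
    ⟫ ∑.⨁-single S (one-equivalence [ n ] (equality [ n ]))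
        (λ E e → Λ-ϵʳ E x ⟫ ↺ (ι̂-natural (equality≃ E (proj₂ e)) _) ⟫ (ι̂ [ n ] ▹ δE-counitʳ E (proj₂ e) x))
        (λ E ne → Λ-ϵʳ E x ⟫ (ι̂ ([ n ] / E) ▹ δ-counitʳ₀ E (λ eq → ne (𝓔.reflexive E , eq)) x)
          ⟫ _⊸_.0ᴹ-homo (ι̂ ([ n ] / E)))
    ⟫ ι̂-[] n x)
    where open Chain S

  δᶠ-counitˡ : unitˡ S ∘ᴸ (ϵᶠ ⊗₁ idᴸ) ∘ᴸ δᶠ ≗ᴸ idᴸ
  δᶠ-counitˡ = ι-ext (unitˡ S ∘ᴸ (ϵᶠ ⊗₁ idᴸ {S}) ∘ᴸ δᶠ) idᴸ (λ n x →
    ((unitˡ S ∘ᴸ (ϵᶠ ⊗₁ idᴸ {S})) ▹ δ-ι n x)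
    ⟫ map-∑ (unitˡ S ∘ᴸ (ϵᶠ ⊗₁ idᴸ {S})) (equivalences [ n ]) (λ E → Λ E ⟨$⟩ x)
    ⟫ ∑-cong S (equivalences [ n ]) (λ E → Λ-ϵˡ E x)
    ⟫ ↺ (map-∑ (ι̂ [ n ]) (equivalences [ n ])
          (λ E → unitˡ (P₀ [ n ]) ⟨$⟩ (ϵ ([ n ] / E) ⊗₁ idᴸ) ⟨$⟩ δ E ⟨$⟩ x))
    ⟫ (ι̂ [ n ] ▹ δE-counitˡ [ n ] x)
    ⟫ ι̂-[] n x)
    where open Chain S

  δᶠ-one : S ⊗ S ⊢ δᶠ ⟨$⟩ one ≈ one ⊗ₜ one
  δᶠ-one = δ-ι 0 1ₚ ⟫ ∑.⨁-single (S ⊗ S) (one-equivalence ∅ (equality ∅))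
      (λ E e → Λ-def E 1ₚ ⟫ ↺ (pure E (δ E ⟨$⟩ 1ₚ)) ⟫ ((ι̂ ∅ ⊗₁ ι̂ ∅) ▹ δ-1 E) ⟫ (ι̂-1 ⊠ ι̂-1))
      (λ E ne → ⊥-elim (ne ((λ { {()} }) , (λ { {()} }))))
    where
    open Chain (S ⊗ S)
    pure : ∀ (E : 𝓔 ∅) t → S ⊗ S ⊢ (ι̂ ∅ ⊗₁ ι̂ ∅) ⟨$⟩ (P₁ (∅/≃ E) ⊗₁ idᴸ {P₀ ∅}) ⟨$⟩ t ≈ (ι̂ (∅ / E) ⊗₁ ι̂ ∅) ⟨$⟩ t
    pure E = ⊗-ext ((ι̂ ∅ ⊗₁ ι̂ ∅) ∘ᴸ (P₁ (∅/≃ E) ⊗₁ idᴸ {P₀ ∅})) (ι̂ (∅ / E) ⊗₁ ι̂ ∅)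
      (λ a b → ι̂-natural (∅/≃ E) a ⊠ Module.≈ᴹ-refl S)

  -- In positive degree every quotient X/E has a point, so every term vanishes along with the
  -- counit; in degree 0 there is one equivalence and the axiom on the empty set applies.
  εᶠ-δᶠ : ∀ x → S ⊢ (unitˡ S ∘ᴸ (εᶠ ⊗₁ idᴸ) ∘ᴸ δᶠ) ⟨$⟩ x ≈ Module._*ₗ_ S (εᶠ ⟨$⟩ x) one
  εᶠ-δᶠ = ι-ext (unitˡ S ∘ᴸ (εᶠ ⊗₁ idᴸ {S}) ∘ᴸ δᶠ) scale (λ n x →
    ((unitˡ S ∘ᴸ (εᶠ ⊗₁ idᴸ {S})) ▹ δ-ι n x)
    ⟫ map-∑ (unitˡ S ∘ᴸ (εᶠ ⊗₁ idᴸ {S})) (equivalences [ n ]) (λ E → Λ E ⟨$⟩ x)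
    ⟫ go n x)
    where
    open Chain S

    scale : S ⊸ S
    scale = linear (λ x → Module._*ₗ_ S (εᶠ ⟨$⟩ x) one)
      (λ p → Module.*ₗ-cong S (εᶠ ▹ p) ∎)
      (λ x y → Module.*ₗ-cong S (_⊸_.+ᴹ-homo εᶠ x y) ∎ ⟫ Module.*ₗ-distribʳ S _ _ _)
      (λ k x → Module.*ₗ-cong S (_⊸_.*ₗ-homo εᶠ k x) ∎ ⟫ Module.*ₗ-assoc S _ _ _)

    go : ∀ n x → S ⊢ ∑ S (equivalences [ n ]) (λ E → unitˡ S ⟨$⟩ (εᶠ ⊗₁ idᴸ {S}) ⟨$⟩ Λ E ⟨$⟩ x)
                   ≈ Module._*ₗ_ S (εᶠ ⟨$⟩ ι n ⟨$⟩ x) one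
    go zero x = ∑.⨁-single S (one-equivalence ∅ (equality ∅))
        (λ E e → ((unitˡ S ∘ᴸ (εᶠ ⊗₁ idᴸ {S})) ▹ Λ-def E x) ⟫ pure E (δ E ⟨$⟩ x)
          ⟫ (ι̂ ∅ ▹ ε-δ E x) ⟫ _⊸_.*ₗ-homo (ι̂ ∅) _ 1ₚ
          ⟫ Module.*ₗ-cong S (𝕜.sym (𝕜.trans (εᶠ ▹ ↺ (ι̂-[] 0 x)) (𝕜.trans (ε-∅ id≃ x) (ε ▹ P-id x)))) ι̂-1)
        (λ E ne → ⊥-elim (ne ((λ { {()} }) , (λ { {()} }))))
      where
      pure : ∀ (E : 𝓔 ∅) t → S ⊢ unitˡ S ⟨$⟩ (εᶠ ⊗₁ idᴸ {S}) ⟨$⟩ (ι̂ (∅ / E) ⊗₁ ι̂ ∅) ⟨$⟩ t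
                            ≈ ι̂ ∅ ⟨$⟩ unitˡ (P₀ ∅) ⟨$⟩ ((ε ∘ᴸ P₁ (∅/≃ E)) ⊗₁ idᴸ) ⟨$⟩ t
      pure E = ⊗-ext (unitˡ S ∘ᴸ (εᶠ ⊗₁ idᴸ {S}) ∘ᴸ (ι̂ (∅ / E) ⊗₁ ι̂ ∅))
        (ι̂ ∅ ∘ᴸ unitˡ (P₀ ∅) ∘ᴸ ((ε ∘ᴸ P₁ (∅/≃ E)) ⊗₁ idᴸ))
        (λ a b → Module.*ₗ-cong S (ε-∅ (∅/≃ E) a) ∎ ⟫ ↺ (_⊸_.*ₗ-homo (ι̂ ∅) _ b))
    go (suc n) x = ∑-cong S (equivalences [ suc n ]) (λ E →
        ((unitˡ S ∘ᴸ (εᶠ ⊗₁ idᴸ {S})) ▹ Λ-def E x)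
        ⟫ ⊗-ext (unitˡ S ∘ᴸ (εᶠ ⊗₁ idᴸ {S}) ∘ᴸ (ι̂ ([ suc n ] / E) ⊗₁ ι̂ [ suc n ])) 0ᴸ
            -- The quotient has the same carrier, so `zero` is a point of it.
            (λ a b → Module.*ₗ-cong S (ε-point {[ suc n ] / E} zero a) ∎ ⟫ Module.*ₗ-zeroˡ S _) (δ E ⟨$⟩ x))
      ⟫ ∑.⨁-0 S (equivalences [ suc n ])
      ⟫ ↺ (Module.*ₗ-zeroˡ S one)
      ⟫ Module.*ₗ-cong S (𝕜.sym (𝕜.trans (εᶠ ▹ ↺ (ι̂-[] (suc n) x)) (ε-point {[ suc n ]} zero x))) ∎

  Λ-mul : ∀ {X Y} (E : 𝓔 (X ⊔ˢ Y)) → Splits E → ∀ x y →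
          S ⊗ S ⊢ Λ E ⟨$⟩ m X Y ⟨$⟩ x ⊗ₜ y
                ≈ (mul ⊗₁ mul) ⟨$⟩ Id⊗c⊗Id S S S S ⟨$⟩ (Λ (restrictˡ {X} {Y} E) ⟨$⟩ x) ⊗ₜ (Λ (restrictʳ {X} {Y} E) ⟨$⟩ y)
  Λ-mul {X} {Y} E s x y = Λ-def E (m X Y ⟨$⟩ x ⊗ₜ y)
    ⟫ ((ι̂ ((X ⊔ˢ Y) / E) ⊗₁ ι̂ (X ⊔ˢ Y)) ▹ δ-m X Y E s (x ⊗ₜ y))
    ⟫ pure (δ (restrictˡ {X} {Y} E) ⟨$⟩ x) (δ (restrictʳ {X} {Y} E) ⟨$⟩ y)
    ⟫ (((mul ⊗₁ mul) ∘ᴸ Id⊗c⊗Id S S S S) ▹ (≈-sym (Λ-def (restrictˡ {X} {Y} E) x) ⊠ ≈-sym (Λ-def (restrictʳ {X} {Y} E) y)))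
    where
    open Chain (S ⊗ S)
    Q = X / restrictˡ {X} {Y} E
    Q′ = Y / restrictʳ {X} {Y} E
    pure : ∀ t t′ → S ⊗ S ⊢ (ι̂ ((X ⊔ˢ Y) / E) ⊗₁ ι̂ (X ⊔ˢ Y)) ⟨$⟩ ((P₁ (split-quotient≃ {X} {Y} E s) ∘ᴸ m Q Q′) ⊗₁ m X Y)
                       ⟨$⟩ Id⊗c⊗Id (P₀ Q) (P₀ X) (P₀ Q′) (P₀ Y) ⟨$⟩ t ⊗ₜ t′
                     ≈ (mul ⊗₁ mul) ⟨$⟩ Id⊗c⊗Id S S S S ⟨$⟩ ((ι̂ Q ⊗₁ ι̂ X) ⟨$⟩ t) ⊗ₜ ((ι̂ Q′ ⊗₁ ι̂ Y) ⟨$⟩ t′)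
    pure t t′ = ⊗-ext₄
      ((ι̂ ((X ⊔ˢ Y) / E) ⊗₁ ι̂ (X ⊔ˢ Y)) ∘ᴸ ((P₁ (split-quotient≃ {X} {Y} E s) ∘ᴸ m Q Q′) ⊗₁ m X Y)
        ∘ᴸ Id⊗c⊗Id (P₀ Q) (P₀ X) (P₀ Q′) (P₀ Y))
      ((mul ⊗₁ mul) ∘ᴸ Id⊗c⊗Id S S S S ∘ᴸ ((ι̂ Q ⊗₁ ι̂ X) ⊗₁ (ι̂ Q′ ⊗₁ ι̂ Y)))
      (λ a b a′ b′ →
        Module.≈ᴹ-trans S (ι̂-natural (split-quotient≃ {X} {Y} E s) (m Q Q′ ⟨$⟩ a ⊗ₜ a′)) (Module.≈ᴹ-sym S (mul-ι̂ Q Q′ a a′))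
        ⊠ Module.≈ᴹ-sym S (mul-ι̂ X Y b b′))
      (t ⊗ₜ t′)

  -- Equivalences that split are matched with pairs of equivalences on the two summands; those that
  -- do not split contribute zero by the axiom.
  δᶠ-mul : δᶠ ∘ᴸ mul ≗ᴸ (mul ⊗₁ mul) ∘ᴸ Id⊗c⊗Id S S S S ∘ᴸ (δᶠ ⊗₁ δᶠ)
  δᶠ-mul = ι-ext₂ (δᶠ ∘ᴸ mul) ((mul ⊗₁ mul) ∘ᴸ Id⊗c⊗Id S S S S ∘ᴸ (δᶠ ⊗₁ δᶠ)) (λ k l x y →
    (δᶠ ▹ mul-ι k l x y)
    ⟫ δ-ι̂ ([ k ] ⊔ˢ [ l ]) (m [ k ] [ l ] ⟨$⟩ x ⊗ₜ y)
    ⟫ ∑.⨁-reindex (S ⊗ S) {as = equivalences ([ k ] ⊔ˢ [ l ])}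
        {bs = dpairs (equivalences [ k ]) (λ _ → equivalences [ l ])}
        (λ E s → E ≐ (proj₁ s ⊔ᴱ proj₂ s))
        (λ E s → E ≐? (proj₁ s ⊔ᴱ proj₂ s))
        (λ E → found k l E (E ≐? (restrictˡ E ⊔ᴱ restrictʳ E)) x y)
        (λ s → inj₁ (one-equivalence ([ k ] ⊔ˢ [ l ]) (proj₁ s ⊔ᴱ proj₂ s)))
        (λ E s e → let (spl , l , r) = splits-≐ {H = E} {proj₁ s} {proj₂ s} e in
          Λ-mul E spl x y
          ⟫ (((mul ⊗₁ mul) ∘ᴸ Id⊗c⊗Id S S S S) ▹
              (Λ-cong (restrictˡ E) (proj₁ s) l x ⊠ Λ-cong (restrictʳ E) (proj₂ s) r y)))
    ⟫ ∑.⨁-dpairs (S ⊗ S) (equivalences [ k ]) (λ _ → equivalences [ l ])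
        (λ s → (mul ⊗₁ mul) ⟨$⟩ Id⊗c⊗Id S S S S ⟨$⟩ (Λ (proj₁ s) ⟨$⟩ x) ⊗ₜ (Λ (proj₂ s) ⟨$⟩ y))
    ⟫ ↺ (map-∑∑ ((mul ⊗₁ mul) ∘ᴸ Id⊗c⊗Id S S S S) (equivalences [ k ]) (λ E → Λ E ⟨$⟩ x)
          (equivalences [ l ]) (λ E → Λ E ⟨$⟩ y))
    ⟫ (((mul ⊗₁ mul) ∘ᴸ Id⊗c⊗Id S S S S) ▹ (≈-sym (δ-ι k x) ⊠ ≈-sym (δ-ι l y))))
    where
    open Chain (S ⊗ S)
    found : ∀ k l (E : 𝓔 ([ k ] ⊔ˢ [ l ])) → Dec (Splits E) → ∀ x y →
            ExactlyOne (λ s → E ≐ (proj₁ s ⊔ᴱ proj₂ s)) (dpairs (equivalences [ k ]) (λ _ → equivalences [ l ]))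
            ⊎ (S ⊗ S ⊢ Λ E ⟨$⟩ m [ k ] [ l ] ⟨$⟩ x ⊗ₜ y ≈ Module.0ᴹ (S ⊗ S) × (∀ s → ¬ (E ≐ (proj₁ s ⊔ᴱ proj₂ s))))
    found k l E (yes spl) x y = inj₁ (one-dpairs
      (λ E₁ e₁ → one-resp
        (λ E₂ e₂ → ≐-trans {E = E} {restrictˡ E ⊔ᴱ restrictʳ E} {E₁ ⊔ᴱ E₂} spl
          (⊔ᴱ-cong {E = restrictˡ E} {E₁} {restrictʳ E} {E₂} (≐-sym {E = E₁} {restrictˡ E} e₁) (≐-sym {E = E₂} {restrictʳ E} e₂)))
        (λ E₂ h → ≐-sym {E = restrictʳ E} {E₂} (proj₂ (proj₂ (splits-≐ {H = E} {E₁} {E₂} h))))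
        (one-equivalence [ l ] (restrictʳ E)))
      (λ E₁ E₂ h → ≐-sym {E = restrictˡ E} {E₁} (proj₁ (proj₂ (splits-≐ {H = E} {E₁} {E₂} h))))
      (one-equivalence [ k ] (restrictˡ E)))
    found k l E (no ¬s) x y = inj₂ (
      (Λ-def E (m [ k ] [ l ] ⟨$⟩ x ⊗ₜ y)
        ⟫ ((ι̂ (([ k ] ⊔ˢ [ l ]) / E) ⊗₁ ι̂ ([ k ] ⊔ˢ [ l ])) ▹ δ-m₀ [ k ] [ l ] E ¬s (x ⊗ₜ y))) ,
      (λ s h → ¬s (proj₁ (splits-≐ {H = E} {proj₁ s} {proj₂ s} h))))

  private
    S₂₁ : Vect
    S₂₁ = (S ⊗ S) ⊗ S

    opaque
      -- Terms of the two sides of the compatibility of Δ with δ: `V` contracts and then splits the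
      -- quotient, `W` splits X and then contracts each part.
      V : ∀ {X} (E : 𝓔 X) → Decomp (X / E) → P₀ X ⊸ S₂₁
      V {X} E d = (D d ⊗₁ ι̂ X) ∘ᴸ δ E

      V-def : ∀ {X} (E : 𝓔 X) d x → S₂₁ ⊢ V E d ⟨$⟩ x ≈ (D d ⊗₁ ι̂ X) ⟨$⟩ δ E ⟨$⟩ x
      V-def E d x = ≈-refl

      V-natural : ∀ {X Y} (σ : X ≃ Y) (E : 𝓔 X) (E′ : 𝓔 Y) (t : E′ ≐ transport σ E)
                  (d : Decomp (X / E)) (e : Decomp (Y / E′)) →
                  (∀ x → side (iso d) x ≡ side (iso e) (_≃_.to σ x)) → ∀ x →
                  S₂₁ ⊢ V E′ e ⟨$⟩ P₁ σ ⟨$⟩ x ≈ V E d ⟨$⟩ x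
      V-natural {X} {Y} σ E E′ t d e h x = ((D e ⊗₁ ι̂ Y) ▹ δ-natural σ E E′ t x) ⟫ pure (δ E ⟨$⟩ x)
        where
        open Chain S₂₁
        pure : ∀ s → S₂₁ ⊢ (D e ⊗₁ ι̂ Y) ⟨$⟩ (P₁ (quotient≃ σ E E′ t) ⊗₁ P₁ σ) ⟨$⟩ s ≈ (D d ⊗₁ ι̂ X) ⟨$⟩ s
        pure = ⊗-ext ((D e ⊗₁ ι̂ Y) ∘ᴸ (P₁ (quotient≃ σ E E′ t) ⊗₁ P₁ σ)) (D d ⊗₁ ι̂ X)
          (λ a b → D-natural d e (quotient≃ σ E E′ t) h a ⊠ ι̂-natural σ b)

      W : ∀ {X} (d : Decomp X) → 𝓔 (L d) → 𝓔 (R d) → P₀ X ⊸ S₂₁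
      W d E₁ E₂ = m₁,₃,₂₄ S S S S mul ∘ᴸ (Λ E₁ ⊗₁ Λ E₂) ∘ᴸ Δ (L d) (R d) ∘ᴸ P₁ (iso d ⁻¹≃)

      W-def : ∀ {X} (d : Decomp X) (E₁ : 𝓔 (L d)) (E₂ : 𝓔 (R d)) x →
              S₂₁ ⊢ W d E₁ E₂ ⟨$⟩ x ≈ m₁,₃,₂₄ S S S S mul ⟨$⟩ (Λ E₁ ⊗₁ Λ E₂) ⟨$⟩ Δ (L d) (R d) ⟨$⟩ P₁ (iso d ⁻¹≃) ⟨$⟩ x
      W-def d E₁ E₂ x = ≈-refl

    -- A decomposition of X/E is a decomposition of X into unions of classes of E, and E is then the
    -- disjoint union of its restrictions to the two parts. This is the correspondence between the
    -- index sets of `V` and `W`.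
    Adapted : ∀ {X} → Σ (𝓔 X) (λ E → Decomp (X / E)) → Σ (Decomp X) (λ d → 𝓔 (L d) × 𝓔 (R d)) → Set
    Adapted (E , d) (d₀ , E₁ , E₂) =
      (E ≐ transport (iso d₀) (E₁ ⊔ᴱ E₂)) × (∀ x → side (iso d) x ≡ side (iso d₀) x)

    -- For a set that is literally a disjoint union, with the decomposition of the quotient given by
    -- the splitting, the axiom for Δ and δ applies as stated.
    V-split : ∀ {A A′} (E : 𝓔 (A ⊔ˢ A′)) (s : Splits E) y →
              S₂₁ ⊢ V E (decomp (split-quotient≃ {A} {A′} E s)) ⟨$⟩ y
                  ≈ m₁,₃,₂₄ S S S S mul ⟨$⟩ (Λ (restrictˡ {A} {A′} E) ⊗₁ Λ (restrictʳ {A} {A′} E)) ⟨$⟩ Δ A A′ ⟨$⟩ y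
    V-split {A} {A′} E s y = V-def E d y ⟫ pure (δ E ⟨$⟩ y)
      ⟫ (((ι̂ Q ⊗₁ ι̂ Q′) ⊗₁ ι̂ (A ⊔ˢ A′)) ▹ Δ-δ A A′ E s y)
      ⟫ pure′ (Δ A A′ ⟨$⟩ y)
      where
      open Chain S₂₁
      Q = A / restrictˡ {A} {A′} E
      Q′ = A′ / restrictʳ {A} {A′} E
      d : Decomp ((A ⊔ˢ A′) / E)
      d = decomp (split-quotient≃ {A} {A′} E s)

      pure : ∀ t → S₂₁ ⊢ (D d ⊗₁ ι̂ (A ⊔ˢ A′)) ⟨$⟩ t
                       ≈ ((ι̂ Q ⊗₁ ι̂ Q′) ⊗₁ ι̂ (A ⊔ˢ A′))
                           ⟨$⟩ ((Δ Q Q′ ∘ᴸ P₁ (split-quotient≃ {A} {A′} E s ⁻¹≃)) ⊗₁ idᴸ {P₀ (A ⊔ˢ A′)}) ⟨$⟩ t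
      pure = ⊗-ext (D d ⊗₁ ι̂ (A ⊔ˢ A′))
        (((ι̂ Q ⊗₁ ι̂ Q′) ⊗₁ ι̂ (A ⊔ˢ A′)) ∘ᴸ ((Δ Q Q′ ∘ᴸ P₁ (split-quotient≃ {A} {A′} E s ⁻¹≃)) ⊗₁ idᴸ {P₀ (A ⊔ˢ A′)}))
        (λ a b → D-def d a ⊠ Module.≈ᴹ-refl S)

      swapped : ∀ u v → S₂₁ ⊢ ((ι̂ Q ⊗₁ ι̂ Q′) ⊗₁ ι̂ (A ⊔ˢ A′)) ⟨$⟩ m₁,₃,₂₄ (P₀ Q) (P₀ A) (P₀ Q′) (P₀ A′) (m A A′) ⟨$⟩ u ⊗ₜ v
                        ≈ m₁,₃,₂₄ S S S S mul ⟨$⟩ ((ι̂ Q ⊗₁ ι̂ A) ⟨$⟩ u) ⊗ₜ ((ι̂ Q′ ⊗₁ ι̂ A′) ⟨$⟩ v)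
      swapped u v = ⊗-ext₄
        (((ι̂ Q ⊗₁ ι̂ Q′) ⊗₁ ι̂ (A ⊔ˢ A′)) ∘ᴸ m₁,₃,₂₄ (P₀ Q) (P₀ A) (P₀ Q′) (P₀ A′) (m A A′))
        (m₁,₃,₂₄ S S S S mul ∘ᴸ ((ι̂ Q ⊗₁ ι̂ A) ⊗₁ (ι̂ Q′ ⊗₁ ι̂ A′)))
        (λ a b a′ b′ → ≈-refl ⊠ Module.≈ᴹ-sym S (mul-ι̂ A A′ b b′)) (u ⊗ₜ v)

      pure′ : ∀ t → S₂₁ ⊢ ((ι̂ Q ⊗₁ ι̂ Q′) ⊗₁ ι̂ (A ⊔ˢ A′)) ⟨$⟩ m₁,₃,₂₄ (P₀ Q) (P₀ A) (P₀ Q′) (P₀ A′) (m A A′)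
                            ⟨$⟩ (δ (restrictˡ {A} {A′} E) ⊗₁ δ (restrictʳ {A} {A′} E)) ⟨$⟩ t
                        ≈ m₁,₃,₂₄ S S S S mul ⟨$⟩ (Λ (restrictˡ {A} {A′} E) ⊗₁ Λ (restrictʳ {A} {A′} E)) ⟨$⟩ t
      pure′ = ⊗-ext
        (((ι̂ Q ⊗₁ ι̂ Q′) ⊗₁ ι̂ (A ⊔ˢ A′)) ∘ᴸ m₁,₃,₂₄ (P₀ Q) (P₀ A) (P₀ Q′) (P₀ A′) (m A A′) ∘ᴸ (δ (restrictˡ {A} {A′} E) ⊗₁ δ (restrictʳ {A} {A′} E)))
        (m₁,₃,₂₄ S S S S mul ∘ᴸ (Λ (restrictˡ {A} {A′} E) ⊗₁ Λ (restrictʳ {A} {A′} E)))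
        (λ a b → swapped (δ (restrictˡ {A} {A′} E) ⟨$⟩ a) (δ (restrictʳ {A} {A′} E) ⟨$⟩ b)
          ⟫ (m₁,₃,₂₄ S S S S mul ▹ ≈-sym (Λ-def (restrictˡ {A} {A′} E) a) ⊠ ≈-sym (Λ-def (restrictʳ {A} {A′} E) b)))

    -- Transport along the decomposition of X reduces to the split case, with `E₁ ⊔ᴱ E₂` in the
    -- place of `E`; its restrictions are `E₁` and `E₂` only up to `≐`, hence the passage through
    -- `Λ-cong`.
    V≈W : ∀ {X} s t → Adapted {X} s t → ∀ x →
          S₂₁ ⊢ V (proj₁ s) (proj₂ s) ⟨$⟩ x ≈ W (proj₁ t) (proj₁ (proj₂ t)) (proj₂ (proj₂ t)) ⟨$⟩ x
    V≈W {X} (E , d) (d₀ , E₁ , E₂) (e , h) x =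
      ↺ (V-natural (iso d₀ ⁻¹≃) E G (⊔-transport (iso d₀) {G} {E} e) d (decomp (split-quotient≃ G s)) h x)
      ⟫ V-split G s (P₁ (iso d₀ ⁻¹≃) ⟨$⟩ x)
      ⟫ (m₁,₃,₂₄ S S S S mul ▹ ⊗₁-cong {f = Λ (restrictˡ G)} {Λ E₁} {Λ (restrictʳ G)} {Λ E₂}
          (Λ-cong (restrictˡ G) E₁ (restrict-⊔ˡ E₁ E₂)) (Λ-cong (restrictʳ G) E₂ (restrict-⊔ʳ E₁ E₂))
          (Δ (L d₀) (R d₀) ⟨$⟩ P₁ (iso d₀ ⁻¹≃) ⟨$⟩ x))
      ⟫ ↺ (W-def d₀ E₁ E₂ x)
      where
      open Chain S₂₁
      G : 𝓔 (L d₀ ⊔ˢ R d₀)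
      G = E₁ ⊔ᴱ E₂
      s : Splits G
      s = splits-⊔ E₁ E₂

    one-adaptedˡ : ∀ {X} (s : Σ (𝓔 X) (λ E → Decomp (X / E))) →
                   ExactlyOne (Adapted s) (dpairs (decompositions X) (λ d → dpairs (equivalences (L d)) (λ _ → equivalences (R d))))
    one-adaptedˡ {X} (E , d) = one-dpairs
      (λ d₀ h → let E′ = transport (iso d₀ ⁻¹≃) E in one-dpairs
        (λ E₁ e₁ → one-resp
          (λ E₂ e₂ → ⊔-transport (iso d₀ ⁻¹≃) {E} {E₁ ⊔ᴱ E₂} (≐-trans {E = E₁ ⊔ᴱ E₂} {restrictˡ E′ ⊔ᴱ restrictʳ E′} {E′}
                 (⊔ᴱ-cong {E = E₁} {restrictˡ E′} {E₂} {restrictʳ E′} e₁ e₂)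
                 (≐-sym {E = E′} {restrictˡ E′ ⊔ᴱ restrictʳ E′} (splits d₀ h)))
               , (λ x → ≡.sym (h x)))
          (λ E₂ k → ≐-sym {E = restrictʳ E′} {E₂} (proj₂ (proj₂ (parts d₀ E₁ E₂ (proj₁ k)))))
          (one-equivalence (R d₀) (restrictʳ E′)))
        (λ E₁ E₂ k → ≐-sym {E = restrictˡ E′} {E₁} (proj₁ (proj₂ (parts d₀ E₁ E₂ (proj₁ k)))))
        (one-equivalence (L d₀) (restrictˡ E′)))
      (λ d₀ t k x → ≡.sym (proj₂ k x))
      (one-decomposition X (side (iso d)) (λ r → side-cong (iso d) (𝓔.reflexive E r)))
      where
      parts : ∀ (d₀ : Decomp X) (E₁ : 𝓔 (L d₀)) (E₂ : 𝓔 (R d₀)) → E ≐ transport (iso d₀) (E₁ ⊔ᴱ E₂) →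
              let E′ = transport (iso d₀ ⁻¹≃) E in Splits E′ × restrictˡ E′ ≐ E₁ × restrictʳ E′ ≐ E₂
      parts d₀ E₁ E₂ e = splits-≐ {H = transport (iso d₀ ⁻¹≃) E} {E₁} {E₂}
        (≐-sym {E = E₁ ⊔ᴱ E₂} {transport (iso d₀ ⁻¹≃) E} (⊔-transport (iso d₀) {E₁ ⊔ᴱ E₂} {E} e))

      splits : ∀ (d₀ : Decomp X) → (∀ x → side (iso d₀) x ≡ side (iso d) x) → Splits (transport (iso d₀ ⁻¹≃) E)
      splits d₀ h = (λ { (inj₁ r) → r ; (inj₂ r) → r }) , (λ {z} {w} → go z w)
        where
        -- The colouring comes from X/E, hence is constant on classes of E: two related elements lie
        -- on the same side, which excludes the mixed cases.
        same : ∀ z w → 𝓔._∼_ E (_≃_.to (iso d₀) z) (_≃_.to (iso d₀) w) → left? z ≡ left? w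
        same z w r = ≡.trans (≡.sym (side-to (iso d₀) z)) (≡.trans (h _)
          (≡.trans (side-cong (iso d) r) (≡.trans (≡.sym (h _)) (side-to (iso d₀) w))))

        go : ∀ z w → 𝓔._∼_ E (_≃_.to (iso d₀) z) (_≃_.to (iso d₀) w) →
             Pointwise (𝓔._∼_ (restrictˡ (transport (iso d₀ ⁻¹≃) E))) (𝓔._∼_ (restrictʳ (transport (iso d₀ ⁻¹≃) E))) z w
        go (inj₁ _) (inj₁ _) r = inj₁ r
        go (inj₂ _) (inj₂ _) r = inj₂ r
        go (inj₁ a) (inj₂ b) r with () ← same (inj₁ a) (inj₂ b) r
        go (inj₂ a) (inj₁ b) r with () ← same (inj₂ a) (inj₁ b) r

    one-adaptedʳ : ∀ {X} (t : Σ (Decomp X) (λ d → 𝓔 (L d) × 𝓔 (R d))) →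
                   ExactlyOne (λ s → Adapted s t) (dpairs (equivalences X) (λ E → decompositions (X / E)))
    one-adaptedʳ {X} (d₀ , E₁ , E₂) = one-dpairs
      (λ E e → one-resp (λ d h → e , h) (λ d k → proj₂ k)
        (one-decomposition (X / E) (side (iso d₀)) (λ r → left?-resp (proj₂ e r))))
      (λ E d k → proj₁ k)
      (one-equivalence X (transport (iso d₀) (E₁ ⊔ᴱ E₂)))

    ΔΛ : ∀ {X} (E : 𝓔 X) x → S₂₁ ⊢ (Δᶠ ⊗₁ idᴸ {S}) ⟨$⟩ Λ E ⟨$⟩ x
                                  ≈ ∑ S₂₁ (decompositions (X / E)) (λ d → V E d ⟨$⟩ x)
    ΔΛ {X} E x = ((Δᶠ ⊗₁ idᴸ {S}) ▹ Λ-def E x) ⟫ pure (δ E ⟨$⟩ x)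
      ⟫ ∑-cong S₂₁ (decompositions (X / E)) (λ d → ↺ (V-def E d x))
      where
      open Chain S₂₁
      pure : ∀ t → S₂₁ ⊢ (Δᶠ ⊗₁ idᴸ {S}) ⟨$⟩ (ι̂ (X / E) ⊗₁ ι̂ X) ⟨$⟩ t
                       ≈ ∑ S₂₁ (decompositions (X / E)) (λ d → (D d ⊗₁ ι̂ X) ⟨$⟩ t)
      pure = ⊗-ext ((Δᶠ ⊗₁ idᴸ {S}) ∘ᴸ (ι̂ (X / E) ⊗₁ ι̂ X)) (∑ᴸ (decompositions (X / E)) (λ d → D d ⊗₁ ι̂ X))
        (λ a b → (inˡ (ι̂ X ⟨$⟩ b) ▹ Δ-ι̂ (X / E) a)
          ⟫ map-∑ (inˡ (ι̂ X ⟨$⟩ b)) (decompositions (X / E)) (λ d → D d ⟨$⟩ a))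

    δD : ∀ {X} (d : Decomp X) x → S₂₁ ⊢ m₁,₃,₂₄ S S S S mul ⟨$⟩ (δᶠ ⊗₁ δᶠ) ⟨$⟩ D d ⟨$⟩ x
           ≈ ∑ S₂₁ (dpairs (equivalences (L d)) (λ _ → equivalences (R d))) (λ e → W d (proj₁ e) (proj₂ e) ⟨$⟩ x)
    δD {X} d x = ((m₁,₃,₂₄ S S S S mul ∘ᴸ (δᶠ ⊗₁ δᶠ)) ▹ D-def d x) ⟫ pure (Δ (L d) (R d) ⟨$⟩ P₁ (iso d ⁻¹≃) ⟨$⟩ x)
      ⟫ ∑-cong S₂₁ (dpairs (equivalences (L d)) (λ _ → equivalences (R d))) (λ e → ↺ (W-def d (proj₁ e) (proj₂ e) x))
      where
      open Chain S₂₁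
      pure : ∀ t → S₂₁ ⊢ m₁,₃,₂₄ S S S S mul ⟨$⟩ (δᶠ ⊗₁ δᶠ) ⟨$⟩ (ι̂ (L d) ⊗₁ ι̂ (R d)) ⟨$⟩ t
                       ≈ ∑ S₂₁ (dpairs (equivalences (L d)) (λ _ → equivalences (R d)))
                           (λ e → m₁,₃,₂₄ S S S S mul ⟨$⟩ (Λ (proj₁ e) ⊗₁ Λ (proj₂ e)) ⟨$⟩ t)
      pure = ⊗-ext (m₁,₃,₂₄ S S S S mul ∘ᴸ (δᶠ ⊗₁ δᶠ) ∘ᴸ (ι̂ (L d) ⊗₁ ι̂ (R d)))
        (∑ᴸ (dpairs (equivalences (L d)) (λ _ → equivalences (R d)))
          (λ e → m₁,₃,₂₄ S S S S mul ∘ᴸ (Λ (proj₁ e) ⊗₁ Λ (proj₂ e))))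
        (λ a b → (m₁,₃,₂₄ S S S S mul ▹ δ-ι̂ (L d) a ⊠ δ-ι̂ (R d) b)
          ⟫ map-∑∑ (m₁,₃,₂₄ S S S S mul) (equivalences (L d)) (λ E → Λ E ⟨$⟩ a) (equivalences (R d)) (λ E → Λ E ⟨$⟩ b)
          ⟫ ↺ (∑.⨁-dpairs S₂₁ (equivalences (L d)) (λ _ → equivalences (R d))
                (λ e → m₁,₃,₂₄ S S S S mul ⟨$⟩ (Λ (proj₁ e) ⟨$⟩ a) ⊗ₜ (Λ (proj₂ e) ⟨$⟩ b))))

  Δᶠ-δᶠ : (Δᶠ ⊗₁ idᴸ) ∘ᴸ δᶠ ≗ᴸ m₁,₃,₂₄ S S S S mul ∘ᴸ (δᶠ ⊗₁ δᶠ) ∘ᴸ Δᶠ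
  Δᶠ-δᶠ = ι-ext ((Δᶠ ⊗₁ idᴸ {S}) ∘ᴸ δᶠ) (m₁,₃,₂₄ S S S S mul ∘ᴸ (δᶠ ⊗₁ δᶠ) ∘ᴸ Δᶠ) (λ n x →
    ((Δᶠ ⊗₁ idᴸ {S}) ▹ δ-ι n x)
    ⟫ map-∑ (Δᶠ ⊗₁ idᴸ {S}) (equivalences [ n ]) (λ E → Λ E ⟨$⟩ x)
    ⟫ ∑-cong S₂₁ (equivalences [ n ]) (λ E → ΔΛ E x)
    ⟫ ↺ (∑.⨁-dpairs S₂₁ (equivalences [ n ]) (λ E → decompositions ([ n ] / E)) (λ s → V (proj₁ s) (proj₂ s) ⟨$⟩ x))
    ⟫ ∑.⨁-reindex S₂₁ Adapted
        (λ s t → (proj₁ s ≐? transport (iso (proj₁ t)) (proj₁ (proj₂ t) ⊔ᴱ proj₂ (proj₂ t)))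
          ×-dec side-dec {[ n ]} _ _ (λ { refl → refl }) (λ { refl → refl }))
        (λ s → inj₁ (one-adaptedˡ s))
        (λ t → inj₁ (one-adaptedʳ t))
        (λ s t h → V≈W s t h x)
    ⟫ ∑.⨁-dpairs S₂₁ (decompositions [ n ]) (λ d → dpairs (equivalences (L d)) (λ _ → equivalences (R d)))
        (λ t → W (proj₁ t) (proj₁ (proj₂ t)) (proj₂ (proj₂ t)) ⟨$⟩ x)
    ⟫ ∑-cong S₂₁ (decompositions [ n ]) (λ d → ↺ (δD d x))
    ⟫ ↺ (map-∑ (m₁,₃,₂₄ S S S S mul ∘ᴸ (δᶠ ⊗₁ δᶠ)) (decompositions [ n ]) (λ d → D d ⟨$⟩ x))
    ⟫ ((m₁,₃,₂₄ S S S S mul ∘ᴸ (δᶠ ⊗₁ δᶠ)) ▹ ≈-sym (Δ-ι n x)))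
    where open Chain S₂₁

  fockStructure : DoubleBialgebraStructure S
  fockStructure = record
    { mul = mul ; one = one ; Δ = Δᶠ ; εΔ = εᶠ ; δ = δᶠ ; ϵδ = ϵᶠ
    ; mul-assoc = mul-assoc ; mul-unitˡ = mul-unitˡ ; mul-unitʳ = mul-unitʳ
    ; Δ-coassoc = Δᶠ-coassoc ; Δ-counitˡ = Δᶠ-counitˡ ; Δ-counitʳ = Δᶠ-counitʳ
    ; Δ-mul = Δᶠ-mul ; Δ-one = Δᶠ-one ; εΔ-mul = εᶠ-mul ; εΔ-one = εᶠ-one
    ; δ-coassoc = δᶠ-coassoc ; δ-counitˡ = δᶠ-counitˡ ; δ-counitʳ = δᶠ-counitʳ
    ; δ-mul = δᶠ-mul ; δ-one = δᶠ-one ; Δ-δ = Δᶠ-δᶠ ; εΔ-δ = εᶠ-δᶠ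
    }

-- Families of vectors over a finite set and their multilinear maps.

module Decorations {ℓ} (K : HeytingField ℓ ℓ ℓ) where
  open Over K
  open Linear K
  private module 𝕜 = CommutativeRing commRing

  record Deco (M : Vect) (X : FinSet) : Set ℓ where
    constructor deco
    field
      at      : Carrier X → ⌊ M ⌋
      at-cong : ∀ {x y} → FinSet._≈_ X x y → M ⊢ at x ≈ at y

  open Deco public

  infix 4 _≈ᵈ_

  _≈ᵈ_ : ∀ {M X} → Deco M X → Deco M X → Set ℓ
  _≈ᵈ_ {M} {X} v w = ∀ x → M ⊢ at v x ≈ at w x

  -- SumAt x u v w: the family u is v + w in the slot x, while u, v, w agree in
  -- all other slots.  Stated as relations, multilinearity needs no updates of
  -- families.

  SumAt : ∀ {M X} → Carrier X → (u v w : Deco M X) → Set ℓ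
  SumAt {M} {X} x u v w =
    (M ⊢ at u x ≈ Module._+ᴹ_ M (at v x) (at w x)) ×
    (∀ y → ¬ FinSet._≈_ X y x → (M ⊢ at v y ≈ at u y) × (M ⊢ at w y ≈ at u y))

  ScaleAt : ∀ {M X} → Carrier X → 𝕜 → (u v : Deco M X) → Set ℓ
  ScaleAt {M} {X} x k u v =
    (M ⊢ at u x ≈ Module._*ₗ_ M k (at v x)) × (∀ y → ¬ FinSet._≈_ X y x → M ⊢ at v y ≈ at u y)

  record Multilinear (M : Vect) (X : FinSet) (Q : Vect) (F : Deco M X → ⌊ Q ⌋) : Set ℓ where
    field
      resp  : ∀ {v w} → v ≈ᵈ w → Q ⊢ F v ≈ F w
      add   : ∀ {x u v w} → SumAt x u v w → Q ⊢ F u ≈ Module._+ᴹ_ Q (F v) (F w)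
      scale : ∀ {x k u v} → ScaleAt x k u v → Q ⊢ F u ≈ Module._*ₗ_ Q k (F v)

  open Multilinear public

  -- Operations on families along which multilinear maps can be pulled back: a change in slot x of
  -- the input is a change of the same kind in one slot of the output. Relabelling, concatenation
  -- and the product over classes are all of this form.
  record SlotwiseLinear (M : Vect) (X : FinSet) (N : Vect) (Y : FinSet) (ψ : Deco M X → Deco N Y) : Set ℓ where
    field
      respˢ  : ∀ {v w} → v ≈ᵈ w → ψ v ≈ᵈ ψ w
      slot   : Carrier X → Carrier Y
      addˢ   : ∀ {x u v w} → SumAt x u v w → SumAt (slot x) (ψ u) (ψ v) (ψ w)
      scaleˢ : ∀ {x k u v} → ScaleAt x k u v → ScaleAt (slot x) k (ψ u) (ψ v)

  multilinear-∘ : ∀ {M X N Y Q F ψ} → Multilinear N Y Q F → SlotwiseLinear M X N Y ψ →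
                  Multilinear M X Q (F ∘ ψ)
  multilinear-∘ m s = record
    { resp  = λ e → resp m (SlotwiseLinear.respˢ s e)
    ; add   = λ a → add m (SlotwiseLinear.addˢ s a)
    ; scale = λ a → scale m (SlotwiseLinear.scaleˢ s a)
    }

  linear-multilinear : ∀ {M X Q R F} (f : Q ⊸ R) → Multilinear M X Q F → Multilinear M X R (λ v → f ⟨$⟩ F v)
  linear-multilinear {R = R} f m = record
    { resp  = λ e → f ▹ resp m e
    ; add   = λ a → (f ▹ add m a) ⟫ _⊸_.+ᴹ-homo f _ _
    ; scale = λ a → (f ▹ scale m a) ⟫ _⊸_.*ₗ-homo f _ _
    }
    where open Chain R

  slotwise-∘ : ∀ {M X N Y O Z ψ φ} → SlotwiseLinear N Y O Z φ → SlotwiseLinear M X N Y ψ →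
               SlotwiseLinear M X O Z (φ ∘ ψ)
  slotwise-∘ s t = record
    { respˢ = λ e → SlotwiseLinear.respˢ s (SlotwiseLinear.respˢ t e)
    ; slot = λ x → SlotwiseLinear.slot s (SlotwiseLinear.slot t x)
    ; addˢ = λ a → SlotwiseLinear.addˢ s (SlotwiseLinear.addˢ t a)
    ; scaleˢ = λ a → SlotwiseLinear.scaleˢ s (SlotwiseLinear.scaleˢ t a)
    }

  infixr 7 _∙ᵈ_

  _∙ᵈ_ : ∀ {M X Y} → X ≃ Y → Deco M X → Deco M Y
  σ ∙ᵈ v = deco (λ y → at v (_≃_.from σ y)) (λ r → at-cong v (_≃_.from-cong σ r))

  ∙ᵈ-slotwise : ∀ {M X Y} (σ : X ≃ Y) → SlotwiseLinear M X M Y (σ ∙ᵈ_)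
  ∙ᵈ-slotwise {M} {X} {Y} σ = record
    { respˢ  = λ e y → e (_≃_.from σ y)
    ; slot   = _≃_.to σ
    ; addˢ   = λ {x} {u} {v} {w} (p , q) →
        (at-cong u (unit x) ⟫ p ⟫ ↺ (Module.+ᴹ-cong M (at-cong v (unit x)) (at-cong w (unit x)))) ,
        (λ y ne → q (_≃_.from σ y) (ne ∘ off))
    ; scaleˢ = λ {x} {k} {u} {v} (p , q) →
        (at-cong u (unit x) ⟫ p ⟫ ↺ (Module.*ₗ-cong M 𝕜.refl (at-cong v (unit x)))) ,
        (λ y ne → q (_≃_.from σ y) (ne ∘ off))
    }
    where
    open Chain M
    unit : ∀ x → FinSet._≈_ X (_≃_.from σ (_≃_.to σ x)) x
    unit = _≃_.strictlyInverseʳ σ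
    off : ∀ {x y} → FinSet._≈_ X (_≃_.from σ y) x → FinSet._≈_ Y y (_≃_.to σ x)
    off r = FinSet.≈-trans Y (FinSet.≈-sym Y (_≃_.strictlyInverseˡ σ _)) (_≃_.to-cong σ r)

  infixr 8 _∘ᵈ_

  _∘ᵈ_ : ∀ {M N X} → M ⊸ N → Deco M X → Deco N X
  f ∘ᵈ v = deco (λ x → f ⟨$⟩ at v x) (λ r → f ▹ at-cong v r)

  ∘ᵈ-slotwise : ∀ {M N X} (f : M ⊸ N) → SlotwiseLinear M X N X (f ∘ᵈ_)
  ∘ᵈ-slotwise {N = N} f = record
    { respˢ  = λ e x → f ▹ e x
    ; slot   = id
    ; addˢ   = λ (p , q) → ((f ▹ p) ⟫ _⊸_.+ᴹ-homo f _ _) , (λ y ne → (f ▹ proj₁ (q y ne)) , (f ▹ proj₂ (q y ne)))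
    ; scaleˢ = λ (p , q) → ((f ▹ p) ⟫ _⊸_.*ₗ-homo f _ _) , (λ y ne → f ▹ q y ne)
    }
    where open Chain N

  _⊎ᵈ_ : ∀ {M X Y} → Deco M X → Deco M Y → Deco M (X ⊔ˢ Y)
  v ⊎ᵈ w = deco (λ { (inj₁ x) → at v x ; (inj₂ y) → at w y })
                (λ { (inj₁ r) → at-cong v r ; (inj₂ r) → at-cong w r })

  ⊎ᵈ-slotwiseˡ : ∀ {M X Y} (w : Deco M Y) → SlotwiseLinear M X M (X ⊔ˢ Y) (_⊎ᵈ w)
  ⊎ᵈ-slotwiseˡ {M} w = record
    { respˢ  = λ e → λ { (inj₁ x) → e x ; (inj₂ y) → ∎ }
    ; slot   = inj₁
    ; addˢ   = λ (p , q) → p , (λ { (inj₁ x) ne → q x (ne ∘ inj₁) ; (inj₂ y) ne → ∎ , ∎ })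
    ; scaleˢ = λ (p , q) → p , (λ { (inj₁ x) ne → q x (ne ∘ inj₁) ; (inj₂ y) ne → ∎ })
    }
    where open Chain M

  ⊎ᵈ-slotwiseʳ : ∀ {M X Y} (v : Deco M X) → SlotwiseLinear M Y M (X ⊔ˢ Y) (v ⊎ᵈ_)
  ⊎ᵈ-slotwiseʳ {M} v = record
    { respˢ  = λ e → λ { (inj₁ x) → ∎ ; (inj₂ y) → e y }
    ; slot   = inj₂
    ; addˢ   = λ (p , q) → p , (λ { (inj₂ x) ne → q x (ne ∘ inj₂) ; (inj₁ y) ne → ∎ , ∎ })
    ; scaleˢ = λ (p , q) → p , (λ { (inj₂ x) ne → q x (ne ∘ inj₂) ; (inj₁ y) ne → ∎ })
    }
    where open Chain M

  fstᵈ : ∀ {M X Y} → Deco M (X ⊔ˢ Y) → Deco M X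
  fstᵈ v = deco (at v ∘ inj₁) (λ r → at-cong v (inj₁ r))

  sndᵈ : ∀ {M X Y} → Deco M (X ⊔ˢ Y) → Deco M Y
  sndᵈ v = deco (at v ∘ inj₂) (λ r → at-cong v (inj₂ r))

  _⊠ᵈ_ : ∀ {M N X} → Deco M X → Deco N X → Deco (M ⊗ N) X
  a ⊠ᵈ b = deco (λ x → at a x ⊗ₜ at b x) (λ r → at-cong a r ⊠ at-cong b r)

  ∅ᵈ : ∀ {M} → Deco M ∅
  ∅ᵈ = deco (λ ()) (λ { {()} })

  finᵈ : ∀ {M n} → (Fin n → ⌊ M ⌋) → Deco M [ n ]
  finᵈ {M} v = deco v (λ { refl → Module.≈ᴹ-refl M })

  module _ {M Q : Vect} where

    consᵈ : ∀ {n} → ⌊ M ⌋ → Deco M [ n ] → Deco M [ suc n ]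
    consᵈ a v = finᵈ (a VF.∷ at v)

    tailᵈ : ∀ {n} → Deco M [ suc n ] → Deco M [ n ]
    tailᵈ v = finᵈ (at v ∘ suc)

    cons-tail : ∀ {n} (v : Deco M [ suc n ]) → v ≈ᵈ consᵈ (at v zero) (tailᵈ v)
    cons-tail v zero    = Module.≈ᴹ-refl M
    cons-tail v (suc i) = Module.≈ᴹ-refl M

    cons-slotwise : ∀ {n} (a : ⌊ M ⌋) → SlotwiseLinear M [ n ] M [ suc n ] (consᵈ a)
    cons-slotwise a = record
      { respˢ  = λ e → λ { zero → ∎ ; (suc i) → e i }
      ; slot   = suc
      ; addˢ   = λ (p , q) → p , (λ { zero ne → ∎ , ∎ ; (suc i) ne → q i (ne ∘ ≡.cong suc) })
      ; scaleˢ = λ (p , q) → p , (λ { zero ne → ∎ ; (suc i) ne → q i (ne ∘ ≡.cong suc) })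
      }
      where open Chain M

    -- Freezing the tail gives a linear map in the head; this is the step by which statements on
    -- families over [n] are proved by induction on n.
    head-linear : ∀ {n} {F : Deco M [ suc n ] → ⌊ Q ⌋} → Multilinear M [ suc n ] Q F → Deco M [ n ] → M ⊸ Q
    head-linear {F = F} m v = linear (λ a → F (consᵈ a v))
      (λ p → resp m (λ { zero → p ; (suc i) → ∎ }))
      (λ a b → add m {zero} (∎ , λ { zero ne → ⊥-elim (ne refl) ; (suc i) ne → ∎ , ∎ }))
      (λ k a → scale m {zero} (∎ , λ { zero ne → ⊥-elim (ne refl) ; (suc i) ne → ∎ }))
      where open Chain M

  module _ {G : Set ℓ} (Q : Vect) where
    private module Q = Module Q
    open Chain Q

    eval-ext : ∀ {f g : G → ⌊ Q ⌋} → (∀ x → Q ⊢ f x ≈ g x) → ∀ t → Q ⊢ eval Q f t ≈ eval Q g t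
    eval-ext h (gen x) = h x
    eval-ext h 𝟎       = ∎
    eval-ext h (s ⊕ t) = Q.+ᴹ-cong (eval-ext h s) (eval-ext h t)
    eval-ext h (k · t) = Q.*ₗ-cong 𝕜.refl (eval-ext h t)

    eval-linear : ∀ {R} (φ : Q ⊸ R) (f : G → ⌊ Q ⌋) t → R ⊢ φ ⟨$⟩ eval Q f t ≈ eval R (λ x → φ ⟨$⟩ f x) t
    eval-linear {R} φ f (gen x) = Module.≈ᴹ-refl R
    eval-linear {R} φ f 𝟎       = _⊸_.0ᴹ-homo φ
    eval-linear {R} φ f (s ⊕ t) = Module.≈ᴹ-trans R (_⊸_.+ᴹ-homo φ _ _)
      (Module.+ᴹ-cong R (eval-linear φ f s) (eval-linear φ f t))
    eval-linear {R} φ f (k · t) = Module.≈ᴹ-trans R (_⊸_.*ₗ-homo φ _ _)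
      (Module.*ₗ-cong R 𝕜.refl (eval-linear φ f t))

    open CommutativeSemigroupProperties
      (CommutativeMonoid.commutativeSemigroup Q.+ᴹ-commutativeMonoid) using (interchange)

    eval-+ : ∀ (f g : G → ⌊ Q ⌋) t → Q ⊢ eval Q (λ x → f x Q.+ᴹ g x) t ≈ eval Q f t Q.+ᴹ eval Q g t
    eval-+ f g (gen x) = ∎
    eval-+ f g 𝟎       = ↺ (Q.+ᴹ-identityˡ _)
    eval-+ f g (s ⊕ t) = Q.+ᴹ-cong (eval-+ f g s) (eval-+ f g t) ⟫ interchange _ _ _ _
    eval-+ f g (k · t) = Q.*ₗ-cong 𝕜.refl (eval-+ f g t) ⟫ Q.*ₗ-distribˡ k _ _

    eval-* : ∀ c (f : G → ⌊ Q ⌋) t → Q ⊢ eval Q (λ x → c Q.*ₗ f x) t ≈ c Q.*ₗ eval Q f t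
    eval-* c f (gen x) = ∎
    eval-* c f 𝟎       = ↺ (Q.*ₗ-zeroʳ c)
    eval-* c f (s ⊕ t) = Q.+ᴹ-cong (eval-* c f s) (eval-* c f t) ⟫ ↺ (Q.*ₗ-distribˡ c _ _)
    eval-* c f (k · t) = Q.*ₗ-cong 𝕜.refl (eval-* c f t) ⟫ ↺ (Q.*ₗ-assoc k c _)
      ⟫ Q.*ₗ-cong (𝕜.*-comm k c) ∎ ⟫ Q.*ₗ-assoc c k _

  record Bimultilinear (M N : Vect) (X : FinSet) (Q : Vect) (G : Deco M X → Deco N X → ⌊ Q ⌋) : Set ℓ where
    field
      multiˡ : ∀ b → Multilinear M X Q (λ a → G a b)
      multiʳ : ∀ a → Multilinear N X Q (G a)

  open Bimultilinear public

  sweedlers-ext : ∀ {A B : Set ℓ} (Q : Vect) n (t : Fin n → Term (A × B)) {f g : (Fin n → A) → (Fin n → B) → ⌊ Q ⌋} →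
                  (∀ a b → Q ⊢ f a b ≈ g a b) → Q ⊢ sweedlers Q t f ≈ sweedlers Q t g
  sweedlers-ext Q zero    t h = h _ _
  sweedlers-ext Q (suc n) t h = eval-ext Q (λ xy → sweedlers-ext Q n (t ∘ suc) (λ a b → h _ _)) (t zero)

  sweedlers-linear : ∀ {A B : Set ℓ} {Q R} (φ : Q ⊸ R) n (t : Fin n → Term (A × B)) f →
                     R ⊢ φ ⟨$⟩ sweedlers Q t f ≈ sweedlers R t (λ a b → φ ⟨$⟩ f a b)
  sweedlers-linear {R = R} φ zero t f = Module.≈ᴹ-refl R
  sweedlers-linear {Q = Q} {R} φ (suc n) t f = eval-linear Q φ _ (t zero)
    ⟫ eval-ext R (λ xy → sweedlers-linear φ n (t ∘ suc) _) (t zero)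
    where open Chain R

  sweedlers-+ : ∀ {A B : Set ℓ} (Q : Vect) n (t : Fin n → Term (A × B)) f g →
                Q ⊢ sweedlers Q t (λ a b → Module._+ᴹ_ Q (f a b) (g a b))
                  ≈ Module._+ᴹ_ Q (sweedlers Q t f) (sweedlers Q t g)
  sweedlers-+ Q zero    t f g = Module.≈ᴹ-refl Q
  sweedlers-+ Q (suc n) t f g = eval-ext Q (λ xy → sweedlers-+ Q n (t ∘ suc) _ _) (t zero) ⟫ eval-+ Q _ _ (t zero)
    where open Chain Q

  sweedlers-* : ∀ {A B : Set ℓ} (Q : Vect) n (t : Fin n → Term (A × B)) c f →
                Q ⊢ sweedlers Q t (λ a b → Module._*ₗ_ Q c (f a b)) ≈ Module._*ₗ_ Q c (sweedlers Q t f)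
  sweedlers-* Q zero    t c f = Module.≈ᴹ-refl Q
  sweedlers-* Q (suc n) t c f = eval-ext Q (λ xy → sweedlers-* Q n (t ∘ suc) c _) (t zero) ⟫ eval-* Q c _ (t zero)
    where open Chain Q

  module _ {M N Q : Vect} where
    private
      sw : ∀ n → (Deco M [ n ] → Deco N [ n ] → ⌊ Q ⌋) → Deco (M ⊗ N) [ n ] → ⌊ Q ⌋
      sw n G τ = sweedlers Q (at τ) (λ a b → G (finᵈ a) (finᵈ b))

    bimulti-tail : ∀ {n} {G : Deco M [ suc n ] → Deco N [ suc n ] → ⌊ Q ⌋} → Bimultilinear M N [ suc n ] Q G →
                   ∀ x y → Bimultilinear M N [ n ] Q (λ a b → G (consᵈ {M} {Q} x a) (consᵈ {N} {Q} y b))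
    bimulti-tail g x y = record
      { multiˡ = λ b → multilinear-∘ (multiˡ g _) (cons-slotwise {M} {Q} x)
      ; multiʳ = λ a → multilinear-∘ (multiʳ g _) (cons-slotwise {N} {Q} y)
      }

    private
      head-bilinear : ∀ {n} {G : Deco M [ suc n ] → Deco N [ suc n ] → ⌊ Q ⌋} → Bimultilinear M N [ suc n ] Q G →
                      Deco (M ⊗ N) [ n ] → Bilinear M N Q
      head-bilinear {n} {G} g τ = record
        { fun  = λ x y → sw n (λ a b → G (consᵈ {M} {Q} x a) (consᵈ {N} {Q} y b)) τ
        ; cong = λ {x} {x′} {y} {y′} p q → sweedlers-ext Q n (at τ) (λ a b →
            (head-linear (multiˡ g _) (finᵈ a) ▹ p) ⟫ (head-linear (multiʳ g _) (finᵈ b) ▹ q))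
        ; +ˡ   = λ x x′ y → sweedlers-ext Q n (at τ) (λ a b → _⊸_.+ᴹ-homo (head-linear (multiˡ g _) (finᵈ a)) x x′)
                   ⟫ sweedlers-+ Q n (at τ) _ _
        ; +ʳ   = λ x y y′ → sweedlers-ext Q n (at τ) (λ a b → _⊸_.+ᴹ-homo (head-linear (multiʳ g _) (finᵈ b)) y y′)
                   ⟫ sweedlers-+ Q n (at τ) _ _
        ; *ˡ   = λ k x y → sweedlers-ext Q n (at τ) (λ a b → _⊸_.*ₗ-homo (head-linear (multiˡ g _) (finᵈ a)) k x)
                   ⟫ sweedlers-* Q n (at τ) k _
        ; *ʳ   = λ k x y → sweedlers-ext Q n (at τ) (λ a b → _⊸_.*ₗ-homo (head-linear (multiʳ g _) (finᵈ b)) k y)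
                   ⟫ sweedlers-* Q n (at τ) k _
        }
        where open Chain Q

      sw-head : ∀ {n} {G : Deco M [ suc n ] → Deco N [ suc n ] → ⌊ Q ⌋} → Bimultilinear M N [ suc n ] Q G →
                Deco (M ⊗ N) [ n ] → M ⊗ N ⊸ Q
      sw-head g τ = ⊗-lift (head-bilinear g τ)

      -- In the first slot the expansion factors through a bilinear map on M × N, hence through M ⊗
      -- N, so it does not depend on how that tensor is written; the other slots follow by
      -- induction, applied under the evaluation of the first.
      sw-multilinear : ∀ n {G} → Bimultilinear M N [ n ] Q G → Multilinear (M ⊗ N) [ n ] Q (sw n G)
      sw-multilinear zero g = record
        { resp = λ e → Module.≈ᴹ-refl Q ; add = λ { {()} } ; scale = λ { {()} } }
      sw-multilinear (suc n) {G} g = record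
        { resp  = λ {τ} {υ} e → (sw-head g (tl τ) ▹ e zero)
            ⟫ eval-ext Q (λ xy → resp (tail-multi xy) {tl τ} {tl υ} (e ∘ suc)) (at υ zero)
        ; add   = λ {x} {u} {v} {w} → add′ {x} {u} {v} {w}
        ; scale = λ {x} {k} {u} {v} → scale′ {x} {k} {u} {v}
        }
        where
        open Chain Q
        tail-multi : ∀ (xy : ⌊ M ⌋ × ⌊ N ⌋) → Multilinear (M ⊗ N) [ n ] Q
                       (sw n (λ a b → G (consᵈ {M} {Q} (proj₁ xy) a) (consᵈ {N} {Q} (proj₂ xy) b)))
        tail-multi xy = sw-multilinear n (bimulti-tail g (proj₁ xy) (proj₂ xy))

        tl : Deco (M ⊗ N) [ suc n ] → Deco (M ⊗ N) [ n ]
        tl = tailᵈ {M ⊗ N} {Q}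

        0≢s : ∀ {i : Fin n} → ¬ (Fin.suc i ≡ zero)
        0≢s ()
        s≢0 : ∀ {i : Fin n} → ¬ (zero ≡ Fin.suc i)
        s≢0 ()
        s-inj : ∀ {i j : Fin n} → Fin.suc i ≡ suc j → i ≡ j
        s-inj refl = refl

        change-tail : ∀ {τ υ : Deco (M ⊗ N) [ suc n ]} t → tl τ ≈ᵈ tl υ →
                      Q ⊢ sw-head g (tl τ) ⟨$⟩ t ≈ sw-head g (tl υ) ⟨$⟩ t
        change-tail {τ} {υ} t e = eval-ext Q (λ xy → resp (tail-multi xy) {tl τ} {tl υ} e) t

        add′ : ∀ {x u v w} → SumAt x u v w → Q ⊢ sw (suc n) G u ≈ Module._+ᴹ_ Q (sw (suc n) G v) (sw (suc n) G w)
        add′ {zero} {u} {v} {w} (p , q) = (sw-head g (tl u) ▹ p) ⟫ _⊸_.+ᴹ-homo (sw-head g (tl u)) (at v zero) (at w zero)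
          ⟫ Module.+ᴹ-cong Q (change-tail {u} {v} (at v zero) (λ i → ≈-sym (proj₁ (q (suc i) 0≢s))))
                             (change-tail {u} {w} (at w zero) (λ i → ≈-sym (proj₂ (q (suc i) 0≢s))))
        -- A change in a later slot happens inside the evaluation of the head term. The heads of `v`
        -- and `w` agree with that of `u` only as tensors, so the bilinear lift is used to exchange
        -- them.
        add′ {suc i} {u} {v} {w} (p , q) =
          eval-ext Q (λ xy → add (tail-multi xy) {i} {tl u} {tl v} {tl w} (p , λ j ne → q (suc j) (ne ∘ s-inj))) (at u zero)
          ⟫ eval-+ Q _ _ (at u zero)
          ⟫ ↺ (Module.+ᴹ-cong Q (sw-head g (tl v) ▹ proj₁ (q zero s≢0)) (sw-head g (tl w) ▹ proj₂ (q zero s≢0)))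

        scale′ : ∀ {x k u v} → ScaleAt x k u v → Q ⊢ sw (suc n) G u ≈ Module._*ₗ_ Q k (sw (suc n) G v)
        scale′ {zero} {k} {u} {v} (p , q) = (sw-head g (tl u) ▹ p) ⟫ _⊸_.*ₗ-homo (sw-head g (tl u)) k (at v zero)
          ⟫ Module.*ₗ-cong Q 𝕜.refl (change-tail {u} {v} (at v zero) (λ i → ≈-sym (q (suc i) 0≢s)))
        scale′ {suc i} {k} {u} {v} (p , q) =
          eval-ext Q (λ xy → scale (tail-multi xy) {i} {k} {tl u} {tl v} (p , λ j ne → q (suc j) (ne ∘ s-inj))) (at u zero)
          ⟫ eval-* Q k _ (at u zero)
          ⟫ ↺ (Module.*ₗ-cong Q 𝕜.refl (sw-head g (tl v) ▹ q zero s≢0))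

      sw-pure : ∀ n {G} → Bimultilinear M N [ n ] Q G → ∀ a b → Q ⊢ sw n G (a ⊠ᵈ b) ≈ G a b
      sw-pure zero g a b = Module.≈ᴹ-trans Q (resp (multiˡ g _) (λ ())) (resp (multiʳ g _) (λ ()))
      sw-pure (suc n) g a b = sw-pure n (bimulti-tail g (at a zero) (at b zero)) (tailᵈ {M} {Q} a) (tailᵈ {N} {Q} b)
        ⟫ resp (multiˡ g _) (λ i → Module.≈ᴹ-sym M (cons-tail {M} {Q} a i))
        ⟫ resp (multiʳ g _) (λ i → Module.≈ᴹ-sym N (cons-tail {N} {Q} b i))
        where open Chain Q

      -- Pure tensors span in every slot: for a fixed tail the function is linear in the head, so
      -- pure heads suffice, and the tail is treated by induction.
      sw-ext : ∀ n {F F′ : Deco (M ⊗ N) [ n ] → ⌊ Q ⌋} → Multilinear (M ⊗ N) [ n ] Q F → Multilinear (M ⊗ N) [ n ] Q F′ →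
               (∀ a b → Q ⊢ F (a ⊠ᵈ b) ≈ F′ (a ⊠ᵈ b)) → ∀ τ → Q ⊢ F τ ≈ F′ τ
      sw-ext zero f f′ h τ = resp f (λ ()) ⟫ h ∅ᵈ ∅ᵈ ⟫ resp f′ (λ ())
        where open Chain Q
      sw-ext (suc n) f f′ h τ = resp f (cons-tail {M ⊗ N} {Q} τ)
        ⟫ ⊗-ext (head-linear f (tailᵈ {M ⊗ N} {Q} τ)) (head-linear f′ (tailᵈ {M ⊗ N} {Q} τ))
            (λ x y → sw-ext n (multilinear-∘ f (cons-slotwise {M ⊗ N} {Q} (x ⊗ₜ y)))
                              (multilinear-∘ f′ (cons-slotwise {M ⊗ N} {Q} (x ⊗ₜ y)))
              (λ a b → resp f (pure-cons x y a b) ⟫ h (consᵈ {M} {Q} x a) (consᵈ {N} {Q} y b)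
                       ⟫ ↺ (resp f′ (pure-cons x y a b)))
              (tailᵈ {M ⊗ N} {Q} τ)) (at τ zero)
        ⟫ ↺ (resp f′ (cons-tail {M ⊗ N} {Q} τ))
        where
        open Chain Q
        pure-cons : ∀ x y (a : Deco M [ n ]) (b : Deco N [ n ]) →
          consᵈ {M ⊗ N} {Q} (x ⊗ₜ y) (a ⊠ᵈ b) ≈ᵈ (consᵈ {M} {Q} x a) ⊠ᵈ (consᵈ {N} {Q} y b)
        pure-cons x y a b zero    = ≈-refl
        pure-cons x y a b (suc i) = ≈-refl

    module _ (X : FinSet) where
      private
        e : X ≃ [ size X ]
        e = enum≃ X

        round : ∀ {L} (v : Deco L X) → (e ⁻¹≃) ∙ᵈ (e ∙ᵈ v) ≈ᵈ v
        round v x = at-cong v (_≃_.strictlyInverseʳ e x)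

        pull : ∀ {G : Deco M X → Deco N X → ⌊ Q ⌋} → Bimultilinear M N X Q G →
               Bimultilinear M N [ size X ] Q (λ a b → G (e ⁻¹≃ ∙ᵈ a) (e ⁻¹≃ ∙ᵈ b))
        pull g = record
          { multiˡ = λ b → multilinear-∘ (multiˡ g _) (∙ᵈ-slotwise (e ⁻¹≃))
          ; multiʳ = λ a → multilinear-∘ (multiʳ g _) (∙ᵈ-slotwise (e ⁻¹≃))
          }

      -- The Sweedler expansion over an unordered set, computed through the enumeration of X.
      -- Multilinearity and the values on pure tensors characterise it, by `multi-ext`, so
      -- identities for it can be checked on pure decorations.
      expand : (Deco M X → Deco N X → ⌊ Q ⌋) → Deco (M ⊗ N) X → ⌊ Q ⌋
      expand G τ = sw (size X) (λ a b → G (e ⁻¹≃ ∙ᵈ a) (e ⁻¹≃ ∙ᵈ b)) (e ∙ᵈ τ)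

      expand-multilinear : ∀ {G} → Bimultilinear M N X Q G → Multilinear (M ⊗ N) X Q (expand G)
      expand-multilinear g = multilinear-∘ (sw-multilinear (size X) (pull g)) (∙ᵈ-slotwise e)

      expand-pure : ∀ {G} → Bimultilinear M N X Q G → ∀ a b → Q ⊢ expand G (a ⊠ᵈ b) ≈ G a b
      expand-pure g a b = resp (sw-multilinear (size X) (pull g)) {e ∙ᵈ (a ⊠ᵈ b)} {(e ∙ᵈ a) ⊠ᵈ (e ∙ᵈ b)} (λ _ → ≈-refl) ⟫ sw-pure (size X) (pull g) (e ∙ᵈ a) (e ∙ᵈ b)
        ⟫ resp (multiˡ g _) (round a) ⟫ resp (multiʳ g _) (round b)
        where open Chain Q

      multi-ext : ∀ {F F′ : Deco (M ⊗ N) X → ⌊ Q ⌋} → Multilinear (M ⊗ N) X Q F → Multilinear (M ⊗ N) X Q F′ →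
                  (∀ a b → Q ⊢ F (a ⊠ᵈ b) ≈ F′ (a ⊠ᵈ b)) → ∀ τ → Q ⊢ F τ ≈ F′ τ
      multi-ext {F} {F′} f f′ h τ = ↺ (resp f (round τ))
        ⟫ sw-ext (size X) (multilinear-∘ f (∙ᵈ-slotwise (e ⁻¹≃))) (multilinear-∘ f′ (∙ᵈ-slotwise (e ⁻¹≃)))
            (λ a b → resp f (λ _ → ≈-refl) ⟫ h (e ⁻¹≃ ∙ᵈ a) (e ⁻¹≃ ∙ᵈ b) ⟫ resp f′ (λ _ → ≈-refl)) (e ∙ᵈ τ)
        ⟫ resp f′ (round τ)
        where open Chain Q

-- Products over the classes of an equivalence.

module _ {c ℓ} (M : CommutativeMonoid c ℓ) where
  open Sums M
  open CommutativeMonoid M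
    renaming (Carrier to C; _∙_ to _+_; ε to 0#; ∙-cong to +-cong; identityˡ to +-identityˡ;
              identityʳ to +-identityʳ; assoc to +-assoc; refl to ≈-refl; sym to ≈-sym; trans to ≈-trans)

  -- A product over a class can start from any chosen representative: the sum over the class is the
  -- entry there combined with the sum over the rest.
  ⨁-extract : ∀ {a p q} {A : Set a} {P : Pred A p} {Q : Pred A q} (P? : Decidable P) (Q? : Decidable Q)
              {as : List A} {f : A → C} {y} → ExactlyOne Q as → (∀ x → Q x → P x) → (∀ x → Q x → f x ≈ y) →
              ⨁ as (λ x → when (P? x) (f x)) ≈ y + ⨁ as (λ x → when (P? x ×-dec ¬? (Q? x)) (f x))
  ⨁-extract P? Q? {as} {f} e h k = ≈-trans
    (⨁-cong as (λ x → split x (P? x) (Q? x) (h x)))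
    (≈-trans (⨁-+ as _ _) (+-cong (⨁-when Q? e k) ≈-refl))
    where
    split : ∀ {p q} {P : Set p} {Q : Set q} x (d : Dec P) (d′ : Dec Q) → (Q → P) →
            when d (f x) ≈ when d′ (f x) + when (d ×-dec ¬? d′) (f x)
    split x (yes p) (yes q) h = ≈-sym (+-identityʳ _)
    split x (yes p) (no n)  h = ≈-sym (+-identityˡ _)
    split x (no n)  (yes q) h = ⊥-elim (n (h q))
    split x (no n)  (no m)  h = ≈-sym (+-identityˡ _)

  ⨁-filter : ∀ {a p} {A : Set a} {P : Pred A p} (P? : Decidable P) (as : List A) (f : A → C) →
             ⨁ (filter P? as) f ≈ ⨁ as (λ x → when (P? x) (f x))
  ⨁-filter P? []       f = ≈-refl
  ⨁-filter P? (x ∷ as) f with P? x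
  ... | yes _ = +-cong ≈-refl (⨁-filter P? as f)
  ... | no _  = ≈-trans (⨁-filter P? as f) (≈-sym (+-identityˡ _))

⨁-hom : ∀ {c ℓ c′ ℓ′} (M : CommutativeMonoid c ℓ) (N : CommutativeMonoid c′ ℓ′) →
        let module M = CommutativeMonoid M
            module N = CommutativeMonoid N
        in (φ : M.Carrier → N.Carrier) → φ M.ε N.≈ N.ε → (∀ x y → φ (x M.∙ y) N.≈ φ x N.∙ φ y) →
        ∀ {a} {A : Set a} (as : List A) f → φ (Sums.⨁ M as f) N.≈ Sums.⨁ N as (φ ∘ f)
⨁-hom M N φ z h []       f = z
⨁-hom M N φ z h (x ∷ as) f = N.trans (h _ _) (N.∙-cong N.refl (⨁-hom M N φ z h as f))
  where module N = CommutativeMonoid N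

elements : ∀ X → List (FinSet.Carrier X)
elements X = tabulateᴸ (_≃_.from (enum≃ X))

one-element : ∀ X x → ExactlyOne (λ y → FinSet._≈_ X y x) (elements X)
one-element X x = one-tabulate _ e.from (e.to x) (e.strictlyInverseʳ x)
  (λ i r → ≡.trans (≡.sym (e.strictlyInverseˡ i)) (e.to-cong r))
  where module e = _≃_ (enum≃ X)

module BlockProducts {ℓ} (K : HeytingField ℓ ℓ ℓ) where
  open Over K
  open Linear K
  open Decorations K
  private module 𝕜 = CommutativeRing commRing

  -- A not necessarily unitary commutative algebra; Maybe adjoins a unit, which
  -- makes products over arbitrary finite families available.

  record CommAlgebra : Set (lsuc ℓ) where
    field
      space : Vect
      mul   : space ⊗ space ⊸ space
      assoc : ∀ x y z → space ⊢ mul ⟨$⟩ (mul ⟨$⟩ x ⊗ₜ y) ⊗ₜ z ≈ mul ⟨$⟩ x ⊗ₜ (mul ⟨$⟩ y ⊗ₜ z)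
      comm  : ∀ x y → space ⊢ mul ⟨$⟩ x ⊗ₜ y ≈ mul ⟨$⟩ y ⊗ₜ x

    infixl 7 _·ᴬ_

    _·ᴬ_ : ⌊ space ⌋ → ⌊ space ⌋ → ⌊ space ⌋
    x ·ᴬ y = mul ⟨$⟩ x ⊗ₜ y

    unital : CommutativeMonoid ℓ ℓ
    unital = record { isCommutativeMonoid = record
      { isMonoid = AddIdentity.isMonoid {_≈_ = Module._≈ᴹ_ space} {op = _·ᴬ_} (record
        { isMagma = record
          { isEquivalence = Module.≈ᴹ-isEquivalence space
          ; ∙-cong = λ p q → mul ▹ p ⊠ q
          }
        ; assoc = assoc
        })
      ; comm = λ { (just x) (just y) → just≈ (comm x y)
                 ; (just x) nothing  → just≈ (Module.≈ᴹ-refl space)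
                 ; nothing  (just y) → just≈ (Module.≈ᴹ-refl space)
                 ; nothing  nothing  → ∙≈∙ }
      } }

    module U = CommutativeMonoid unital

    infixr 6 _◃_

    -- A product with at least one genuine factor stays in the algebra itself; only the remaining
    -- factors may form an empty product, that is, the adjoined unit.
    _◃_ : ⌊ space ⌋ → Maybe ⌊ space ⌋ → ⌊ space ⌋
    x ◃ nothing = x
    x ◃ just y  = x ·ᴬ y

    just-◃ : ∀ x r → just (x ◃ r) U.≈ just x U.∙ r
    just-◃ x nothing  = just≈ (Module.≈ᴹ-refl space)
    just-◃ x (just y) = just≈ (Module.≈ᴹ-refl space)

    drop-just : ∀ {x y} → just x U.≈ just y → space ⊢ x ≈ y
    drop-just (just≈ p) = p

    ◃-linear : Maybe ⌊ space ⌋ → space ⊸ space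
    ◃-linear nothing  = idᴸ
    ◃-linear (just y) = mul ∘ᴸ inˡ y

    ◃-≈ : ∀ x r → space ⊢ ◃-linear r ⟨$⟩ x ≈ x ◃ r
    ◃-≈ x nothing  = Module.≈ᴹ-refl space
    ◃-≈ x (just y) = Module.≈ᴹ-refl space

    ◃-cong : ∀ {x y r s} → space ⊢ x ≈ y → r U.≈ s → space ⊢ x ◃ r ≈ y ◃ s
    ◃-cong p (just≈ q) = mul ▹ p ⊠ q
    ◃-cong p ∙≈∙       = p

    open Sums unital public

    -- The product over the class of x in the unital algebra, symmetric in the elements of the
    -- class. It is compared with `blockAt`, which starts at x and therefore has values in the
    -- algebra without adjoined unit.
    over : ∀ {X} (E : 𝓔 X) → (Carrier X → ⌊ space ⌋) → Carrier X → Maybe ⌊ space ⌋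
    over {X} E v x = ⨁ (elements X) (λ y → when (𝓔._∼?_ E y x) (just (v y)))

    rest : ∀ {X} (E : 𝓔 X) → (Carrier X → ⌊ space ⌋) → Carrier X → Maybe ⌊ space ⌋
    rest {X} E v x = ⨁ (elements X) (λ y → when (𝓔._∼?_ E y x ×-dec ¬? (≈-dec X y x)) (just (v y)))

    blockAt : ∀ {X} (E : 𝓔 X) → Deco space X → Carrier X → ⌊ space ⌋
    blockAt E v x = at v x ◃ rest E (at v) x

    blockAt-over : ∀ {X} (E : 𝓔 X) (v : Deco space X) x → just (blockAt E v x) U.≈ over E (at v) x
    blockAt-over {X} E v x = U.trans (just-◃ (at v x) (rest E (at v) x))
      (U.sym (⨁-extract unital (λ y → 𝓔._∼?_ E y x) (λ y → ≈-dec X y x) (one-element X x)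
        (λ y → 𝓔.reflexive E) (λ y r → just≈ (at-cong v r))))

    over-cong : ∀ {X} (E : 𝓔 X) {v w : Carrier X → ⌊ space ⌋} {x y} → 𝓔._∼_ E x y →
                (∀ z → 𝓔._∼_ E z x → space ⊢ v z ≈ w z) → over E v x U.≈ over E w y
    over-cong {X} E {x = x} {y} r h = ⨁-cong (elements X) (λ z → when-cong (𝓔._∼?_ E z x) (𝓔._∼?_ E z y)
      (λ s → 𝓔.∼-trans E s r) (λ s → 𝓔.∼-trans E s (𝓔.∼-sym E r)) (λ s → just≈ (h z s)))

    -- The families w^∼ of the second coproduct.

    π : ∀ {X} (E : 𝓔 X) → Deco space X → Deco space (X / E)
    π E v = deco (blockAt E v) (λ {x} {y} r → drop-just (U.trans (blockAt-over E v x)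
      (U.trans (over-cong E r (λ _ _ → Module.≈ᴹ-refl space)) (U.sym (blockAt-over E v y)))))

    -- Since `just` is injective, a class product is identified by computing `over` in the unital
    -- monoid, where sums may be reindexed freely. Most identities for `π` are proved this way.
    π-unique : ∀ {X} (E : 𝓔 X) (v : Deco space X) x a → just a U.≈ over E (at v) x → space ⊢ at (π E v) x ≈ a
    π-unique E v x a h = drop-just (U.trans (blockAt-over E v x) (U.sym h))

    rest-agree : ∀ {X} (E : 𝓔 X) {v w : Deco space X} x →
                 (∀ y → ¬ FinSet._≈_ X y x → space ⊢ at v y ≈ at w y) → rest E (at v) x U.≈ rest E (at w) x
    rest-agree {X} E x h = ⨁-cong (elements X) (λ y → when-cong (𝓔._∼?_ E y x ×-dec ¬? (≈-dec X y x)) (𝓔._∼?_ E y x ×-dec ¬? (≈-dec X y x))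
      id id (λ (_ , n) → just≈ (h y n)))

    π-agree : ∀ {X} (E : 𝓔 X) {v w : Deco space X} {x} →
              (∀ y → ¬ FinSet._≈_ X y x → space ⊢ at v y ≈ at w y) →
              ∀ z → ¬ 𝓔._∼_ E z x → space ⊢ at (π E v) z ≈ at (π E w) z
    π-agree E {v} {w} h z n = π-unique E v z _ (U.trans (blockAt-over E w z)
      (over-cong E (𝓔.∼-refl E) (λ y r → Module.≈ᴹ-sym space
        (h y (λ e → n (𝓔.∼-trans E (𝓔.∼-sym E r) (𝓔.reflexive E e)))))))

    -- A change in slot x reaches only the class of x, and there the product is a linear function of
    -- its factor at x, the others being fixed. Starting `blockAt` at x itself makes this visible.
    π-slotwise : ∀ {X} (E : 𝓔 X) → SlotwiseLinear space X space (X / E) (π E)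
    π-slotwise {X} E = record
      { respˢ  = λ {v} {w} e x → ◃-cong (e x) (rest-agree E {v} {w} x (λ y _ → e y))
      ; slot   = id
      ; addˢ   = λ {x} {u} {v} {w} (p , q) →
          (◃-cong {r = rest E (at u) x} {rest E (at u) x} p U.refl ⟫ ↺ (◃-≈ (Module._+ᴹ_ space (at v x) (at w x)) (rest E (at u) x))
            ⟫ _⊸_.+ᴹ-homo (◃-linear (rest E (at u) x)) (at v x) (at w x)
            ⟫ Module.+ᴹ-cong space
                (◃-≈ (at v x) (rest E (at u) x) ⟫ ◃-cong {at v x} ∎ (rest-agree E {u} {v} x (λ y n → ↺ (proj₁ (q y n)))))
                (◃-≈ (at w x) (rest E (at u) x) ⟫ ◃-cong {at w x} ∎ (rest-agree E {u} {w} x (λ y n → ↺ (proj₂ (q y n)))))) ,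
          (λ z n → π-agree E {v} {u} (λ y ne → proj₁ (q y ne)) z n , π-agree E {w} {u} (λ y ne → proj₂ (q y ne)) z n)
      ; scaleˢ = λ {x} {k} {u} {v} (p , q) →
          (◃-cong {r = rest E (at u) x} {rest E (at u) x} p U.refl ⟫ ↺ (◃-≈ (Module._*ₗ_ space k (at v x)) (rest E (at u) x))
            ⟫ _⊸_.*ₗ-homo (◃-linear (rest E (at u) x)) k (at v x)
            ⟫ Module.*ₗ-cong space 𝕜.refl
                (◃-≈ (at v x) (rest E (at u) x) ⟫ ◃-cong {at v x} ∎ (rest-agree E {u} {v} x (λ y n → ↺ (q y n))))) ,
          (λ z n → π-agree E {v} {u} q z n)
      }
      where open Chain space

    π-∙ : ∀ {X Y} (σ : X ≃ Y) (E : 𝓔 X) (E′ : 𝓔 Y) (t : E′ ≐ transport σ E) (v : Deco space X) →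
          π E′ (σ ∙ᵈ v) ≈ᵈ quotient≃ σ E E′ t ∙ᵈ π E v
    π-∙ {X} {Y} σ E E′ t v y = π-unique E′ (σ ∙ᵈ v) y _ (U.trans (blockAt-over E v (_≃_.from σ y)) (U.sym
      (⨁-reindex (λ y′ x → FinSet._≈_ X (_≃_.from σ y′) x) (λ y′ x → ≈-dec X _ x)
        (λ y′ → inj₁ (one-resp (λ _ → X.≈-sym) (λ _ → X.≈-sym) (one-element X (_≃_.from σ y′))))
        (λ x → inj₁ (one-resp
          (λ y′ r → X.≈-trans (_≃_.from-cong σ r) (_≃_.strictlyInverseʳ σ x))
          (λ y′ r → FinSet.≈-trans Y (FinSet.≈-sym Y (_≃_.strictlyInverseˡ σ y′)) (_≃_.to-cong σ r))
          (one-element Y (_≃_.to σ x))))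
        (λ y′ x r → when-cong (𝓔._∼?_ E′ y′ y) (𝓔._∼?_ E x (_≃_.from σ y))
          (λ s → 𝓔.∼-trans E (𝓔.reflexive E (X.≈-sym r)) (proj₂ t s))
          (λ s → proj₁ t (𝓔.∼-trans E (𝓔.reflexive E r) s))
          (λ _ → just≈ (at-cong v r))))))
      where module X = FinSet X

    -- The class of x for the coarser `E` is a union of classes of `E′`. Expanding the inner
    -- products and interchanging the two sums leaves, for each y, a sum over the elements of X/E′
    -- that equal y there, which has exactly one term.
    π-π : ∀ {X} (E E′ : 𝓔 X) (le : E ≤ᴱ E′) (v : Deco space X) x →
          space ⊢ at (π (descend E E′ le) (π E′ v)) x ≈ at (π E v) x
    π-π {X} E E′ le v x = π-unique (descend E E′ le) (π E′ v) x _ (U.trans (blockAt-over E v x)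
      (U.sym (U.trans
        (⨁-cong (elements (X / E′)) (λ z → expanded z (𝓔._∼?_ E z x)))
        (U.trans (⨁-swap (elements (X / E′)) (elements X) _)
          (⨁-cong (elements X) (λ y → ⨁-single (one-element (X / E′) y)
            (λ z r → collapse y z r (𝓔._∼?_ E z x))
            (λ z n → missed y z n (𝓔._∼?_ E z x))))))))
      where
      inner : ∀ z {p} {P : Set p} → Dec P → Carrier X → Maybe ⌊ space ⌋
      inner z d y = when d (when (𝓔._∼?_ E′ y z) (just (at v y)))

      expanded : ∀ z {p} {P : Set p} (d : Dec P) → when d (just (at (π E′ v) z)) U.≈ ⨁ (elements X) (inner z d)
      expanded z (yes _) = blockAt-over E′ v z
      expanded z (no _)  = U.sym (⨁-0 (elements X))

      collapse : ∀ y z → 𝓔._∼_ E′ z y → ∀ d → inner z d y U.≈ when (𝓔._∼?_ E y x) (just (at v y))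
      collapse y z r (yes s) = U.trans (when-yes (𝓔._∼?_ E′ y z) _ (𝓔.∼-sym E′ r))
        (U.sym (when-yes (𝓔._∼?_ E y x) _ (𝓔.∼-trans E (le (𝓔.∼-sym E′ r)) s)))
      collapse y z r (no n)  = U.sym (when-no (𝓔._∼?_ E y x) _ (λ s → n (𝓔.∼-trans E (le r) s)))

      missed : ∀ y z → ¬ 𝓔._∼_ E′ z y → ∀ {p} {P : Set p} (d : Dec P) → inner z d y U.≈ nothing
      missed y z n (yes _) = when-no (𝓔._∼?_ E′ y z) _ (λ r → n (𝓔.∼-sym E′ r))
      missed y z n (no _)  = U.refl

    π-equality : ∀ {X} (E : 𝓔 X) → IsEquality E → (v : Deco space X) → ∀ x → space ⊢ at (π E v) x ≈ at v x
    π-equality {X} E eq v x = π-unique E v x (at v x) (U.sym (⨁-when (λ y → 𝓔._∼?_ E y x)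
      (one-resp (λ y → 𝓔.reflexive E) (λ y → eq) (one-element X x))
      (λ y r → just≈ (at-cong v (eq r)))))

    -- If `E` splits, the class of an element of X contains nothing of Y, so the factors indexed by
    -- Y are the adjoined unit and drop out.
    π-splitˡ : ∀ {X Y} (E : 𝓔 (X ⊔ˢ Y)) → Splits E → (v : Deco space (X ⊔ˢ Y)) → ∀ x →
               space ⊢ at (π E v) (inj₁ x) ≈ at (π (restrictˡ E) (fstᵈ v)) x
    π-splitˡ {X} {Y} E s v x = π-unique E v (inj₁ x) _ (U.trans (blockAt-over (restrictˡ E) (fstᵈ v) x) (U.sym
      (⨁-reindex (λ z y → FinSet._≈_ (X ⊔ˢ Y) z (inj₁ y)) (λ z y → ≈-dec (X ⊔ˢ Y) z (inj₁ y))
        row (λ y → inj₁ (one-element (X ⊔ˢ Y) (inj₁ y)))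
        (λ { z y r → when-cong (𝓔._∼?_ E z (inj₁ x)) (𝓔._∼?_ E (inj₁ y) (inj₁ x))
          (λ q → 𝓔.∼-trans E (𝓔.∼-sym E (𝓔.reflexive E r)) q) (λ q → 𝓔.∼-trans E (𝓔.reflexive E r) q)
          (λ _ → just≈ (at-cong v r)) }))))
      where
      row : ∀ z → ExactlyOne (λ y → FinSet._≈_ (X ⊔ˢ Y) z (inj₁ y)) (elements X) ⊎
            (when (𝓔._∼?_ E z (inj₁ x)) (just (at v z)) U.≈ nothing × (∀ y → ¬ FinSet._≈_ (X ⊔ˢ Y) z (inj₁ y)))
      row (inj₁ z) = inj₁ (one-resp (λ y r → inj₁ (FinSet.≈-sym X r)) (λ y r → FinSet.≈-sym X (drop-inj₁ r)) (one-element X z))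
      row (inj₂ z) = inj₂ (when-no (𝓔._∼?_ E (inj₂ z) (inj₁ x)) _ (λ r → case (proj₂ s r)) , λ y → λ ())
        where
        case : ∀ {R : X .Carrier → X .Carrier → Set} {T : Y .Carrier → Y .Carrier → Set} {z x} → ¬ Pointwise R T (inj₂ z) (inj₁ x)
        case ()

    π-splitʳ : ∀ {X Y} (E : 𝓔 (X ⊔ˢ Y)) → Splits E → (v : Deco space (X ⊔ˢ Y)) → ∀ x →
               space ⊢ at (π E v) (inj₂ x) ≈ at (π (restrictʳ E) (sndᵈ v)) x
    π-splitʳ {X} {Y} E s v x = π-unique E v (inj₂ x) _ (U.trans (blockAt-over (restrictʳ E) (sndᵈ v) x) (U.sym
      (⨁-reindex (λ z y → FinSet._≈_ (X ⊔ˢ Y) z (inj₂ y)) (λ z y → ≈-dec (X ⊔ˢ Y) z (inj₂ y))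
        row (λ y → inj₁ (one-element (X ⊔ˢ Y) (inj₂ y)))
        (λ { z y r → when-cong (𝓔._∼?_ E z (inj₂ x)) (𝓔._∼?_ E (inj₂ y) (inj₂ x))
          (λ q → 𝓔.∼-trans E (𝓔.∼-sym E (𝓔.reflexive E r)) q) (λ q → 𝓔.∼-trans E (𝓔.reflexive E r) q)
          (λ _ → just≈ (at-cong v r)) }))))
      where
      row : ∀ z → ExactlyOne (λ y → FinSet._≈_ (X ⊔ˢ Y) z (inj₂ y)) (elements Y) ⊎
            (when (𝓔._∼?_ E z (inj₂ x)) (just (at v z)) U.≈ nothing × (∀ y → ¬ FinSet._≈_ (X ⊔ˢ Y) z (inj₂ y)))
      row (inj₂ z) = inj₁ (one-resp (λ y r → inj₂ (FinSet.≈-sym Y r)) (λ y r → FinSet.≈-sym Y (drop-inj₂ r)) (one-element Y z))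
      row (inj₁ z) = inj₂ (when-no (𝓔._∼?_ E (inj₁ z) (inj₂ x)) _ (λ r → case (proj₂ s r)) , λ y → λ ())
        where
        case : ∀ {R : X .Carrier → X .Carrier → Set} {T : Y .Carrier → Y .Carrier → Set} {z x} → ¬ Pointwise R T (inj₁ z) (inj₂ x)
        case ()

    -- Commutativity moves the starting value of the fold to the front, which is the form in which
    -- `⨁-extract` splits off a representative.
    foldr-over : ∀ {I : Set} (as : List I) (v : I → ⌊ space ⌋) a →
                 just (foldr (λ i x → mul ⟨$⟩ v i ⊗ₜ x) a as) U.≈ just a U.∙ ⨁ as (just ∘ v)
    foldr-over []       v a = U.sym (U.identityʳ (just a))
    foldr-over (i ∷ as) v a = U.trans (U.∙-cong (U.refl {just (v i)}) (foldr-over as v a))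
      (U.trans (U.sym (U.assoc (just (v i)) (just a) _)) (U.trans (U.∙-cong (U.comm (just (v i)) (just a)) U.refl)
        (U.assoc (just a) (just (v i)) _)))

  module _ (A B : CommAlgebra) where
    private
      module A = CommAlgebra A
      module B = CommAlgebra B

    -- A multiplicative map extends to a homomorphism of the algebras with adjoined unit, which
    -- commutes with finite products. It is used for δ_V, with values in V ⊗ V, and for morphisms V
    -- → W.
    π-hom : ∀ (f : A.space ⊸ B.space) → (∀ x y → B.space ⊢ f ⟨$⟩ A.mul ⟨$⟩ x ⊗ₜ y ≈ B.mul ⟨$⟩ (f ⟨$⟩ x) ⊗ₜ (f ⟨$⟩ y)) →
            ∀ {X} (E : 𝓔 X) v x → B.space ⊢ f ⟨$⟩ at (A.π E v) x ≈ at (B.π E (f ∘ᵈ v)) x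
    π-hom f h {X} E v x = Module.≈ᴹ-sym B.space (B.π-unique E (f ∘ᵈ v) x _ (B.U.trans (map-≈ (A.blockAt-over E v x))
      (B.U.trans (⨁-hom A.unital B.unital map∙ ∙≈∙ map-∙ (elements X) _)
        (B.⨁-cong (elements X) (λ y → map-when (𝓔._∼?_ E y x) (at v y))))))
      where
      map∙ : Maybe ⌊ A.space ⌋ → Maybe ⌊ B.space ⌋
      map∙ (just a) = just (f ⟨$⟩ a)
      map∙ nothing  = nothing

      map-≈ : ∀ {a b} → a A.U.≈ b → map∙ a B.U.≈ map∙ b
      map-≈ (just≈ p) = just≈ (f ▹ p)
      map-≈ ∙≈∙       = ∙≈∙

      map-∙ : ∀ a b → map∙ (a A.U.∙ b) B.U.≈ map∙ a B.U.∙ map∙ b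
      map-∙ (just a) (just b) = just≈ (h a b)
      map-∙ (just a) nothing  = B.U.refl
      map-∙ nothing  (just b) = B.U.refl
      map-∙ nothing  nothing  = ∙≈∙

      map-when : ∀ {P : Set} (d : Dec P) a → map∙ (A.when d (just a)) B.U.≈ B.when d (just (f ⟨$⟩ a))
      map-when (yes _) a = B.U.refl
      map-when (no _)  a = ∙≈∙

  _⊗ᴬ_ : CommAlgebra → CommAlgebra → CommAlgebra
  A ⊗ᴬ B = record
    { space = A.space ⊗ B.space
    ; mul   = mul₂
    ; assoc = λ x y z → ⊗-ext₃′ x y z
    ; comm  = λ x y → ⊗-ext₄ mul₂ (mul₂ ∘ᴸ ⊗-flip (A.space ⊗ B.space) (A.space ⊗ B.space))
        (λ a b a′ b′ → A.comm a a′ ⊠ B.comm b b′) (x ⊗ₜ y)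
    }
    where
    module A = CommAlgebra A
    module B = CommAlgebra B
    AB : Vect
    AB = A.space ⊗ B.space

    mul₂ : AB ⊗ AB ⊸ AB
    mul₂ = (A.mul ⊗₁ B.mul) ∘ᴸ Id⊗c⊗Id A.space B.space A.space B.space

    ⊗-ext₃′ : ∀ x y z → AB ⊢ mul₂ ⟨$⟩ (mul₂ ⟨$⟩ x ⊗ₜ y) ⊗ₜ z ≈ mul₂ ⟨$⟩ x ⊗ₜ (mul₂ ⟨$⟩ y ⊗ₜ z)
    ⊗-ext₃′ x y z = ⊗-ext₄ (mul₂ ∘ᴸ inˡ z ∘ᴸ mul₂) (mul₂ ∘ᴸ (idᴸ {AB} ⊗₁ (mul₂ ∘ᴸ inˡ z)))
      (λ a b a′ b′ → ⊗-ext (mul₂ ∘ᴸ inʳ ((a A.·ᴬ a′) ⊗ₜ (b B.·ᴬ b′))) (mul₂ ∘ᴸ inʳ (a ⊗ₜ b) ∘ᴸ mul₂ ∘ᴸ inʳ (a′ ⊗ₜ b′))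
        (λ a″ b″ → A.assoc a a′ a″ ⊠ B.assoc b b′ b″) z) (x ⊗ₜ y)

  module _ (A B : CommAlgebra) where
    private
      module A = CommAlgebra A
      module B = CommAlgebra B
      module AB = CommAlgebra (A ⊗ᴬ B)

      -- Adjoining a unit does not commute with tensor products, so the comparison is made by a
      -- relation: three partial products are either all empty or all genuine, and in the second
      -- case the first is the tensor of the other two.
      data Zip : Maybe (Term (⌊ A.space ⌋ × ⌊ B.space ⌋)) → Maybe ⌊ A.space ⌋ → Maybe ⌊ B.space ⌋ → Set ℓ where
        both    : ∀ {a b t} → A.space ⊗ B.space ⊢ t ≈ a ⊗ₜ b → Zip (just t) (just a) (just b)
        neither : Zip nothing nothing nothing

      zip-∙ : ∀ {t a b t′ a′ b′} → Zip t a b → Zip t′ a′ b′ → Zip (t AB.U.∙ t′) (a A.U.∙ a′) (b B.U.∙ b′)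
      zip-∙ (both p) (both q) = both (AB.mul ▹ p ⊠ q)
      zip-∙ (both p) neither  = both p
      zip-∙ neither  (both q) = both q
      zip-∙ neither  neither  = neither

      zip-⨁ : ∀ {I : Set} (as : List I) {f : I → _} {g : I → _} {h : I → _} → (∀ i → Zip (f i) (g i) (h i)) →
              Zip (AB.⨁ as f) (A.⨁ as g) (B.⨁ as h)
      zip-⨁ []       k = neither
      zip-⨁ (i ∷ as) k = zip-∙ (k i) (zip-⨁ as k)

      zip-when : ∀ {P : Set} (d : Dec P) a b → Zip (AB.when d (just (a ⊗ₜ b))) (A.when d (just a)) (B.when d (just b))
      zip-when (yes _) a b = both ≈-refl
      zip-when (no _)  a b = neither

      zip-≈ : ∀ {s t a b x y} → Zip t a b → just s AB.U.≈ t → just x A.U.≈ a → just y B.U.≈ b →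
              A.space ⊗ B.space ⊢ s ≈ x ⊗ₜ y
      zip-≈ (both p) (just≈ q) (just≈ r) (just≈ r′) = ≈-trans q (≈-trans p (Module.≈ᴹ-sym A.space r ⊠ Module.≈ᴹ-sym B.space r′))

    π-⊠ : ∀ {X} (E : 𝓔 X) (a : Deco A.space X) (b : Deco B.space X) → AB.π E (a ⊠ᵈ b) ≈ᵈ A.π E a ⊠ᵈ B.π E b
    π-⊠ {X} E a b x = zip-≈ (zip-⨁ (elements X) (λ y → zip-when (𝓔._∼?_ E y x) (at a y) (at b y)))
      (AB.blockAt-over E (a ⊠ᵈ b) x) (A.blockAt-over E a x) (B.blockAt-over E b x)

  ∏ : ∀ X → (Carrier X → 𝕜) → 𝕜
  ∏ X = Sums.⨁ 𝕜.*-commutativeMonoid (elements X)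

  ∏-cong : ∀ X {k l : Carrier X → 𝕜} → (∀ x → k x ≈ᵏ l x) → ∏ X k ≈ᵏ ∏ X l
  ∏-cong X = Sums.⨁-cong 𝕜.*-commutativeMonoid (elements X)

  ∏-natural : ∀ {X Y} (σ : X ≃ Y) (k : Carrier X → 𝕜) → (∀ {x y} → FinSet._≈_ X x y → k x ≈ᵏ k y) →
              ∏ Y (λ y → k (_≃_.from σ y)) ≈ᵏ ∏ X k
  ∏-natural {X} {Y} σ k k-cong = Sums.⨁-reindex 𝕜.*-commutativeMonoid
    (λ y x → FinSet._≈_ X (_≃_.from σ y) x) (λ y x → ≈-dec X _ x)
    (λ y → inj₁ (one-resp (λ _ → X.≈-sym) (λ _ → X.≈-sym) (one-element X (_≃_.from σ y))))
    (λ x → inj₁ (one-resp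
      (λ y r → X.≈-trans (_≃_.from-cong σ r) (_≃_.strictlyInverseʳ σ x))
      (λ y r → FinSet.≈-trans Y (FinSet.≈-sym Y (_≃_.strictlyInverseˡ σ y)) (_≃_.to-cong σ r))
      (one-element Y (_≃_.to σ x))))
    (λ y x r → k-cong r)
    where module X = FinSet X

  ∏-multilinear : ∀ X → Multilinear 𝕂 X 𝕂 (λ k → ∏ X (at k))
  ∏-multilinear X = record
    { resp  = ∏-cong X
    ; add   = λ {x} {u} {v} {w} (p , q) → 𝕜.trans (extract x u) (𝕜.trans (𝕜.*-cong p 𝕜.refl) (𝕜.trans (𝕜.distribʳ _ _ _)
        (𝕜.+-cong
          (𝕜.trans (𝕜.*-cong 𝕜.refl (others x u v (λ y n → 𝕜.sym (proj₁ (q y n))))) (𝕜.sym (extract x v)))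
          (𝕜.trans (𝕜.*-cong 𝕜.refl (others x u w (λ y n → 𝕜.sym (proj₂ (q y n))))) (𝕜.sym (extract x w))))))
    ; scale = λ {x} {k} {u} {v} (p , q) → 𝕜.trans (extract x u) (𝕜.trans (𝕜.*-cong p 𝕜.refl) (𝕜.trans (𝕜.*-assoc _ _ _)
        (𝕜.*-cong 𝕜.refl
          (𝕜.trans (𝕜.*-cong 𝕜.refl (others x u v (λ y n → 𝕜.sym (q y n)))) (𝕜.sym (extract x v))))))
    }
    where
    module S = Sums 𝕜.*-commutativeMonoid

    -- Every element is kept, so extraction is applied with a trivially true condition.
    always : Dec ⊤
    always = yes tt

    extract : ∀ x (v : Deco 𝕂 X) → ∏ X (at v) ≈ᵏ at v x * S.⨁ (elements X) (λ y → S.when (always ×-dec ¬? (≈-dec X y x)) (at v y))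
    extract x v = ⨁-extract 𝕜.*-commutativeMonoid (λ _ → always) (λ y → ≈-dec X y x) (one-element X x) (λ _ _ → tt) (λ y r → at-cong v r)

    others : ∀ x (u v : Deco 𝕂 X) → (∀ y → ¬ FinSet._≈_ X y x → at u y ≈ᵏ at v y) →
             S.⨁ (elements X) (λ y → S.when (always ×-dec ¬? (≈-dec X y x)) (at u y))
             ≈ᵏ S.⨁ (elements X) (λ y → S.when (always ×-dec ¬? (≈-dec X y x)) (at v y))
    others x u v h = S.⨁-cong (elements X) (λ y → S.when-cong (always ×-dec ¬? (≈-dec X y x)) (always ×-dec ¬? (≈-dec X y x)) id id (λ (_ , n) → h y n))

  -- A multiplicative functional extends to the unital algebra with value 1 on the adjoined unit, so
  -- its value on a class product is the product over the class; and each element of X lies in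
  -- exactly one class.
  ∏-π : ∀ (A : CommAlgebra) (let module A = CommAlgebra A) (f : A.space ⊸ 𝕂) →
        (∀ x y → f ⟨$⟩ A.mul ⟨$⟩ x ⊗ₜ y ≈ᵏ (f ⟨$⟩ x) * (f ⟨$⟩ y)) →
        ∀ {X} (E : 𝓔 X) v → ∏ (X / E) (at (f ∘ᵈ A.π E v)) ≈ᵏ ∏ X (at (f ∘ᵈ v))
  ∏-π A f h {X} E v = 𝕜.trans (S.⨁-cong (elements (X / E)) (λ z → block z))
    (𝕜.trans (S.⨁-swap (elements (X / E)) (elements X) _)
      (S.⨁-cong (elements X) (λ y → S.⨁-when (λ z → 𝓔._∼?_ E y z)
        (one-resp (λ z → 𝓔.∼-sym E) (λ z → 𝓔.∼-sym E) (one-element (X / E) y)) (λ _ _ → 𝕜.refl))))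
    where
    module A = CommAlgebra A
    module S = Sums 𝕜.*-commutativeMonoid

    φ : Maybe ⌊ A.space ⌋ → 𝕜
    φ (just a) = f ⟨$⟩ a
    φ nothing  = 1#

    φ-≈ : ∀ {a b} → a A.U.≈ b → φ a ≈ᵏ φ b
    φ-≈ (just≈ p) = f ▹ p
    φ-≈ ∙≈∙       = 𝕜.refl

    φ-∙ : ∀ a b → φ (a A.U.∙ b) ≈ᵏ φ a * φ b
    φ-∙ (just a) (just b) = h a b
    φ-∙ (just a) nothing  = 𝕜.sym (𝕜.*-identityʳ _)
    φ-∙ nothing  (just b) = 𝕜.sym (𝕜.*-identityˡ _)
    φ-∙ nothing  nothing  = 𝕜.sym (𝕜.*-identityˡ _)

    φ-when : ∀ {P : Set} (d : Dec P) a → φ (A.when d (just a)) ≈ᵏ S.when d (f ⟨$⟩ a)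
    φ-when (yes _) a = 𝕜.refl
    φ-when (no _)  a = 𝕜.refl

    block : ∀ z → f ⟨$⟩ at (A.π E v) z ≈ᵏ S.⨁ (elements X) (λ y → S.when (𝓔._∼?_ E y z) (f ⟨$⟩ at v y))
    block z = 𝕜.trans (φ-≈ (A.blockAt-over E v z)) (𝕜.trans (⨁-hom A.unital 𝕜.*-commutativeMonoid φ 𝕜.refl φ-∙ (elements X) _)
      (S.⨁-cong (elements X) (λ y → φ-when (𝓔._∼?_ E y z) (at v y))))

  _*ᵈ_ : ∀ {M X} → Deco 𝕂 X → Deco M X → Deco M X
  _*ᵈ_ {M} k v = deco (λ x → Module._*ₗ_ M (at k x) (at v x)) (λ r → Module.*ₗ-cong M (at-cong k r) (at-cong v r))

  -- Linearity in each slot releases one scalar per slot. With the scalars ε_V(v_x) this is how the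
  -- counit of V, a product over X, is moved into the individual slots.
  multi-scale : ∀ {M X Q F} → Multilinear M X Q F → ∀ k v →
                Q ⊢ F (k *ᵈ v) ≈ Module._*ₗ_ Q (∏ X (at k)) (F v)
  multi-scale {M} {X} {Q} {F} f k v = resp f (λ x → Module.≈ᴹ-sym M (at-cong (k *ᵈ v) (_≃_.strictlyInverseʳ e x)))
    ⟫ go (size X) (multilinear-∘ f (∙ᵈ-slotwise (e ⁻¹≃))) (e ∙ᵈ k) (e ∙ᵈ v)
    ⟫ Module.*ₗ-cong Q (product (size X) (_≃_.from e)) (resp f (λ x → at-cong v (_≃_.strictlyInverseʳ e x)))
    where
    open Chain Q
    e : X ≃ [ size X ]
    e = enum≃ X

    module S = Sums 𝕜.*-commutativeMonoid

    finProduct : ∀ n → (Fin n → 𝕜) → 𝕜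
    finProduct zero    k = 1#
    finProduct (suc n) k = k zero * finProduct n (k ∘ suc)

    product : ∀ n (g : Fin n → Carrier X) → finProduct n (at k ∘ g) ≈ᵏ S.⨁ (tabulateᴸ g) (at k)
    product zero    g = 𝕜.refl
    product (suc n) g = 𝕜.*-cong 𝕜.refl (product n (g ∘ suc))

    go : ∀ n {F : Deco M [ n ] → ⌊ Q ⌋} → Multilinear M [ n ] Q F → ∀ k v →
         Q ⊢ F (k *ᵈ v) ≈ Module._*ₗ_ Q (finProduct n (at k)) (F v)
    go zero    f k v = resp f (λ ()) ⟫ ↺ (Module.*ₗ-identityˡ Q _)
    go (suc n) f k v = resp f (λ { zero → Module.≈ᴹ-refl M ; (suc i) → Module.≈ᴹ-refl M })
      ⟫ _⊸_.*ₗ-homo (head-linear {M} {Q} f (tailᵈ {𝕂} {Q} k *ᵈ tailᵈ {M} {Q} v)) (at k zero) (at v zero)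
      ⟫ Module.*ₗ-cong Q 𝕜.refl
          (go n (multilinear-∘ f (cons-slotwise {M} {Q} (at v zero))) (tailᵈ {𝕂} {Q} k) (tailᵈ {M} {Q} v)
           ⟫ Module.*ₗ-cong Q 𝕜.refl (resp f (λ i → Module.≈ᴹ-sym M (cons-tail {M} {Q} v i))))
      ⟫ ↺ (Module.*ₗ-assoc Q _ _ _)

-- Multilinear families of linear maps.

module PointwiseMultilinear {ℓ} (K : HeytingField ℓ ℓ ℓ) where
  open Over K
  open Linear K
  open Decorations K
  private module 𝕜 = CommutativeRing commRing

  tensorˡ-at : ∀ {M X A A′ B B′} {F : Deco M X → A ⊸ A′} → (∀ p → Multilinear M X A′ (λ v → F v ⟨$⟩ p)) → (g : B ⊸ B′) →
               ∀ z → Multilinear M X (A′ ⊗ B′) (λ v → (F v ⊗₁ g) ⟨$⟩ z)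
  tensorˡ-at {B′ = B′} {F} f g z = record
    { resp  = λ {v} {w} e → ⊗-ext (F v ⊗₁ g) (F w ⊗₁ g) (λ x y → resp (f x) e ⊠ Module.≈ᴹ-refl B′) z
    ; add   = λ {x} {u} {v} {w} a → ⊗-ext (F u ⊗₁ g) ((F v ⊗₁ g) +ᴸ (F w ⊗₁ g)) (λ x y →
        ≈-trans (add (f x) a ⊠ Module.≈ᴹ-refl B′) (rel (⊗-+ˡ (F v ⟨$⟩ x) (F w ⟨$⟩ x) (g ⟨$⟩ y)))) z
    ; scale = λ {x} {k} {u} {v} a → ⊗-ext (F u ⊗₁ g) (k *ᴸ (F v ⊗₁ g)) (λ x y →
        ≈-trans (scale (f x) a ⊠ Module.≈ᴹ-refl B′) (rel (⊗-*ˡ k (F v ⟨$⟩ x) (g ⟨$⟩ y)))) z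
    }

  tensorʳ-at : ∀ {M X A A′ B B′} {F : Deco M X → B ⊸ B′} (g : A ⊸ A′) → (∀ p → Multilinear M X B′ (λ v → F v ⟨$⟩ p)) →
               ∀ z → Multilinear M X (A′ ⊗ B′) (λ v → (g ⊗₁ F v) ⟨$⟩ z)
  tensorʳ-at {A′ = A′} {F = F} g f z = record
    { resp  = λ {v} {w} e → ⊗-ext (g ⊗₁ F v) (g ⊗₁ F w) (λ x y → Module.≈ᴹ-refl A′ ⊠ resp (f y) e) z
    ; add   = λ {x} {u} {v} {w} a → ⊗-ext (g ⊗₁ F u) ((g ⊗₁ F v) +ᴸ (g ⊗₁ F w)) (λ x y →
        ≈-trans (Module.≈ᴹ-refl A′ ⊠ add (f y) a) (rel (⊗-+ʳ (g ⟨$⟩ x) (F v ⟨$⟩ y) (F w ⟨$⟩ y)))) z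
    ; scale = λ {x} {k} {u} {v} a → ⊗-ext (g ⊗₁ F u) (k *ᴸ (g ⊗₁ F v)) (λ x y →
        ≈-trans (Module.≈ᴹ-refl A′ ⊠ scale (f y) a) (rel (⊗-*ʳ k (g ⟨$⟩ x) (F v ⟨$⟩ y)))) z
    }

  -- A slot of X ⊔ Y lies in one summand only, so a change there reaches one tensor factor while the
  -- other stays fixed.
  tensor-at : ∀ {M X Y A A′ B B′} {F : Deco M X → A ⊸ A′} {G : Deco M Y → B ⊸ B′} →
              (∀ p → Multilinear M X A′ (λ v → F v ⟨$⟩ p)) → (∀ q → Multilinear M Y B′ (λ v → G v ⟨$⟩ q)) →
              ∀ z → Multilinear M (X ⊔ˢ Y) (A′ ⊗ B′) (λ v → (F (fstᵈ {M} {X} {Y} v) ⊗₁ G (sndᵈ {M} {X} {Y} v)) ⟨$⟩ z)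
  tensor-at {M} {X} {Y} {A} {A′} {B} {B′} {F} {G} f g z = record
    { resp  = λ {v} {w} e → ⊗-ext (FG v) (FG w) (λ a b → resp (f a) (e ∘ inj₁) ⊠ resp (g b) (e ∘ inj₂)) z
    ; add   = λ {x} {u} {v} {w} s → ⊗-ext (FG u) (FG v +ᴸ FG w) (λ a b → add′ x u v w s a b) z
    ; scale = λ {x} {k} {u} {v} s → ⊗-ext (FG u) (k *ᴸ FG v) (λ a b → scale′ x k u v s a b) z
    }
    where
    FG : Deco M (X ⊔ˢ Y) → A ⊗ B ⊸ A′ ⊗ B′
    FG v = F (fstᵈ {M} {X} {Y} v) ⊗₁ G (sndᵈ {M} {X} {Y} v)

    1≢2 : ∀ {a b} {R : Rel (FinSet.Carrier X) a} {S : Rel (FinSet.Carrier Y) b} {x y} → ¬ Pointwise R S (inj₁ x) (inj₂ y)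
    1≢2 ()
    2≢1 : ∀ {a b} {R : Rel (FinSet.Carrier X) a} {S : Rel (FinSet.Carrier Y) b} {x y} → ¬ Pointwise R S (inj₂ y) (inj₁ x)
    2≢1 ()

    open Chain (A′ ⊗ B′)

    add′ : ∀ x u v w → SumAt x u v w → ∀ a b → A′ ⊗ B′ ⊢ FG u ⟨$⟩ a ⊗ₜ b ≈ (FG v ⟨$⟩ a ⊗ₜ b) ⊕ (FG w ⟨$⟩ a ⊗ₜ b)
    add′ (inj₁ x) u v w (p , q) a b =
      (add (f a) {x} {fstᵈ {M} {X} {Y} u} {fstᵈ {M} {X} {Y} v} {fstᵈ {M} {X} {Y} w} (p , λ y ne → q (inj₁ y) (λ { (inj₁ r) → ne r })) ⊠ Module.≈ᴹ-refl B′)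
      ⟫ rel (⊗-+ˡ (F (fstᵈ {M} {X} {Y} v) ⟨$⟩ a) (F (fstᵈ {M} {X} {Y} w) ⟨$⟩ a) (G (sndᵈ {M} {X} {Y} u) ⟨$⟩ b))
      ⟫ ⊕-cong (Module.≈ᴹ-refl A′ ⊠ resp (g b) {sndᵈ {M} {X} {Y} u} {sndᵈ {M} {X} {Y} v} (λ y → Module.≈ᴹ-sym M (proj₁ (q (inj₂ y) 2≢1))))
               (Module.≈ᴹ-refl A′ ⊠ resp (g b) {sndᵈ {M} {X} {Y} u} {sndᵈ {M} {X} {Y} w} (λ y → Module.≈ᴹ-sym M (proj₂ (q (inj₂ y) 2≢1))))
    add′ (inj₂ x) u v w (p , q) a b =
      (Module.≈ᴹ-refl A′ ⊠ add (g b) {x} {sndᵈ {M} {X} {Y} u} {sndᵈ {M} {X} {Y} v} {sndᵈ {M} {X} {Y} w} (p , λ y ne → q (inj₂ y) (λ { (inj₂ r) → ne r })))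
      ⟫ rel (⊗-+ʳ (F (fstᵈ {M} {X} {Y} u) ⟨$⟩ a) (G (sndᵈ {M} {X} {Y} v) ⟨$⟩ b) (G (sndᵈ {M} {X} {Y} w) ⟨$⟩ b))
      ⟫ ⊕-cong (resp (f a) {fstᵈ {M} {X} {Y} u} {fstᵈ {M} {X} {Y} v} (λ y → Module.≈ᴹ-sym M (proj₁ (q (inj₁ y) 1≢2))) ⊠ Module.≈ᴹ-refl B′)
               (resp (f a) {fstᵈ {M} {X} {Y} u} {fstᵈ {M} {X} {Y} w} (λ y → Module.≈ᴹ-sym M (proj₂ (q (inj₁ y) 1≢2))) ⊠ Module.≈ᴹ-refl B′)

    scale′ : ∀ x k u v → ScaleAt x k u v → ∀ a b → A′ ⊗ B′ ⊢ FG u ⟨$⟩ a ⊗ₜ b ≈ k · (FG v ⟨$⟩ a ⊗ₜ b)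
    scale′ (inj₁ x) k u v (p , q) a b =
      (scale (f a) {x} {k} {fstᵈ {M} {X} {Y} u} {fstᵈ {M} {X} {Y} v} (p , λ y ne → q (inj₁ y) (λ { (inj₁ r) → ne r })) ⊠ Module.≈ᴹ-refl B′)
      ⟫ rel (⊗-*ˡ k (F (fstᵈ {M} {X} {Y} v) ⟨$⟩ a) (G (sndᵈ {M} {X} {Y} u) ⟨$⟩ b))
      ⟫ ·-cong 𝕜.refl (Module.≈ᴹ-refl A′ ⊠ resp (g b) {sndᵈ {M} {X} {Y} u} {sndᵈ {M} {X} {Y} v} (λ y → Module.≈ᴹ-sym M (q (inj₂ y) 2≢1)))
    scale′ (inj₂ x) k u v (p , q) a b =
      (Module.≈ᴹ-refl A′ ⊠ scale (g b) {x} {k} {sndᵈ {M} {X} {Y} u} {sndᵈ {M} {X} {Y} v} (p , λ y ne → q (inj₂ y) (λ { (inj₂ r) → ne r })))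
      ⟫ rel (⊗-*ʳ k (F (fstᵈ {M} {X} {Y} u) ⟨$⟩ a) (G (sndᵈ {M} {X} {Y} v) ⟨$⟩ b))
      ⟫ ·-cong 𝕜.refl (resp (f a) {fstᵈ {M} {X} {Y} u} {fstᵈ {M} {X} {Y} v} (λ y → Module.≈ᴹ-sym M (q (inj₁ y) 1≢2)) ⊠ Module.≈ᴹ-refl B′)

  module _ {M N A Q : Vect} (X : FinSet) {G : Deco M X → Deco N X → A ⊸ Q}
           (bi : ∀ z → Bimultilinear M N X Q (λ a b → G a b ⟨$⟩ z)) where

    private
      pulled : (Fin (FinSet.size X) → ⌊ M ⌋) → (Fin (FinSet.size X) → ⌊ N ⌋) → A ⊸ Q
      pulled a b = G (enum≃ X ⁻¹≃ ∙ᵈ finᵈ a) (enum≃ X ⁻¹≃ ∙ᵈ finᵈ b)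

      tensors : Deco (M ⊗ N) X → Fin (FinSet.size X) → ⌊ M ⊗ N ⌋
      tensors τ = at (enum≃ X ∙ᵈ τ)

    expandᴸ : Deco (M ⊗ N) X → A ⊸ Q
    expandᴸ τ = linear (λ z → sweedlers Q (tensors τ) (λ a b → pulled a b ⟨$⟩ z))
      (λ p → sweedlers-ext Q n (tensors τ) (λ a b → pulled a b ▹ p))
      (λ z z′ → sweedlers-ext Q n (tensors τ) (λ a b → _⊸_.+ᴹ-homo (pulled a b) z z′)
        ⟫ sweedlers-+ Q n (tensors τ) (λ a b → pulled a b ⟨$⟩ z) (λ a b → pulled a b ⟨$⟩ z′))
      (λ k z → sweedlers-ext Q n (tensors τ) (λ a b → _⊸_.*ₗ-homo (pulled a b) k z)
        ⟫ sweedlers-* Q n (tensors τ) k (λ a b → pulled a b ⟨$⟩ z))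
      where
      open Chain Q
      n = FinSet.size X

    expandᴸ-at : ∀ z → Multilinear (M ⊗ N) X Q (λ τ → expandᴸ τ ⟨$⟩ z)
    expandᴸ-at z = expand-multilinear X (bi z)

    expandᴸ-pure : ∀ a b z → Q ⊢ expandᴸ (a ⊠ᵈ b) ⟨$⟩ z ≈ G a b ⟨$⟩ z
    expandᴸ-pure a b z = expand-pure X (bi z) a b

-- The species V^{⊗X} ⊗ P[X].

module DecoratedSpecies {ℓ} (K : HeytingField ℓ ℓ ℓ)
                        (V : Over.Vect K) (P : Over.Species K) where
  open Over K
  open Linear K
  open Decorations K
  open PointwiseMultilinear K
  open Species P
  private module 𝕜 = CommutativeRing commRing

  -- V^⊗X ⊗ P[X] is presented by families over X, since X has no order; multilinearity is imposed
  -- through the relations `SumAt` and `ScaleAt` between families.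
  data HRel (X : FinSet) : Rel (Term (Deco V X × ⌊ P₀ X ⌋)) ℓ where
    h-cong  : ∀ {v w p q} → v ≈ᵈ w → P₀ X ⊢ p ≈ q → HRel X (gen (v , p)) (gen (w , q))
    h-add   : ∀ {x u v w} → SumAt x u v w → ∀ p → HRel X (gen (u , p)) (gen (v , p) ⊕ gen (w , p))
    h-scale : ∀ {x k u v} → ScaleAt x k u v → ∀ p → HRel X (gen (u , p)) (k · gen (v , p))
    h-+     : ∀ v p q → HRel X (gen (v , Module._+ᴹ_ (P₀ X) p q)) (gen (v , p) ⊕ gen (v , q))
    h-*     : ∀ v k p → HRel X (gen (v , Module._*ₗ_ (P₀ X) k p)) (k · gen (v , p))

  H₀ : FinSet → Vect
  H₀ X = Presented (HRel X)

  j : ∀ {X} → Deco V X → P₀ X ⊸ H₀ X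
  j v = linear (λ p → gen (v , p)) (λ e → rel (h-cong (λ _ → Module.≈ᴹ-refl V) e))
    (λ p q → rel (h-+ v p q)) (λ k p → rel (h-* v k p))

  j-at : ∀ {X} p → Multilinear V X (H₀ X) (λ v → j v ⟨$⟩ p)
  j-at {X} p = record
    { resp  = λ e → rel (h-cong e (Module.≈ᴹ-refl (P₀ X)))
    ; add   = λ a → rel (h-add a p)
    ; scale = λ a → rel (h-scale a p)
    }

  j-resp : ∀ {X} {v w : Deco V X} → v ≈ᵈ w → ∀ p → H₀ X ⊢ j v ⟨$⟩ p ≈ j w ⟨$⟩ p
  j-resp {X} e p = rel (h-cong e (Module.≈ᴹ-refl (P₀ X)))

  H-lift : ∀ {X} Q (F : Deco V X → P₀ X ⊸ Q) → (∀ p → Multilinear V X Q (λ v → F v ⟨$⟩ p)) → H₀ X ⊸ Q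
  H-lift {X} Q F f = lift (HRel X) Q (λ vp → F (proj₁ vp) ⟨$⟩ proj₂ vp) λ
    { (h-cong {w = w} {p = p} e r) → resp (f p) e ⟫ (F w ▹ r)
    ; (h-add a p)    → add (f p) a
    ; (h-scale a p)  → scale (f p) a
    ; (h-+ v p q)    → _⊸_.+ᴹ-homo (F v) p q
    ; (h-* v k p)    → _⊸_.*ₗ-homo (F v) k p
    }
    where open Chain Q

  H-ext : ∀ {X Q} (f g : H₀ X ⊸ Q) → (∀ v p → Q ⊢ f ⟨$⟩ j v ⟨$⟩ p ≈ g ⟨$⟩ j v ⟨$⟩ p) → f ≗ᴸ g
  H-ext {X} f g h = ext (HRel X) f g (λ vp → h (proj₁ vp) (proj₂ vp))

  H-ext₂ : ∀ {X Y Q} (f g : H₀ X ⊗ H₀ Y ⊸ Q) →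
           (∀ v p w q → Q ⊢ f ⟨$⟩ (j v ⟨$⟩ p) ⊗ₜ (j w ⟨$⟩ q) ≈ g ⟨$⟩ (j v ⟨$⟩ p) ⊗ₜ (j w ⟨$⟩ q)) → f ≗ᴸ g
  H-ext₂ {X} {Y} f g h = ⊗-ext f g (λ s t → H-ext (f ∘ᴸ inˡ t) (g ∘ᴸ inˡ t) (λ v p →
    H-ext (f ∘ᴸ inʳ (j v ⟨$⟩ p)) (g ∘ᴸ inʳ (j v ⟨$⟩ p)) (λ w q → h v p w q) t) s)

  H-ext₃ : ∀ {X Y Z Q} (f g : (H₀ X ⊗ H₀ Y) ⊗ H₀ Z ⊸ Q) →
           (∀ v p w q u r → Q ⊢ f ⟨$⟩ ((j v ⟨$⟩ p) ⊗ₜ (j w ⟨$⟩ q)) ⊗ₜ (j u ⟨$⟩ r)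
                              ≈ g ⟨$⟩ ((j v ⟨$⟩ p) ⊗ₜ (j w ⟨$⟩ q)) ⊗ₜ (j u ⟨$⟩ r)) → f ≗ᴸ g
  H-ext₃ {X} {Y} {Z} f g h = ⊗-ext {H₀ X ⊗ H₀ Y} {H₀ Z} f g (λ s t → H-ext₂ (f ∘ᴸ inˡ t) (g ∘ᴸ inˡ t) (λ v p w q →
    H-ext (f ∘ᴸ inʳ _) (g ∘ᴸ inʳ _) (λ u r → h v p w q u r) t) s)

  opaque
    H₁ : ∀ {X Y} → X ≃ Y → H₀ X ⊸ H₀ Y
    H₁ {X} {Y} σ = H-lift (H₀ Y) (λ v → j (σ ∙ᵈ v) ∘ᴸ P₁ σ)
      (λ p → multilinear-∘ (j-at (P₁ σ ⟨$⟩ p)) (∙ᵈ-slotwise σ))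

    H₁-j : ∀ {X Y} (σ : X ≃ Y) v p → H₀ Y ⊢ H₁ σ ⟨$⟩ j v ⟨$⟩ p ≈ j (σ ∙ᵈ v) ⟨$⟩ P₁ σ ⟨$⟩ p
    H₁-j σ v p = ≈-refl

  from-≗ : ∀ {X Y} {σ τ : X ≃ Y} → σ ≗≃ τ → ∀ y → FinSet._≈_ X (_≃_.from σ y) (_≃_.from τ y)
  from-≗ {X} {Y} {σ} {τ} e y = X.≈-trans (X.≈-sym (_≃_.strictlyInverseʳ τ (_≃_.from σ y)))
    (_≃_.from-cong τ (FinSet.≈-trans Y (FinSet.≈-sym Y (e (_≃_.from σ y))) (_≃_.strictlyInverseˡ σ y)))
    where module X = FinSet X

  decorated : Species
  decorated = record
    { P₀     = H₀
    ; P₁     = H₁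
    ; P-resp = λ {X} {Y} {σ} {τ} e → H-ext (H₁ σ) (H₁ τ) (λ v p → H₁-j σ v p
        ⟫′ (j (σ ∙ᵈ v) ▹ P-resp {σ = σ} {τ} e p) ⟫′ j-resp (λ y → at-cong v (from-≗ {σ = σ} {τ} e y)) _ ⟫′ ≈-sym (H₁-j τ v p))
    ; P-id   = λ {X} → H-ext (H₁ id≃) idᴸ (λ v p → H₁-j id≃ v p ⟫′ (j (id≃ ∙ᵈ v) ▹ P-id p) ⟫′ j-resp (λ _ → Module.≈ᴹ-refl V) p)
    ; P-∘    = λ τ σ → H-ext (H₁ (τ ∘≃ σ)) (H₁ τ ∘ᴸ H₁ σ) (λ v p → H₁-j (τ ∘≃ σ) v p
        ⟫′ (j ((τ ∘≃ σ) ∙ᵈ v) ▹ P-∘ τ σ p) ⟫′ j-resp (λ _ → Module.≈ᴹ-refl V) _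
        ⟫′ ≈-sym (H₁-j τ (σ ∙ᵈ v) (P₁ σ ⟨$⟩ p)) ⟫′ (H₁ τ ▹ ≈-sym (H₁-j σ v p)))
    }
    where
    infixr 4 _⟫′_
    _⟫′_ : ∀ {X} {s t u : ⌊ H₀ X ⌋} → H₀ X ⊢ s ≈ t → H₀ X ⊢ t ≈ u → H₀ X ⊢ s ≈ u
    _⟫′_ = ≈-trans

  private
    infixr 4 _⟫_
    _⟫_ : ∀ {G : Set ℓ} {R : Rel (Term G) ℓ} {s t u} → _≈ᵗ_ R s t → _≈ᵗ_ R t u → _≈ᵗ_ R s u
    _⟫_ = ≈-trans

  module DecoratedAlgebra (A : TwistedAlgebra P) where
    open TwistedAlgebra A

    private
      row : ∀ X Y → Deco V X → ⌊ P₀ X ⌋ → H₀ Y ⊸ H₀ (X ⊔ˢ Y)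
      row X Y v p = H-lift (H₀ (X ⊔ˢ Y)) (λ w → j (v ⊎ᵈ w) ∘ᴸ m X Y ∘ᴸ inʳ p)
        (λ q → multilinear-∘ (j-at (m X Y ⟨$⟩ p ⊗ₜ q)) (⊎ᵈ-slotwiseʳ v))

      rows : ∀ X Y → Deco V X → P₀ X ⊸ Hom (H₀ Y) (H₀ (X ⊔ˢ Y))
      rows X Y v = linear {P₀ X} {Hom (H₀ Y) (H₀ (X ⊔ˢ Y))} (row X Y v)
        (λ {p} {p′} e → H-ext (row X Y v p) (row X Y v p′) (λ w q → (j (v ⊎ᵈ w) ∘ᴸ m X Y ∘ᴸ inˡ q) ▹ e))
        (λ p p′ → H-ext (row X Y v (Module._+ᴹ_ (P₀ X) p p′)) (row X Y v p +ᴸ row X Y v p′)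
          (λ w q → _⊸_.+ᴹ-homo (j (v ⊎ᵈ w) ∘ᴸ m X Y ∘ᴸ inˡ q) p p′))
        (λ k p → H-ext (row X Y v (Module._*ₗ_ (P₀ X) k p)) (k *ᴸ row X Y v p)
          (λ w q → _⊸_.*ₗ-homo (j (v ⊎ᵈ w) ∘ᴸ m X Y ∘ᴸ inˡ q) k p))

      -- Two-variable maps out of presented spaces are curried: for fixed `v` and `p` the second
      -- factor is lifted, and multilinearity in `v` is checked on the generators of that factor.
      table : ∀ X Y → H₀ X ⊸ Hom (H₀ Y) (H₀ (X ⊔ˢ Y))
      table X Y = H-lift {X} (Hom (H₀ Y) (H₀ (X ⊔ˢ Y))) (rows X Y) (λ p → record
        { resp  = λ {v} {w} e → H-ext (row X Y v p) (row X Y w p) (λ b q → resp (multi b p q) {v} {w} e)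
        ; add   = λ {x} {u} {v} {w} a → H-ext (row X Y u p) (row X Y v p +ᴸ row X Y w p)
            (λ b q → add (multi b p q) {x} {u} {v} {w} a)
        ; scale = λ {x} {k} {u} {v} a → H-ext (row X Y u p) (k *ᴸ row X Y v p)
            (λ b q → scale (multi b p q) {x} {k} {u} {v} a)
        })
        where
        multi : ∀ w p q → Multilinear V X (H₀ (X ⊔ˢ Y)) (λ v → j (v ⊎ᵈ w) ⟨$⟩ m X Y ⟨$⟩ p ⊗ₜ q)
        multi w p q = multilinear-∘ (j-at (m X Y ⟨$⟩ p ⊗ₜ q)) (⊎ᵈ-slotwiseˡ w)

    opaque
      mᴴ : ∀ X Y → H₀ X ⊗ H₀ Y ⊸ H₀ (X ⊔ˢ Y)
      mᴴ X Y = uncurry {H₀ X} {H₀ Y} {H₀ (X ⊔ˢ Y)} (table X Y)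

      m-j : ∀ {X Y} (v : Deco V X) p (w : Deco V Y) q →
            H₀ (X ⊔ˢ Y) ⊢ mᴴ X Y ⟨$⟩ (j v ⟨$⟩ p) ⊗ₜ (j w ⟨$⟩ q) ≈ j (v ⊎ᵈ w) ⟨$⟩ m X Y ⟨$⟩ p ⊗ₜ q
      m-j v p w q = ≈-refl

    decoratedAlgebra : TwistedAlgebra decorated
    decoratedAlgebra = record
      { m = mᴴ
      ; 1ₚ = j ∅ᵈ ⟨$⟩ 1ₚ
      ; m-natural = λ {X} {Y} {X′} {Y′} σ τ → H-ext₂ (mᴴ X′ Y′ ∘ᴸ (H₁ σ ⊗₁ H₁ τ)) (H₁ (σ ⊔≃ τ) ∘ᴸ mᴴ X Y) (λ v p w q →
          (mᴴ X′ Y′ ▹ H₁-j σ v p ⊠ H₁-j τ w q)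
          ⟫ m-j (σ ∙ᵈ v) (P₁ σ ⟨$⟩ p) (τ ∙ᵈ w) (P₁ τ ⟨$⟩ q)
          ⟫ (j ((σ ∙ᵈ v) ⊎ᵈ (τ ∙ᵈ w)) ▹ m-natural σ τ (p ⊗ₜ q))
          ⟫ j-resp {v = (σ ∙ᵈ v) ⊎ᵈ (τ ∙ᵈ w)} {(σ ⊔≃ τ) ∙ᵈ (v ⊎ᵈ w)}
              (λ { (inj₁ _) → Module.≈ᴹ-refl V ; (inj₂ _) → Module.≈ᴹ-refl V }) (P₁ (σ ⊔≃ τ) ⟨$⟩ m X Y ⟨$⟩ p ⊗ₜ q)
          ⟫ ≈-sym (H₁-j (σ ⊔≃ τ) (v ⊎ᵈ w) (m X Y ⟨$⟩ p ⊗ₜ q))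
          ⟫ (H₁ (σ ⊔≃ τ) ▹ ≈-sym (m-j v p w q)))
      ; m-assoc = λ X Y Z → H-ext₃ (H₁ (⊔-assoc X Y Z) ∘ᴸ mᴴ (X ⊔ˢ Y) Z ∘ᴸ (mᴴ X Y ⊗₁ idᴸ))
          (mᴴ X (Y ⊔ˢ Z) ∘ᴸ (idᴸ ⊗₁ mᴴ Y Z) ∘ᴸ ⊗-assoc (H₀ X) (H₀ Y) (H₀ Z)) (λ v p w q u r →
          ((H₁ (⊔-assoc X Y Z) ∘ᴸ mᴴ (X ⊔ˢ Y) Z) ▹ m-j v p w q ⊠ ≈-refl)
          ⟫ (H₁ (⊔-assoc X Y Z) ▹ m-j (v ⊎ᵈ w) (m X Y ⟨$⟩ p ⊗ₜ q) u r)
          ⟫ H₁-j (⊔-assoc X Y Z) ((v ⊎ᵈ w) ⊎ᵈ u) (m (X ⊔ˢ Y) Z ⟨$⟩ (m X Y ⟨$⟩ p ⊗ₜ q) ⊗ₜ r)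
          ⟫ (j (⊔-assoc X Y Z ∙ᵈ ((v ⊎ᵈ w) ⊎ᵈ u)) ▹ m-assoc X Y Z ((p ⊗ₜ q) ⊗ₜ r))
          ⟫ j-resp {v = ⊔-assoc X Y Z ∙ᵈ ((v ⊎ᵈ w) ⊎ᵈ u)} {v ⊎ᵈ (w ⊎ᵈ u)}
              (λ { (inj₁ _) → Module.≈ᴹ-refl V ; (inj₂ (inj₁ _)) → Module.≈ᴹ-refl V ; (inj₂ (inj₂ _)) → Module.≈ᴹ-refl V })
              (m X (Y ⊔ˢ Z) ⟨$⟩ p ⊗ₜ (m Y Z ⟨$⟩ q ⊗ₜ r))
          ⟫ ≈-sym (m-j v p (w ⊎ᵈ u) (m Y Z ⟨$⟩ q ⊗ₜ r))
          ⟫ (mᴴ X (Y ⊔ˢ Z) ▹ ≈-refl ⊠ ≈-sym (m-j w q u r)))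
      ; m-unitˡ = λ X → H-ext (H₁ (∅⊔≃ X) ∘ᴸ mᴴ ∅ X ∘ᴸ inʳ (j ∅ᵈ ⟨$⟩ 1ₚ)) idᴸ (λ v p →
          (H₁ (∅⊔≃ X) ▹ m-j ∅ᵈ 1ₚ v p)
          ⟫ H₁-j (∅⊔≃ X) (∅ᵈ ⊎ᵈ v) (m ∅ X ⟨$⟩ 1ₚ ⊗ₜ p)
          ⟫ (j (∅⊔≃ X ∙ᵈ (∅ᵈ ⊎ᵈ v)) ▹ m-unitˡ X p)
          ⟫ j-resp {v = ∅⊔≃ X ∙ᵈ (∅ᵈ ⊎ᵈ v)} {v} (λ _ → Module.≈ᴹ-refl V) p)
      ; m-unitʳ = λ X → H-ext (H₁ (⊔∅≃ X) ∘ᴸ mᴴ X ∅ ∘ᴸ inˡ (j ∅ᵈ ⟨$⟩ 1ₚ)) idᴸ (λ v p →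
          (H₁ (⊔∅≃ X) ▹ m-j v p ∅ᵈ 1ₚ)
          ⟫ H₁-j (⊔∅≃ X) (v ⊎ᵈ ∅ᵈ) (m X ∅ ⟨$⟩ p ⊗ₜ 1ₚ)
          ⟫ (j (⊔∅≃ X ∙ᵈ (v ⊎ᵈ ∅ᵈ)) ▹ m-unitʳ X p)
          ⟫ j-resp {v = ⊔∅≃ X ∙ᵈ (v ⊎ᵈ ∅ᵈ)} {v} (λ _ → Module.≈ᴹ-refl V) p)
      }

  module DecoratedCoalgebra (C : TwistedCoalgebra P) where
    open TwistedCoalgebra C

    opaque
      Δᴴ : ∀ X Y → H₀ (X ⊔ˢ Y) ⊸ H₀ X ⊗ H₀ Y
      Δᴴ X Y = H-lift (H₀ X ⊗ H₀ Y) (λ v → (j (fstᵈ v) ⊗₁ j (sndᵈ v)) ∘ᴸ Δ X Y)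
        (λ p → tensor-at {F = j} {j} j-at j-at (Δ X Y ⟨$⟩ p))

      Δ-j : ∀ {X Y} (v : Deco V (X ⊔ˢ Y)) p →
            H₀ X ⊗ H₀ Y ⊢ Δᴴ X Y ⟨$⟩ j v ⟨$⟩ p ≈ (j (fstᵈ v) ⊗₁ j (sndᵈ v)) ⟨$⟩ Δ X Y ⟨$⟩ p
      Δ-j v p = ≈-refl

      εᴴ : H₀ ∅ ⊸ 𝕂
      εᴴ = H-lift 𝕂 (λ _ → ε) (λ _ → record { resp = λ _ → 𝕜.refl ; add = λ { {()} } ; scale = λ { {()} } })

      ε-j : ∀ v p → εᴴ ⟨$⟩ j v ⟨$⟩ p ≈ᵏ ε ⟨$⟩ p
      ε-j v p = 𝕜.refl

    jj-resp : ∀ {X Y} {v v′ : Deco V X} {w w′ : Deco V Y} → v ≈ᵈ v′ → w ≈ᵈ w′ → ∀ t →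
              H₀ X ⊗ H₀ Y ⊢ (j v ⊗₁ j w) ⟨$⟩ t ≈ (j v′ ⊗₁ j w′) ⟨$⟩ t
    jj-resp {v = v} {v′} {w} {w′} e e′ = ⊗₁-cong {f = j v} {j v′} {j w} {j w′} (j-resp e) (j-resp e′)

    H₁-jj : ∀ {X Y X′ Y′} (σ : X ≃ X′) (τ : Y ≃ Y′) v w t →
            H₀ X′ ⊗ H₀ Y′ ⊢ (H₁ σ ⊗₁ H₁ τ) ⟨$⟩ (j v ⊗₁ j w) ⟨$⟩ t ≈ (j (σ ∙ᵈ v) ⊗₁ j (τ ∙ᵈ w)) ⟨$⟩ (P₁ σ ⊗₁ P₁ τ) ⟨$⟩ t
    H₁-jj σ τ v w = ⊗-ext ((H₁ σ ⊗₁ H₁ τ) ∘ᴸ (j v ⊗₁ j w)) ((j (σ ∙ᵈ v) ⊗₁ j (τ ∙ᵈ w)) ∘ᴸ (P₁ σ ⊗₁ P₁ τ))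
      (λ p q → H₁-j σ v p ⊠ H₁-j τ w q)

    decoratedCoalgebra : TwistedCoalgebra decorated
    decoratedCoalgebra = record
      { Δ = Δᴴ
      ; ε = εᴴ
      ; Δ-natural = λ {X} {Y} {X′} {Y′} σ τ → H-ext (Δᴴ X′ Y′ ∘ᴸ H₁ (σ ⊔≃ τ)) ((H₁ σ ⊗₁ H₁ τ) ∘ᴸ Δᴴ X Y) (λ v p →
          let v₁ = fstᵈ {V} {X} {Y} v
              v₂ = sndᵈ {V} {X} {Y} v
              w₁ = fstᵈ {V} {X′} {Y′} ((σ ⊔≃ τ) ∙ᵈ v)
              w₂ = sndᵈ {V} {X′} {Y′} ((σ ⊔≃ τ) ∙ᵈ v)
          in
          (Δᴴ X′ Y′ ▹ H₁-j (σ ⊔≃ τ) v p)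
          ⟫ Δ-j {X′} {Y′} ((σ ⊔≃ τ) ∙ᵈ v) (P₁ (σ ⊔≃ τ) ⟨$⟩ p)
          ⟫ ((j w₁ ⊗₁ j w₂) ▹ Δ-natural σ τ p)
          ⟫ jj-resp {v = w₁} {σ ∙ᵈ v₁} {w₂} {τ ∙ᵈ v₂} (λ _ → Module.≈ᴹ-refl V) (λ _ → Module.≈ᴹ-refl V)
              ((P₁ σ ⊗₁ P₁ τ) ⟨$⟩ Δ X Y ⟨$⟩ p)
          ⟫ ≈-sym (H₁-jj σ τ v₁ v₂ (Δ X Y ⟨$⟩ p))
          ⟫ ((H₁ σ ⊗₁ H₁ τ) ▹ ≈-sym (Δ-j {X} {Y} v p)))
      ; Δ-coassoc = λ X Y Z → H-ext (⊗-assoc (H₀ X) (H₀ Y) (H₀ Z) ∘ᴸ (Δᴴ X Y ⊗₁ idᴸ) ∘ᴸ Δᴴ (X ⊔ˢ Y) Z)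
          ((idᴸ ⊗₁ Δᴴ Y Z) ∘ᴸ Δᴴ X (Y ⊔ˢ Z) ∘ᴸ H₁ (⊔-assoc X Y Z)) (λ v p →
          let v₁ = fstᵈ {V} {X ⊔ˢ Y} {Z} v
              v₂ = sndᵈ {V} {X ⊔ˢ Y} {Z} v
              v₁₁ = fstᵈ {V} {X} {Y} v₁
              v₁₂ = sndᵈ {V} {X} {Y} v₁
              w = ⊔-assoc X Y Z ∙ᵈ v
              w₁ = fstᵈ {V} {X} {Y ⊔ˢ Z} w
              w₂ = sndᵈ {V} {X} {Y ⊔ˢ Z} w
              w₂₁ = fstᵈ {V} {Y} {Z} w₂
              w₂₂ = sndᵈ {V} {Y} {Z} w₂
          in
          ((⊗-assoc (H₀ X) (H₀ Y) (H₀ Z) ∘ᴸ (Δᴴ X Y ⊗₁ idᴸ {H₀ Z})) ▹ Δ-j {X ⊔ˢ Y} {Z} v p)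
          ⟫ coassocˡ {X} {Y} {Z} v₁ v₂ (Δ (X ⊔ˢ Y) Z ⟨$⟩ p)
          ⟫ ((j v₁₁ ⊗₁ (j v₁₂ ⊗₁ j v₂)) ▹ Δ-coassoc X Y Z p)
          ⟫ ⊗₁-cong {f = j v₁₁} {j w₁} {j v₁₂ ⊗₁ j v₂} {j w₂₁ ⊗₁ j w₂₂}
              (j-resp {v = v₁₁} {w₁} (λ _ → Module.≈ᴹ-refl V))
              (jj-resp {v = v₁₂} {w₂₁} {v₂} {w₂₂} (λ _ → Module.≈ᴹ-refl V) (λ _ → Module.≈ᴹ-refl V))
              ((idᴸ ⊗₁ Δ Y Z) ⟨$⟩ Δ X (Y ⊔ˢ Z) ⟨$⟩ P₁ (⊔-assoc X Y Z) ⟨$⟩ p)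
          ⟫ ≈-sym (coassocʳ {X} {Y} {Z} w₁ w₂ (Δ X (Y ⊔ˢ Z) ⟨$⟩ P₁ (⊔-assoc X Y Z) ⟨$⟩ p))
          ⟫ ((idᴸ {H₀ X} ⊗₁ Δᴴ Y Z) ▹ ≈-sym (Δ-j {X} {Y ⊔ˢ Z} w (P₁ (⊔-assoc X Y Z) ⟨$⟩ p)))
          ⟫ (((idᴸ {H₀ X} ⊗₁ Δᴴ Y Z) ∘ᴸ Δᴴ X (Y ⊔ˢ Z)) ▹ ≈-sym (H₁-j (⊔-assoc X Y Z) v p)))
      ; Δ-counitˡ = λ X → H-ext (unitˡ (H₀ X) ∘ᴸ (εᴴ ⊗₁ idᴸ {H₀ X}) ∘ᴸ Δᴴ ∅ X) (H₁ (∅⊔≃ X)) (λ v p →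
          ((unitˡ (H₀ X) ∘ᴸ (εᴴ ⊗₁ idᴸ {H₀ X})) ▹ Δ-j {∅} {X} v p)
          ⟫ ⊗-ext (unitˡ (H₀ X) ∘ᴸ (εᴴ ⊗₁ idᴸ {H₀ X}) ∘ᴸ (j (fstᵈ {V} {∅} {X} v) ⊗₁ j (sndᵈ {V} {∅} {X} v)))
                  (j (sndᵈ {V} {∅} {X} v) ∘ᴸ unitˡ (P₀ X) ∘ᴸ (ε ⊗₁ idᴸ))
              (λ a b → Module.*ₗ-cong (H₀ X) (ε-j (fstᵈ {V} {∅} {X} v) a) ≈-refl ⟫ ≈-sym (_⊸_.*ₗ-homo (j (sndᵈ {V} {∅} {X} v)) _ b)) (Δ ∅ X ⟨$⟩ p)
          ⟫ (j (sndᵈ {V} {∅} {X} v) ▹ Δ-counitˡ X p)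
          ⟫ j-resp {v = sndᵈ {V} {∅} {X} v} {∅⊔≃ X ∙ᵈ v} (λ _ → Module.≈ᴹ-refl V) (P₁ (∅⊔≃ X) ⟨$⟩ p)
          ⟫ ≈-sym (H₁-j (∅⊔≃ X) v p))
      ; Δ-counitʳ = λ X → H-ext (unitʳ (H₀ X) ∘ᴸ (idᴸ {H₀ X} ⊗₁ εᴴ) ∘ᴸ Δᴴ X ∅) (H₁ (⊔∅≃ X)) (λ v p →
          ((unitʳ (H₀ X) ∘ᴸ (idᴸ {H₀ X} ⊗₁ εᴴ)) ▹ Δ-j {X} {∅} v p)
          ⟫ ⊗-ext (unitʳ (H₀ X) ∘ᴸ (idᴸ {H₀ X} ⊗₁ εᴴ) ∘ᴸ (j (fstᵈ {V} {X} {∅} v) ⊗₁ j (sndᵈ {V} {X} {∅} v)))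
                  (j (fstᵈ {V} {X} {∅} v) ∘ᴸ unitʳ (P₀ X) ∘ᴸ (idᴸ ⊗₁ ε))
              (λ a b → Module.*ₗ-cong (H₀ X) (ε-j (sndᵈ {V} {X} {∅} v) b) ≈-refl ⟫ ≈-sym (_⊸_.*ₗ-homo (j (fstᵈ {V} {X} {∅} v)) _ a)) (Δ X ∅ ⟨$⟩ p)
          ⟫ (j (fstᵈ {V} {X} {∅} v) ▹ Δ-counitʳ X p)
          ⟫ j-resp {v = fstᵈ {V} {X} {∅} v} {⊔∅≃ X ∙ᵈ v} (λ _ → Module.≈ᴹ-refl V) (P₁ (⊔∅≃ X) ⟨$⟩ p)
          ⟫ ≈-sym (H₁-j (⊔∅≃ X) v p))
      }
      where
      coassocˡ : ∀ {X Y Z} (v : Deco V (X ⊔ˢ Y)) (w : Deco V Z) t →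
        H₀ X ⊗ (H₀ Y ⊗ H₀ Z) ⊢ ⊗-assoc (H₀ X) (H₀ Y) (H₀ Z) ⟨$⟩ (Δᴴ X Y ⊗₁ idᴸ {H₀ Z}) ⟨$⟩ (j v ⊗₁ j w) ⟨$⟩ t
        ≈ (j (fstᵈ {V} {X} {Y} v) ⊗₁ (j (sndᵈ {V} {X} {Y} v) ⊗₁ j w)) ⟨$⟩ ⊗-assoc (P₀ X) (P₀ Y) (P₀ Z) ⟨$⟩ (Δ X Y ⊗₁ idᴸ) ⟨$⟩ t
      coassocˡ {X} {Y} {Z} v w = ⊗-ext (⊗-assoc (H₀ X) (H₀ Y) (H₀ Z) ∘ᴸ (Δᴴ X Y ⊗₁ idᴸ {H₀ Z}) ∘ᴸ (j v ⊗₁ j w))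
        ((j (fstᵈ {V} {X} {Y} v) ⊗₁ (j (sndᵈ {V} {X} {Y} v) ⊗₁ j w)) ∘ᴸ ⊗-assoc (P₀ X) (P₀ Y) (P₀ Z) ∘ᴸ (Δ X Y ⊗₁ idᴸ))
        (λ p q → (⊗-assoc (H₀ X) (H₀ Y) (H₀ Z) ▹ Δ-j {X} {Y} v p ⊠ ≈-refl)
          ⟫ assoc-natural (j (fstᵈ {V} {X} {Y} v)) (j (sndᵈ {V} {X} {Y} v)) (j w) ((Δ X Y ⟨$⟩ p) ⊗ₜ q))

      coassocʳ : ∀ {X Y Z} (v : Deco V X) (w : Deco V (Y ⊔ˢ Z)) t →
        H₀ X ⊗ (H₀ Y ⊗ H₀ Z) ⊢ (idᴸ {H₀ X} ⊗₁ Δᴴ Y Z) ⟨$⟩ (j v ⊗₁ j w) ⟨$⟩ t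
        ≈ (j v ⊗₁ (j (fstᵈ {V} {Y} {Z} w) ⊗₁ j (sndᵈ {V} {Y} {Z} w))) ⟨$⟩ (idᴸ ⊗₁ Δ Y Z) ⟨$⟩ t
      coassocʳ {X} {Y} {Z} v w = ⊗-ext ((idᴸ {H₀ X} ⊗₁ Δᴴ Y Z) ∘ᴸ (j v ⊗₁ j w))
        ((j v ⊗₁ (j (fstᵈ {V} {Y} {Z} w) ⊗₁ j (sndᵈ {V} {Y} {Z} w))) ∘ᴸ (idᴸ ⊗₁ Δ Y Z)) (λ p q → ≈-refl ⊠ Δ-j {Y} {Z} w q)

  module DecoratedBialgebra (B : TwistedBialgebra P) where
    open TwistedBialgebra B
    open DecoratedAlgebra algebra public
    open DecoratedCoalgebra coalgebra public

    private
      swapped : ∀ {A B C D I J} (i : (A ⊔ˢ C) ≃ I) (k : (B ⊔ˢ D) ≃ J)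
                (a : Deco V A) (b : Deco V B) (c : Deco V C) (d : Deco V D) s t →
        H₀ I ⊗ H₀ J ⊢ ((H₁ i ∘ᴸ mᴴ A C) ⊗₁ (H₁ k ∘ᴸ mᴴ B D)) ⟨$⟩ Id⊗c⊗Id (H₀ A) (H₀ B) (H₀ C) (H₀ D)
                        ⟨$⟩ ((j a ⊗₁ j b) ⟨$⟩ s) ⊗ₜ ((j c ⊗₁ j d) ⟨$⟩ t)
                    ≈ (j (i ∙ᵈ (a ⊎ᵈ c)) ⊗₁ j (k ∙ᵈ (b ⊎ᵈ d))) ⟨$⟩ ((P₁ i ∘ᴸ m A C) ⊗₁ (P₁ k ∘ᴸ m B D))
                        ⟨$⟩ Id⊗c⊗Id (P₀ A) (P₀ B) (P₀ C) (P₀ D) ⟨$⟩ s ⊗ₜ t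
      swapped {A} {B} {C} {D} i k a b c d s t = ⊗-ext₄
        (((H₁ i ∘ᴸ mᴴ A C) ⊗₁ (H₁ k ∘ᴸ mᴴ B D)) ∘ᴸ Id⊗c⊗Id (H₀ A) (H₀ B) (H₀ C) (H₀ D) ∘ᴸ ((j a ⊗₁ j b) ⊗₁ (j c ⊗₁ j d)))
        ((j (i ∙ᵈ (a ⊎ᵈ c)) ⊗₁ j (k ∙ᵈ (b ⊎ᵈ d))) ∘ᴸ ((P₁ i ∘ᴸ m A C) ⊗₁ (P₁ k ∘ᴸ m B D))
          ∘ᴸ Id⊗c⊗Id (P₀ A) (P₀ B) (P₀ C) (P₀ D))
        (λ p q p′ q′ → ((H₁ i ▹ m-j a p c p′) ⟫ H₁-j i (a ⊎ᵈ c) (m A C ⟨$⟩ p ⊗ₜ p′))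
                     ⊠ ((H₁ k ▹ m-j b q d q′) ⟫ H₁-j k (b ⊎ᵈ d) (m B D ⟨$⟩ q ⊗ₜ q′)))
        (s ⊗ₜ t)

      half : ∀ {A B X} (σ : (A ⊔ˢ B) ≃ X) (v : Deco V X) p →
             H₀ A ⊗ H₀ B ⊢ Δᴴ A B ⟨$⟩ H₁ (σ ⁻¹≃) ⟨$⟩ j v ⟨$⟩ p
                         ≈ (j (fstᵈ {V} {A} {B} (σ ⁻¹≃ ∙ᵈ v)) ⊗₁ j (sndᵈ {V} {A} {B} (σ ⁻¹≃ ∙ᵈ v))) ⟨$⟩ Δ A B ⟨$⟩ P₁ (σ ⁻¹≃) ⟨$⟩ p
      half {A} {B} σ v p = (Δᴴ A B ▹ H₁-j (σ ⁻¹≃) v p) ⟫ Δ-j {A} {B} (σ ⁻¹≃ ∙ᵈ v) (P₁ (σ ⁻¹≃) ⟨$⟩ p)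

    decoratedBialgebra : TwistedBialgebra decorated
    decoratedBialgebra = record
      { algebra   = decoratedAlgebra
      ; coalgebra = decoratedCoalgebra
      ; Δ-m = λ {I} {J} {I′} {J′} {A} {B} {C} {D} θ i′ j′ i k sq →
          H-ext₂ (Δᴴ I J ∘ᴸ H₁ θ ∘ᴸ mᴴ I′ J′)
            (((H₁ i ∘ᴸ mᴴ A C) ⊗₁ (H₁ k ∘ᴸ mᴴ B D)) ∘ᴸ Id⊗c⊗Id (H₀ A) (H₀ B) (H₀ C) (H₀ D)
              ∘ᴸ ((Δᴴ A B ∘ᴸ H₁ (i′ ⁻¹≃)) ⊗₁ (Δᴴ C D ∘ᴸ H₁ (j′ ⁻¹≃))))
            (λ v p w q →
              let a = fstᵈ {V} {A} {B} (i′ ⁻¹≃ ∙ᵈ v)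
                  b = sndᵈ {V} {A} {B} (i′ ⁻¹≃ ∙ᵈ v)
                  c = fstᵈ {V} {C} {D} (j′ ⁻¹≃ ∙ᵈ w)
                  d = sndᵈ {V} {C} {D} (j′ ⁻¹≃ ∙ᵈ w)
                  r = m I′ J′ ⟨$⟩ p ⊗ₜ q
                  s = Δ A B ⟨$⟩ P₁ (i′ ⁻¹≃) ⟨$⟩ p
                  t = Δ C D ⟨$⟩ P₁ (j′ ⁻¹≃) ⟨$⟩ q
                  u = θ ∙ᵈ (v ⊎ᵈ w)
                  -- Inverts the square pointwise: θ⁻¹ of a point of I ⊔ J is found by going back
                  -- through the four intersections, where the two decorations are compared.
                  back = λ z → FinSet.≈-trans (I′ ⊔ˢ J′) (_≃_.from-cong θ (square {I} {J} {I′} {J′} {A} {B} {C} {D} θ i′ j′ i k sq z))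
                                 (_≃_.strictlyInverseʳ θ _)
              in
              ((Δᴴ I J ∘ᴸ H₁ θ) ▹ m-j v p w q)
              ⟫ (Δᴴ I J ▹ H₁-j θ (v ⊎ᵈ w) r)
              ⟫ Δ-j {I} {J} u (P₁ θ ⟨$⟩ r)
              ⟫ ((j (fstᵈ {V} {I} {J} u) ⊗₁ j (sndᵈ {V} {I} {J} u)) ▹ Δ-m θ i′ j′ i k sq (p ⊗ₜ q))
              ⟫ jj-resp {v = fstᵈ {V} {I} {J} u} {i ∙ᵈ (a ⊎ᵈ c)} {sndᵈ {V} {I} {J} u} {k ∙ᵈ (b ⊎ᵈ d)}
                  (λ y → Module.≈ᴹ-trans V (at-cong (v ⊎ᵈ w) (FinSet.≈-trans (I′ ⊔ˢ J′)
                      (_≃_.from-cong θ (inj₁ (FinSet.≈-sym I (_≃_.strictlyInverseˡ i y)))) (back (inj₁ (_≃_.from i y)))))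
                    (left {A = A} {B} {C} {D} i′ j′ v w (_≃_.from i y)))
                  (λ y → Module.≈ᴹ-trans V (at-cong (v ⊎ᵈ w) (FinSet.≈-trans (I′ ⊔ˢ J′)
                      (_≃_.from-cong θ (inj₂ (FinSet.≈-sym J (_≃_.strictlyInverseˡ k y)))) (back (inj₂ (_≃_.from k y)))))
                    (right {A = A} {B} {C} {D} i′ j′ v w (_≃_.from k y)))
                  (((P₁ i ∘ᴸ m A C) ⊗₁ (P₁ k ∘ᴸ m B D)) ⟨$⟩ Id⊗c⊗Id (P₀ A) (P₀ B) (P₀ C) (P₀ D) ⟨$⟩ s ⊗ₜ t)
              ⟫ ≈-sym (swapped {A} {B} {C} {D} i k a b c d s t)
              ⟫ ((((H₁ i ∘ᴸ mᴴ A C) ⊗₁ (H₁ k ∘ᴸ mᴴ B D)) ∘ᴸ Id⊗c⊗Id (H₀ A) (H₀ B) (H₀ C) (H₀ D))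
                  ▹ ≈-sym (half {A} {B} i′ v p) ⊠ ≈-sym (half {C} {D} j′ w q)))
      ; Δ-1 = (Δᴴ ∅ ∅ ▹ H₁-j (∅⊔≃ ∅ ⁻¹≃) ∅ᵈ 1ₚ) ⟫ Δ-j {∅} {∅} (∅⊔≃ ∅ ⁻¹≃ ∙ᵈ ∅ᵈ) (P₁ (∅⊔≃ ∅ ⁻¹≃) ⟨$⟩ 1ₚ)
          ⟫ ((j (fstᵈ {V} {∅} {∅} (∅⊔≃ ∅ ⁻¹≃ ∙ᵈ ∅ᵈ)) ⊗₁ j (sndᵈ {V} {∅} {∅} (∅⊔≃ ∅ ⁻¹≃ ∙ᵈ ∅ᵈ))) ▹ Δ-1) ⟫ (j-resp (λ ()) 1ₚ ⊠ j-resp (λ ()) 1ₚ)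
      ; ε-m = H-ext₂ (εᴴ ∘ᴸ H₁ (∅⊔≃ ∅) ∘ᴸ mᴴ ∅ ∅) (unitˡ 𝕂 ∘ᴸ (εᴴ ⊗₁ εᴴ)) (λ v p w q →
          𝕜.trans ((εᴴ ∘ᴸ H₁ (∅⊔≃ ∅)) ▹ m-j v p w q) (𝕜.trans (εᴴ ▹ H₁-j (∅⊔≃ ∅) (v ⊎ᵈ w) (m ∅ ∅ ⟨$⟩ p ⊗ₜ q))
            (𝕜.trans (ε-j (∅⊔≃ ∅ ∙ᵈ (v ⊎ᵈ w)) (P₁ (∅⊔≃ ∅) ⟨$⟩ m ∅ ∅ ⟨$⟩ p ⊗ₜ q))
              (𝕜.trans (ε-m (p ⊗ₜ q)) (𝕜.*-cong (𝕜.sym (ε-j v p)) (𝕜.sym (ε-j w q)))))))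
      ; ε-1 = 𝕜.trans (ε-j ∅ᵈ 1ₚ) ε-1
      }
      where
      square : ∀ {I J I′ J′ A B C D} (θ : (I′ ⊔ˢ J′) ≃ (I ⊔ˢ J)) (i′ : (A ⊔ˢ B) ≃ I′) (j′ : (C ⊔ˢ D) ≃ J′)
               (i : (A ⊔ˢ C) ≃ I) (k : (B ⊔ˢ D) ≃ J) → θ ∘≃ (i′ ⊔≃ j′) ≗≃ (i ⊔≃ k) ∘≃ middle-swap A B C D → ∀ z →
               FinSet._≈_ (I ⊔ˢ J) (_≃_.to (i ⊔≃ k) z)
                 (_≃_.to θ (_≃_.to (i′ ⊔≃ j′) (_≃_.from (middle-swap A B C D) z)))
      square {I} {J} {A = A} {B} {C} {D} θ i′ j′ i k sq z = FinSet.≈-sym (I ⊔ˢ J) (FinSet.≈-trans (I ⊔ˢ J)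
        (sq (_≃_.from (middle-swap A B C D) z)) (_≃_.to-cong (i ⊔≃ k) (_≃_.strictlyInverseˡ (middle-swap A B C D) z)))

      left : ∀ {I′ J′ A B C D} (i′ : (A ⊔ˢ B) ≃ I′) (j′ : (C ⊔ˢ D) ≃ J′) (v : Deco V I′) (w : Deco V J′) z →
             V ⊢ at (v ⊎ᵈ w) (_≃_.to (i′ ⊔≃ j′) (_≃_.from (middle-swap A B C D) (inj₁ z)))
               ≈ at (fstᵈ {V} {A} {B} (i′ ⁻¹≃ ∙ᵈ v) ⊎ᵈ fstᵈ {V} {C} {D} (j′ ⁻¹≃ ∙ᵈ w)) z
      left i′ j′ v w (inj₁ _) = Module.≈ᴹ-refl V
      left i′ j′ v w (inj₂ _) = Module.≈ᴹ-refl V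

      right : ∀ {I′ J′ A B C D} (i′ : (A ⊔ˢ B) ≃ I′) (j′ : (C ⊔ˢ D) ≃ J′) (v : Deco V I′) (w : Deco V J′) z →
              V ⊢ at (v ⊎ᵈ w) (_≃_.to (i′ ⊔≃ j′) (_≃_.from (middle-swap A B C D) (inj₂ z)))
                ≈ at (sndᵈ {V} {A} {B} (i′ ⁻¹≃ ∙ᵈ v) ⊎ᵈ sndᵈ {V} {C} {D} (j′ ⁻¹≃ ∙ᵈ w)) z
      right i′ j′ v w (inj₁ _) = Module.≈ᴹ-refl V
      right i′ j′ v w (inj₂ _) = Module.≈ᴹ-refl V

-- Contraction maps of the decorated species.  They are developed for arbitrary
-- finite sets A in the place of X/E, with a slotwise linear map in the place of
-- the product over the blocks.

module Extension {ℓ} (K : HeytingField ℓ ℓ ℓ)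
                 (V : Over.CommBialgebra K) (P : Over.Species K) (B : Over.TwistedBialgebra K P) where
  open Over K
  open Linear K
  open Decorations K
  open PointwiseMultilinear K
  open BlockProducts K
  open Species P
  open TwistedBialgebra B
  private
    module 𝕜 = CommutativeRing commRing
    module V = CommBialgebra V

    U : Vect
    U = V.space

  open DecoratedSpecies K (CommBialgebra.space V) P
  open DecoratedBialgebra B

  private
    infixr 4 _⟫_
    _⟫_ : ∀ {G : Set ℓ} {R : Rel (Term G) ℓ} {s t u} → _≈ᵗ_ R s t → _≈ᵗ_ R t u → _≈ᵗ_ R s u
    _⟫_ = ≈-trans

    id-slotwise : ∀ {M X} → SlotwiseLinear M X M X id
    id-slotwise = record { respˢ = id ; slot = id ; addˢ = id ; scaleˢ = id }

    ⊠ᵈ-slotwiseˡ : ∀ {M N X} (b : Deco N X) → SlotwiseLinear M X (M ⊗ N) X (_⊠ᵈ b)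
    ⊠ᵈ-slotwiseˡ {M} {N} b = record
      { respˢ  = λ e x → e x ⊠ Module.≈ᴹ-refl N
      ; slot   = id
      ; addˢ   = λ {x} {u} {v} {w} (p , q) → ((p ⊠ Module.≈ᴹ-refl N) ⟫ rel (⊗-+ˡ (at v x) (at w x) (at b x))) ,
          (λ y ne → (proj₁ (q y ne) ⊠ Module.≈ᴹ-refl N) , (proj₂ (q y ne) ⊠ Module.≈ᴹ-refl N))
      ; scaleˢ = λ {x} {k} {u} {v} (p , q) → ((p ⊠ Module.≈ᴹ-refl N) ⟫ rel (⊗-*ˡ k (at v x) (at b x))) ,
          (λ y ne → q y ne ⊠ Module.≈ᴹ-refl N)
      }

  record Push (M : Vect) (X A : FinSet) : Set ℓ where
    field
      push     : Deco M X → Deco M A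
      slotwise : SlotwiseLinear M X M A push

  open Push public

  push-at : ∀ {X A} (ρ : Push U X A) p → Multilinear U X (H₀ A) (λ a → j (push ρ a) ⟨$⟩ p)
  push-at ρ p = multilinear-∘ (j-at p) (slotwise ρ)

  private
    pair : ∀ {X A} → Push U X A → Deco U X → Deco U X → P₀ A ⊗ P₀ X ⊸ H₀ A ⊗ H₀ X
    pair ρ a b = j (push ρ a) ⊗₁ j b

    pair-bi : ∀ {X A} (ρ : Push U X A) z → Bimultilinear U U X (H₀ A ⊗ H₀ X) (λ a b → pair ρ a b ⟨$⟩ z)
    pair-bi ρ z = record
      { multiˡ = λ b → tensorˡ-at {F = λ a → j (push ρ a)} (push-at ρ) (j b) z
      ; multiʳ = λ a → tensorʳ-at {F = j} (j (push ρ a)) j-at z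
      }

  opaque
    -- One term of the coproduct with δ_V still to be applied: a decoration by tensors v′ ⊗ v″ sends
    -- the v′ through `ρ` to A and keeps the v″ on X.
    Λ : ∀ {X A} → Push U X A → Deco (U ⊗ U) X → P₀ A ⊗ P₀ X ⊸ H₀ A ⊗ H₀ X
    Λ {X} ρ = expandᴸ X {pair ρ} (pair-bi ρ)

    Λ-def : ∀ {X A} (ρ : Push U X A) τ z →
            H₀ A ⊗ H₀ X ⊢ Λ ρ τ ⟨$⟩ z ≈ expand {U} {U} {H₀ A ⊗ H₀ X} X (λ a b → (j (push ρ a) ⊗₁ j b) ⟨$⟩ z) τ
    Λ-def ρ τ z = ≈-refl

    Λ-at : ∀ {X A} (ρ : Push U X A) z → Multilinear (U ⊗ U) X (H₀ A ⊗ H₀ X) (λ τ → Λ ρ τ ⟨$⟩ z)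
    Λ-at {X} ρ = expandᴸ-at X {pair ρ} (pair-bi ρ)

    Λ-pure : ∀ {X A} (ρ : Push U X A) a b z → H₀ A ⊗ H₀ X ⊢ Λ ρ (a ⊠ᵈ b) ⟨$⟩ z ≈ (j (push ρ a) ⊗₁ j b) ⟨$⟩ z
    Λ-pure {X} ρ = expandᴸ-pure X {pair ρ} (pair-bi ρ)

  Λ-resp : ∀ {X A} (ρ : Push U X A) {τ υ} → τ ≈ᵈ υ → ∀ z → H₀ A ⊗ H₀ X ⊢ Λ ρ τ ⟨$⟩ z ≈ Λ ρ υ ⟨$⟩ z
  Λ-resp ρ e z = resp (Λ-at ρ z) e

  private
    Λ-comp : ∀ {M Y X A} (ρ : Push U X A) z {R} (f : H₀ A ⊗ H₀ X ⊸ R) {ψ : Deco M Y → Deco (U ⊗ U) X} →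
             SlotwiseLinear M Y (U ⊗ U) X ψ → Multilinear M Y R (λ τ → f ⟨$⟩ Λ ρ (ψ τ) ⟨$⟩ z)
    Λ-comp ρ z f {ψ} s = linear-multilinear {F = λ τ → Λ ρ (ψ τ) ⟨$⟩ z} f (multilinear-∘ (Λ-at ρ z) s)

  opaque
    -- With `d` the map δ_∼ of P and `ρ` the class product, this is δ_∼ on V^⊗X ⊗ P[X].
    extend : ∀ {X A} → Push U X A → P₀ X ⊸ P₀ A ⊗ P₀ X → H₀ X ⊸ H₀ A ⊗ H₀ X
    extend {X} {A} ρ d = H-lift (H₀ A ⊗ H₀ X) (λ v → Λ ρ (V.δ ∘ᵈ v) ∘ᴸ d)
      (λ p → multilinear-∘ (Λ-at ρ (d ⟨$⟩ p)) (∘ᵈ-slotwise V.δ))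

    extend-j : ∀ {X A} (ρ : Push U X A) d v p →
               H₀ A ⊗ H₀ X ⊢ extend ρ d ⟨$⟩ j v ⟨$⟩ p ≈ Λ ρ (V.δ ∘ᵈ v) ⟨$⟩ d ⟨$⟩ p
    extend-j ρ d v p = ≈-refl

    ϵᴴ : ∀ {X} → P₀ X ⊸ 𝕂 → H₀ X ⊸ 𝕂
    ϵᴴ {X} ϵ = H-lift 𝕂 (λ v → ∏ X (at (V.ε ∘ᵈ v)) *ᴸ ϵ) (λ p → record
      { resp  = λ {v} {w} e → 𝕜.*-cong (resp t {v} {w} e) 𝕜.refl
      ; add   = λ {x} {u} {v} {w} a → 𝕜.trans (𝕜.*-cong (add t {x} {u} {v} {w} a) 𝕜.refl) (𝕜.distribʳ _ _ _)
      ; scale = λ {x} {k} {u} {v} a → 𝕜.trans (𝕜.*-cong (scale t {x} {k} {u} {v} a) 𝕜.refl) (𝕜.*-assoc _ _ _)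
      })
      where
      t : Multilinear U X 𝕂 (λ v → ∏ X (at (V.ε ∘ᵈ v)))
      t = multilinear-∘ (∏-multilinear X) (∘ᵈ-slotwise V.ε)

    ϵ-j : ∀ {X} (ϵ : P₀ X ⊸ 𝕂) v p → ϵᴴ ϵ ⟨$⟩ j v ⟨$⟩ p ≈ᵏ ∏ X (at (V.ε ∘ᵈ v)) * (ϵ ⟨$⟩ p)
    ϵ-j ϵ v p = 𝕜.refl

  module _ {X Y A A′ : FinSet} (σ : X ≃ Y) (q : A ≃ A′) (ρ : Push U X A) (ρ′ : Push U Y A′)
           (square : ∀ a → push ρ′ (σ ∙ᵈ a) ≈ᵈ q ∙ᵈ push ρ a) where

    Λ-natural : ∀ τ z → H₀ A′ ⊗ H₀ Y ⊢ Λ ρ′ (σ ∙ᵈ τ) ⟨$⟩ (P₁ q ⊗₁ P₁ σ) ⟨$⟩ z ≈ (H₁ q ⊗₁ H₁ σ) ⟨$⟩ Λ ρ τ ⟨$⟩ z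
    Λ-natural τ z = multi-ext {U} {U} {H₀ A′ ⊗ H₀ Y} X
      {λ τ → Λ ρ′ (σ ∙ᵈ τ) ⟨$⟩ z′} {λ τ → (H₁ q ⊗₁ H₁ σ) ⟨$⟩ Λ ρ τ ⟨$⟩ z}
      (Λ-comp ρ′ z′ idᴸ (∙ᵈ-slotwise σ)) (Λ-comp ρ z (H₁ q ⊗₁ H₁ σ) id-slotwise)
      (λ a b → Λ-resp ρ′ {σ ∙ᵈ (a ⊠ᵈ b)} {(σ ∙ᵈ a) ⊠ᵈ (σ ∙ᵈ b)} (λ _ → ≈-refl) z′
        ⟫ Λ-pure ρ′ (σ ∙ᵈ a) (σ ∙ᵈ b) z′
        ⟫ jj-resp {v = push ρ′ (σ ∙ᵈ a)} {q ∙ᵈ push ρ a} {σ ∙ᵈ b} {σ ∙ᵈ b} (square a) (λ _ → Module.≈ᴹ-refl U) z′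
        ⟫ ≈-sym (H₁-jj q σ (push ρ a) b z)
        ⟫ ((H₁ q ⊗₁ H₁ σ) ▹ ≈-sym (Λ-pure ρ a b z))) τ
      where z′ = (P₁ q ⊗₁ P₁ σ) ⟨$⟩ z

    extend-natural : ∀ d d′ → (∀ p → P₀ A′ ⊗ P₀ Y ⊢ d′ ⟨$⟩ P₁ σ ⟨$⟩ p ≈ (P₁ q ⊗₁ P₁ σ) ⟨$⟩ d ⟨$⟩ p) →
                     extend ρ′ d′ ∘ᴸ H₁ σ ≗ᴸ (H₁ q ⊗₁ H₁ σ) ∘ᴸ extend ρ d
    extend-natural d d′ h = H-ext (extend ρ′ d′ ∘ᴸ H₁ σ) ((H₁ q ⊗₁ H₁ σ) ∘ᴸ extend ρ d) (λ v p →
      (extend ρ′ d′ ▹ H₁-j σ v p)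
      ⟫ extend-j ρ′ d′ (σ ∙ᵈ v) (P₁ σ ⟨$⟩ p)
      ⟫ Λ-resp ρ′ {V.δ ∘ᵈ (σ ∙ᵈ v)} {σ ∙ᵈ (V.δ ∘ᵈ v)} (λ _ → ≈-refl) (d′ ⟨$⟩ P₁ σ ⟨$⟩ p)
      ⟫ (Λ ρ′ (σ ∙ᵈ (V.δ ∘ᵈ v)) ▹ h p)
      ⟫ Λ-natural (V.δ ∘ᵈ v) (d ⟨$⟩ p)
      ⟫ ((H₁ q ⊗₁ H₁ σ) ▹ ≈-sym (extend-j ρ d v p)))

  module _ {X A A′ : FinSet} (ρ : Push U X A) (ρ′ : Push U X A′) where
    private
      pair₃ : Deco U X → Deco (U ⊗ U) X → P₀ A ⊗ (P₀ A′ ⊗ P₀ X) ⊸ H₀ A ⊗ (H₀ A′ ⊗ H₀ X)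
      pair₃ a υ = j (push ρ a) ⊗₁ Λ ρ′ υ

      pair₃-bi : ∀ z → Bimultilinear U (U ⊗ U) X (H₀ A ⊗ (H₀ A′ ⊗ H₀ X)) (λ a υ → pair₃ a υ ⟨$⟩ z)
      pair₃-bi z = record
        { multiˡ = λ υ → tensorˡ-at {F = λ a → j (push ρ a)} (push-at ρ) (Λ ρ′ υ) z
        ; multiʳ = λ a → tensorʳ-at {F = Λ ρ′} (j (push ρ a)) (Λ-at ρ′) z
        }

    opaque
      -- Both iterated maps pass through decorations by three-fold tensors: the first leg is pushed
      -- to A, the second to A′, and the third stays on X.
      Θ : Deco (U ⊗ (U ⊗ U)) X → P₀ A ⊗ (P₀ A′ ⊗ P₀ X) ⊸ H₀ A ⊗ (H₀ A′ ⊗ H₀ X)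
      Θ = expandᴸ X {pair₃} pair₃-bi

      Θ-at : ∀ z → Multilinear (U ⊗ (U ⊗ U)) X (H₀ A ⊗ (H₀ A′ ⊗ H₀ X)) (λ τ → Θ τ ⟨$⟩ z)
      Θ-at = expandᴸ-at X {pair₃} pair₃-bi

      Θ-pure : ∀ a υ z → H₀ A ⊗ (H₀ A′ ⊗ H₀ X) ⊢ Θ (a ⊠ᵈ υ) ⟨$⟩ z ≈ (j (push ρ a) ⊗₁ Λ ρ′ υ) ⟨$⟩ z
      Θ-pure = expandᴸ-pure X {pair₃} pair₃-bi

    module _ (d : P₀ X ⊸ P₀ A ⊗ P₀ X) (d′ : P₀ X ⊸ P₀ A′ ⊗ P₀ X) where

      Θʳ : ∀ τ z → H₀ A ⊗ (H₀ A′ ⊗ H₀ X) ⊢ (idᴸ {H₀ A} ⊗₁ extend ρ′ d′) ⟨$⟩ Λ ρ τ ⟨$⟩ z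
                                         ≈ Θ ((idᴸ {U} ⊗₁ V.δ) ∘ᵈ τ) ⟨$⟩ (idᴸ {P₀ A} ⊗₁ d′) ⟨$⟩ z
      Θʳ τ z = multi-ext {U} {U} {H₀ A ⊗ (H₀ A′ ⊗ H₀ X)} X
        {λ τ → (idᴸ {H₀ A} ⊗₁ extend ρ′ d′) ⟨$⟩ Λ ρ τ ⟨$⟩ z} {λ τ → Θ ((idᴸ {U} ⊗₁ V.δ) ∘ᵈ τ) ⟨$⟩ z′}
        (Λ-comp ρ z (idᴸ ⊗₁ extend ρ′ d′) id-slotwise)
        (multilinear-∘ (Θ-at z′) (∘ᵈ-slotwise (idᴸ {U} ⊗₁ V.δ)))
        (λ a b → ((idᴸ {H₀ A} ⊗₁ extend ρ′ d′) ▹ Λ-pure ρ a b z)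
          ⟫ ⊗-ext ((idᴸ {H₀ A} ⊗₁ extend ρ′ d′) ∘ᴸ (j (push ρ a) ⊗₁ j b)) ((j (push ρ a) ⊗₁ Λ ρ′ (V.δ ∘ᵈ b)) ∘ᴸ (idᴸ {P₀ A} ⊗₁ d′))
              (λ x y → ≈-refl ⊠ extend-j ρ′ d′ b y) z
          ⟫ ≈-sym (Θ-pure a (V.δ ∘ᵈ b) z′)
          ⟫ resp (Θ-at z′) {a ⊠ᵈ (V.δ ∘ᵈ b)} {(idᴸ {U} ⊗₁ V.δ) ∘ᵈ (a ⊠ᵈ b)} (λ _ → ≈-refl)) τ
        where z′ = (idᴸ {P₀ A} ⊗₁ d′) ⟨$⟩ z

      extend-vanish : (idᴸ {P₀ A} ⊗₁ d′) ∘ᴸ d ≗ᴸ 0ᴸ → (idᴸ {H₀ A} ⊗₁ extend ρ′ d′) ∘ᴸ extend ρ d ≗ᴸ 0ᴸ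
      extend-vanish h = H-ext ((idᴸ {H₀ A} ⊗₁ extend ρ′ d′) ∘ᴸ extend ρ d) 0ᴸ (λ v p →
        ((idᴸ {H₀ A} ⊗₁ extend ρ′ d′) ▹ extend-j ρ d v p)
        ⟫ Θʳ (V.δ ∘ᵈ v) (d ⟨$⟩ p)
        ⟫ (Θ ((idᴸ {U} ⊗₁ V.δ) ∘ᵈ (V.δ ∘ᵈ v)) ▹ h p)
        ⟫ _⊸_.0ᴹ-homo (Θ ((idᴸ {U} ⊗₁ V.δ) ∘ᵈ (V.δ ∘ᵈ v))))

      -- Here A, A′, A″ stand for X/E, X/E′ and (X/E′)/E. The map `ρ²` is the class product in V ⊗
      -- V: `ρ²-⊠` says that it is computed factorwise, `ρ²-δ` that δ_V commutes with class
      -- products, and `t-push` that products over classes of classes are products over classes.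
      module _ {A″ : FinSet} (ρ² : Push (U ⊗ U) X A′) (ω : Push U A′ A″) (t : A″ ≃ A)
               (ρ²-⊠ : ∀ a b → push ρ² (a ⊠ᵈ b) ≈ᵈ push ρ′ a ⊠ᵈ push ρ′ b)
               (ρ²-δ : ∀ a → V.δ ∘ᵈ push ρ′ a ≈ᵈ push ρ² (V.δ ∘ᵈ a))
               (t-push : ∀ a → t ∙ᵈ push ω (push ρ′ a) ≈ᵈ push ρ a)
               (e : P₀ A′ ⊸ P₀ A″ ⊗ P₀ A′) where
        private
          αᵁ : (U ⊗ U) ⊗ U ⊸ U ⊗ (U ⊗ U)
          αᵁ = ⊗-assoc U U U

          opaque
            δ³ : U ⊗ U ⊸ U ⊗ (U ⊗ U)
            δ³ = αᵁ ∘ᴸ (V.δ ⊗₁ idᴸ {U})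

            δ³-pure : ∀ x y → U ⊗ (U ⊗ U) ⊢ δ³ ⟨$⟩ x ⊗ₜ y ≈ αᵁ ⟨$⟩ (V.δ ⟨$⟩ x) ⊗ₜ y
            δ³-pure x y = ≈-refl

            δ³-coassoc : ∀ x → U ⊗ (U ⊗ U) ⊢ δ³ ⟨$⟩ V.δ ⟨$⟩ x ≈ (idᴸ {U} ⊗₁ V.δ) ⟨$⟩ V.δ ⟨$⟩ x
            δ³-coassoc x = V.δ-coassoc x

        opaque
          joinᴴ : (H₀ A″ ⊗ H₀ A′) ⊗ H₀ X ⊸ H₀ A ⊗ (H₀ A′ ⊗ H₀ X)
          joinᴴ = ⊗-assoc (H₀ A) (H₀ A′) (H₀ X) ∘ᴸ ((H₁ t ⊗₁ idᴸ {H₀ A′}) ⊗₁ idᴸ {H₀ X})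

          joinᴾ : (P₀ A″ ⊗ P₀ A′) ⊗ P₀ X ⊸ P₀ A ⊗ (P₀ A′ ⊗ P₀ X)
          joinᴾ = ⊗-assoc (P₀ A) (P₀ A′) (P₀ X) ∘ᴸ ((P₁ t ⊗₁ idᴸ {P₀ A′}) ⊗₁ idᴸ {P₀ X})

          joinᴴ-pure : ∀ x x′ y → H₀ A ⊗ (H₀ A′ ⊗ H₀ X) ⊢ joinᴴ ⟨$⟩ (x ⊗ₜ x′) ⊗ₜ y ≈ (H₁ t ⟨$⟩ x) ⊗ₜ (x′ ⊗ₜ y)
          joinᴴ-pure x x′ y = ≈-refl

          joinᴾ-pure : ∀ x x′ y → P₀ A ⊗ (P₀ A′ ⊗ P₀ X) ⊢ joinᴾ ⟨$⟩ (x ⊗ₜ x′) ⊗ₜ y ≈ (P₁ t ⟨$⟩ x) ⊗ₜ (x′ ⊗ₜ y)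
          joinᴾ-pure x x′ y = ≈-refl

          joinᴴ-def : ∀ (f : H₀ A′ ⊸ H₀ A″ ⊗ H₀ A′) z → H₀ A ⊗ (H₀ A′ ⊗ H₀ X) ⊢ ⊗-assoc (H₀ A) (H₀ A′) (H₀ X)
            ⟨$⟩ (((H₁ t ⊗₁ idᴸ {H₀ A′}) ∘ᴸ f) ⊗₁ idᴸ {H₀ X}) ⟨$⟩ z ≈ joinᴴ ⟨$⟩ (f ⊗₁ idᴸ {H₀ X}) ⟨$⟩ z
          joinᴴ-def f = ⊗-ext (⊗-assoc (H₀ A) (H₀ A′) (H₀ X) ∘ᴸ (((H₁ t ⊗₁ idᴸ {H₀ A′}) ∘ᴸ f) ⊗₁ idᴸ {H₀ X}))
            (joinᴴ ∘ᴸ (f ⊗₁ idᴸ {H₀ X})) (λ x y → ≈-refl)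

          joinᴾ-def : ∀ z → P₀ A ⊗ (P₀ A′ ⊗ P₀ X) ⊢ joinᴾ ⟨$⟩ (e ⊗₁ idᴸ {P₀ X}) ⟨$⟩ z
            ≈ ⊗-assoc (P₀ A) (P₀ A′) (P₀ X) ⟨$⟩ (((P₁ t ⊗₁ idᴸ {P₀ A′}) ∘ᴸ e) ⊗₁ idᴸ {P₀ X}) ⟨$⟩ z
          joinᴾ-def = ⊗-ext (joinᴾ ∘ᴸ (e ⊗₁ idᴸ {P₀ X}))
            (⊗-assoc (P₀ A) (P₀ A′) (P₀ X) ∘ᴸ (((P₁ t ⊗₁ idᴸ {P₀ A′}) ∘ᴸ e) ⊗₁ idᴸ {P₀ X})) (λ x y → ≈-refl)

        private
          inner-pure : ∀ a c b s y → H₀ A ⊗ (H₀ A′ ⊗ H₀ X) ⊢ joinᴴ ⟨$⟩ ((j (push ω (push ρ′ a)) ⊗₁ j (push ρ′ c)) ⟨$⟩ s) ⊗ₜ (j b ⟨$⟩ y)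
                                        ≈ (j (push ρ a) ⊗₁ Λ ρ′ (c ⊠ᵈ b)) ⟨$⟩ joinᴾ ⟨$⟩ s ⊗ₜ y
          inner-pure a c b s y = ⊗-ext
            (joinᴴ ∘ᴸ inˡ (j b ⟨$⟩ y) ∘ᴸ (j (push ω (push ρ′ a)) ⊗₁ j (push ρ′ c)))
            ((j (push ρ a) ⊗₁ Λ ρ′ (c ⊠ᵈ b)) ∘ᴸ joinᴾ ∘ᴸ inˡ y)
            (λ x x′ → joinᴴ-pure (j (push ω (push ρ′ a)) ⟨$⟩ x) (j (push ρ′ c) ⟨$⟩ x′) (j b ⟨$⟩ y)
              ⟫ ((H₁-j t (push ω (push ρ′ a)) x ⟫ j-resp (t-push a) (P₁ t ⟨$⟩ x)) ⊠ ≈-sym (Λ-pure ρ′ c b (x′ ⊗ₜ y)))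
              ⟫ ((j (push ρ a) ⊗₁ Λ ρ′ (c ⊠ᵈ b)) ▹ ≈-sym (joinᴾ-pure x x′ y))) s

          inner : ∀ υ b s y → H₀ A ⊗ (H₀ A′ ⊗ H₀ X) ⊢ joinᴴ ⟨$⟩ (Λ ω (push ρ² υ) ⟨$⟩ s) ⊗ₜ (j b ⟨$⟩ y)
                                 ≈ Θ (αᵁ ∘ᵈ (υ ⊠ᵈ b)) ⟨$⟩ joinᴾ ⟨$⟩ s ⊗ₜ y
          inner υ b s y = multi-ext {U} {U} {H₀ A ⊗ (H₀ A′ ⊗ H₀ X)} X
            {λ υ → joinᴴ ⟨$⟩ (Λ ω (push ρ² υ) ⟨$⟩ s) ⊗ₜ (j b ⟨$⟩ y)} {λ υ → Θ (αᵁ ∘ᵈ (υ ⊠ᵈ b)) ⟨$⟩ joinᴾ ⟨$⟩ s ⊗ₜ y}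
            (Λ-comp ω s (joinᴴ ∘ᴸ inˡ (j b ⟨$⟩ y)) (slotwise ρ²))
            (multilinear-∘ (Θ-at (joinᴾ ⟨$⟩ s ⊗ₜ y)) (slotwise-∘ (∘ᵈ-slotwise αᵁ) (⊠ᵈ-slotwiseˡ b)))
            (λ a c → ((joinᴴ ∘ᴸ inˡ (j b ⟨$⟩ y)) ▹
                (Λ-resp ω {push ρ² (a ⊠ᵈ c)} {push ρ′ a ⊠ᵈ push ρ′ c} (ρ²-⊠ a c) s ⟫ Λ-pure ω (push ρ′ a) (push ρ′ c) s))
              ⟫ inner-pure a c b s y
              ⟫ ≈-sym (Θ-pure a (c ⊠ᵈ b) (joinᴾ ⟨$⟩ s ⊗ₜ y))
              ⟫ resp (Θ-at (joinᴾ ⟨$⟩ s ⊗ₜ y)) {a ⊠ᵈ (c ⊠ᵈ b)} {αᵁ ∘ᵈ ((a ⊠ᵈ c) ⊠ᵈ b)} (λ _ → ≈-refl)) υ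

          Θˡ-pure : ∀ a b z → H₀ A ⊗ (H₀ A′ ⊗ H₀ X) ⊢ joinᴴ ⟨$⟩ (extend ω e ⊗₁ idᴸ {H₀ X}) ⟨$⟩ (j (push ρ′ a) ⊗₁ j b) ⟨$⟩ z
                                ≈ Θ (αᵁ ∘ᵈ ((V.δ ∘ᵈ a) ⊠ᵈ b)) ⟨$⟩ joinᴾ ⟨$⟩ (e ⊗₁ idᴸ {P₀ X}) ⟨$⟩ z
          Θˡ-pure a b = ⊗-ext (joinᴴ ∘ᴸ (extend ω e ⊗₁ idᴸ {H₀ X}) ∘ᴸ (j (push ρ′ a) ⊗₁ j b))
            (Θ (αᵁ ∘ᵈ ((V.δ ∘ᵈ a) ⊠ᵈ b)) ∘ᴸ joinᴾ ∘ᴸ (e ⊗₁ idᴸ {P₀ X}))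
            (λ x y → ((joinᴴ ∘ᴸ inˡ (j b ⟨$⟩ y)) ▹ (extend-j ω e (push ρ′ a) x
                  ⟫ Λ-resp ω {V.δ ∘ᵈ push ρ′ a} {push ρ² (V.δ ∘ᵈ a)} (ρ²-δ a) (e ⟨$⟩ x)))
              ⟫ inner (V.δ ∘ᵈ a) b (e ⟨$⟩ x) y)

          Θˡ : ∀ τ z → H₀ A ⊗ (H₀ A′ ⊗ H₀ X) ⊢ joinᴴ ⟨$⟩ (extend ω e ⊗₁ idᴸ {H₀ X}) ⟨$⟩ Λ ρ′ τ ⟨$⟩ z
                          ≈ Θ (δ³ ∘ᵈ τ) ⟨$⟩ joinᴾ ⟨$⟩ (e ⊗₁ idᴸ {P₀ X}) ⟨$⟩ z
          Θˡ τ z = multi-ext {U} {U} {H₀ A ⊗ (H₀ A′ ⊗ H₀ X)} X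
            {λ τ → joinᴴ ⟨$⟩ (extend ω e ⊗₁ idᴸ {H₀ X}) ⟨$⟩ Λ ρ′ τ ⟨$⟩ z} {λ τ → Θ (δ³ ∘ᵈ τ) ⟨$⟩ z′}
            (Λ-comp ρ′ z (joinᴴ ∘ᴸ (extend ω e ⊗₁ idᴸ {H₀ X})) id-slotwise)
            (multilinear-∘ (Θ-at z′) (∘ᵈ-slotwise δ³))
            (λ a b → ((joinᴴ ∘ᴸ (extend ω e ⊗₁ idᴸ {H₀ X})) ▹ Λ-pure ρ′ a b z) ⟫ Θˡ-pure a b z
              ⟫ resp (Θ-at z′) {αᵁ ∘ᵈ ((V.δ ∘ᵈ a) ⊠ᵈ b)} {δ³ ∘ᵈ (a ⊠ᵈ b)} (λ x → ≈-sym (δ³-pure (at a x) (at b x)))) τ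
            where z′ = joinᴾ ⟨$⟩ (e ⊗₁ idᴸ {P₀ X}) ⟨$⟩ z

        -- Both sides are values of `Θ`, on the decoration (δ_V ⊗ Id)δ_V(v) on the left and (Id ⊗
        -- δ_V)δ_V(v) on the right, so coassociativity of V handles the decorations and the
        -- hypothesis handles the component in P.
        extend-coassoc :
          ⊗-assoc (P₀ A) (P₀ A′) (P₀ X) ∘ᴸ (((P₁ t ⊗₁ idᴸ {P₀ A′}) ∘ᴸ e) ⊗₁ idᴸ {P₀ X}) ∘ᴸ d′ ≗ᴸ (idᴸ {P₀ A} ⊗₁ d′) ∘ᴸ d →
          ⊗-assoc (H₀ A) (H₀ A′) (H₀ X) ∘ᴸ (((H₁ t ⊗₁ idᴸ {H₀ A′}) ∘ᴸ extend ω e) ⊗₁ idᴸ {H₀ X}) ∘ᴸ extend ρ′ d′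
            ≗ᴸ (idᴸ {H₀ A} ⊗₁ extend ρ′ d′) ∘ᴸ extend ρ d
        extend-coassoc h x = joinᴴ-def (extend ω e) (extend ρ′ d′ ⟨$⟩ x)
          ⟫ H-ext (joinᴴ ∘ᴸ (extend ω e ⊗₁ idᴸ {H₀ X}) ∘ᴸ extend ρ′ d′) ((idᴸ {H₀ A} ⊗₁ extend ρ′ d′) ∘ᴸ extend ρ d) (λ v p →
              ((joinᴴ ∘ᴸ (extend ω e ⊗₁ idᴸ {H₀ X})) ▹ extend-j ρ′ d′ v p)
              ⟫ Θˡ (V.δ ∘ᵈ v) (d′ ⟨$⟩ p)
              ⟫ (Θ (δ³ ∘ᵈ (V.δ ∘ᵈ v)) ▹ (joinᴾ-def (d′ ⟨$⟩ p) ⟫ h p))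
              ⟫ resp (Θ-at ((idᴸ {P₀ A} ⊗₁ d′) ⟨$⟩ d ⟨$⟩ p))
                  {δ³ ∘ᵈ (V.δ ∘ᵈ v)} {(idᴸ {U} ⊗₁ V.δ) ∘ᵈ (V.δ ∘ᵈ v)} (λ x → δ³-coassoc (at v x))
              ⟫ ≈-sym (Θʳ (V.δ ∘ᵈ v) (d ⟨$⟩ p))
              ⟫ ((idᴸ {H₀ A} ⊗₁ extend ρ′ d′) ▹ ≈-sym (extend-j ρ d v p))) x

  module _ {X A : FinSet} (ρ : Push U X A) where
    private
      rᵁ : U ⊗ U ⊸ U
      rᵁ = unitʳ U ∘ᴸ (idᴸ {U} ⊗₁ V.ε)

      lᵁ : U ⊗ U ⊸ U
      lᵁ = unitˡ U ∘ᴸ (V.ε ⊗₁ idᴸ {U})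

      module HA = Module (H₀ A)
      module HX = Module (H₀ X)

      -- The scalar produced by the counit contains the product of all ε_V(b x); `multi-scale`
      -- returns one factor to each slot, which turns a ⊗ b into ε_V(b) a slot by slot.
      Λ-counitʳ : ∀ (ϵ : P₀ X ⊸ 𝕂) τ z → H₀ A ⊢ unitʳ (H₀ A) ⟨$⟩ (idᴸ {H₀ A} ⊗₁ ϵᴴ ϵ) ⟨$⟩ Λ ρ τ ⟨$⟩ z
                             ≈ j (push ρ (rᵁ ∘ᵈ τ)) ⟨$⟩ unitʳ (P₀ A) ⟨$⟩ (idᴸ ⊗₁ ϵ) ⟨$⟩ z
      Λ-counitʳ ϵ τ z = multi-ext {U} {U} {H₀ A} X
        {λ τ → unitʳ (H₀ A) ⟨$⟩ (idᴸ {H₀ A} ⊗₁ ϵᴴ ϵ) ⟨$⟩ Λ ρ τ ⟨$⟩ z} {λ τ → j (push ρ (rᵁ ∘ᵈ τ)) ⟨$⟩ z′}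
        (Λ-comp ρ z (unitʳ (H₀ A) ∘ᴸ (idᴸ {H₀ A} ⊗₁ ϵᴴ ϵ)) id-slotwise)
        (multilinear-∘ (push-at ρ z′) (∘ᵈ-slotwise rᵁ))
        (λ a b → ((unitʳ (H₀ A) ∘ᴸ (idᴸ {H₀ A} ⊗₁ ϵᴴ ϵ)) ▹ Λ-pure ρ a b z)
          ⟫ ⊗-ext (unitʳ (H₀ A) ∘ᴸ (idᴸ {H₀ A} ⊗₁ ϵᴴ ϵ) ∘ᴸ (j (push ρ a) ⊗₁ j b))
              (j (push ρ (rᵁ ∘ᵈ (a ⊠ᵈ b))) ∘ᴸ unitʳ (P₀ A) ∘ᴸ (idᴸ ⊗₁ ϵ))
              (λ x y → HA.*ₗ-cong (ϵ-j ϵ b y) HA.≈ᴹ-refl ⟫ HA.*ₗ-assoc _ _ _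
                ⟫ HA.*ₗ-cong 𝕜.refl (≈-sym (_⊸_.*ₗ-homo (j (push ρ a)) (ϵ ⟨$⟩ y) x))
                ⟫ ≈-sym (multi-scale (push-at ρ (Module._*ₗ_ (P₀ A) (ϵ ⟨$⟩ y) x)) (V.ε ∘ᵈ b) a)
                ⟫ resp (push-at ρ (Module._*ₗ_ (P₀ A) (ϵ ⟨$⟩ y) x)) {(V.ε ∘ᵈ b) *ᵈ a} {rᵁ ∘ᵈ (a ⊠ᵈ b)}
                    (λ _ → Module.≈ᴹ-refl U)) z) τ
        where z′ = unitʳ (P₀ A) ⟨$⟩ (idᴸ ⊗₁ ϵ) ⟨$⟩ z

      -- Here the product runs over A and the pushed decoration. The hypothesis, which for class
      -- products is multiplicativity of ε_V, replaces it by the product over X, and the factors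
      -- return to the slots as before.
      Λ-counitˡ : ∀ (ϵ : P₀ A ⊸ 𝕂) → (∀ a → ∏ A (at (V.ε ∘ᵈ push ρ a)) ≈ᵏ ∏ X (at (V.ε ∘ᵈ a))) →
                  ∀ τ z → H₀ X ⊢ unitˡ (H₀ X) ⟨$⟩ (ϵᴴ ϵ ⊗₁ idᴸ {H₀ X}) ⟨$⟩ Λ ρ τ ⟨$⟩ z
                               ≈ j (lᵁ ∘ᵈ τ) ⟨$⟩ unitˡ (P₀ X) ⟨$⟩ (ϵ ⊗₁ idᴸ) ⟨$⟩ z
      Λ-counitˡ ϵ h τ z = multi-ext {U} {U} {H₀ X} X
        {λ τ → unitˡ (H₀ X) ⟨$⟩ (ϵᴴ ϵ ⊗₁ idᴸ {H₀ X}) ⟨$⟩ Λ ρ τ ⟨$⟩ z} {λ τ → j (lᵁ ∘ᵈ τ) ⟨$⟩ z′}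
        (Λ-comp ρ z (unitˡ (H₀ X) ∘ᴸ (ϵᴴ ϵ ⊗₁ idᴸ {H₀ X})) id-slotwise)
        (multilinear-∘ (j-at z′) (∘ᵈ-slotwise lᵁ))
        (λ a b → ((unitˡ (H₀ X) ∘ᴸ (ϵᴴ ϵ ⊗₁ idᴸ {H₀ X})) ▹ Λ-pure ρ a b z)
          ⟫ ⊗-ext (unitˡ (H₀ X) ∘ᴸ (ϵᴴ ϵ ⊗₁ idᴸ {H₀ X}) ∘ᴸ (j (push ρ a) ⊗₁ j b))
              (j (lᵁ ∘ᵈ (a ⊠ᵈ b)) ∘ᴸ unitˡ (P₀ X) ∘ᴸ (ϵ ⊗₁ idᴸ))
              (λ x y → HX.*ₗ-cong (𝕜.trans (ϵ-j ϵ (push ρ a) x) (𝕜.*-cong (h a) 𝕜.refl)) HX.≈ᴹ-refl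
                ⟫ HX.*ₗ-assoc _ _ _
                ⟫ HX.*ₗ-cong 𝕜.refl (≈-sym (_⊸_.*ₗ-homo (j b) (ϵ ⟨$⟩ x) y))
                ⟫ ≈-sym (multi-scale (j-at (Module._*ₗ_ (P₀ X) (ϵ ⟨$⟩ x) y)) (V.ε ∘ᵈ a) b)
                ⟫ j-resp {v = (V.ε ∘ᵈ a) *ᵈ b} {lᵁ ∘ᵈ (a ⊠ᵈ b)} (λ _ → Module.≈ᴹ-refl U) (Module._*ₗ_ (P₀ X) (ϵ ⟨$⟩ x) y)) z) τ
        where z′ = unitˡ (P₀ X) ⟨$⟩ (ϵ ⊗₁ idᴸ) ⟨$⟩ z

    extend-counitʳ : ∀ d (ϵ : P₀ X ⊸ 𝕂) v p → H₀ A ⊢ unitʳ (H₀ A) ⟨$⟩ (idᴸ {H₀ A} ⊗₁ ϵᴴ ϵ) ⟨$⟩ extend ρ d ⟨$⟩ j v ⟨$⟩ p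
                       ≈ j (push ρ v) ⟨$⟩ unitʳ (P₀ A) ⟨$⟩ (idᴸ ⊗₁ ϵ) ⟨$⟩ d ⟨$⟩ p
    extend-counitʳ d ϵ v p = ((unitʳ (H₀ A) ∘ᴸ (idᴸ {H₀ A} ⊗₁ ϵᴴ ϵ)) ▹ extend-j ρ d v p) ⟫ Λ-counitʳ ϵ (V.δ ∘ᵈ v) (d ⟨$⟩ p)
      ⟫ resp (push-at ρ (unitʳ (P₀ A) ⟨$⟩ (idᴸ ⊗₁ ϵ) ⟨$⟩ d ⟨$⟩ p)) {rᵁ ∘ᵈ (V.δ ∘ᵈ v)} {v} (λ x → V.δ-counitʳ (at v x))

    extend-counitˡ : ∀ d (ϵ : P₀ A ⊸ 𝕂) → (∀ a → ∏ A (at (V.ε ∘ᵈ push ρ a)) ≈ᵏ ∏ X (at (V.ε ∘ᵈ a))) →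
                     ∀ v p → H₀ X ⊢ unitˡ (H₀ X) ⟨$⟩ (ϵᴴ ϵ ⊗₁ idᴸ {H₀ X}) ⟨$⟩ extend ρ d ⟨$⟩ j v ⟨$⟩ p
                                  ≈ j v ⟨$⟩ unitˡ (P₀ X) ⟨$⟩ (ϵ ⊗₁ idᴸ) ⟨$⟩ d ⟨$⟩ p
    extend-counitˡ d ϵ h v p = ((unitˡ (H₀ X) ∘ᴸ (ϵᴴ ϵ ⊗₁ idᴸ {H₀ X})) ▹ extend-j ρ d v p) ⟫ Λ-counitˡ ϵ h (V.δ ∘ᵈ v) (d ⟨$⟩ p)
      ⟫ j-resp {v = lᵁ ∘ᵈ (V.δ ∘ᵈ v)} {v} (λ x → V.δ-counitˡ (at v x)) (unitˡ (P₀ X) ⟨$⟩ (ϵ ⊗₁ idᴸ) ⟨$⟩ d ⟨$⟩ p)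

  module _ {X Y A A′ Q : FinSet} (σ : (A ⊔ˢ A′) ≃ Q) (ρ₁ : Push U X A) (ρ₂ : Push U Y A′) (ρ : Push U (X ⊔ˢ Y) Q)
           (ρ-⊎ : ∀ a → push ρ a ≈ᵈ σ ∙ᵈ (push ρ₁ (fstᵈ {_} {X} {Y} a) ⊎ᵈ push ρ₂ (sndᵈ {_} {X} {Y} a)))
           (d₁ : P₀ X ⊸ P₀ A ⊗ P₀ X) (d₂ : P₀ Y ⊸ P₀ A′ ⊗ P₀ Y) (d : P₀ (X ⊔ˢ Y) ⊸ P₀ Q ⊗ P₀ (X ⊔ˢ Y)) where
    opaque
      mergeᴴ : (H₀ A ⊗ H₀ X) ⊗ (H₀ A′ ⊗ H₀ Y) ⊸ H₀ Q ⊗ H₀ (X ⊔ˢ Y)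
      mergeᴴ = ((H₁ σ ∘ᴸ mᴴ A A′) ⊗₁ mᴴ X Y) ∘ᴸ Id⊗c⊗Id (H₀ A) (H₀ X) (H₀ A′) (H₀ Y)

      mergeᴾ : (P₀ A ⊗ P₀ X) ⊗ (P₀ A′ ⊗ P₀ Y) ⊸ P₀ Q ⊗ P₀ (X ⊔ˢ Y)
      mergeᴾ = ((P₁ σ ∘ᴸ m A A′) ⊗₁ m X Y) ∘ᴸ Id⊗c⊗Id (P₀ A) (P₀ X) (P₀ A′) (P₀ Y)

      mergeᴴ-def : ∀ z → H₀ Q ⊗ H₀ (X ⊔ˢ Y) ⊢ mergeᴴ ⟨$⟩ z
        ≈ ((H₁ σ ∘ᴸ mᴴ A A′) ⊗₁ mᴴ X Y) ⟨$⟩ Id⊗c⊗Id (H₀ A) (H₀ X) (H₀ A′) (H₀ Y) ⟨$⟩ z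
      mergeᴴ-def z = ≈-refl

      mergeᴾ-def : ∀ z → P₀ Q ⊗ P₀ (X ⊔ˢ Y) ⊢ mergeᴾ ⟨$⟩ z
        ≈ ((P₁ σ ∘ᴸ m A A′) ⊗₁ m X Y) ⟨$⟩ Id⊗c⊗Id (P₀ A) (P₀ X) (P₀ A′) (P₀ Y) ⟨$⟩ z
      mergeᴾ-def z = ≈-refl

      mergeᴴ-pure : ∀ x y x′ y′ → H₀ Q ⊗ H₀ (X ⊔ˢ Y) ⊢ mergeᴴ ⟨$⟩ (x ⊗ₜ y) ⊗ₜ (x′ ⊗ₜ y′)
                                  ≈ (H₁ σ ⟨$⟩ mᴴ A A′ ⟨$⟩ x ⊗ₜ x′) ⊗ₜ (mᴴ X Y ⟨$⟩ y ⊗ₜ y′)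
      mergeᴴ-pure x y x′ y′ = ≈-refl

      mergeᴾ-pure : ∀ x y x′ y′ → P₀ Q ⊗ P₀ (X ⊔ˢ Y) ⊢ mergeᴾ ⟨$⟩ (x ⊗ₜ y) ⊗ₜ (x′ ⊗ₜ y′)
                                  ≈ (P₁ σ ⟨$⟩ m A A′ ⟨$⟩ x ⊗ₜ x′) ⊗ₜ (m X Y ⟨$⟩ y ⊗ₜ y′)
      mergeᴾ-pure x y x′ y′ = ≈-refl

    private
      merge-pure : ∀ a b c e t t′ → H₀ Q ⊗ H₀ (X ⊔ˢ Y) ⊢ (j (push ρ (a ⊎ᵈ c)) ⊗₁ j (b ⊎ᵈ e)) ⟨$⟩ mergeᴾ ⟨$⟩ t ⊗ₜ t′
        ≈ mergeᴴ ⟨$⟩ ((j (push ρ₁ a) ⊗₁ j b) ⟨$⟩ t) ⊗ₜ ((j (push ρ₂ c) ⊗₁ j e) ⟨$⟩ t′)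
      merge-pure a b c e t t′ = ⊗-ext₄ ((j (push ρ (a ⊎ᵈ c)) ⊗₁ j (b ⊎ᵈ e)) ∘ᴸ mergeᴾ)
        (mergeᴴ ∘ᴸ ((j (push ρ₁ a) ⊗₁ j b) ⊗₁ (j (push ρ₂ c) ⊗₁ j e)))
        (λ x y x′ y′ → ((j (push ρ (a ⊎ᵈ c)) ⊗₁ j (b ⊎ᵈ e)) ▹ mergeᴾ-pure x y x′ y′)
          ⟫ ((j-resp {v = push ρ (a ⊎ᵈ c)} {σ ∙ᵈ (push ρ₁ (fstᵈ {_} {X} {Y} (a ⊎ᵈ c)) ⊎ᵈ push ρ₂ (sndᵈ {_} {X} {Y} (a ⊎ᵈ c)))}
                (ρ-⊎ (a ⊎ᵈ c)) (P₁ σ ⟨$⟩ m A A′ ⟨$⟩ x ⊗ₜ x′)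
              ⟫ j-resp {v = σ ∙ᵈ (push ρ₁ (fstᵈ {_} {X} {Y} (a ⊎ᵈ c)) ⊎ᵈ push ρ₂ (sndᵈ {_} {X} {Y} (a ⊎ᵈ c)))} {σ ∙ᵈ (push ρ₁ a ⊎ᵈ push ρ₂ c)}
                  (λ y → halves a c (_≃_.from σ y)) (P₁ σ ⟨$⟩ m A A′ ⟨$⟩ x ⊗ₜ x′)
              ⟫ ≈-sym (H₁-j σ (push ρ₁ a ⊎ᵈ push ρ₂ c) (m A A′ ⟨$⟩ x ⊗ₜ x′))
              ⟫ (H₁ σ ▹ ≈-sym (m-j (push ρ₁ a) x (push ρ₂ c) x′)))
            ⊠ ≈-sym (m-j b y e y′))
          ⟫ ≈-sym (mergeᴴ-pure (j (push ρ₁ a) ⟨$⟩ x) (j b ⟨$⟩ y) (j (push ρ₂ c) ⟨$⟩ x′) (j e ⟨$⟩ y′))) (t ⊗ₜ t′)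
        where
        halves : ∀ (a : Deco U X) (c : Deco U Y) y →
                 U ⊢ at (push ρ₁ (fstᵈ {_} {X} {Y} (a ⊎ᵈ c)) ⊎ᵈ push ρ₂ (sndᵈ {_} {X} {Y} (a ⊎ᵈ c))) y ≈ at (push ρ₁ a ⊎ᵈ push ρ₂ c) y
        halves a c (inj₁ y) = SlotwiseLinear.respˢ (slotwise ρ₁) {fstᵈ {_} {X} {Y} (a ⊎ᵈ c)} {a} (λ _ → Module.≈ᴹ-refl U) y
        halves a c (inj₂ y) = SlotwiseLinear.respˢ (slotwise ρ₂) {sndᵈ {_} {X} {Y} (a ⊎ᵈ c)} {c} (λ _ → Module.≈ᴹ-refl U) y

      -- Both sides are multilinear in the decorations of X and of Y, so pure tensors may be assumed
      -- in every slot; for these `ρ-⊎` splits the pushed decoration.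
      Λ-merge : ∀ τ τ′ t t′ → H₀ Q ⊗ H₀ (X ⊔ˢ Y) ⊢ Λ ρ (τ ⊎ᵈ τ′) ⟨$⟩ mergeᴾ ⟨$⟩ t ⊗ₜ t′ ≈ mergeᴴ ⟨$⟩ (Λ ρ₁ τ ⟨$⟩ t) ⊗ₜ (Λ ρ₂ τ′ ⟨$⟩ t′)
      Λ-merge τ τ′ t t′ = multi-ext {U} {U} {H₀ Q ⊗ H₀ (X ⊔ˢ Y)} X
        {λ τ → Λ ρ (τ ⊎ᵈ τ′) ⟨$⟩ z} {λ τ → mergeᴴ ⟨$⟩ (Λ ρ₁ τ ⟨$⟩ t) ⊗ₜ (Λ ρ₂ τ′ ⟨$⟩ t′)}
        (Λ-comp ρ z idᴸ (⊎ᵈ-slotwiseˡ τ′)) (Λ-comp ρ₁ t (mergeᴴ ∘ᴸ inˡ (Λ ρ₂ τ′ ⟨$⟩ t′)) id-slotwise)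
        (λ a b → multi-ext {U} {U} {H₀ Q ⊗ H₀ (X ⊔ˢ Y)} Y
          {λ τ′ → Λ ρ ((a ⊠ᵈ b) ⊎ᵈ τ′) ⟨$⟩ z} {λ τ′ → mergeᴴ ⟨$⟩ (Λ ρ₁ (a ⊠ᵈ b) ⟨$⟩ t) ⊗ₜ (Λ ρ₂ τ′ ⟨$⟩ t′)}
          (Λ-comp ρ z idᴸ (⊎ᵈ-slotwiseʳ (a ⊠ᵈ b))) (Λ-comp ρ₂ t′ (mergeᴴ ∘ᴸ inʳ (Λ ρ₁ (a ⊠ᵈ b) ⟨$⟩ t)) id-slotwise)
          (λ c e → Λ-resp ρ {(a ⊠ᵈ b) ⊎ᵈ (c ⊠ᵈ e)} {(a ⊎ᵈ c) ⊠ᵈ (b ⊎ᵈ e)} (λ { (inj₁ _) → ≈-refl ; (inj₂ _) → ≈-refl }) z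
            ⟫ Λ-pure ρ (a ⊎ᵈ c) (b ⊎ᵈ e) z
            ⟫ merge-pure a b c e t t′
            ⟫ (mergeᴴ ▹ ≈-sym (Λ-pure ρ₁ a b t) ⊠ ≈-sym (Λ-pure ρ₂ c e t′))) τ′) τ
        where z = mergeᴾ ⟨$⟩ t ⊗ₜ t′

    extend-m : d ∘ᴸ m X Y ≗ᴸ ((P₁ σ ∘ᴸ m A A′) ⊗₁ m X Y) ∘ᴸ Id⊗c⊗Id (P₀ A) (P₀ X) (P₀ A′) (P₀ Y) ∘ᴸ (d₁ ⊗₁ d₂) →
               extend ρ d ∘ᴸ mᴴ X Y
               ≗ᴸ ((H₁ σ ∘ᴸ mᴴ A A′) ⊗₁ mᴴ X Y) ∘ᴸ Id⊗c⊗Id (H₀ A) (H₀ X) (H₀ A′) (H₀ Y) ∘ᴸ (extend ρ₁ d₁ ⊗₁ extend ρ₂ d₂)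
    extend-m h x = H-ext₂ (extend ρ d ∘ᴸ mᴴ X Y) (mergeᴴ ∘ᴸ (extend ρ₁ d₁ ⊗₁ extend ρ₂ d₂)) (λ v p w q →
        (extend ρ d ▹ m-j v p w q)
        ⟫ extend-j ρ d (v ⊎ᵈ w) (m X Y ⟨$⟩ p ⊗ₜ q)
        ⟫ Λ-resp ρ {V.δ ∘ᵈ (v ⊎ᵈ w)} {(V.δ ∘ᵈ v) ⊎ᵈ (V.δ ∘ᵈ w)} (λ { (inj₁ _) → ≈-refl ; (inj₂ _) → ≈-refl }) (d ⟨$⟩ m X Y ⟨$⟩ p ⊗ₜ q)
        ⟫ (Λ ρ ((V.δ ∘ᵈ v) ⊎ᵈ (V.δ ∘ᵈ w)) ▹ (h (p ⊗ₜ q) ⟫ ≈-sym (mergeᴾ-def ((d₁ ⟨$⟩ p) ⊗ₜ (d₂ ⟨$⟩ q)))))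
        ⟫ Λ-merge (V.δ ∘ᵈ v) (V.δ ∘ᵈ w) (d₁ ⟨$⟩ p) (d₂ ⟨$⟩ q)
        ⟫ (mergeᴴ ▹ ≈-sym (extend-j ρ₁ d₁ v p) ⊠ ≈-sym (extend-j ρ₂ d₂ w q))) x
      ⟫ mergeᴴ-def ((extend ρ₁ d₁ ⊗₁ extend ρ₂ d₂) ⟨$⟩ x)

    private
      leg : Deco U (X ⊔ˢ Y) → P₀ A ⊗ P₀ A′ ⊸ H₀ A ⊗ H₀ A′
      leg a = j (push ρ₁ (fstᵈ {_} {X} {Y} a)) ⊗₁ j (push ρ₂ (sndᵈ {_} {X} {Y} a))

      leg-at : ∀ z → Multilinear U (X ⊔ˢ Y) (H₀ A ⊗ H₀ A′) (λ a → leg a ⟨$⟩ z)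
      leg-at = tensor-at {F = λ a → j (push ρ₁ a)} {λ a → j (push ρ₂ a)} (push-at ρ₁) (push-at ρ₂)

      triple : Deco U (X ⊔ˢ Y) → Deco U (X ⊔ˢ Y) → (P₀ A ⊗ P₀ A′) ⊗ P₀ (X ⊔ˢ Y) ⊸ (H₀ A ⊗ H₀ A′) ⊗ H₀ (X ⊔ˢ Y)
      triple a b = leg a ⊗₁ j b

      triple-bi : ∀ z → Bimultilinear U U (X ⊔ˢ Y) ((H₀ A ⊗ H₀ A′) ⊗ H₀ (X ⊔ˢ Y)) (λ a b → triple a b ⟨$⟩ z)
      triple-bi z = record
        { multiˡ = λ b → tensorˡ-at {F = leg} leg-at (j b) z
        ; multiʳ = λ a → tensorʳ-at {F = j} (leg a) j-at z
        }

    opaque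
      -- Both sides of the compatibility of Δ with δ are values of this map: the pushed decoration
      -- is distributed over A and A′ while the v″ remain together on X ⊔ Y.
      Ξ : Deco (U ⊗ U) (X ⊔ˢ Y) → (P₀ A ⊗ P₀ A′) ⊗ P₀ (X ⊔ˢ Y) ⊸ (H₀ A ⊗ H₀ A′) ⊗ H₀ (X ⊔ˢ Y)
      Ξ = expandᴸ (X ⊔ˢ Y) {triple} triple-bi

      Ξ-at : ∀ z → Multilinear (U ⊗ U) (X ⊔ˢ Y) ((H₀ A ⊗ H₀ A′) ⊗ H₀ (X ⊔ˢ Y)) (λ τ → Ξ τ ⟨$⟩ z)
      Ξ-at = expandᴸ-at (X ⊔ˢ Y) {triple} triple-bi

      Ξ-pure : ∀ a b z → (H₀ A ⊗ H₀ A′) ⊗ H₀ (X ⊔ˢ Y) ⊢ Ξ (a ⊠ᵈ b) ⟨$⟩ z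
                         ≈ ((j (push ρ₁ (fstᵈ {_} {X} {Y} a)) ⊗₁ j (push ρ₂ (sndᵈ {_} {X} {Y} a))) ⊗₁ j b) ⟨$⟩ z
      Ξ-pure = expandᴸ-pure (X ⊔ˢ Y) {triple} triple-bi

      cutᴴ : H₀ Q ⊗ H₀ (X ⊔ˢ Y) ⊸ (H₀ A ⊗ H₀ A′) ⊗ H₀ (X ⊔ˢ Y)
      cutᴴ = (Δᴴ A A′ ∘ᴸ H₁ (σ ⁻¹≃)) ⊗₁ idᴸ {H₀ (X ⊔ˢ Y)}

      cutᴾ : P₀ Q ⊗ P₀ (X ⊔ˢ Y) ⊸ (P₀ A ⊗ P₀ A′) ⊗ P₀ (X ⊔ˢ Y)
      cutᴾ = (Δ A A′ ∘ᴸ P₁ (σ ⁻¹≃)) ⊗₁ idᴸ {P₀ (X ⊔ˢ Y)}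

      m³ᴴ : (H₀ A ⊗ H₀ X) ⊗ (H₀ A′ ⊗ H₀ Y) ⊸ (H₀ A ⊗ H₀ A′) ⊗ H₀ (X ⊔ˢ Y)
      m³ᴴ = m₁,₃,₂₄ (H₀ A) (H₀ X) (H₀ A′) (H₀ Y) (mᴴ X Y)

      m³ᴾ : (P₀ A ⊗ P₀ X) ⊗ (P₀ A′ ⊗ P₀ Y) ⊸ (P₀ A ⊗ P₀ A′) ⊗ P₀ (X ⊔ˢ Y)
      m³ᴾ = m₁,₃,₂₄ (P₀ A) (P₀ X) (P₀ A′) (P₀ Y) (m X Y)

      cutᴴ-def : ∀ z → (H₀ A ⊗ H₀ A′) ⊗ H₀ (X ⊔ˢ Y) ⊢ cutᴴ ⟨$⟩ z ≈ ((Δᴴ A A′ ∘ᴸ H₁ (σ ⁻¹≃)) ⊗₁ idᴸ {H₀ (X ⊔ˢ Y)}) ⟨$⟩ z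
      cutᴴ-def z = ≈-refl

      cutᴾ-def : ∀ z → (P₀ A ⊗ P₀ A′) ⊗ P₀ (X ⊔ˢ Y) ⊢ cutᴾ ⟨$⟩ z ≈ ((Δ A A′ ∘ᴸ P₁ (σ ⁻¹≃)) ⊗₁ idᴸ {P₀ (X ⊔ˢ Y)}) ⟨$⟩ z
      cutᴾ-def z = ≈-refl

      m³ᴴ-def : ∀ z → (H₀ A ⊗ H₀ A′) ⊗ H₀ (X ⊔ˢ Y) ⊢ m³ᴴ ⟨$⟩ z ≈ m₁,₃,₂₄ (H₀ A) (H₀ X) (H₀ A′) (H₀ Y) (mᴴ X Y) ⟨$⟩ z
      m³ᴴ-def z = ≈-refl

      m³ᴾ-def : ∀ z → (P₀ A ⊗ P₀ A′) ⊗ P₀ (X ⊔ˢ Y) ⊢ m³ᴾ ⟨$⟩ z ≈ m₁,₃,₂₄ (P₀ A) (P₀ X) (P₀ A′) (P₀ Y) (m X Y) ⟨$⟩ z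
      m³ᴾ-def z = ≈-refl

      cutᴴ-pure : ∀ x y → (H₀ A ⊗ H₀ A′) ⊗ H₀ (X ⊔ˢ Y) ⊢ cutᴴ ⟨$⟩ x ⊗ₜ y ≈ (Δᴴ A A′ ⟨$⟩ H₁ (σ ⁻¹≃) ⟨$⟩ x) ⊗ₜ y
      cutᴴ-pure x y = ≈-refl

      cutᴾ-pure : ∀ x y → (P₀ A ⊗ P₀ A′) ⊗ P₀ (X ⊔ˢ Y) ⊢ cutᴾ ⟨$⟩ x ⊗ₜ y ≈ (Δ A A′ ⟨$⟩ P₁ (σ ⁻¹≃) ⟨$⟩ x) ⊗ₜ y
      cutᴾ-pure x y = ≈-refl

      m³ᴴ-pure : ∀ x y x′ y′ → (H₀ A ⊗ H₀ A′) ⊗ H₀ (X ⊔ˢ Y) ⊢ m³ᴴ ⟨$⟩ (x ⊗ₜ y) ⊗ₜ (x′ ⊗ₜ y′) ≈ (x ⊗ₜ x′) ⊗ₜ (mᴴ X Y ⟨$⟩ y ⊗ₜ y′)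
      m³ᴴ-pure x y x′ y′ = ≈-refl

      m³ᴾ-pure : ∀ x y x′ y′ → (P₀ A ⊗ P₀ A′) ⊗ P₀ (X ⊔ˢ Y) ⊢ m³ᴾ ⟨$⟩ (x ⊗ₜ y) ⊗ₜ (x′ ⊗ₜ y′) ≈ (x ⊗ₜ x′) ⊗ₜ (m X Y ⟨$⟩ y ⊗ₜ y′)
      m³ᴾ-pure x y x′ y′ = ≈-refl

    private
      σ-halves : ∀ a (z : FinSet.Carrier (A ⊔ˢ A′)) →
                 U ⊢ at (σ ⁻¹≃ ∙ᵈ push ρ a) z ≈ at (push ρ₁ (fstᵈ {_} {X} {Y} a) ⊎ᵈ push ρ₂ (sndᵈ {_} {X} {Y} a)) z
      σ-halves a z = Module.≈ᴹ-trans U (ρ-⊎ a (_≃_.to σ z))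
        (at-cong (push ρ₁ (fstᵈ {_} {X} {Y} a) ⊎ᵈ push ρ₂ (sndᵈ {_} {X} {Y} a)) (_≃_.strictlyInverseʳ σ z))

      cut-pure : ∀ a b z → (H₀ A ⊗ H₀ A′) ⊗ H₀ (X ⊔ˢ Y) ⊢ cutᴴ ⟨$⟩ (j (push ρ a) ⊗₁ j b) ⟨$⟩ z ≈ (leg a ⊗₁ j b) ⟨$⟩ cutᴾ ⟨$⟩ z
      cut-pure a b = ⊗-ext (cutᴴ ∘ᴸ (j (push ρ a) ⊗₁ j b)) ((leg a ⊗₁ j b) ∘ᴸ cutᴾ)
        (λ x y → cutᴴ-pure (j (push ρ a) ⟨$⟩ x) (j b ⟨$⟩ y)
          ⟫ (((Δᴴ A A′ ▹ H₁-j (σ ⁻¹≃) (push ρ a) x)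
              ⟫ Δ-j {A} {A′} (σ ⁻¹≃ ∙ᵈ push ρ a) (P₁ (σ ⁻¹≃) ⟨$⟩ x)
              ⟫ jj-resp {v = fstᵈ {U} {A} {A′} (σ ⁻¹≃ ∙ᵈ push ρ a)} {push ρ₁ (fstᵈ {_} {X} {Y} a)} {sndᵈ {U} {A} {A′} (σ ⁻¹≃ ∙ᵈ push ρ a)} {push ρ₂ (sndᵈ {_} {X} {Y} a)}
                  (λ z → σ-halves a (inj₁ z)) (λ z → σ-halves a (inj₂ z)) (Δ A A′ ⟨$⟩ P₁ (σ ⁻¹≃) ⟨$⟩ x))
            ⊠ ≈-refl)
          ⟫ ((leg a ⊗₁ j b) ▹ ≈-sym (cutᴾ-pure x y)))

      m³-pure : ∀ a b z → (H₀ A ⊗ H₀ A′) ⊗ H₀ (X ⊔ˢ Y) ⊢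
                  m³ᴴ ⟨$⟩ ((j (push ρ₁ (fstᵈ {_} {X} {Y} a)) ⊗₁ j (fstᵈ {_} {X} {Y} b)) ⊗₁ (j (push ρ₂ (sndᵈ {_} {X} {Y} a)) ⊗₁ j (sndᵈ {_} {X} {Y} b))) ⟨$⟩ z
                  ≈ (leg a ⊗₁ j b) ⟨$⟩ m³ᴾ ⟨$⟩ z
      m³-pure a b = ⊗-ext₄ (m³ᴴ ∘ᴸ ((j (push ρ₁ (fstᵈ {_} {X} {Y} a)) ⊗₁ j (fstᵈ {_} {X} {Y} b)) ⊗₁ (j (push ρ₂ (sndᵈ {_} {X} {Y} a)) ⊗₁ j (sndᵈ {_} {X} {Y} b))))
        ((leg a ⊗₁ j b) ∘ᴸ m³ᴾ)
        (λ x y x′ y′ → m³ᴴ-pure (j (push ρ₁ (fstᵈ {_} {X} {Y} a)) ⟨$⟩ x) (j (fstᵈ {_} {X} {Y} b) ⟨$⟩ y) (j (push ρ₂ (sndᵈ {_} {X} {Y} a)) ⟨$⟩ x′) (j (sndᵈ {_} {X} {Y} b) ⟨$⟩ y′)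
          ⟫ (≈-refl ⊠ (m-j (fstᵈ {_} {X} {Y} b) y (sndᵈ {_} {X} {Y} b) y′
              ⟫ j-resp {v = fstᵈ {_} {X} {Y} b ⊎ᵈ sndᵈ {_} {X} {Y} b} {b} (λ { (inj₁ _) → Module.≈ᴹ-refl U ; (inj₂ _) → Module.≈ᴹ-refl U })
                  (m X Y ⟨$⟩ y ⊗ₜ y′)))
          ⟫ ((leg a ⊗₁ j b) ▹ ≈-sym (m³ᴾ-pure x y x′ y′)))

      Ξ-cut : ∀ τ z → (H₀ A ⊗ H₀ A′) ⊗ H₀ (X ⊔ˢ Y) ⊢ cutᴴ ⟨$⟩ Λ ρ τ ⟨$⟩ z ≈ Ξ τ ⟨$⟩ cutᴾ ⟨$⟩ z
      Ξ-cut τ z = multi-ext {U} {U} {(H₀ A ⊗ H₀ A′) ⊗ H₀ (X ⊔ˢ Y)} (X ⊔ˢ Y) {λ τ → cutᴴ ⟨$⟩ Λ ρ τ ⟨$⟩ z} {λ τ → Ξ τ ⟨$⟩ cutᴾ ⟨$⟩ z}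
        (Λ-comp ρ z cutᴴ id-slotwise) (Ξ-at (cutᴾ ⟨$⟩ z))
        (λ a b → (cutᴴ ▹ Λ-pure ρ a b z) ⟫ cut-pure a b z ⟫ ≈-sym (Ξ-pure a b (cutᴾ ⟨$⟩ z))) τ

      Ξ-merge : ∀ τ t t′ → (H₀ A ⊗ H₀ A′) ⊗ H₀ (X ⊔ˢ Y) ⊢ m³ᴴ ⟨$⟩ (Λ ρ₁ (fstᵈ {_} {X} {Y} τ) ⟨$⟩ t) ⊗ₜ (Λ ρ₂ (sndᵈ {_} {X} {Y} τ) ⟨$⟩ t′) ≈ Ξ τ ⟨$⟩ m³ᴾ ⟨$⟩ t ⊗ₜ t′
      Ξ-merge τ t t′ = multi-ext {U} {U} {(H₀ A ⊗ H₀ A′) ⊗ H₀ (X ⊔ˢ Y)} (X ⊔ˢ Y)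
        {λ τ → m³ᴴ ⟨$⟩ (Λ ρ₁ (fstᵈ {_} {X} {Y} τ) ⟨$⟩ t) ⊗ₜ (Λ ρ₂ (sndᵈ {_} {X} {Y} τ) ⟨$⟩ t′)} {λ τ → Ξ τ ⟨$⟩ m³ᴾ ⟨$⟩ t ⊗ₜ t′}
        (linear-multilinear {F = λ τ → (Λ ρ₁ (fstᵈ {_} {X} {Y} τ) ⟨$⟩ t) ⊗ₜ (Λ ρ₂ (sndᵈ {_} {X} {Y} τ) ⟨$⟩ t′)} m³ᴴ
          (tensor-at {F = Λ ρ₁} {Λ ρ₂} (Λ-at ρ₁) (Λ-at ρ₂) (t ⊗ₜ t′)))
        (Ξ-at (m³ᴾ ⟨$⟩ t ⊗ₜ t′))
        (λ a b → (m³ᴴ ▹ (Λ-resp ρ₁ {fstᵈ {_} {X} {Y} (a ⊠ᵈ b)} {fstᵈ {_} {X} {Y} a ⊠ᵈ fstᵈ {_} {X} {Y} b} (λ _ → ≈-refl) t ⟫ Λ-pure ρ₁ (fstᵈ {_} {X} {Y} a) (fstᵈ {_} {X} {Y} b) t)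
                       ⊠ (Λ-resp ρ₂ {sndᵈ {_} {X} {Y} (a ⊠ᵈ b)} {sndᵈ {_} {X} {Y} a ⊠ᵈ sndᵈ {_} {X} {Y} b} (λ _ → ≈-refl) t′ ⟫ Λ-pure ρ₂ (sndᵈ {_} {X} {Y} a) (sndᵈ {_} {X} {Y} b) t′))
          ⟫ m³-pure a b (t ⊗ₜ t′)
          ⟫ ≈-sym (Ξ-pure a b (m³ᴾ ⟨$⟩ t ⊗ₜ t′))) τ

      Ξ-Δ : ∀ v t → (H₀ A ⊗ H₀ A′) ⊗ H₀ (X ⊔ˢ Y) ⊢ m³ᴴ ⟨$⟩ (extend ρ₁ d₁ ⊗₁ extend ρ₂ d₂) ⟨$⟩ (j (fstᵈ {_} {X} {Y} v) ⊗₁ j (sndᵈ {_} {X} {Y} v)) ⟨$⟩ t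
                    ≈ Ξ (V.δ ∘ᵈ v) ⟨$⟩ m³ᴾ ⟨$⟩ (d₁ ⊗₁ d₂) ⟨$⟩ t
      Ξ-Δ v = ⊗-ext (m³ᴴ ∘ᴸ (extend ρ₁ d₁ ⊗₁ extend ρ₂ d₂) ∘ᴸ (j (fstᵈ {_} {X} {Y} v) ⊗₁ j (sndᵈ {_} {X} {Y} v)))
        (Ξ (V.δ ∘ᵈ v) ∘ᴸ m³ᴾ ∘ᴸ (d₁ ⊗₁ d₂))
        (λ p q → (m³ᴴ ▹ extend-j ρ₁ d₁ (fstᵈ {_} {X} {Y} v) p ⊠ extend-j ρ₂ d₂ (sndᵈ {_} {X} {Y} v) q)
          ⟫ Ξ-merge (V.δ ∘ᵈ v) (d₁ ⟨$⟩ p) (d₂ ⟨$⟩ q))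

    extend-Δ : ((Δ A A′ ∘ᴸ P₁ (σ ⁻¹≃)) ⊗₁ idᴸ {P₀ (X ⊔ˢ Y)}) ∘ᴸ d
                 ≗ᴸ m₁,₃,₂₄ (P₀ A) (P₀ X) (P₀ A′) (P₀ Y) (m X Y) ∘ᴸ (d₁ ⊗₁ d₂) ∘ᴸ Δ X Y →
               ((Δᴴ A A′ ∘ᴸ H₁ (σ ⁻¹≃)) ⊗₁ idᴸ {H₀ (X ⊔ˢ Y)}) ∘ᴸ extend ρ d
                 ≗ᴸ m₁,₃,₂₄ (H₀ A) (H₀ X) (H₀ A′) (H₀ Y) (mᴴ X Y) ∘ᴸ (extend ρ₁ d₁ ⊗₁ extend ρ₂ d₂) ∘ᴸ Δᴴ X Y
    extend-Δ h x = ≈-sym (cutᴴ-def (extend ρ d ⟨$⟩ x))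
      ⟫ H-ext (cutᴴ ∘ᴸ extend ρ d) (m³ᴴ ∘ᴸ (extend ρ₁ d₁ ⊗₁ extend ρ₂ d₂) ∘ᴸ Δᴴ X Y) (λ v p →
          (cutᴴ ▹ extend-j ρ d v p)
          ⟫ Ξ-cut (V.δ ∘ᵈ v) (d ⟨$⟩ p)
          ⟫ (Ξ (V.δ ∘ᵈ v) ▹ (cutᴾ-def (d ⟨$⟩ p) ⟫ h p ⟫ ≈-sym (m³ᴾ-def ((d₁ ⊗₁ d₂) ⟨$⟩ Δ X Y ⟨$⟩ p))))
          ⟫ ≈-sym (Ξ-Δ v (Δ X Y ⟨$⟩ p))
          ⟫ ((m³ᴴ ∘ᴸ (extend ρ₁ d₁ ⊗₁ extend ρ₂ d₂)) ▹ ≈-sym (Δ-j {X} {Y} v p))) x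
      ⟫ m³ᴴ-def ((extend ρ₁ d₁ ⊗₁ extend ρ₂ d₂) ⟨$⟩ Δᴴ X Y ⟨$⟩ x)

  extend-m₀ : ∀ {X Y Q} (ρ : Push U (X ⊔ˢ Y) Q) d → d ∘ᴸ m X Y ≗ᴸ 0ᴸ → extend ρ d ∘ᴸ mᴴ X Y ≗ᴸ 0ᴸ
  extend-m₀ {X} {Y} ρ d h = H-ext₂ (extend ρ d ∘ᴸ mᴴ X Y) 0ᴸ (λ v p w q →
    (extend ρ d ▹ m-j v p w q) ⟫ extend-j ρ d (v ⊎ᵈ w) (m X Y ⟨$⟩ p ⊗ₜ q)
    ⟫ (Λ ρ (V.δ ∘ᵈ (v ⊎ᵈ w)) ▹ h (p ⊗ₜ q)) ⟫ _⊸_.0ᴹ-homo (Λ ρ (V.δ ∘ᵈ (v ⊎ᵈ w))))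

  module _ {A : FinSet} (e : A ≃ ∅) (ρ : Push U ∅ A) (d : P₀ ∅ ⊸ P₀ A ⊗ P₀ ∅) where

    extend-1 : P₀ ∅ ⊗ P₀ ∅ ⊢ (P₁ e ⊗₁ idᴸ {P₀ ∅}) ⟨$⟩ d ⟨$⟩ 1ₚ ≈ 1ₚ ⊗ₜ 1ₚ →
               H₀ ∅ ⊗ H₀ ∅ ⊢ (H₁ e ⊗₁ idᴸ {H₀ ∅}) ⟨$⟩ extend ρ d ⟨$⟩ j ∅ᵈ ⟨$⟩ 1ₚ ≈ (j ∅ᵈ ⟨$⟩ 1ₚ) ⊗ₜ (j ∅ᵈ ⟨$⟩ 1ₚ)
    extend-1 h = ((H₁ e ⊗₁ idᴸ {H₀ ∅}) ▹ (extend-j ρ d ∅ᵈ 1ₚ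
          -- A decoration of the empty set has no slots, so all of them agree, and δ_V of one may be
          -- taken to be pure.
          ⟫ Λ-resp ρ {V.δ ∘ᵈ ∅ᵈ} {∅ᵈ ⊠ᵈ ∅ᵈ} (λ ()) (d ⟨$⟩ 1ₚ) ⟫ Λ-pure ρ ∅ᵈ ∅ᵈ (d ⟨$⟩ 1ₚ)))
      ⟫ ⊗-ext ((H₁ e ⊗₁ idᴸ {H₀ ∅}) ∘ᴸ (j (push ρ ∅ᵈ) ⊗₁ j ∅ᵈ)) ((j ∅ᵈ ⊗₁ j ∅ᵈ) ∘ᴸ (P₁ e ⊗₁ idᴸ {P₀ ∅}))
          (λ x y → (H₁-j e (push ρ ∅ᵈ) x ⟫ j-resp {v = e ∙ᵈ push ρ ∅ᵈ} {∅ᵈ} (λ ()) (P₁ e ⟨$⟩ x)) ⊠ ≈-refl) (d ⟨$⟩ 1ₚ)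
      ⟫ ((j ∅ᵈ ⊗₁ j ∅ᵈ) ▹ h)

    extend-ε : (∀ x → P₀ ∅ ⊢ (unitˡ (P₀ ∅) ∘ᴸ ((ε ∘ᴸ P₁ e) ⊗₁ idᴸ) ∘ᴸ d) ⟨$⟩ x ≈ Module._*ₗ_ (P₀ ∅) (ε ⟨$⟩ x) 1ₚ) →
               ∀ x → H₀ ∅ ⊢ (unitˡ (H₀ ∅) ∘ᴸ ((εᴴ ∘ᴸ H₁ e) ⊗₁ idᴸ {H₀ ∅}) ∘ᴸ extend ρ d) ⟨$⟩ x
                          ≈ Module._*ₗ_ (H₀ ∅) (εᴴ ⟨$⟩ x) (j ∅ᵈ ⟨$⟩ 1ₚ)
    extend-ε h = H-ext (unitˡ (H₀ ∅) ∘ᴸ ((εᴴ ∘ᴸ H₁ e) ⊗₁ idᴸ {H₀ ∅}) ∘ᴸ extend ρ d)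
      (linear (λ x → Module._*ₗ_ (H₀ ∅) (εᴴ ⟨$⟩ x) (j ∅ᵈ ⟨$⟩ 1ₚ))
        (λ p → Module.*ₗ-cong (H₀ ∅) (εᴴ ▹ p) ≈-refl)
        (λ x y → Module.*ₗ-cong (H₀ ∅) (_⊸_.+ᴹ-homo εᴴ x y) ≈-refl ⟫ Module.*ₗ-distribʳ (H₀ ∅) _ _ _)
        (λ k x → Module.*ₗ-cong (H₀ ∅) (_⊸_.*ₗ-homo εᴴ k x) ≈-refl ⟫ Module.*ₗ-assoc (H₀ ∅) _ _ _))
      (λ v p →
        ((unitˡ (H₀ ∅) ∘ᴸ ((εᴴ ∘ᴸ H₁ e) ⊗₁ idᴸ {H₀ ∅})) ▹
          (extend-j ρ d v p ⟫ Λ-resp ρ {V.δ ∘ᵈ v} {v ⊠ᵈ v} (λ ()) (d ⟨$⟩ p) ⟫ Λ-pure ρ v v (d ⟨$⟩ p)))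
        ⟫ ⊗-ext (unitˡ (H₀ ∅) ∘ᴸ ((εᴴ ∘ᴸ H₁ e) ⊗₁ idᴸ {H₀ ∅}) ∘ᴸ (j (push ρ v) ⊗₁ j v))
            (j v ∘ᴸ unitˡ (P₀ ∅) ∘ᴸ ((ε ∘ᴸ P₁ e) ⊗₁ idᴸ))
            (λ x y → Module.*ₗ-cong (H₀ ∅) (𝕜.trans (εᴴ ▹ H₁-j e (push ρ v) x) (ε-j (e ∙ᵈ push ρ v) (P₁ e ⟨$⟩ x))) ≈-refl
              ⟫ ≈-sym (_⊸_.*ₗ-homo (j v) (ε ⟨$⟩ P₁ e ⟨$⟩ x) y)) (d ⟨$⟩ p)
        ⟫ (j v ▹ h p)
        ⟫ _⊸_.*ₗ-homo (j v) (ε ⟨$⟩ p) 1ₚ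
        ⟫ Module.*ₗ-cong (H₀ ∅) (𝕜.sym (ε-j v p)) (j-resp {v = v} {∅ᵈ} (λ ()) 1ₚ))

-- Contraction-extraction coproduct of the decorated species.

module DecoratedContraction {ℓ} (K : HeytingField ℓ ℓ ℓ)
                            (V : Over.CommBialgebra K) (P : Over.Species K) (B : Over.TwistedBialgebra K P)
                            (C : Over.ContractionExtraction K P) where
  open Over K
  open Linear K
  open Decorations K
  open BlockProducts K
  open Species P
  open TwistedBialgebra B
  open ContractionExtraction C
  private
    module 𝕜 = CommutativeRing commRing
    module V = CommBialgebra V

    U : Vect
    U = V.space

  open DecoratedSpecies K (CommBialgebra.space V) P
  open DecoratedBialgebra B
  open Extension K V P B

  algebraOf : CommAlgebra
  algebraOf = record
    { space = U
    ; mul   = V.mul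
    ; assoc = λ x y z → V.mul-assoc ((x ⊗ₜ y) ⊗ₜ z)
    ; comm  = λ x y → V.mul-comm (y ⊗ₜ x)
    }

  module A = CommAlgebra algebraOf
  module A² = CommAlgebra (algebraOf ⊗ᴬ algebraOf)

  blocks : ∀ {X} (E : 𝓔 X) → Push U X (X / E)
  blocks E = record { push = A.π E ; slotwise = A.π-slotwise E }

  private
    blocks² : ∀ {X} (E : 𝓔 X) → Push (U ⊗ U) X (X / E)
    blocks² E = record { push = A².π E ; slotwise = A².π-slotwise E }

  δᴴ : ∀ {X} (E : 𝓔 X) → H₀ X ⊸ H₀ (X / E) ⊗ H₀ X
  δᴴ E = extend (blocks E) (δ E)

  private
    δᴴ-counitʳ : ∀ {X} (E : 𝓔 X) (eq : IsEquality E) →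
                 H₁ (equality≃ E eq) ∘ᴸ unitʳ (H₀ (X / E)) ∘ᴸ (idᴸ {H₀ (X / E)} ⊗₁ ϵᴴ (ϵ X)) ∘ᴸ δᴴ E ≗ᴸ idᴸ
    δᴴ-counitʳ {X} E eq = H-ext (H₁ (equality≃ E eq) ∘ᴸ unitʳ (H₀ (X / E)) ∘ᴸ (idᴸ {H₀ (X / E)} ⊗₁ ϵᴴ (ϵ X)) ∘ᴸ δᴴ E) idᴸ (λ v p →
      let z = unitʳ (P₀ (X / E)) ⟨$⟩ (idᴸ ⊗₁ ϵ X) ⟨$⟩ δ E ⟨$⟩ p in
      (H₁ (equality≃ E eq) ▹ extend-counitʳ (blocks E) (δ E) (ϵ X) v p)
      ⟫ H₁-j (equality≃ E eq) (A.π E v) z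
      ⟫ j-resp {v = equality≃ E eq ∙ᵈ A.π E v} {v} (A.π-equality E eq v) (P₁ (equality≃ E eq) ⟨$⟩ z)
      ⟫ (j v ▹ δ-counitʳ E eq p))
      where open Chain (H₀ X)

    δᴴ-counitʳ₀ : ∀ {X} (E : 𝓔 X) → ¬ IsEquality E → unitʳ (H₀ (X / E)) ∘ᴸ (idᴸ {H₀ (X / E)} ⊗₁ ϵᴴ (ϵ X)) ∘ᴸ δᴴ E ≗ᴸ 0ᴸ
    δᴴ-counitʳ₀ {X} E neq = H-ext (unitʳ (H₀ (X / E)) ∘ᴸ (idᴸ {H₀ (X / E)} ⊗₁ ϵᴴ (ϵ X)) ∘ᴸ δᴴ E) 0ᴸ (λ v p →
      extend-counitʳ (blocks E) (δ E) (ϵ X) v p ⟫ (j (A.π E v) ▹ δ-counitʳ₀ E neq p) ⟫ _⊸_.0ᴹ-homo (j (A.π E v)))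
      where open Chain (H₀ (X / E))

    δᴴ-counitˡ : ∀ X p → H₀ X ⊢ ∑ (H₀ X) (equivalences X) (λ E → (unitˡ (H₀ X) ∘ᴸ (ϵᴴ (ϵ (X / E)) ⊗₁ idᴸ {H₀ X}) ∘ᴸ δᴴ E) ⟨$⟩ p) ≈ p
    δᴴ-counitˡ X = H-ext (∑ᴸ (equivalences X) (λ E → unitˡ (H₀ X) ∘ᴸ (ϵᴴ (ϵ (X / E)) ⊗₁ idᴸ {H₀ X}) ∘ᴸ δᴴ E)) idᴸ (λ v p →
      ∑-cong (H₀ X) (equivalences X) (λ E → extend-counitˡ (blocks E) (δ E) (ϵ (X / E))
        -- Multiplicativity of ε_V: the counit of a class product is the product of the counits.
        (∏-π algebraOf V.ε (λ u u′ → V.ε-mul (u ⊗ₜ u′)) E) v p)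
      ⟫ ↺ (map-∑ (j v) (equivalences X) (λ E → unitˡ (P₀ X) ⟨$⟩ (ϵ (X / E) ⊗₁ idᴸ) ⟨$⟩ δ E ⟨$⟩ p))
      ⟫ (j v ▹ δ-counitˡ X p))
      where open Chain (H₀ X)

    ϵᴴ-natural : ∀ {X Y} (σ : X ≃ Y) → ϵᴴ (ϵ Y) ∘ᴸ H₁ σ ≗ᴸ ϵᴴ (ϵ X)
    ϵᴴ-natural {X} {Y} σ = H-ext (ϵᴴ (ϵ Y) ∘ᴸ H₁ σ) (ϵᴴ (ϵ X)) (λ v p →
      𝕜.trans (ϵᴴ (ϵ Y) ▹ H₁-j σ v p) (𝕜.trans (ϵ-j (ϵ Y) (σ ∙ᵈ v) (P₁ σ ⟨$⟩ p))
        (𝕜.trans (𝕜.*-cong (∏-natural σ (at (V.ε ∘ᵈ v)) (at-cong (V.ε ∘ᵈ v))) (ϵ-natural σ p)) (𝕜.sym (ϵ-j (ϵ X) v p)))))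

  decoratedContraction : ContractionExtraction decorated
  decoratedContraction = record
    { δ          = δᴴ
    ; δ-natural  = λ σ E E′ t → extend-natural σ (quotient≃ σ E E′ t) (blocks E) (blocks E′) (A.π-∙ σ E E′ t)
                     (δ E) (δ E′) (δ-natural σ E E′ t)
    -- Beyond coassociativity of δ_V this rests on two facts: δ_V is multiplicative, so it commutes
    -- with class products, and class products compose because V is associative and commutative.
    ; δ-coassoc  = λ E E′ le → extend-coassoc (blocks E) (blocks E′) (δ E) (δ E′) (blocks² E′) (blocks (descend E E′ le))
                     (third-iso E E′ le) (π-⊠ algebraOf algebraOf E′)
                     (π-hom algebraOf (algebraOf ⊗ᴬ algebraOf) V.δ (λ u u′ → V.δ-mul (u ⊗ₜ u′)) E′)
                     (A.π-π E E′ le) (δ (descend E E′ le)) (δ-coassoc E E′ le)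
    ; δ-vanish   = λ E E′ n → extend-vanish (blocks E) (blocks E′) (δ E) (δ E′) (δ-vanish E E′ n)
    ; ϵ          = λ X → ϵᴴ (ϵ X)
    ; ϵ-natural  = ϵᴴ-natural
    ; δ-counitʳ  = δᴴ-counitʳ
    ; δ-counitʳ₀ = δᴴ-counitʳ₀
    ; δ-counitˡ  = δᴴ-counitˡ
    }

  module _ (compatible : Compatible B C) where
    open Compatible compatible

    private
      blocks-⊎ : ∀ {X Y} (E : 𝓔 (X ⊔ˢ Y)) (s : Splits {X} {Y} E) (a : Deco U (X ⊔ˢ Y)) z →
                 U ⊢ at (A.π E a) z ≈ at (A.π (restrictˡ {X} {Y} E) (fstᵈ a) ⊎ᵈ A.π (restrictʳ {X} {Y} E) (sndᵈ a)) z
      blocks-⊎ {X} {Y} E s a (inj₁ z) = A.π-splitˡ {X} {Y} E s a z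
      blocks-⊎ {X} {Y} E s a (inj₂ z) = A.π-splitʳ {X} {Y} E s a z

    decoratedCompatible : Compatible decoratedBialgebra decoratedContraction
    decoratedCompatible = record
      { δ-m  = λ X Y E s → extend-m {X} {Y} {X / restrictˡ {X} {Y} E} {Y / restrictʳ {X} {Y} E} {(X ⊔ˢ Y) / E} (split-quotient≃ {X} {Y} E s) (blocks {X} (restrictˡ {X} {Y} E)) (blocks {Y} (restrictʳ {X} {Y} E)) (blocks {X ⊔ˢ Y} E)
                 (blocks-⊎ {X} {Y} E s) (δ {X} (restrictˡ {X} {Y} E)) (δ {Y} (restrictʳ {X} {Y} E)) (δ {X ⊔ˢ Y} E) (δ-m X Y E s)
      ; δ-m₀ = λ X Y E n → extend-m₀ {X} {Y} {(X ⊔ˢ Y) / E} (blocks {X ⊔ˢ Y} E) (δ {X ⊔ˢ Y} E) (δ-m₀ X Y E n)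
      ; Δ-δ  = λ X Y E s → extend-Δ {X} {Y} {X / restrictˡ {X} {Y} E} {Y / restrictʳ {X} {Y} E} {(X ⊔ˢ Y) / E} (split-quotient≃ {X} {Y} E s) (blocks {X} (restrictˡ {X} {Y} E)) (blocks {Y} (restrictʳ {X} {Y} E)) (blocks {X ⊔ˢ Y} E)
                 (blocks-⊎ {X} {Y} E s) (δ {X} (restrictˡ {X} {Y} E)) (δ {Y} (restrictʳ {X} {Y} E)) (δ {X ⊔ˢ Y} E) (Δ-δ X Y E s)
      ; δ-1  = λ E → extend-1 (∅/≃ E) (blocks E) (δ E) (δ-1 E)
      ; ε-δ  = λ E → extend-ε (∅/≃ E) (blocks E) (δ E) (ε-δ E)
      }

-- Morphisms of twisted structures and the induced maps of Fock spaces.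

module FockMorphism {ℓ} (K : HeytingField ℓ ℓ ℓ) where
  open Over K
  open Linear K

  private module 𝕜 = CommutativeRing commRing

  record Morphism {H G : Species} {B : TwistedBialgebra H} {B′ : TwistedBialgebra G}
                  (C : ContractionExtraction H) (C′ : ContractionExtraction G) : Set (lsuc 0ℓ ⊔ ℓ) where
    private
      module H = Species H
      module G = Species G
      module B = TwistedBialgebra B
      module B′ = TwistedBialgebra B′
      module C = ContractionExtraction C
      module C′ = ContractionExtraction C′
    field
      φ         : ∀ X → H.P₀ X ⊸ G.P₀ X
      φ-natural : ∀ {X Y} (σ : X ≃ Y) x → G.P₀ Y ⊢ φ Y ⟨$⟩ H.P₁ σ ⟨$⟩ x ≈ G.P₁ σ ⟨$⟩ φ X ⟨$⟩ x
      φ-m       : ∀ X Y x y → G.P₀ (X ⊔ˢ Y) ⊢ φ (X ⊔ˢ Y) ⟨$⟩ B.m X Y ⟨$⟩ x ⊗ₜ y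
                                            ≈ B′.m X Y ⟨$⟩ (φ X ⟨$⟩ x) ⊗ₜ (φ Y ⟨$⟩ y)
      φ-1       : G.P₀ ∅ ⊢ φ ∅ ⟨$⟩ B.1ₚ ≈ B′.1ₚ
      φ-Δ       : ∀ X Y x → G.P₀ X ⊗ G.P₀ Y ⊢ B′.Δ X Y ⟨$⟩ φ (X ⊔ˢ Y) ⟨$⟩ x ≈ (φ X ⊗₁ φ Y) ⟨$⟩ B.Δ X Y ⟨$⟩ x
      φ-ε       : ∀ x → B′.ε ⟨$⟩ φ ∅ ⟨$⟩ x ≈ᵏ B.ε ⟨$⟩ x
      φ-δ       : ∀ {X} (E : 𝓔 X) x → G.P₀ (X / E) ⊗ G.P₀ X ⊢ C′.δ E ⟨$⟩ φ X ⟨$⟩ x ≈ (φ (X / E) ⊗₁ φ X) ⟨$⟩ C.δ E ⟨$⟩ x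
      φ-ϵ       : ∀ X x → C′.ϵ X ⟨$⟩ φ X ⟨$⟩ x ≈ᵏ C.ϵ X ⟨$⟩ x

  module Induced {H G : Species} (F : FockSpace H) (F′ : FockSpace G)
                 (B : TwistedBialgebra H) (B′ : TwistedBialgebra G)
                 (C : ContractionExtraction H) (C′ : ContractionExtraction G)
                 (c : Compatible B C) (c′ : Compatible B′ C′)
                 (f : Morphism {B = B} {B′} C C′) where
    open Morphism f
    private
      module H = Species H
      module G = Species G
      module F = FockSpace F
      module F′ = FockSpace F′
      module B = TwistedBialgebra B
      module B′ = TwistedBialgebra B′
      module C = ContractionExtraction C
      module A = FockAlgebra K H F
      module A′ = FockAlgebra K G F′
      module M = A.Product B.algebra
      module M′ = A′.Product B′.algebra
      module D = A.Coproduct B.coalgebra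
      module D′ = A′.Coproduct B′.coalgebra
      module E = FockCoproduct K H F B
      module E′ = FockCoproduct K G F′ B′
      module X = FockContraction K H F B C c
      module X′ = FockContraction K G F′ B′ C′ c′

    opaque
      Φ : F.space ⊸ F′.space
      Φ = F.desc {F′.space} (λ n → F′.ι n ∘ᴸ φ [ n ])
        (λ {n} σ x → Module.≈ᴹ-trans F′.space (F′.ι n ▹ φ-natural σ x) (F′.ι-𝔖 σ (φ [ n ] ⟨$⟩ x)))

      Φ-ι : ∀ n x → F′.space ⊢ Φ ⟨$⟩ F.ι n ⟨$⟩ x ≈ F′.ι n ⟨$⟩ φ [ n ] ⟨$⟩ x
      Φ-ι = F.desc-ι {F′.space} (λ n → F′.ι n ∘ᴸ φ [ n ])
        (λ {n} σ x → Module.≈ᴹ-trans F′.space (F′.ι n ▹ φ-natural σ x) (F′.ι-𝔖 σ (φ [ n ] ⟨$⟩ x)))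

    Φ-ι̂ : ∀ X x → F′.space ⊢ Φ ⟨$⟩ A.ι̂ X ⟨$⟩ x ≈ A′.ι̂ X ⟨$⟩ φ X ⟨$⟩ x
    Φ-ι̂ X x = Module.≈ᴹ-trans F′.space (Φ-ι _ _) (F′.ι (FinSet.size X) ▹ φ-natural (enum≃ X) x)

    private
      Φι̂² : ∀ X Y t → F′.space ⊗ F′.space ⊢ (Φ ⊗₁ Φ) ⟨$⟩ (A.ι̂ X ⊗₁ A.ι̂ Y) ⟨$⟩ t
                                          ≈ (A′.ι̂ X ⊗₁ A′.ι̂ Y) ⟨$⟩ (φ X ⊗₁ φ Y) ⟨$⟩ t
      Φι̂² X Y = ⊗-ext ((Φ ⊗₁ Φ) ∘ᴸ (A.ι̂ X ⊗₁ A.ι̂ Y)) ((A′.ι̂ X ⊗₁ A′.ι̂ Y) ∘ᴸ (φ X ⊗₁ φ Y))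
        (λ x y → Φ-ι̂ X x ⊠ Φ-ι̂ Y y)

      -- Both sides index their sums by the same decompositions of the same set, so no reindexing
      -- occurs and the comparison is term by term.
      Φ-D : ∀ {X} (d : Decomp X) x → F′.space ⊗ F′.space ⊢ D′.D d ⟨$⟩ φ X ⟨$⟩ x ≈ (Φ ⊗₁ Φ) ⟨$⟩ D.D d ⟨$⟩ x
      Φ-D {X} d x = D′.D-def d (φ X ⟨$⟩ x)
        ⟫ (((A′.ι̂ (L d) ⊗₁ A′.ι̂ (R d)) ∘ᴸ B′.Δ (L d) (R d)) ▹ Module.≈ᴹ-sym (G.P₀ (L d ⊔ˢ R d)) (φ-natural (iso d ⁻¹≃) x))
        ⟫ ((A′.ι̂ (L d) ⊗₁ A′.ι̂ (R d)) ▹ φ-Δ (L d) (R d) (H.P₁ (iso d ⁻¹≃) ⟨$⟩ x))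
        ⟫ ↺ (Φι̂² (L d) (R d) (B.Δ (L d) (R d) ⟨$⟩ H.P₁ (iso d ⁻¹≃) ⟨$⟩ x))
        ⟫ ((Φ ⊗₁ Φ) ▹ ≈-sym (D.D-def d x))
        where open Chain (F′.space ⊗ F′.space)

      Φ-Λ : ∀ {X} (E : 𝓔 X) x → F′.space ⊗ F′.space ⊢ X′.Λ E ⟨$⟩ φ X ⟨$⟩ x ≈ (Φ ⊗₁ Φ) ⟨$⟩ X.Λ E ⟨$⟩ x
      Φ-Λ {X} E x = X′.Λ-def E (φ X ⟨$⟩ x)
        ⟫ ((A′.ι̂ (X / E) ⊗₁ A′.ι̂ X) ▹ φ-δ E x)
        ⟫ ↺ (Φι̂² (X / E) X (C.δ E ⟨$⟩ x))
        ⟫ ((Φ ⊗₁ Φ) ▹ ≈-sym (X.Λ-def E x))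
        where open Chain (F′.space ⊗ F′.space)

      Φ-mul : Φ ∘ᴸ M.mul ≗ᴸ M′.mul ∘ᴸ (Φ ⊗₁ Φ)
      Φ-mul = A.ι-ext₂ (Φ ∘ᴸ M.mul) (M′.mul ∘ᴸ (Φ ⊗₁ Φ)) (λ k l x y →
        (Φ ▹ M.mul-ι k l x y)
        ⟫ Φ-ι̂ ([ k ] ⊔ˢ [ l ]) (B.m [ k ] [ l ] ⟨$⟩ x ⊗ₜ y)
        ⟫ (A′.ι̂ ([ k ] ⊔ˢ [ l ]) ▹ φ-m [ k ] [ l ] x y)
        ⟫ ↺ (M′.mul-ι k l (φ [ k ] ⟨$⟩ x) (φ [ l ] ⟨$⟩ y))
        ⟫ (M′.mul ▹ ↺ (Φ-ι k x) ⊠ ↺ (Φ-ι l y)))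
        where open Chain F′.space

      Φ-Δ : D′.Δᶠ ∘ᴸ Φ ≗ᴸ (Φ ⊗₁ Φ) ∘ᴸ D.Δᶠ
      Φ-Δ = F.ι-ext (D′.Δᶠ ∘ᴸ Φ) ((Φ ⊗₁ Φ) ∘ᴸ D.Δᶠ) (λ n x →
        (D′.Δᶠ ▹ Φ-ι n x)
        ⟫ D′.Δ-ι n (φ [ n ] ⟨$⟩ x)
        ⟫ ∑-cong (F′.space ⊗ F′.space) (decompositions [ n ]) (λ d → Φ-D d x)
        ⟫ ↺ (map-∑ (Φ ⊗₁ Φ) (decompositions [ n ]) (λ d → D.D d ⟨$⟩ x))
        ⟫ ((Φ ⊗₁ Φ) ▹ ≈-sym (D.Δ-ι n x)))
        where open Chain (F′.space ⊗ F′.space)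

      Φ-δ : X′.δᶠ ∘ᴸ Φ ≗ᴸ (Φ ⊗₁ Φ) ∘ᴸ X.δᶠ
      Φ-δ = F.ι-ext (X′.δᶠ ∘ᴸ Φ) ((Φ ⊗₁ Φ) ∘ᴸ X.δᶠ) (λ n x →
        (X′.δᶠ ▹ Φ-ι n x)
        ⟫ X′.δ-ι n (φ [ n ] ⟨$⟩ x)
        ⟫ ∑-cong (F′.space ⊗ F′.space) (equivalences [ n ]) (λ E → Φ-Λ E x)
        ⟫ ↺ (map-∑ (Φ ⊗₁ Φ) (equivalences [ n ]) (λ E → X.Λ E ⟨$⟩ x))
        ⟫ ((Φ ⊗₁ Φ) ▹ ≈-sym (X.δ-ι n x)))
        where open Chain (F′.space ⊗ F′.space)

      Φ-ε : E′.εᶠ ∘ᴸ Φ ≗ᴸ E.εᶠ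
      Φ-ε = F.ι-ext (E′.εᶠ ∘ᴸ Φ) E.εᶠ λ
        { zero x → 𝕜.trans (E′.εᶠ ▹ Φ-ι zero x) (𝕜.trans (E′.ε-ι zero (φ [ zero ] ⟨$⟩ x)) (𝕜.trans (φ-ε x) (𝕜.sym (E.ε-ι zero x))))
        ; (suc n) x → 𝕜.trans (E′.εᶠ ▹ Φ-ι (suc n) x) (𝕜.trans (E′.ε-ι (suc n) (φ [ suc n ] ⟨$⟩ x)) (𝕜.sym (E.ε-ι (suc n) x))) }

      Φ-ϵ : X′.ϵᶠ ∘ᴸ Φ ≗ᴸ X.ϵᶠ
      Φ-ϵ = F.ι-ext (X′.ϵᶠ ∘ᴸ Φ) X.ϵᶠ (λ n x →
        𝕜.trans (X′.ϵᶠ ▹ Φ-ι n x) (𝕜.trans (X′.ϵ-ι n (φ [ n ] ⟨$⟩ x)) (𝕜.trans (φ-ϵ [ n ] x) (𝕜.sym (X.ϵ-ι n x)))))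

    induced : DoubleBialgebraHom (doubleBialgebra F.space X.fockStructure) (doubleBialgebra F′.space X′.fockStructure)
    induced = record
      { map     = Φ
      ; map-mul = Φ-mul
      ; map-one = Module.≈ᴹ-trans F′.space (Φ-ι 0 B.1ₚ) (F′.ι 0 ▹ φ-1)
      ; map-Δ   = Φ-Δ
      ; map-εΔ  = Φ-ε
      ; map-δ   = Φ-δ
      ; map-ϵδ  = Φ-ϵ
      }

-- The space `𝓕` as coinvariants of the decorated species.

module DecoratedFock {ℓ} (K : HeytingField ℓ ℓ ℓ)
                     (V : Over.Vect K) (P : Over.Species K) where
  open Over K
  open Linear K
  open Decorations K
  open DecoratedSpecies K V P
  open Species P
  private
    module V = Module V

    𝓕V : Vect
    𝓕V = 𝓕 P V

    -- Translates between two statements of multilinearity: the relations of `𝓕` change a family by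
    -- an update, those of the decorated species compare families slot by slot.
    updated : ∀ {n} (u v : Fin n → ⌊ V ⌋) i a → V ⊢ a ≈ v i → (∀ k → ¬ k ≡ i → V ⊢ u k ≈ v k) →
              ∀ k → V ⊢ VF.updateAt u i (λ _ → a) k ≈ v k
    updated u v i a p q k with k Fin.≟ i
    ... | yes refl = V.≈ᴹ-trans (V.≈ᴹ-reflexive (updateAt-updates k u)) p
    ... | no k≢i   = V.≈ᴹ-trans (V.≈ᴹ-reflexive (updateAt-minimal k i u k≢i)) (q k k≢i)

    same-elsewhere : ∀ {n} (u : Fin n → ⌊ V ⌋) i a b k → ¬ k ≡ i →
                     V ⊢ VF.updateAt u i (λ _ → a) k ≈ VF.updateAt u i (λ _ → b) k
    same-elsewhere u i a b k k≢i = V.≈ᴹ-reflexive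
      (≡.trans (updateAt-minimal k i u k≢i) (≡.sym (updateAt-minimal k i u k≢i)))

    at-i : ∀ {n} (u : Fin n → ⌊ V ⌋) i a → V ⊢ VF.updateAt u i (λ _ → a) i ≈ a
    at-i u i a = V.≈ᴹ-reflexive (updateAt-updates i u)

    cls : ∀ {n} → Deco V [ n ] → P₀ [ n ] ⊸ 𝓕V
    cls {n} v = linear (cl P V n (at v)) (λ e → rel (f-cong (λ _ → V.≈ᴹ-refl) e))
      (λ p q → rel (f-+ₚ (at v) p q)) (λ k p → rel (f-*ₚ (at v) k p))

    cls-at : ∀ {n} p → Multilinear V [ n ] 𝓕V (λ v → cls v ⟨$⟩ p)
    cls-at {n} p = record
      { resp  = λ e → change e
      ; add   = λ {i} {u} {v} {w} (e , h) →
          change (λ k → V.≈ᴹ-sym (updated (at u) (at u) i _ (V.≈ᴹ-sym e) (λ _ _ → V.≈ᴹ-refl) k))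
          ⟫ rel (f-+ᵥ (at u) i (at v i) (at w i) p)
          ⟫ ⊕-cong (change (updated (at u) (at v) i (at v i) V.≈ᴹ-refl (λ k ne → V.≈ᴹ-sym (proj₁ (h k ne)))))
                   (change (updated (at u) (at w) i (at w i) V.≈ᴹ-refl (λ k ne → V.≈ᴹ-sym (proj₂ (h k ne)))))
      ; scale = λ {i} {c} {u} {v} (e , h) →
          change (λ k → V.≈ᴹ-sym (updated (at u) (at u) i _ (V.≈ᴹ-sym e) (λ _ _ → V.≈ᴹ-refl) k))
          ⟫ rel (f-*ᵥ (at u) i c (at v i) p)
          ⟫ ·-cong (CommutativeRing.refl commRing)
              (change (updated (at u) (at v) i (at v i) V.≈ᴹ-refl (λ k ne → V.≈ᴹ-sym (h k ne))))
      }
      where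
      open Chain 𝓕V
      change : ∀ {v w : Fin n → ⌊ V ⌋} → (∀ k → V ⊢ v k ≈ w k) → 𝓕V ⊢ cl P V n v p ≈ cl P V n w p
      change e = rel (f-cong e (Module.≈ᴹ-refl (P₀ [ n ])))

  opaque
    ιᴴ : ∀ n → H₀ [ n ] ⊸ 𝓕V
    ιᴴ n = H-lift 𝓕V cls cls-at

    ι-j : ∀ {n} v p → 𝓕V ⊢ ιᴴ n ⟨$⟩ j v ⟨$⟩ p ≈ cl P V n (at v) p
    ι-j v p = ≈-refl

  private
    module _ {M : Vect} (f : ∀ n → H₀ [ n ] ⊸ M)
             (inv : ∀ {n} (σ : [ n ] ≃ [ n ]) x → M ⊢ f n ⟨$⟩ H₁ σ ⟨$⟩ x ≈ f n ⟨$⟩ x) where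
      open Chain M

      value : FockGen P V → ⌊ M ⌋
      value (n , v , p) = f n ⟨$⟩ j (finᵈ v) ⟨$⟩ p

      value-resp : ∀ {s t} → FockRel P V s t → M ⊢ eval M value s ≈ eval M value t
      value-resp (f-cong {n} e r)      = f n ▹ rel (h-cong e r)
      value-resp (f-+ᵥ {n} v i a b p)  = (f n ▹ rel (h-add {x = i}
          ( V.≈ᴹ-trans (at-i v i _) (V.≈ᴹ-sym (V.+ᴹ-cong (at-i v i a) (at-i v i b)))
          , λ k ne → same-elsewhere v i a _ k ne , same-elsewhere v i b _ k ne) p))
        ⟫ _⊸_.+ᴹ-homo (f n) _ _
      value-resp (f-*ᵥ {n} v i k a p)  = (f n ▹ rel (h-scale {x = i}
          ( V.≈ᴹ-trans (at-i v i _) (V.≈ᴹ-sym (V.*ₗ-cong (CommutativeRing.refl commRing) (at-i v i a)))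
          , λ k′ ne → same-elsewhere v i a _ k′ ne) p))
        ⟫ _⊸_.*ₗ-homo (f n) k _
      value-resp (f-+ₚ {n} v p q)      = _⊸_.+ᴹ-homo (f n ∘ᴸ j (finᵈ v)) p q
      value-resp (f-*ₚ {n} v k p)      = _⊸_.*ₗ-homo (f n ∘ᴸ j (finᵈ v)) k p
      -- The action of σ on families reads through σ⁻¹, so `v` is the image under σ of the family i
      -- ↦ v(σ i); the relation then becomes invariance of `f`.
      value-resp (f-𝔖 {n} v σ p)       =
        (f n ▹ ≈-trans (j-resp {v = finᵈ v} {σ ∙ᵈ finᵈ (λ i → v (_≃_.to σ i))}
                          (λ i → V.≈ᴹ-reflexive (≡.cong v (≡.sym (_≃_.strictlyInverseˡ σ i)))) (P₁ σ ⟨$⟩ p))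
                       (≈-sym (H₁-j σ (finᵈ (λ i → v (_≃_.to σ i))) p)))
        ⟫ inv σ (j (finᵈ (λ i → v (_≃_.to σ i))) ⟨$⟩ p)

      descend-𝓕 : 𝓕V ⊸ M
      descend-𝓕 = lift (FockRel P V) M value value-resp

      descend-ι : ∀ n x → M ⊢ descend-𝓕 ⟨$⟩ ιᴴ n ⟨$⟩ x ≈ f n ⟨$⟩ x
      descend-ι n = H-ext (descend-𝓕 ∘ᴸ ιᴴ n) (f n) (λ v p →
        (descend-𝓕 ▹ ι-j v p) ⟫ (f n ▹ j-resp {v = finᵈ (at v)} {v} (λ _ → V.≈ᴹ-refl) p))

  decoratedFock : FockSpace decorated
  decoratedFock = record
    { space  = 𝓕V
    ; ι      = ιᴴ
    ; ι-𝔖    = λ {n} σ → H-ext (ιᴴ n ∘ᴸ H₁ σ) (ιᴴ n) (λ v p →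
        (ιᴴ n ▹ H₁-j σ v p) ⟫ ι-j (σ ∙ᵈ v) (P₁ σ ⟨$⟩ p) ⟫ rel (f-𝔖 (at (σ ∙ᵈ v)) σ p)
        ⟫ rel (f-cong (λ i → at-cong v (_≃_.strictlyInverseʳ σ i)) (Module.≈ᴹ-refl (P₀ [ n ])))
        ⟫ ↺ (ι-j v p))
    ; desc   = descend-𝓕
    ; desc-ι = descend-ι
    ; ι-ext  = λ {M} f g h → ext (FockRel P V) f g (λ { (n , v , p) →
        Module.≈ᴹ-trans M (f ▹ ↺ (ι-j (finᵈ v) p)) (Module.≈ᴹ-trans M (h n (j (finᵈ v) ⟨$⟩ p)) (g ▹ ι-j (finᵈ v) p)) })
    }
    where open Chain 𝓕V

-- Explicit formulas for the product and the two coproducts.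

module Formulas {ℓ} (K : HeytingField ℓ ℓ ℓ)
                (V : Over.CommBialgebra K) (P : Over.Species K) (B : Over.TwistedBialgebra K P)
                (C : Over.ContractionExtraction K P) (compatible : Over.Compatible K B C) where
  open Over K
  open Linear K
  open Decorations K
  private
    module 𝕜 = CommutativeRing commRing
    module V = CommBialgebra V
    module B = TwistedBialgebra B
    module C = ContractionExtraction C

    U : Vect
    U = V.space

    𝓕V : Vect
    𝓕V = 𝓕 P U

    infixr 4 _⟫_
    _⟫_ : ∀ {G : Set ℓ} {R : Rel (Term G) ℓ} {s t u} → _≈ᵗ_ R s t → _≈ᵗ_ R t u → _≈ᵗ_ R s u
    _⟫_ = ≈-trans

  open Species P
  open DecoratedSpecies K (CommBialgebra.space V) P
  open DecoratedBialgebra B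
  open Extension K V P B using (Λ; Λ-def; extend-j)
  open DecoratedContraction K V P B C
  open DecoratedFock K (CommBialgebra.space V) P
  private
    module Fock = FockContraction K
      (DecoratedSpecies.decorated K (CommBialgebra.space V) P)
      (DecoratedFock.decoratedFock K (CommBialgebra.space V) P)
      (DecoratedSpecies.DecoratedBialgebra.decoratedBialgebra K (CommBialgebra.space V) P B)
      (DecoratedContraction.decoratedContraction K V P B C)
      (DecoratedContraction.decoratedCompatible K V P B C compatible)
    module Alg = FockAlgebra K decorated decoratedFock
    module Prod = Alg.Product decoratedAlgebra
    module Coprod = Alg.Coproduct decoratedCoalgebra

  structure : DoubleBialgebraStructure 𝓕V
  structure = Fock.fockStructure

  module S = DoubleBialgebraStructure structure

  -- Justifies Sweedler notation: a linear map may be applied to a term by evaluating the term with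
  -- the map on its generators.
  linear-eval : ∀ {G : Set ℓ} {R : Rel (Term G) ℓ} {Q} (f : Presented R ⊸ Q) t → Q ⊢ f ⟨$⟩ t ≈ eval Q (λ x → f ⟨$⟩ gen x) t
  linear-eval {Q = Q} f (gen x) = Module.≈ᴹ-refl Q
  linear-eval         f 𝟎       = _⊸_.0ᴹ-homo f
  linear-eval {Q = Q} f (s ⊕ t) = Module.≈ᴹ-trans Q (_⊸_.+ᴹ-homo f s t) (Module.+ᴹ-cong Q (linear-eval f s) (linear-eval f t))
  linear-eval {Q = Q} f (k · t) = Module.≈ᴹ-trans Q (_⊸_.*ₗ-homo f k t) (Module.*ₗ-cong Q 𝕜.refl (linear-eval f t))

  ι̂-j : ∀ {X} (v : Deco U X) p →
        𝓕V ⊢ Alg.ι̂ X ⟨$⟩ j v ⟨$⟩ p ≈ cl P U (FinSet.size X) (at (enum≃ X ∙ᵈ v)) (P₁ (enum≃ X) ⟨$⟩ p)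
  ι̂-j {X} v p = (ιᴴ (FinSet.size X) ▹ H₁-j (enum≃ X) v p) ⟫ ι-j (enum≃ X ∙ᵈ v) (P₁ (enum≃ X) ⟨$⟩ p)

  private
    cl-cong : ∀ n {v w : Fin n → ⌊ U ⌋} {p q} → (∀ i → U ⊢ v i ≈ w i) → P₀ [ n ] ⊢ p ≈ q → 𝓕V ⊢ cl P U n v p ≈ cl P U n w q
    cl-cong n e r = rel (f-cong e r)

    ⊎-++ : ∀ {k l} (v : Fin k → ⌊ U ⌋) (w : Fin l → ⌊ U ⌋) i →
           U ⊢ at (enum≃ ([ k ] ⊔ˢ [ l ]) ∙ᵈ (finᵈ {U} v ⊎ᵈ finᵈ {U} w)) i ≈ (v VF.++ w) i
    ⊎-++ {k} v w i with splitAt k i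
    ... | inj₁ _ = Module.≈ᴹ-refl U
    ... | inj₂ _ = Module.≈ᴹ-refl U

  mul-formula : ∀ {k l} v w p q →
    𝓕V ⊢ S.mul ⟨$⟩ cl P U k v p ⊗ₜ cl P U l w q ≈ cl P U _ (v VF.++ w) (P₁ (shift k l) ⟨$⟩ B.m [ k ] [ l ] ⟨$⟩ p ⊗ₜ q)
  mul-formula {k} {l} v w p q =
    (S.mul ▹ ≈-sym (ι-j (finᵈ v) p) ⊠ ≈-sym (ι-j (finᵈ w) q))
    ⟫ Prod.mul-ι k l (j (finᵈ v) ⟨$⟩ p) (j (finᵈ w) ⟨$⟩ q)
    ⟫ (Alg.ι̂ ([ k ] ⊔ˢ [ l ]) ▹ m-j (finᵈ v) p (finᵈ w) q)
    ⟫ ι̂-j (finᵈ v ⊎ᵈ finᵈ w) (B.m [ k ] [ l ] ⟨$⟩ p ⊗ₜ q)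
    ⟫ cl-cong _ (⊎-++ v w)
        (P-resp {σ = enum≃ ([ k ] ⊔ˢ [ l ])} {shift k l} (λ { (inj₁ _) → refl ; (inj₂ _) → refl }) (B.m [ k ] [ l ] ⟨$⟩ p ⊗ₜ q))

  Δ-formula : ∀ {n} v p →
    𝓕V ⊗ 𝓕V ⊢ S.Δ ⟨$⟩ cl P U n v p
            ≈ ∑ (𝓕V ⊗ 𝓕V) (subsets n) λ A →
                sweedler (𝓕V ⊗ 𝓕V) (B.Δ ⟪ A ⟫ ⟪ ∁ A ⟫ ⟨$⟩ P₁ (partition≃ A ⁻¹≃) ⟨$⟩ p) λ p₁ p₂ →
                  cl P U _ (λ i → v (proj₁ (unrank A i))) (P₁ σ⟪ A ⟫ ⟨$⟩ p₁)
                  ⊗ₜ cl P U _ (λ i → v (proj₁ (unrank (∁ A) i))) (P₁ σ⟪ ∁ A ⟫ ⟨$⟩ p₂)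
  Δ-formula {n} v p =
    (S.Δ ▹ ≈-sym (ι-j (finᵈ v) p))
    ⟫ Coprod.Δ-ι n (j (finᵈ v) ⟨$⟩ p)
    -- `decompositions [ n ]` is by definition the image of `subsets n`, so the two sums have the
    -- same terms in the same order.
    ⟫ Module.≈ᴹ-reflexive (𝓕V ⊗ 𝓕V) (∑.⨁-map (𝓕V ⊗ 𝓕V) (subsetDecomp [ n ]) (subsets n) (λ d → Coprod.D d ⟨$⟩ j (finᵈ v) ⟨$⟩ p))
    ⟫ ∑-cong (𝓕V ⊗ 𝓕V) (subsets n) part
    where
    part : ∀ A → 𝓕V ⊗ 𝓕V ⊢ Coprod.D (subsetDecomp [ n ] A) ⟨$⟩ j (finᵈ v) ⟨$⟩ p
      ≈ sweedler (𝓕V ⊗ 𝓕V) (B.Δ ⟪ A ⟫ ⟪ ∁ A ⟫ ⟨$⟩ P₁ (partition≃ A ⁻¹≃) ⟨$⟩ p) (λ p₁ p₂ →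
          cl P U _ (λ i → v (proj₁ (unrank A i))) (P₁ σ⟪ A ⟫ ⟨$⟩ p₁)
          ⊗ₜ cl P U _ (λ i → v (proj₁ (unrank (∁ A) i))) (P₁ σ⟪ ∁ A ⟫ ⟨$⟩ p₂))
    part A =
      Coprod.D-def (subsetDecomp [ n ] A) (j (finᵈ v) ⟨$⟩ p)
      ⟫ (((Alg.ι̂ ⟪ A ⟫ ⊗₁ Alg.ι̂ ⟪ ∁ A ⟫) ∘ᴸ Δᴴ ⟪ A ⟫ ⟪ ∁ A ⟫) ▹ H₁-j τ (finᵈ v) p)
      ⟫ ((Alg.ι̂ ⟪ A ⟫ ⊗₁ Alg.ι̂ ⟪ ∁ A ⟫) ▹ Δ-j {⟪ A ⟫} {⟪ ∁ A ⟫} w (P₁ τ ⟨$⟩ p))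
      -- The enumeration of [n] in `subsetDecomp` is the identity; only the composite with it has to
      -- be removed.
      ⟫ (f ▹ (B.Δ ⟪ A ⟫ ⟪ ∁ A ⟫ ▹ P-resp {σ = τ} {partition≃ A ⁻¹≃} (λ _ → FinSet.≈-refl (⟪ A ⟫ ⊔ˢ ⟪ ∁ A ⟫)) p))
      ⟫ linear-eval f (B.Δ ⟪ A ⟫ ⟪ ∁ A ⟫ ⟨$⟩ P₁ (partition≃ A ⁻¹≃) ⟨$⟩ p)
      ⟫ eval-ext (𝓕V ⊗ 𝓕V) (λ p₁₂ → ι̂-j (fstᵈ {U} {⟪ A ⟫} {⟪ ∁ A ⟫} w) (proj₁ p₁₂) ⊠ ι̂-j (sndᵈ {U} {⟪ A ⟫} {⟪ ∁ A ⟫} w) (proj₂ p₁₂))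
          (B.Δ ⟪ A ⟫ ⟪ ∁ A ⟫ ⟨$⟩ P₁ (partition≃ A ⁻¹≃) ⟨$⟩ p)
      where
      τ : [ n ] ≃ (⟪ A ⟫ ⊔ˢ ⟪ ∁ A ⟫)
      τ = iso (subsetDecomp [ n ] A) ⁻¹≃

      w : Deco U (⟪ A ⟫ ⊔ˢ ⟪ ∁ A ⟫)
      w = τ ∙ᵈ finᵈ v

      f : P₀ ⟪ A ⟫ ⊗ P₀ ⟪ ∁ A ⟫ ⊸ 𝓕V ⊗ 𝓕V
      f = (Alg.ι̂ ⟪ A ⟫ ⊗₁ Alg.ι̂ ⟪ ∁ A ⟫) ∘ᴸ (j (fstᵈ {U} {⟪ A ⟫} {⟪ ∁ A ⟫} w) ⊗₁ j (sndᵈ {U} {⟪ A ⟫} {⟪ ∁ A ⟫} w))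

  private
    -- `blockProduct` folds the remaining elements of the class onto the representative σ⁻¹(i).
    -- Extracting that representative from the unital product over the class gives the same value,
    -- once membership is rewritten as `σ.to a ≡ i`.
    block : ∀ {n k} (E : 𝓔 [ n ]) (σ : ([ n ] / E) ≃ [ k ]) (v : Deco U [ n ]) i →
            U ⊢ at (A.π E v) (_≃_.from σ i) ≈ blockProduct V E σ (at v) i
    block {n} {k} E σ v i = A.π-unique E v i₀ _ (A.U.trans (A.foldr-over (filter P? (allFinᴸ n)) (at v) (at v i₀))
      (A.U.trans (A.U.∙-cong A.U.refl (⨁-filter A.unital P? (allFinᴸ n) (just ∘ at v)))
        (A.U.trans (A.U.sym (⨁-extract A.unital (λ a → σ.to a Fin.≟ i) (λ a → a Fin.≟ i₀) (one-element [ n ] i₀)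
            (λ { _ refl → σ.strictlyInverseˡ i }) (λ { _ refl → A.U.refl })))
          (A.⨁-cong (allFinᴸ n) (λ a → A.when-cong (σ.to a Fin.≟ i) (𝓔._∼?_ E a i₀)
            (λ e → 𝓔.∼-trans E (𝓔.∼-sym E (σ.strictlyInverseʳ a)) (σ.from-cong e))
            (λ r → ≡.trans (σ.to-cong r) (σ.strictlyInverseˡ i)) (λ _ → A.U.refl))))))
      where
      module σ = _≃_ σ
      i₀ : Fin n
      i₀ = σ.from i
      P? = λ (a : Fin n) → (σ.to a Fin.≟ i) ×-dec ¬? (a Fin.≟ i₀)

  δ-formula : ∀ {n} (σ : ∀ (E : 𝓔 [ n ]) → ([ n ] / E) ≃ [ FinSet.size ([ n ] / E) ]) v p →
    𝓕V ⊗ 𝓕V ⊢ S.δ ⟨$⟩ cl P U n v p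
            ≈ ∑ (𝓕V ⊗ 𝓕V) (equivalences [ n ]) λ E →
                sweedlers (𝓕V ⊗ 𝓕V) (λ i → V.δ ⟨$⟩ v i) λ v′ v″ →
                  sweedler (𝓕V ⊗ 𝓕V) (C.δ E ⟨$⟩ p) λ p₁ p₂ →
                    cl P U _ (blockProduct V E (σ E) v′) (P₁ (σ E) ⟨$⟩ p₁) ⊗ₜ cl P U n v″ p₂
  δ-formula {n} σ v p =
    (S.δ ▹ ≈-sym (ι-j (finᵈ v) p))
    ⟫ Fock.δ-ι n (j (finᵈ v) ⟨$⟩ p)
    ⟫ ∑-cong (𝓕V ⊗ 𝓕V) (equivalences [ n ]) part
    where
    module _ (E : 𝓔 [ n ]) where
      ι̂² : H₀ ([ n ] / E) ⊗ H₀ [ n ] ⊸ 𝓕V ⊗ 𝓕V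
      ι̂² = Alg.ι̂ ([ n ] / E) ⊗₁ Alg.ι̂ [ n ]

      left : ∀ (a : Deco U [ n ]) p₁ → 𝓕V ⊢ Alg.ι̂ ([ n ] / E) ⟨$⟩ j (A.π E a) ⟨$⟩ p₁
        ≈ cl P U _ (blockProduct V E (σ E) (at a)) (P₁ (σ E) ⟨$⟩ p₁)
      -- Any bijection onto [k] may replace the enumeration of the quotient, because `ι̂` is
      -- invariant; this allows an arbitrary choice of the σ_∼.
      left a p₁ = ≈-sym (Alg.ι̂-natural (σ E) (j (A.π E a) ⟨$⟩ p₁))
        ⟫ Alg.ι̂-[] _ (H₁ (σ E) ⟨$⟩ j (A.π E a) ⟨$⟩ p₁)
        ⟫ (ιᴴ _ ▹ H₁-j (σ E) (A.π E a) p₁)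
        ⟫ ι-j (σ E ∙ᵈ A.π E a) (P₁ (σ E) ⟨$⟩ p₁)
        ⟫ cl-cong _ (block E (σ E) a) (Module.≈ᴹ-refl (P₀ [ FinSet.size ([ n ] / E) ]))

      right : ∀ (b : Deco U [ n ]) p₂ → 𝓕V ⊢ Alg.ι̂ [ n ] ⟨$⟩ j b ⟨$⟩ p₂ ≈ cl P U n (at b) p₂
      right b p₂ = Alg.ι̂-[] n (j b ⟨$⟩ p₂) ⟫ ι-j b p₂

      pure : ∀ (a b : Deco U [ n ]) → 𝓕V ⊗ 𝓕V ⊢ ι̂² ⟨$⟩ (j (A.π E a) ⊗₁ j b) ⟨$⟩ C.δ E ⟨$⟩ p
        ≈ sweedler (𝓕V ⊗ 𝓕V) (C.δ E ⟨$⟩ p) (λ p₁ p₂ →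
            cl P U _ (blockProduct V E (σ E) (at a)) (P₁ (σ E) ⟨$⟩ p₁) ⊗ₜ cl P U n (at b) p₂)
      pure a b = linear-eval (ι̂² ∘ᴸ (j (A.π E a) ⊗₁ j b)) (C.δ E ⟨$⟩ p)
        ⟫ eval-ext (𝓕V ⊗ 𝓕V) (λ p₁₂ → left a (proj₁ p₁₂) ⊠ right b (proj₂ p₁₂)) (C.δ E ⟨$⟩ p)

      term : (a b : Fin n → ⌊ U ⌋) → ⌊ H₀ ([ n ] / E) ⊗ H₀ [ n ] ⌋
      term a b = (j (A.π E (enum≃ [ n ] ⁻¹≃ ∙ᵈ finᵈ a)) ⊗₁ j (enum≃ [ n ] ⁻¹≃ ∙ᵈ finᵈ b)) ⟨$⟩ C.δ E ⟨$⟩ p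

      part : 𝓕V ⊗ 𝓕V ⊢ Fock.Λ E ⟨$⟩ j (finᵈ v) ⟨$⟩ p
        ≈ sweedlers (𝓕V ⊗ 𝓕V) (λ i → V.δ ⟨$⟩ v i) (λ v′ v″ →
            sweedler (𝓕V ⊗ 𝓕V) (C.δ E ⟨$⟩ p) (λ p₁ p₂ →
              cl P U _ (blockProduct V E (σ E) v′) (P₁ (σ E) ⟨$⟩ p₁) ⊗ₜ cl P U n v″ p₂))
      part = Fock.Λ-def E (j (finᵈ v) ⟨$⟩ p)
        ⟫ (ι̂² ▹ (extend-j (blocks E) (C.δ E) (finᵈ v) p ⟫ Λ-def (blocks E) (V.δ ∘ᵈ finᵈ v) (C.δ E ⟨$⟩ p)))
        ⟫ sweedlers-linear ι̂² n (λ i → V.δ ⟨$⟩ v i) term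
        ⟫ sweedlers-ext (𝓕V ⊗ 𝓕V) n (λ i → V.δ ⟨$⟩ v i) (λ a b →
            pure (enum≃ [ n ] ⁻¹≃ ∙ᵈ finᵈ a) (enum≃ [ n ] ⁻¹≃ ∙ᵈ finᵈ b))

  formulas : FockFormulas B C V structure
  formulas = record { mul-formula = mul-formula ; Δ-formula = Δ-formula ; δ-formula = δ-formula }

-- Naturality of the decorated species in V.

module DecoratedMorphism {ℓ} (K : HeytingField ℓ ℓ ℓ)
                         (P : Over.Species K) (B : Over.TwistedBialgebra K P) (C : Over.ContractionExtraction K P)
                         {V W : Over.CommBialgebra K} (f : Over.BialgebraHom K V W) where
  open Over K
  open Linear K
  open Decorations K
  open PointwiseMultilinear K
  open BlockProducts K
  open FockMorphism K
  private
    module 𝕜 = CommutativeRing commRing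
    module V = CommBialgebra V
    module W = CommBialgebra W
    module f = BialgebraHom f
    module P = Species P
    module B = TwistedBialgebra B
    module C = ContractionExtraction C
    module SV = DecoratedSpecies K (CommBialgebra.space V) P
    module SW = DecoratedSpecies K (CommBialgebra.space W) P
    module BV = SV.DecoratedBialgebra B
    module BW = SW.DecoratedBialgebra B
    module EV = Extension K V P B
    module EW = Extension K W P B
    module CV = DecoratedContraction K V P B C
    module CW = DecoratedContraction K W P B C

    infixr 4 _⟫_
    _⟫_ : ∀ {G : Set ℓ} {R : Rel (Term G) ℓ} {s t u} → _≈ᵗ_ R s t → _≈ᵗ_ R t u → _≈ᵗ_ R s u
    _⟫_ = ≈-trans

  opaque
    φ : ∀ X → SV.H₀ X ⊸ SW.H₀ X
    φ X = SV.H-lift (SW.H₀ X) (λ v → SW.j (f.map ∘ᵈ v)) (λ p → multilinear-∘ (SW.j-at p) (∘ᵈ-slotwise f.map))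

    φ-j : ∀ {X} v p → SW.H₀ X ⊢ φ X ⟨$⟩ SV.j v ⟨$⟩ p ≈ SW.j (f.map ∘ᵈ v) ⟨$⟩ p
    φ-j v p = ≈-refl

  private
    φ-jj : ∀ {X Y} v w t → SW.H₀ X ⊗ SW.H₀ Y ⊢ (φ X ⊗₁ φ Y) ⟨$⟩ (SV.j v ⊗₁ SV.j w) ⟨$⟩ t
                                              ≈ (SW.j (f.map ∘ᵈ v) ⊗₁ SW.j (f.map ∘ᵈ w)) ⟨$⟩ t
    φ-jj {X} {Y} v w = ⊗-ext ((φ X ⊗₁ φ Y) ∘ᴸ (SV.j v ⊗₁ SV.j w)) (SW.j (f.map ∘ᵈ v) ⊗₁ SW.j (f.map ∘ᵈ w))
      (λ p q → φ-j v p ⊠ φ-j w q)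

    φ-natural : ∀ {X Y} (σ : X ≃ Y) x → SW.H₀ Y ⊢ φ Y ⟨$⟩ SV.H₁ σ ⟨$⟩ x ≈ SW.H₁ σ ⟨$⟩ φ X ⟨$⟩ x
    φ-natural {X} {Y} σ = SV.H-ext (φ Y ∘ᴸ SV.H₁ σ) (SW.H₁ σ ∘ᴸ φ X) (λ v p →
      (φ Y ▹ SV.H₁-j σ v p) ⟫ φ-j (σ ∙ᵈ v) (P.P₁ σ ⟨$⟩ p)
      ⟫ SW.j-resp {v = f.map ∘ᵈ (σ ∙ᵈ v)} {σ ∙ᵈ (f.map ∘ᵈ v)} (λ _ → Module.≈ᴹ-refl W.space) (P.P₁ σ ⟨$⟩ p)
      ⟫ ≈-sym (SW.H₁-j σ (f.map ∘ᵈ v) p) ⟫ (SW.H₁ σ ▹ ≈-sym (φ-j v p)))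

    φ-m : ∀ X Y x y → SW.H₀ (X ⊔ˢ Y) ⊢ φ (X ⊔ˢ Y) ⟨$⟩ BV.mᴴ X Y ⟨$⟩ x ⊗ₜ y ≈ BW.mᴴ X Y ⟨$⟩ (φ X ⟨$⟩ x) ⊗ₜ (φ Y ⟨$⟩ y)
    φ-m X Y x y = SV.H-ext₂ (φ (X ⊔ˢ Y) ∘ᴸ BV.mᴴ X Y) (BW.mᴴ X Y ∘ᴸ (φ X ⊗₁ φ Y)) (λ v p w q →
      (φ (X ⊔ˢ Y) ▹ BV.m-j v p w q) ⟫ φ-j (v ⊎ᵈ w) (B.m X Y ⟨$⟩ p ⊗ₜ q)
      ⟫ SW.j-resp {v = f.map ∘ᵈ (v ⊎ᵈ w)} {(f.map ∘ᵈ v) ⊎ᵈ (f.map ∘ᵈ w)}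
          (λ { (inj₁ _) → Module.≈ᴹ-refl W.space ; (inj₂ _) → Module.≈ᴹ-refl W.space }) (B.m X Y ⟨$⟩ p ⊗ₜ q)
      ⟫ ≈-sym (BW.m-j (f.map ∘ᵈ v) p (f.map ∘ᵈ w) q)
      ⟫ (BW.mᴴ X Y ▹ ≈-sym (φ-j v p) ⊠ ≈-sym (φ-j w q))) (x ⊗ₜ y)

    φ-Δ : ∀ X Y x → SW.H₀ X ⊗ SW.H₀ Y ⊢ BW.Δᴴ X Y ⟨$⟩ φ (X ⊔ˢ Y) ⟨$⟩ x ≈ (φ X ⊗₁ φ Y) ⟨$⟩ BV.Δᴴ X Y ⟨$⟩ x
    φ-Δ X Y = SV.H-ext (BW.Δᴴ X Y ∘ᴸ φ (X ⊔ˢ Y)) ((φ X ⊗₁ φ Y) ∘ᴸ BV.Δᴴ X Y) (λ v p →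
      (BW.Δᴴ X Y ▹ φ-j v p) ⟫ BW.Δ-j {X} {Y} (f.map ∘ᵈ v) p
      ⟫ BW.jj-resp {v = fstᵈ {W.space} {X} {Y} (f.map ∘ᵈ v)} {f.map ∘ᵈ fstᵈ {V.space} {X} {Y} v} {sndᵈ {W.space} {X} {Y} (f.map ∘ᵈ v)} {f.map ∘ᵈ sndᵈ {V.space} {X} {Y} v}
          (λ _ → Module.≈ᴹ-refl W.space) (λ _ → Module.≈ᴹ-refl W.space) (B.Δ X Y ⟨$⟩ p)
      ⟫ ≈-sym (φ-jj (fstᵈ {V.space} {X} {Y} v) (sndᵈ {V.space} {X} {Y} v) (B.Δ X Y ⟨$⟩ p))
      ⟫ ((φ X ⊗₁ φ Y) ▹ ≈-sym (BV.Δ-j {X} {Y} v p)))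

    φ-ε : ∀ x → BW.εᴴ ⟨$⟩ φ ∅ ⟨$⟩ x ≈ᵏ BV.εᴴ ⟨$⟩ x
    φ-ε = SV.H-ext (BW.εᴴ ∘ᴸ φ ∅) BV.εᴴ (λ v p →
      𝕜.trans (BW.εᴴ ▹ φ-j v p) (𝕜.trans (BW.ε-j (f.map ∘ᵈ v) p) (𝕜.sym (BV.ε-j v p))))

    φ-ϵ : ∀ {X} (ϵ : P.P₀ X ⊸ 𝕂) x → EW.ϵᴴ ϵ ⟨$⟩ φ X ⟨$⟩ x ≈ᵏ EV.ϵᴴ ϵ ⟨$⟩ x
    φ-ϵ {X} ϵ = SV.H-ext (EW.ϵᴴ ϵ ∘ᴸ φ X) (EV.ϵᴴ ϵ) (λ v p →
      𝕜.trans (EW.ϵᴴ ϵ ▹ φ-j v p) (𝕜.trans (EW.ϵ-j ϵ (f.map ∘ᵈ v) p)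
        (𝕜.trans (𝕜.*-cong (∏-cong X (λ x → f.map-ε (at v x))) 𝕜.refl) (𝕜.sym (EV.ϵ-j ϵ v p)))))

    module _ {X A : FinSet} (ρ : EV.Push V.space X A) (ρ′ : EW.Push W.space X A)
             (square : ∀ a → EW.push ρ′ (f.map ∘ᵈ a) ≈ᵈ f.map ∘ᵈ EV.push ρ a) where

      -- On pure decorations the claim reduces to `square`, the compatibility of `f` with the maps
      -- pushing families to A.
      φ-Λ : ∀ τ z → SW.H₀ A ⊗ SW.H₀ X ⊢ EW.Λ ρ′ ((f.map ⊗₁ f.map) ∘ᵈ τ) ⟨$⟩ z ≈ (φ A ⊗₁ φ X) ⟨$⟩ EV.Λ ρ τ ⟨$⟩ z
      φ-Λ τ z = multi-ext {V.space} {V.space} {SW.H₀ A ⊗ SW.H₀ X} X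
        {λ τ → EW.Λ ρ′ ((f.map ⊗₁ f.map) ∘ᵈ τ) ⟨$⟩ z} {λ τ → (φ A ⊗₁ φ X) ⟨$⟩ EV.Λ ρ τ ⟨$⟩ z}
        (multilinear-∘ (EW.Λ-at ρ′ z) (∘ᵈ-slotwise (f.map ⊗₁ f.map)))
        (linear-multilinear {F = λ τ → EV.Λ ρ τ ⟨$⟩ z} (φ A ⊗₁ φ X) (EV.Λ-at ρ z))
        (λ a b → EW.Λ-resp ρ′ {(f.map ⊗₁ f.map) ∘ᵈ (a ⊠ᵈ b)} {(f.map ∘ᵈ a) ⊠ᵈ (f.map ∘ᵈ b)} (λ _ → ≈-refl) z
          ⟫ EW.Λ-pure ρ′ (f.map ∘ᵈ a) (f.map ∘ᵈ b) z
          ⟫ BW.jj-resp {v = EW.push ρ′ (f.map ∘ᵈ a)} {f.map ∘ᵈ EV.push ρ a} {f.map ∘ᵈ b} {f.map ∘ᵈ b}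
              (square a) (λ _ → Module.≈ᴹ-refl W.space) z
          ⟫ ≈-sym (φ-jj (EV.push ρ a) b z)
          ⟫ ((φ A ⊗₁ φ X) ▹ ≈-sym (EV.Λ-pure ρ a b z))) τ

      φ-extend : ∀ d x → SW.H₀ A ⊗ SW.H₀ X ⊢ EW.extend ρ′ d ⟨$⟩ φ X ⟨$⟩ x ≈ (φ A ⊗₁ φ X) ⟨$⟩ EV.extend ρ d ⟨$⟩ x
      φ-extend d = SV.H-ext (EW.extend ρ′ d ∘ᴸ φ X) ((φ A ⊗₁ φ X) ∘ᴸ EV.extend ρ d) (λ v p →
        (EW.extend ρ′ d ▹ φ-j v p) ⟫ EW.extend-j ρ′ d (f.map ∘ᵈ v) p
        ⟫ EW.Λ-resp ρ′ {W.δ ∘ᵈ (f.map ∘ᵈ v)} {(f.map ⊗₁ f.map) ∘ᵈ (V.δ ∘ᵈ v)} (λ x → f.map-δ (at v x)) (d ⟨$⟩ p)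
        ⟫ φ-Λ (V.δ ∘ᵈ v) (d ⟨$⟩ p)
        ⟫ ((φ A ⊗₁ φ X) ▹ ≈-sym (EV.extend-j ρ d v p)))

  decoratedMorphism : Morphism {B = BV.decoratedBialgebra} {BW.decoratedBialgebra}
                               CV.decoratedContraction CW.decoratedContraction
  decoratedMorphism = record
    { φ         = φ
    ; φ-natural = φ-natural
    ; φ-m       = φ-m
    ; φ-1       = φ-j ∅ᵈ B.1ₚ ⟫ SW.j-resp {v = f.map ∘ᵈ ∅ᵈ} {∅ᵈ} (λ ()) B.1ₚ
    ; φ-Δ       = φ-Δ
    ; φ-ε       = φ-ε
    -- For class products the square is multiplicativity of `f`.
    ; φ-δ       = λ {X} E → φ-extend {X} {X / E} (CV.blocks E) (CW.blocks E)
        (λ a x → Module.≈ᴹ-sym W.space (π-hom CV.algebraOf CW.algebraOf f.map (λ u u′ → f.map-mul (u ⊗ₜ u′)) E a x)) (C.δ E)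
    ; φ-ϵ       = λ X → φ-ϵ {X} (C.ϵ X)
    }

-- The functor and its action on classes.

module FockFunctor {ℓ} (K : HeytingField ℓ ℓ ℓ)
                   (P : Over.Species K) (B : Over.TwistedBialgebra K P) (C : Over.ContractionExtraction K P)
                   (compatible : Over.Compatible K B C) where
  open Over K
  open Linear K
  open Decorations K

  structures : (V : CommBialgebra) → DoubleBialgebraStructure (𝓕 P (CommBialgebra.space V))
  structures V = Formulas.structure K V P B C compatible

  object : CommBialgebra → DoubleBialgebra
  object V = doubleBialgebra (𝓕 P (CommBialgebra.space V)) (structures V)

  module _ {V W : CommBialgebra} (f : BialgebraHom V W) where
    private
      module DV = DecoratedFock K (CommBialgebra.space V) P
      module DW = DecoratedFock K (CommBialgebra.space W) P
      module SV = DecoratedSpecies K (CommBialgebra.space V) P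
      module M = DecoratedMorphism K P B C f
      module I = FockMorphism.Induced K
        {DecoratedSpecies.decorated K (CommBialgebra.space V) P} {DecoratedSpecies.decorated K (CommBialgebra.space W) P}
        (DecoratedFock.decoratedFock K (CommBialgebra.space V) P)
        (DecoratedFock.decoratedFock K (CommBialgebra.space W) P)
        (DecoratedSpecies.DecoratedBialgebra.decoratedBialgebra K (CommBialgebra.space V) P B)
        (DecoratedSpecies.DecoratedBialgebra.decoratedBialgebra K (CommBialgebra.space W) P B)
        (DecoratedContraction.decoratedContraction K V P B C)
        (DecoratedContraction.decoratedContraction K W P B C)
        (DecoratedContraction.decoratedCompatible K V P B C compatible)
        (DecoratedContraction.decoratedCompatible K W P B C compatible) M.decoratedMorphism

    opaque
      arrow : DoubleBialgebraHom (object V) (object W)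
      arrow = I.induced

      arrow-cl : ∀ n v p → 𝓕 P (CommBialgebra.space W) ⊢ DoubleBialgebraHom.map arrow ⟨$⟩ cl P (CommBialgebra.space V) n v p
                         ≈ cl P (CommBialgebra.space W) n (λ i → BialgebraHom.map f ⟨$⟩ v i) p
      arrow-cl n v p = (I.Φ ▹ ↺ (DV.ι-j (finᵈ v) p))
        ⟫ I.Φ-ι n (SV.j (finᵈ v) ⟨$⟩ p)
        ⟫ (DW.ιᴴ n ▹ M.φ-j (finᵈ v) p)
        ⟫ DW.ι-j (BialgebraHom.map f ∘ᵈ finᵈ v) p
        where
        open Chain (𝓕 P (CommBialgebra.space W)) using (_⟫_)
        open Chain (𝓕 P (CommBialgebra.space V)) using (↺)

  private
    -- The classes span `𝓕`, so the functor laws follow from the formula for `arrow` on classes.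
    generated : ∀ {V W : CommBialgebra} (g h : 𝓕 P (CommBialgebra.space V) ⊸ 𝓕 P (CommBialgebra.space W)) →
                (∀ n v p → 𝓕 P (CommBialgebra.space W) ⊢ g ⟨$⟩ cl P (CommBialgebra.space V) n v p
                                                      ≈ h ⟨$⟩ cl P (CommBialgebra.space V) n v p) → g ≗ᴸ h
    generated {V} g h e = ext (FockRel P (CommBialgebra.space V)) g h (λ { (n , v , p) → e n v p })

    map : ∀ {A A′} → DoubleBialgebraHom A A′ → DoubleBialgebra.space A ⊸ DoubleBialgebra.space A′
    map = DoubleBialgebraHom.map

    arrow-resp : ∀ {V W : CommBialgebra} (f g : BialgebraHom V W) → BialgebraHom.map f ≗ᴸ BialgebraHom.map g →
                 map (arrow f) ≗ᴸ map (arrow g)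
    arrow-resp {V} {W} f g e = generated {V} {W} (map (arrow f)) (map (arrow g)) (λ n v p →
      ≈-trans (arrow-cl f n v p) (≈-trans
        (rel (f-cong (λ i → e (v i)) (Module.≈ᴹ-refl (Species.P₀ P [ n ])))) (≈-sym (arrow-cl g n v p))))

    arrow-id : ∀ {V : CommBialgebra} → map (arrow (BialgebraHom-id {V})) ≗ᴸ idᴸ
    arrow-id {V} = generated {V} {V} (map (arrow (BialgebraHom-id {V}))) idᴸ (arrow-cl (BialgebraHom-id {V}))

    arrow-∘ : ∀ {U V W : CommBialgebra} (g : BialgebraHom V W) (f : BialgebraHom U V) →
              map (arrow (BialgebraHom-∘ g f)) ≗ᴸ map (arrow g) ∘ᴸ map (arrow f)
    arrow-∘ {U} {V} {W} g f = generated {U} {W} (map (arrow gf)) (map (arrow g) ∘ᴸ map (arrow f)) (λ n v p →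
      arrow-cl gf n v p
      ⟫ ↺ (arrow-cl g n (λ i → BialgebraHom.map f ⟨$⟩ v i) p)
      ⟫ (map (arrow g) ▹ ≈-sym (arrow-cl f n v p)))
      where
      open Chain (𝓕 P (CommBialgebra.space W))
      gf : BialgebraHom U W
      gf = BialgebraHom-∘ {U} {V} {W} g f

  functor : FunctorOn CommBialgebras DoubleBialgebras object
  functor = record
    { F₁       = arrow
    ; F-resp-≈ = λ {V} {W} {f} {g} → arrow-resp {V} {W} f g
    ; F-id     = λ {V} → arrow-id {V}
    ; F-∘      = λ {U} {V} {W} g f → arrow-∘ {U} {V} {W} g f
    }

corollary3p8 : ∀ {ℓ} (K : HeytingField ℓ ℓ ℓ) → let open Over K in
    (P : Species) (B : TwistedBialgebra P) (C : ContractionExtraction P) → Compatible B C →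
    Σ[ S ∈ ((V : CommBialgebra) → DoubleBialgebraStructure (𝓕 P (CommBialgebra.space V))) ]
      (∀ V → FockFormulas B C V (S V)) ×
      (Σ[ F ∈ FunctorOn CommBialgebras DoubleBialgebras (λ V → doubleBialgebra (𝓕 P (CommBialgebra.space V)) (S V)) ]
        (∀ {V W} (f : BialgebraHom V W) n v p →
          𝓕 P (CommBialgebra.space W) ⊢
            DoubleBialgebraHom.map (FunctorOn.F₁ F f) ⟨$⟩ cl P (CommBialgebra.space V) n v p
            ≈ cl P (CommBialgebra.space W) n (λ i → BialgebraHom.map f ⟨$⟩ v i) p))
corollary3p8 K P B C compatible =
  structures , (λ V → Formulas.formulas K V P B C compatible) , functor , λ f → arrow-cl f
  where open FockFunctor K P B C compatible
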